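{- Let \(G\) be a 3-connected plane triangulation and let \(uv\) be an edge of \(G\) which is contained in every separating triangle of \(G\). Then \(G\) is hamiltonian-connected.
   Context: A plane triangulation is a simple plane graph all of whose faces, including the outer face, are triangles. A separating triangle is a cycle of length 3 whose removal disconnects the graph (equivalently, a triangle that is not a facial cycle). A graph is hamiltonian-connected if for every pair of distinct vertices \(x,y\) there is a hamiltonian path (a path visiting every vertex exactly once) with end vertices \(x\) and \(y\). -}

module Defs where

open import Data.Nat using (ℕ; zero; suc; _+_; _*_; _≤_)
open import Data.Fin using (Fin)
open import Data.Bool using (Bool; true; false; T)
open import Data.List using (List; []; _∷_; length; filterᵇ; allFin; map)
open import Data.Nat.ListAction using (sum)
open import Data.List.Membership.Propositional using (_∈_)
open import Data.List.Relation.Unary.Unique.Propositional using (Unique)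
open import Data.Product using (Σ; ∃; _×_; _,_)
open import Data.Sum using (_⊎_)
open import Data.Unit using (⊤)
open import Relation.Nullary using (¬_)
open import Relation.Binary.PropositionalEquality using (_≡_; _≢_)

record SimpleGraph (n : ℕ) : Set where
  field
    adj       : Fin n → Fin n → Bool
    adj-sym   : ∀ v w → adj v w ≡ adj w v
    adj-irrefl : ∀ v → adj v v ≡ false

iterate : {A : Set} → (A → A) → ℕ → A → A
iterate f zero a = a
iterate f (suc k) a = f (iterate f k a)

module _ {n : ℕ} (G : SimpleGraph n) where
  open SimpleGraph G

  Adj : Fin n → Fin n → Set
  Adj v w = T (adj v w)

  degree : Fin n → ℕ
  degree v = length (filterᵇ (adj v) (allFin n))

  darts : ℕ
  darts = sum (map degree (allFin n))

  data WalkIn (ok : Fin n → Set) : Fin n → Fin n → Set where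
    here : ∀ {x} → ok x → WalkIn ok x x
    step : ∀ {x y z} → ok x → Adj x y → WalkIn ok y z → WalkIn ok x z

  ConnectedOn : (Fin n → Set) → Set
  ConnectedOn ok = ∀ x y → ok x → ok y → WalkIn ok x y

  Connected : Set
  Connected = ConnectedOn (λ _ → ⊤)

  -- G is 3-connected: more than 3 vertices, and G - X is connected for every
  -- set X of fewer than 3 vertices (X = ∅, {a}, {a,b}).
  ThreeConnected : Set
  ThreeConnected =
    4 ≤ n × Connected
      × (∀ a b → ConnectedOn (λ x → x ≢ a × x ≢ b))

  Triangle : Fin n → Fin n → Fin n → Set
  Triangle a b c = Adj a b × Adj b c × Adj c a

  SeparatingTriangle : Fin n → Fin n → Fin n → Set
  SeparatingTriangle a b c =
    Triangle a b c × ¬ ConnectedOn (λ x → x ≢ a × x ≢ b × x ≢ c)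

  data PathList : Fin n → Fin n → List (Fin n) → Set where
    single : ∀ {x} → PathList x x (x ∷ [])
    cons   : ∀ {x y z p} → Adj x y → PathList y z p → PathList x z (x ∷ p)

  HamiltonianPath : Fin n → Fin n → Set
  HamiltonianPath x y =
    Σ (List (Fin n)) λ p → PathList x y p × Unique p × (∀ v → v ∈ p)

  HamiltonianConnected : Set
  HamiltonianConnected = ∀ x y → x ≢ y → HamiltonianPath x y

-- A plane triangulation, given combinatorially as a simple graph together with
-- a rotation system (combinatorial embedding): rot v is a cyclic permutation of
-- the neighbourhood of v.  Faces are traced by the dart map (v,w) ↦ (w, rot w v).
-- Conditions: the underlying graph is connected, every face is a triangle, and
-- Euler's formula V - E + F = 2 holds (genus 0).  Since all faces are triangles,
-- F = 2E/3 and Euler's formula reads  2E + 12 = 6V.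
record PlaneTriangulation (n : ℕ) : Set where
  field
    graph : SimpleGraph n
  open SimpleGraph graph
  field
    rot : Fin n → Fin n → Fin n
    rot-closed : ∀ v w → Adj graph v w → Adj graph v (rot v w)
    rot-inj : ∀ v w w' → Adj graph v w → Adj graph v w' → rot v w ≡ rot v w' → w ≡ w'
    rot-cyclic : ∀ v w w' → Adj graph v w → Adj graph v w' →
                 Σ ℕ λ k → iterate (rot v) k w ≡ w'
    connected : Connected graph
    faces-triangular : ∀ v w → Adj graph v w →
                 rot (rot w v) w ≡ v × rot v (rot w v) ≡ w
    euler : darts graph + 12 ≡ 6 * n

{-# OPTIONS --safe #-}

-- Without the edge uv, the triangulation is a disk bounded by the 4-cycle u, w₀, v, w₁, and it has no separating
-- triangles left. For a triangulated disk without separating triangles, a root edge za on its boundary and any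
-- two vertices x, y, one shows that there are two disjoint paths from {x, y} to {z, a} which visit everything except
-- for the interiors of pockets, regions cut off by a chord that joins two successive visited boundary vertices. With
-- the edge za this is a path from x to y, and the pockets of the 4-cycle are trivial unless u or v has degree three,
-- in which case n = 4 or the neighbours of that vertex form a separating triangle which does not contain uv.
--
-- The induction removes a boundary arc by peeling off the triangles along it; the arc itself becomes a path, the
-- smaller disk behind it carries the solution, and what is cut off in between is swept by one of the two. A chord at the
-- arc, or a region that contains both x and y, leads to a decomposition into smaller disks.
--
-- That the deletion of uv leaves such a disk rests on the Jordan curve theorem. If the two sides of a cycle were
-- connected in the dual graph off the cycle, then a spanning tree of the dual graph could avoid the cycle; the edges not
-- crossed by it contain the cycle and connect all vertices, so there are too many edges for Euler's formula.

module Submission where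

open import Defs using (PlaneTriangulation; SimpleGraph; iterate; WalkIn; ConnectedOn; SeparatingTriangle; ThreeConnected; degree)
import Defs
open import Data.Bool using (Bool; true; false; if_then_else_)
import Data.Bool as Bool
open import Data.Empty using (⊥; ⊥-elim)
open import Data.Fin using (Fin)
import Data.Fin as Fin
open import Data.List using (List; []; _∷_; _++_; _∷ʳ_; length; [_]; map; filterᵇ; allFin)
import Data.List.Properties as Lₚ
import Data.List.Membership.DecPropositional as DecMembership
open import Data.List.Membership.Propositional using (_∈_; _∉_)
import Data.List.Membership.Propositional.Properties as ∈ₚ
open import Data.List.Relation.Binary.Permutation.Propositional using (_↭_; ↭-refl; ↭-sym; ↭-trans; ↭-reflexive; prep; swap; ↭⇒↭ₛ)
open import Data.List.Relation.Binary.Permutation.Propositional.Properties using (++⁺; ++⁺ˡ; ++⁺ʳ; shift; shifts; drop-∷; ∈-resp-↭; ↭-length; ↭-empty-inv)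
import Data.List.Relation.Binary.Permutation.Setoid.Properties as PermS
open import Data.List.Relation.Binary.Subset.Propositional using (_⊆_)
open import Data.List.Relation.Unary.All using (All; []; _∷_)
import Data.List.Relation.Unary.All as All
open import Data.List.Relation.Unary.AllPairs using ([]; _∷_)
open import Data.List.Relation.Unary.Any using (here; there)
import Data.List.Relation.Unary.Any as Any
open import Data.List.Relation.Unary.Unique.Propositional using (Unique)
import Data.List.Relation.Unary.Unique.Propositional.Properties as Uniqueₚ
open import Data.Maybe as Maybe using (Maybe; just; nothing; maybe)
open import Data.Nat using (ℕ; zero; suc; _+_; _*_; _≤_; _<_; z≤n; s≤s; _≡ᵇ_)
open import Data.Nat.ListAction using (sum)
import Data.Nat.Properties as ℕₚ
open import Data.Nat.Tactic.RingSolver using (solve-∀)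
open import Data.Product using (∃-syntax; Σ-syntax; _×_; _,_; proj₁; proj₂)
open import Data.Product.Properties using (≡-dec)
open import Data.Sum using (_⊎_; inj₁; inj₂; [_,_]′)
open import Data.Unit using (⊤; tt)
open import Function using (_∘_)
open import Relation.Binary.Definitions using (DecidableEquality)
open import Relation.Binary.PropositionalEquality using (_≡_; _≢_; refl; sym; trans; cong; cong₂; subst; setoid)
open import Relation.Nullary using (¬_; Dec; yes; no)


-- Why two paths: a part behind a chord or a 2-path meets the rest in two vertices, and solutions on
-- both sides can be concatenated there if each consists of two disjoint paths whose ends are
-- prescribed as pairs. Why pockets are delicate: skipping a region is harmless at the original
-- boundary, but deleting an arc exposes vertices that are interior to the larger disk. A pocket
-- there has to be visited after all; together with peeled triangles it becomes attached to the
-- deleted arc, and the path along the arc is rerouted through it. The rerouting is again an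
-- instance of the induction: if an end vertex is also an end of the root edge, then one of the two
-- paths is trivial and the other one misses that vertex. Disks form an inductive type, so that
-- cutting, pasting and induction on the size need no topology; distinctness of the vertices is a
-- separate hypothesis. The embedding matters only for the construction of the first disk and for
-- the emptiness of digons and triangles. Vertex sets are lists up to permutation; `lin` and `prove`
-- settle the bookkeeping.

module Lists (V : Set) (_≟_ : DecidableEquality V) where

  -- Lists up to permutation and the darts of a cycle

  Ls : Set
  Ls = List V

  private variable
    x y z a p q s t : V
    r xs ys zs ws as bs cs : Ls

  infixr 5 _⊕_

  -- Expressions over list-valued atoms, compared up to permutation by comparing the lists of atoms.
  data Ex : Set where
    # : ℕ → Ex
    ε : Ex
    _⊕_ : Ex → Ex → Ex

  lookupAt : List Ls → ℕ → Ls
  lookupAt [] _ = []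
  lookupAt (x ∷ ρ) zero = x
  lookupAt (x ∷ ρ) (suc k) = lookupAt ρ k

  ⟦_⟧ : Ex → List Ls → Ls
  ⟦ # k ⟧ ρ = lookupAt ρ k
  ⟦ ε ⟧ ρ = []
  ⟦ e ⊕ f ⟧ ρ = ⟦ e ⟧ ρ ++ ⟦ f ⟧ ρ

  flat : Ex → List ℕ → List ℕ
  flat (# k) l = k ∷ l
  flat ε l = l
  flat (e ⊕ f) l = flat e (flat f l)

  concatAt : List Ls → List ℕ → Ls
  concatAt ρ [] = []
  concatAt ρ (k ∷ l) = lookupAt ρ k ++ concatAt ρ l

  flat-correct : ∀ e ρ l → ⟦ e ⟧ ρ ++ concatAt ρ l ≡ concatAt ρ (flat e l)
  flat-correct (# k) ρ l = refl
  flat-correct ε ρ l = refl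
  flat-correct (e ⊕ f) ρ l = trans (Lₚ.++-assoc (⟦ e ⟧ ρ) _ _) (trans (cong (⟦ e ⟧ ρ ++_) (flat-correct f ρ l)) (flat-correct e ρ (flat f l)))

  remove : ℕ → List ℕ → Maybe (List ℕ)
  remove k [] = nothing
  remove k (m ∷ l) = if k ≡ᵇ m then just l else Maybe.map (m ∷_) (remove k l)

  isPerm : List ℕ → List ℕ → Bool
  isPerm [] [] = true
  isPerm [] (_ ∷ _) = false
  isPerm (k ∷ l) m = maybe (isPerm l) false (remove k m)

  remove-correct : ∀ ρ k l {m} → remove k l ≡ just m → concatAt ρ l ↭ lookupAt ρ k ++ concatAt ρ m
  remove-correct ρ k (j ∷ l) e with k ≡ᵇ j in eq
  remove-correct ρ k (j ∷ l) refl | true rewrite ℕₚ.≡ᵇ⇒≡ k j (subst Bool.T (sym eq) tt) = ↭-refl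
  ... | false with remove k l in er
  remove-correct ρ k (j ∷ l) refl | false | just m =
    ↭-trans (++⁺ˡ (lookupAt ρ j) (remove-correct ρ k l er)) (shifts (lookupAt ρ j) (lookupAt ρ k))

  isPerm-correct : ∀ ρ l m → Bool.T (isPerm l m) → concatAt ρ l ↭ concatAt ρ m
  isPerm-correct ρ [] [] _ = ↭-refl
  isPerm-correct ρ (k ∷ l) m t with remove k m in er
  ... | just m' = ↭-trans (++⁺ˡ (lookupAt ρ k) (isPerm-correct ρ l m' t)) (↭-sym (remove-correct ρ k m er))

  prove : ∀ e f ρ {_ : Bool.T (isPerm (flat e []) (flat f []))} → ⟦ e ⟧ ρ ↭ ⟦ f ⟧ ρ
  prove e f ρ {t} = ↭-trans (↭-reflexive (lem e)) (↭-trans (isPerm-correct ρ (flat e []) (flat f []) t) (↭-reflexive (sym (lem f))))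
    where
    lem : ∀ e → ⟦ e ⟧ ρ ≡ concatAt ρ (flat e [])
    lem e = trans (sym (Lₚ.++-identityʳ _)) (flat-correct e ρ [])

  ++-cancelʳ-↭ : ∀ zs → xs ++ zs ↭ ys ++ zs → xs ↭ ys
  ++-cancelʳ-↭ {xs} {ys} [] p = ↭-trans (↭-reflexive (sym (Lₚ.++-identityʳ xs))) (↭-trans p (↭-reflexive (Lₚ.++-identityʳ ys)))
  ++-cancelʳ-↭ {xs} {ys} (z ∷ zs) p =
    ++-cancelʳ-↭ zs (drop-∷ (↭-trans (↭-sym (shift z xs zs)) (↭-trans p (shift z ys zs))))

  -- Linear combination: hypotheses are moved across with their sides swapped, so that
  -- what remains is a pure rearrangement.
  lin : ∀ {as bs} → xs ↭ ys → as ++ ys ↭ bs ++ xs → as ↭ bs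
  lin {xs} {ys} {as} {bs} h e = ++-cancelʳ-↭ ys (↭-trans e (++⁺ˡ bs h))

  infixr 5 _⊹_
  _⊹_ : xs ↭ ys → zs ↭ ws → xs ++ zs ↭ ys ++ ws
  _⊹_ = ++⁺

  Unique-↭ : xs ↭ ys → Unique xs → Unique ys
  Unique-↭ h = PermS.Unique-resp-↭ (setoid V) (↭⇒↭ₛ h)

  Unique-++ˡ : ∀ xs → Unique (xs ++ ys) → Unique xs
  Unique-++ˡ [] _ = []
  Unique-++ˡ (x ∷ xs) (h ∷ u) = All.tabulate (λ m → All.lookup h (∈ₚ.∈-++⁺ˡ m)) ∷ Unique-++ˡ xs u

  Unique-disj : ∀ xs → Unique (xs ++ ys) → x ∈ xs → x ∈ ys → ⊥
  Unique-disj (x ∷ xs) (h ∷ u) (here refl) m = All.lookup h (∈ₚ.∈-++⁺ʳ xs m) refl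
  Unique-disj (x ∷ xs) (h ∷ u) (there k) m = Unique-disj xs u k m

  Unique-sub : xs ++ ys ↭ zs → Unique zs → Unique xs
  Unique-sub {xs} h u = Unique-++ˡ xs (Unique-↭ (↭-sym h) u)

  Unique-clash : zs ↭ xs ++ ys → Unique zs → x ∈ xs → x ∈ ys → ⊥
  Unique-clash {xs = xs} h u = Unique-disj xs (Unique-↭ h u)

  Unique-≢ : zs ↭ x ∷ y ∷ xs → Unique zs → x ≢ y
  Unique-≢ h u refl = Unique-clash {xs = [ _ ]} h u (here refl) (here refl)

  ∈-mid : ∀ xs → t ∈ xs ++ t ∷ ys
  ∈-mid xs = ∈ₚ.∈-++⁺ʳ xs (here refl)

  _∈?_ : ∀ (x : V) xs → Dec (x ∈ xs)
  x ∈? xs = Any.any? (x ≟_) xs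

  ∈-split : x ∈ xs → ∃[ as ] ∃[ bs ] xs ≡ as ++ x ∷ bs
  ∈-split = ∈ₚ.∈-∃++

  ++-compare : ∀ xs as → xs ++ t ∷ ys ≡ as ++ bs →
    (∃[ cs ] as ≡ xs ++ t ∷ cs × ys ≡ cs ++ bs) ⊎ (∃[ cs ] xs ≡ as ++ cs × bs ≡ cs ++ t ∷ ys)
  ++-compare [] [] refl = inj₂ ([] , refl , refl)
  ++-compare [] (a ∷ as) refl = inj₁ (as , refl , refl)
  ++-compare (x ∷ xs) [] refl = inj₂ (x ∷ xs , refl , refl)
  ++-compare (x ∷ xs) (a ∷ as) e with Lₚ.∷-injective e
  ... | refl , e' with ++-compare xs as e'
  ... | inj₁ (cs , refl , refl) = inj₁ (cs , refl , refl)
  ... | inj₂ (cs , refl , refl) = inj₂ (cs , refl , refl)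

  -- Nonempty lists are given by head and tail throughout, so that `last` and `init` are total.
  last : V → Ls → V
  last h [] = h
  last h (x ∷ l) = last x l

  last-++ : ∀ h xs → last h (xs ++ x ∷ ys) ≡ last x ys
  last-++ h [] = refl
  last-++ h (y ∷ xs) = last-++ y xs

  last-∷ʳ : ∀ h xs → last h (xs ∷ʳ x) ≡ x
  last-∷ʳ h xs = last-++ h xs

  last-∈ : ∀ h l → last h l ∈ h ∷ l
  last-∈ h [] = here refl
  last-∈ h (x ∷ l) = there (last-∈ x l)

  init : V → Ls → Ls
  init h [] = []
  init h (x ∷ l) = h ∷ init x l

  init-last : ∀ h l → h ∷ l ≡ init h l ∷ʳ last h l
  init-last h [] = refl
  init-last h (x ∷ l) = cong (h ∷_) (init-last x l)

  unsnoc : ∀ xs → xs ≡ [] ⊎ ∃[ ys ] ∃[ y ] xs ≡ ys ∷ʳ y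
  unsnoc [] = inj₁ refl
  unsnoc (x ∷ xs) = inj₂ (init x xs , last x xs , init-last x xs)

  ∷ʳ-inj : ∀ xs ys → xs ∷ʳ x ≡ ys ∷ʳ y → xs ≡ ys × x ≡ y
  ∷ʳ-inj xs ys = Lₚ.∷ʳ-injective xs ys

  ∷ʳ-≢[] : ∀ xs → xs ++ x ∷ ys ≢ []
  ∷ʳ-≢[] [] ()
  ∷ʳ-≢[] (_ ∷ _) ()

  -- Replacing the part strictly between p and q of a list does not affect its two end points.
  reframe : ∀ {a z r} xs m₀ → a ∷ r ∷ʳ z ≡ xs ++ p ∷ m₀ ++ q ∷ ys → ∀ m → ∃[ r' ] a ∷ r' ∷ʳ z ≡ xs ++ p ∷ m ++ q ∷ ys
  reframe {p} {q} {ys} {r = r} [] m₀ e m with Lₚ.∷-injective e | unsnoc ys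
  ... | refl , e' | inj₁ refl with ∷ʳ-inj r m₀ e'
  ... | refl , refl = m , refl
  reframe {p} {q} {ys} {r = r} [] m₀ e m | refl , e' | inj₂ (ys' , y , refl)
    with ∷ʳ-inj r (m₀ ++ q ∷ ys') (trans e' (sym (Lₚ.++-assoc m₀ _ _)))
  ... | refl , refl = m ++ q ∷ ys' , cong (p ∷_) (Lₚ.++-assoc m _ _)
  reframe {p} {q} {ys} {r = r} (x ∷ xs) m₀ e m with Lₚ.∷-injective e | unsnoc ys
  ... | refl , e' | inj₁ refl with ∷ʳ-inj r (xs ++ p ∷ m₀) (trans e' (sym (Lₚ.++-assoc xs (p ∷ m₀) _)))
  ... | refl , refl = xs ++ p ∷ m , cong (x ∷_) (Lₚ.++-assoc xs (p ∷ m) _)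
  reframe {p} {q} {ys} {r = r} (x ∷ xs) m₀ e m | refl , e' | inj₂ (ys' , y , refl)
    with ∷ʳ-inj r (xs ++ p ∷ m₀ ++ q ∷ ys') (trans e' (trans (cong (λ l → xs ++ p ∷ l) (sym (Lₚ.++-assoc m₀ _ _))) (sym (Lₚ.++-assoc xs _ _))))
  ... | refl , refl = xs ++ p ∷ m ++ q ∷ ys' ,
    cong (x ∷_) (trans (Lₚ.++-assoc xs _ _) (cong (λ l → xs ++ p ∷ l) (Lₚ.++-assoc m _ _)))

  -- The form in which a decrease of the number of vertices is shown: `x` is some vertex outside the
  -- part `xs`.
  length-↭-< : ∀ {x} → zs ↭ x ∷ xs ++ ys → length xs < length zs
  length-↭-< {zs} {xs} {ys} {x} h = subst (length xs <_) (sym (trans (↭-length h) (cong suc (Lₚ.length-++ xs)))) (s≤s (ℕₚ.m≤m+n _ _))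

  Dart : Set
  Dart = V × V

  pairs : V → Ls → List Dart
  pairs h [] = []
  pairs h (x ∷ l) = (h , x) ∷ pairs x l

  pairs-++ : ∀ h xs {t ys} → pairs h (xs ++ t ∷ ys) ≡ pairs h (xs ∷ʳ t) ++ pairs t ys
  pairs-++ h [] = refl
  pairs-++ h (x ∷ xs) = cong ((h , x) ∷_) (pairs-++ x xs)

  pairs-∈ : ∀ h l → (x , y) ∈ pairs h l → x ∈ h ∷ l × y ∈ l
  pairs-∈ h (w ∷ l) (here refl) = here refl , here refl
  pairs-∈ h (w ∷ l) (there m) with pairs-∈ w l m
  ... | m₁ , m₂ = there m₁ , there m₂

  pairs-∈ˡ : ∀ h xs → (x , y) ∈ pairs h (xs ∷ʳ t) → x ∈ h ∷ xs
  pairs-∈ˡ h [] (here refl) = here refl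
  pairs-∈ˡ h (w ∷ xs) (here refl) = here refl
  pairs-∈ˡ h (w ∷ xs) (there m) = there (pairs-∈ˡ w xs m)

  boundary : V → V → Ls → List Dart
  boundary z a r = (z , a) ∷ pairs a (r ∷ʳ z)

  boundary-∈ : (x , y) ∈ boundary z a r → x ∈ z ∷ a ∷ r
  boundary-∈ (here refl) = here refl
  boundary-∈ {a = a} {r} (there m) = there (pairs-∈ˡ a r m)

  triangle : V → V → V → List Dart
  triangle z a t = (z , a) ∷ (a , t) ∷ (t , z) ∷ []

-- Face x y z says that x, y, z is a facial triangle, to the left of the dart (x, y).
record Surface : Set₁ where
  field
    V : Set
    _≟_ : DecidableEquality V
    Adj : V → V → Set
    Face : V → V → V → Set
    adj-sym : ∀ {x y} → Adj x y → Adj y x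
    adj-irrefl : ∀ {x} → Adj x x → ⊥
    face-adj : ∀ {x y z} → Face x y z → Adj x y
    face-rot : ∀ {x y z} → Face x y z → Face y z x

-- Triangulated disks

module Disks (𝒮 : Surface) where

  open Surface 𝒮
  open Lists V _≟_

  private variable
    x y z a b c p q s t h w : V
    r r' i i' j k u u' xs ys m X Y l l' d e f cs : Ls

  -- A triangulated disk with boundary cycle z, a, r and interior vertices i. The disk lies to the left of its
  -- root dart (z, a); the constructors are distinguished by the apex t of the triangle at the root.
  data Disk : V → V → Ls → Ls → Set where
    edge  : Adj z a → Disk z a [] []
    inner : Face z a t → Disk t a (r ∷ʳ z) i → j ↭ t ∷ i → Disk z a r j
    split : Face z a t → Disk t a xs i → Disk z t ys k → r ≡ xs ++ t ∷ ys → j ↭ i ++ k → Disk z a r j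

  root-adj : Disk z a r i → Adj z a
  root-adj (edge h) = h
  root-adj (inner f _ _) = face-adj f
  root-adj (split f _ _ _ _) = face-adj f

  face-adj₂ : Face x y z → Adj y z
  face-adj₂ f = face-adj (face-rot f)

  face-adj₃ : Face x y z → Adj z x
  face-adj₃ f = face-adj (face-rot (face-rot f))

  permute : i ↭ j → Disk z a r i → Disk z a r j
  permute h (edge e) with ↭-empty-inv (↭-sym h)
  ... | refl = edge e
  permute h (inner f D e) = inner f D (↭-trans (↭-sym h) e)
  permute h (split f D E q e) = split f D E q (↭-trans (↭-sym h) e)

  -- Pasting disks and moving the root

  ∷-∷ʳ-inj : a ∷ r ∷ʳ z ≡ a ∷ r' ∷ʳ z → r ≡ r'
  ∷-∷ʳ-inj {r = r} {r' = r'} e = proj₁ (∷ʳ-inj r r' (Lₚ.∷-injectiveʳ e))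

  snoc-++ : ∀ (X : Ls) {Y z} → (X ++ Y) ∷ʳ z ≡ X ++ (Y ∷ʳ z)
  snoc-++ X = Lₚ.++-assoc X _ _

  -- Two successive vertices cannot lie on different sides of `c`, because `c` belongs to both
  -- sides. This locates a boundary edge in one of the two parts of a `split`.
  pair-side : ∀ as X → as ++ c ∷ ys ≡ X ++ s ∷ t ∷ Y →
    (∃[ Y' ] as ∷ʳ c ≡ X ++ s ∷ t ∷ Y' × Y ≡ Y' ++ ys) ⊎
    (∃[ X' ] c ∷ ys ≡ X' ++ s ∷ t ∷ Y × X ≡ as ++ X')
  pair-side [] X e = inj₂ (X , e , refl)
  pair-side (a ∷ []) [] refl = inj₁ ([] , refl , refl)
  pair-side (a ∷ b ∷ as) [] refl = inj₁ (as ∷ʳ _ , refl , sym (Lₚ.++-assoc as _ _))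
  pair-side (a ∷ as) (x ∷ X) e with Lₚ.∷-injective e
  ... | refl , e' with pair-side as X e'
  ... | inj₁ (Y' , e₁ , e₂) = inj₁ (Y' , cong (a ∷_) e₁ , e₂)
  ... | inj₂ (X' , e₁ , refl) = inj₂ (X' , e₁ , refl)

  -- The pasted disk lies to the left of its root dart from `t` to `s`, hence its arc `s`, `m`, `t`
  -- replaces the boundary edge from `s` to `t`. The boundary is written as the arc from `a` to `z`,
  -- so the root edge is never the place of pasting and the root triangle survives.
  pasteAt : Disk z a r i → ∀ X {Y} → a ∷ r ∷ʳ z ≡ X ++ s ∷ t ∷ Y → Disk t s m j →
    ∀ {r'} → a ∷ r' ∷ʳ z ≡ X ++ s ∷ m ++ t ∷ Y → Disk z a r' (i ++ j)
  pasteAt (edge h) [] refl W e' with ∷-∷ʳ-inj e'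
  ... | refl = W
  pasteAt (edge h) (_ ∷ []) () W e'
  pasteAt (edge h) (_ ∷ _ ∷ []) () W e'
  pasteAt (edge h) (_ ∷ _ ∷ _ ∷ _) () W e'
  pasteAt {z} {a} {r} {i} {s} {t} {m} {j} (inner {t = u} {i = i'} f D h) X {Y} e W {r'} e' =
    inner f (pasteAt D X (trans (cong (_∷ʳ u) e) (snoc-++ X)) W
              (trans (cong (_∷ʳ u) e') (trans (snoc-++ X) (cong (λ l → X ++ s ∷ l) (snoc-++ m)))))
      (++⁺ʳ j h)
  pasteAt {z} {a} {i = i} {s} {t} {m} {j} (split {t = c} {xs} {i₁} {ys} {i₂} f D E refl h) X {Y} e W {r'} e'
    with pair-side (a ∷ xs) X (trans (cong (a ∷_) (sym (snoc-++ xs))) e)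
  ... | inj₁ (Y' , e₁ , refl) with reframe X [] e₁ m
  ... | r₁ , er₁ = split f (pasteAt D X e₁ W er₁) E
        (∷-∷ʳ-inj (trans e' (trans (cong (λ l → X ++ s ∷ l) (sym (Lₚ.++-assoc m _ _)))
           (trans (sym (Lₚ.++-assoc X _ _)) (trans (cong (_++ (ys ∷ʳ z)) (sym er₁))
             (cong (a ∷_) (trans (Lₚ.++-assoc r₁ _ _) (sym (snoc-++ r₁)))))))))
        (lin h (prove ((# 0 ⊕ # 1) ⊕ (# 2 ⊕ # 3)) (((# 2 ⊕ # 1) ⊕ # 3) ⊕ # 0) (i ∷ j ∷ i₁ ∷ i₂ ∷ [])))
  pasteAt {z} {a} {i = i} {s} {t} {m} {j} (split {t = c} {xs} {i₁} {ys} {i₂} f D E refl h) X {Y} e W {r'} e'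
    | inj₂ (X' , e₁ , refl) with reframe X' [] e₁ m
  ... | r₁ , er₁ = split f D (pasteAt E X' e₁ W er₁)
        (∷-∷ʳ-inj (trans e' (trans (Lₚ.++-assoc (a ∷ xs) X' _) (trans (cong (λ l → a ∷ xs ++ l) (sym er₁))
           (cong (a ∷_) (sym (snoc-++ xs)))))))
        (lin h (prove ((# 0 ⊕ # 1) ⊕ (# 2 ⊕ # 3)) ((# 2 ⊕ (# 3 ⊕ # 1)) ⊕ # 0) (i ∷ j ∷ i₁ ∷ i₂ ∷ [])))

  -- In contrast to an edge, three successive vertices may have `c` in the middle. In that case the
  -- apex of the root triangle is about to become interior.
  triple-side : ∀ as X → as ++ c ∷ ys ≡ X ++ p ∷ t ∷ q ∷ Y →
    (∃[ Y' ] as ∷ʳ c ≡ X ++ p ∷ t ∷ q ∷ Y' × Y ≡ Y' ++ ys) ⊎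
    (∃[ X' ] c ∷ ys ≡ X' ++ p ∷ t ∷ q ∷ Y × X ≡ as ++ X') ⊎
    (as ≡ X ∷ʳ p × c ≡ t × ys ≡ q ∷ Y)
  triple-side [] X e = inj₂ (inj₁ (X , e , refl))
  triple-side (a ∷ []) [] refl = inj₂ (inj₂ (refl , refl , refl))
  triple-side (a ∷ b ∷ []) [] refl = inj₁ ([] , refl , refl)
  triple-side (a ∷ b ∷ c ∷ as) [] refl = inj₁ (as ∷ʳ _ , refl , sym (Lₚ.++-assoc as _ _))
  triple-side (a ∷ as) (x ∷ X) e with Lₚ.∷-injective e
  ... | refl , e' with triple-side as X e'
  ... | inj₁ (Y' , e₁ , e₂) = inj₁ (Y' , cong (a ∷_) e₁ , e₂)
  ... | inj₂ (inj₁ (X' , e₁ , refl)) = inj₂ (inj₁ (X' , e₁ , refl))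
  ... | inj₂ (inj₂ (refl , e₁ , e₂)) = inj₂ (inj₂ (refl , e₁ , e₂))

  -- The number of triangles of a disk.
  μ : Ls → Ls → ℕ
  μ r i = length r + (length i + length i)

  μ-inner : ∀ r z {t i j N} → j ↭ t ∷ i → μ r j ≤ suc N → μ (r ∷ʳ z) i ≤ N
  μ-inner r z {t} {i} {j} h l rewrite ↭-length h | Lₚ.length-++ r {[ z ]} | ℕₚ.+-suc (length i) (length i)
    | ℕₚ.+-suc (length r) (suc (length i + length i)) | ℕₚ.+-suc (length r) (length i + length i) | ℕₚ.+-comm (length r) 1 = ℕₚ.≤-pred l

  μ-split : ∀ xs {t ys i k j N} → j ↭ i ++ k → μ (xs ++ t ∷ ys) j ≤ suc N → μ xs i ≤ N × μ ys k ≤ N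
  μ-split xs {t} {ys} {i} {k} {j} {N} h l = ℕₚ.≤-trans (ℕₚ.m≤m+n _ (μ ys k)) l'' , ℕₚ.≤-trans (ℕₚ.m≤n+m _ (μ xs i)) l''
    where
    bound : length xs + suc (length ys) + ((length i + length k) + (length i + length k)) ≤ suc N
    bound rewrite sym (Lₚ.length-++ i {k}) | sym (↭-length h) | sym (Lₚ.length-++ xs {t ∷ ys}) = l
    count : ∀ x y i k → x + suc y + ((i + k) + (i + k)) ≡ suc ((x + (i + i)) + (y + (k + k)))
    count = solve-∀
    l'' : μ xs i + μ ys k ≤ N
    l'' = ℕₚ.≤-pred (subst (_≤ suc N) (count (length xs) (length ys) (length i) (length k)) bound)

  μ-0 : ∀ xs {t ys i} → μ (xs ++ t ∷ ys) i ≤ 0 → ⊥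
  μ-0 [] ()
  μ-0 (_ ∷ _) ()

  private
    μ-0i : ∀ {r t i j} → j ↭ t ∷ i → μ r j ≤ 0 → ⊥
    μ-0i {r} {t} {i} {j} h l with ℕₚ.m+n≡0⇒n≡0 (length r) (ℕₚ.n≤0⇒n≡0 l)
    ... | e rewrite ↭-length h with e
    ... | ()

  mutual
    -- In the `inner` case the smaller disk is re-rooted and the old root triangle has to be put
    -- back at a place that is no longer the root, by `glueAt′`; this in turn re-roots one half of a
    -- `split`. Neither call is structural on a re-rooted disk, so `N` bounds the number of
    -- triangles.
    rotate′ : ∀ N → Disk z a r i → μ r i ≤ N → ∀ {b s} → r ∷ʳ z ≡ b ∷ s → Disk a b s i
    rotate′ _ (edge h) _ refl = edge (adj-sym h)
    rotate′ {r = r} zero (inner f D h) l _ = ⊥-elim (μ-0i {r} h l)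
    rotate′ {i = i} zero (split {xs = xs} f D E refl h) l _ = ⊥-elim (μ-0 xs {i = i} l)
    rotate′ {z} {a} {r} (suc N) (inner {t = t} {i = i} f D h) l {b} {s} e =
      permute (↭-sym h) (glueAt′ N (rotate′ N D (μ-inner r z h l) (cong (_∷ʳ t) e))
        (subst (λ k → k + (length i + length i) ≤ N)
           (trans (cong length e) (trans (ℕₚ.+-comm 1 (length s)) (sym (Lₚ.length-++ s)))) (μ-inner r z h l))
        r (trans (cong (λ l → l ∷ʳ t ∷ʳ a) (sym e)) (trans (cong (_∷ʳ a) (snoc-++ r)) (snoc-++ r))) f
        (trans (cong (_∷ʳ a) (sym e)) (snoc-++ r)))
    rotate′ {z} {a} {i = i} (suc N) (split {t = t} {xs} {i₁} {ys} {i₂} f D E refl h) l {b} {s} e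
      with xs ∷ʳ t in e₁ | snoc-++ xs {t ∷ ys} {z}
    ... | [] | _ = ⊥-elim (∷ʳ-≢[] xs e₁)
    ... | b' ∷ s' | e₂ with Lₚ.∷-injective (trans (sym e) (trans e₂ (trans (sym (Lₚ.++-assoc xs [ t ] (ys ∷ʳ z))) (cong (_++ (ys ∷ʳ z)) e₁))))
    ... | refl , refl = permute (↭-sym h) (pasteAt (rotate′ N D (proj₁ (μ-split xs {i = i₁} {i₂} h l)) e₁) xs
          (trans (cong (_∷ʳ a) (sym e₁)) (snoc-++ xs))
          (split (face-rot f) E (edge (adj-sym (face-adj f))) refl (↭-reflexive (sym (Lₚ.++-identityʳ i₂))))
          (trans (cong (λ l → (l ++ (ys ∷ʳ z)) ∷ʳ a) (sym e₁)) (trans (cong (_∷ʳ a) (Lₚ.++-assoc xs [ t ] _)) (trans (snoc-++ xs) (cong (λ l → xs ++ t ∷ l) refl)))))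

    -- The triangle is glued along both boundary edges at `t`, which thereby becomes interior. If
    -- `t` is the apex of the root `split`, the result is an `inner` disk: the new triangle,
    -- extended by the re-rooted second half, is pasted onto the first half.
    glueAt′ : ∀ N → Disk z a r i → μ r i ≤ N → ∀ X {Y} → a ∷ r ∷ʳ z ≡ X ++ p ∷ t ∷ q ∷ Y → Face p q t →
      ∀ {r'} → a ∷ r' ∷ʳ z ≡ X ++ p ∷ q ∷ Y → Disk z a r' (t ∷ i)
    glueAt′ _ (edge h) _ [] ()
    glueAt′ _ (edge h) _ (_ ∷ []) ()
    glueAt′ _ (edge h) _ (_ ∷ _ ∷ []) ()
    glueAt′ _ (edge h) _ (_ ∷ _ ∷ _ ∷ _) ()
    glueAt′ {r = r} zero (inner f D h) l _ _ = ⊥-elim (μ-0i {r} h l)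
    glueAt′ {i = i} zero (split {xs = xs} f D E refl h) l _ _ = ⊥-elim (μ-0 xs {i = i} l)
    glueAt′ {z} {a} {r} {i} {p} {t} {q} (suc N) (inner {t = u} {i = i'} f D h) l X e g {r'} e' =
      inner f (glueAt′ N D (μ-inner r z h l) X (trans (cong (_∷ʳ u) e) (snoc-++ X)) g (trans (cong (_∷ʳ u) e') (snoc-++ X)))
        (↭-trans (prep t h) (swap t u ↭-refl))
    glueAt′ {z} {a} {i = i} {p} {t} {q} (suc N) (split {t = c} {xs} {i₁} {ys} {i₂} f D E refl h) l X {Y} e g {r'} e'
      with μ-split xs {i = i₁} {i₂} h l | triple-side (a ∷ xs) X (trans (cong (a ∷_) (sym (snoc-++ xs))) e)
    ... | l₁ , l₂ | inj₁ (Y' , e₁ , refl) with reframe X [ t ] e₁ []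
    ... | r₁ , er₁ = split f (glueAt′ N D l₁ X e₁ g er₁) E
        (∷-∷ʳ-inj (trans e' (trans (sym (Lₚ.++-assoc X _ _)) (trans (cong (_++ (ys ∷ʳ z)) (sym er₁))
             (cong (a ∷_) (trans (Lₚ.++-assoc r₁ _ _) (sym (snoc-++ r₁)))))))) (prep t h)
    glueAt′ {z} {a} {i = i} {p} {t} {q} (suc N) (split {t = c} {xs} {i₁} {ys} {i₂} f D E refl h) l X {Y} e g {r'} e'
      | l₁ , l₂ | inj₂ (inj₁ (X' , e₁ , refl)) with reframe X' [ t ] e₁ []
    ... | r₁ , er₁ = split f D (glueAt′ N E l₂ X' e₁ g er₁)
        (∷-∷ʳ-inj (trans e' (trans (Lₚ.++-assoc (a ∷ xs) X' _) (trans (cong (λ l → a ∷ xs ++ l) (sym er₁))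
           (cong (a ∷_) (sym (snoc-++ xs)))))))
        (lin h (prove ((# 0 ⊕ # 1) ⊕ (# 2 ⊕ # 3)) ((# 2 ⊕ (# 0 ⊕ # 3)) ⊕ # 1) ([ t ] ∷ i ∷ i₁ ∷ i₂ ∷ [])))
    glueAt′ {z} {a} {i = i} {p} {t} {q} (suc N) (split {t = c} {xs} {i₁} {ys} {i₂} f D E refl h) l X {Y} e g {r'} e'
      | l₁ , l₂ | inj₂ (inj₂ (ea , refl , ey)) =
      inner f (pasteAt D X (trans (cong (_∷ʳ t) ea) (snoc-++ X))
        (split (face-rot (face-rot g)) (edge (adj-sym (face-adj g))) (rotate′ N E l₂ ey) refl ↭-refl)
        (trans (cong (_∷ʳ t) e') (snoc-++ X))) (prep t h)

  rotate : Disk z a r i → r ∷ʳ z ≡ b ∷ ys → Disk a b ys i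
  rotate D = rotate′ _ D ℕₚ.≤-refl

  -- With the whole boundary as one list, re-rooting is a cyclic rotation of that list.
  Disk∘ : Ls → Ls → Set
  Disk∘ (z ∷ a ∷ r) i = Disk z a r i
  Disk∘ _ i = ⊥

  rotate∘ : ∀ xs ys → Disk∘ (xs ++ ys) i → Disk∘ (ys ++ xs) i
  rotate∘ {i} [] ys D = subst (λ l → Disk∘ l i) (sym (Lₚ.++-identityʳ ys)) D
  rotate∘ {i} (x ∷ xs) ys D = subst (λ l → Disk∘ l i) (Lₚ.++-assoc ys [ x ] xs)
     (rotate∘ xs (ys ∷ʳ x) (subst (λ l → Disk∘ l i) (Lₚ.++-assoc xs ys [ x ]) (step (xs ++ ys) D)))
    where
    step : ∀ l → Disk∘ (x ∷ l) i → Disk∘ (l ∷ʳ x) i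
    step (a ∷ []) D = rotate D refl
    step (a ∷ b ∷ l) D = rotate D refl

  -- A path that keeps some of the vertices of the boundary arc h ∷ l; between two consecutive kept
  -- vertices lies a disk (a pocket), cut off by the chord joining them, whose content u is not visited.
  data Pockets : V → Ls → Ls → Ls → Set where
    nil  : Pockets h [] [] []
    cons : Disk y h m i → Pockets y l k u → l' ≡ m ++ y ∷ l → u' ↭ m ++ i ++ u → Pockets h l' (y ∷ k) u'

  pockets-perm : Pockets h l k u → u ↭ u' → Pockets h l k u'
  pockets-perm nil e with ↭-empty-inv (↭-sym e)
  ... | refl = nil
  pockets-perm (cons D p q h) e = cons D p q (↭-trans (↭-sym e) h)

  pockets-edge : Adj h y → Pockets h [ y ] [ y ] []
  pockets-edge e = cons (edge (adj-sym e)) nil refl ↭-refl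

  pockets-last : Pockets h l k u → last h k ≡ last h l
  pockets-last nil = refl
  pockets-last {h = h} (cons {m = m} D p refl _) = trans (pockets-last p) (sym (last-++ h m))

  pockets-++ : Pockets h l k u → last h l ≡ y → Pockets y l' r u' → Pockets h (l ++ l') (k ++ r) (u ++ u')
  pockets-++ nil refl P = P
  pockets-++ {h = h} {u = u} {l' = l'} {u' = u'} (cons {m = m} {i = i} {u = v} D p refl g) e P =
    cons D (pockets-++ p (trans (sym (last-++ h m)) e) P) (Lₚ.++-assoc m _ _)
      (lin g (prove ((# 0 ⊕ # 1) ⊕ (# 2 ⊕ # 3 ⊕ # 4)) ((# 2 ⊕ # 3 ⊕ (# 4 ⊕ # 1)) ⊕ # 0) (u ∷ u' ∷ m ∷ i ∷ v ∷ [])))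

  record KeepSplit (h : V) (l₁ : Ls) (v : V) (l₂ k u : Ls) : Set where
    constructor keepSplit
    field
      {k₁ k₂ u₁ u₂} : Ls
      left   : Pockets h (l₁ ∷ʳ v) (k₁ ∷ʳ v) u₁
      right  : Pockets v l₂ k₂ u₂
      kept   : k ≡ k₁ ++ v ∷ k₂
      unvis  : u ↭ u₁ ++ u₂

  -- The arc vertices that are not kept are part of the unvisited content, so a vertex outside `u`
  -- is kept and the pockets can be cut there.
  pockets-split : Pockets h l k u → ∀ l₁ {v l₂} → l ≡ l₁ ++ v ∷ l₂ → v ∉ u → KeepSplit h l₁ v l₂ k u
  pockets-split nil l₁ e _ = ⊥-elim (∷ʳ-≢[] l₁ (sym e))
  pockets-split {u = u} (cons {y = y} {m = m} {i} {u = v'} D p refl g) l₁ {v} {l₂} e n with ++-compare m l₁ e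
  ... | inj₁ (cs , refl , refl) with pockets-split p cs refl (λ w → n (∈-resp-↭ (↭-sym g) (∈ₚ.∈-++⁺ʳ m (∈ₚ.∈-++⁺ʳ i w))))
  ... | keepSplit {k₁ = k₁} {u₁ = u₁} {u₂} L R refl q = keepSplit {k₁ = y ∷ k₁} (cons D L (Lₚ.++-assoc m _ _) ↭-refl) R refl
        (lin (g ⊹ q) (prove (# 0 ⊕ ((# 1 ⊕ # 2 ⊕ # 3) ⊕ (# 4 ⊕ # 5))) (((# 1 ⊕ # 2 ⊕ # 4) ⊕ # 5) ⊕ (# 0 ⊕ # 3)) (u ∷ m ∷ i ∷ v' ∷ u₁ ∷ u₂ ∷ [])))
  pockets-split {u = u} (cons {y = y} {m = m} {i} {u = v'} D p refl g) l₁ {v} {l₂} e n | inj₂ ([] , refl , refl) =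
    keepSplit {k₁ = []} {u₁ = m ++ i} (cons D nil (cong (_∷ʳ y) (sym (Lₚ.++-identityʳ l₁))) (↭-reflexive (cong (m ++_) (sym (Lₚ.++-identityʳ i))))) p refl
      (↭-trans g (↭-reflexive (sym (Lₚ.++-assoc m i _))))
  pockets-split {u = u} (cons {m = m} {i} D p refl g) l₁ e n | inj₂ (c ∷ cs , refl , refl) =
    ⊥-elim (n (∈-resp-↭ (↭-sym g) (∈ₚ.∈-++⁺ˡ (∈-mid l₁))))

  record LastPocket (h : V) (l : Ls) (t : V) (k u : Ls) : Set where
    constructor lastPocket
    field
      {l₁ mₗ iₗ k₁ u₁} : Ls
      before : Pockets h l₁ k₁ u₁
      disk  : Disk t (last h l₁) mₗ iₗ
      list  : l ≡ l₁ ++ mₗ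
      kept  : k ≡ k₁ ∷ʳ t
      unvis : u ↭ u₁ ++ mₗ ++ iₗ

  pockets-last-pocket : Pockets h l' k u → l' ≡ l ∷ʳ t → LastPocket h l t k u
  pockets-last-pocket {l = l} nil e = ⊥-elim (∷ʳ-≢[] l (sym e))
  pockets-last-pocket {h = h} {u = u} {l = l} {t = t} (cons {y = y} {m = m} {i} {l = l''} {u = v'} D p refl g) e with unsnoc l''
  pockets-last-pocket {l = l} (cons {m = m} {i} D nil refl g) e | inj₁ refl with ∷ʳ-inj m l e
  ... | refl , refl = lastPocket nil D refl refl (↭-trans g (↭-reflexive (cong (m ++_) (Lₚ.++-identityʳ i))))
  pockets-last-pocket (cons D (cons {m = m} _ _ e' _) refl g) e | inj₁ refl = ⊥-elim (∷ʳ-≢[] m (sym e'))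
  pockets-last-pocket {h = h} {u = u} {l = l} {t = t} (cons {y = y} {m = m} {i} {l = l''} {u = v'} D p refl g) e | inj₂ (l₀ , t' , eq)
    with ∷ʳ-inj (m ++ y ∷ l₀) l (trans (trans (snoc-++ m) (cong (λ z → m ++ y ∷ z) (sym eq))) e) | pockets-last-pocket p eq
  ... | refl , refl | lastPocket {l₁} {m'} {iₘ} {k₁} {u₁} P D' refl ek g' = lastPocket (cons D P refl ↭-refl)
          (subst (λ v → Disk t' v m' iₘ) (sym (last-++ h m)) D') (sym (Lₚ.++-assoc m _ _)) (cong (y ∷_) ek)
          (lin (g ⊹ g') (prove (# 0 ⊕ ((# 1 ⊕ # 2 ⊕ # 3) ⊕ (# 4 ⊕ # 5 ⊕ # 6))) (((# 1 ⊕ # 2 ⊕ # 4) ⊕ # 5 ⊕ # 6) ⊕ (# 0 ⊕ # 3)) (u ∷ m ∷ i ∷ v' ∷ u₁ ∷ m' ∷ iₘ ∷ [])))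

  record PocketAt (h : V) (l k u X : Ls) (s t : V) (Y : Ls) : Set where
    constructor pocketAt
    field
      {yₚ} : V
      {l₁ mₚ iₚ l₂ k₁ k₂ u₁ u₂ X' Y'} : Ls
      before : Pockets h l₁ k₁ u₁
      disk   : Disk yₚ (last h l₁) mₚ iₚ
      after  : Pockets yₚ l₂ k₂ u₂
      list   : l ≡ l₁ ++ mₚ ++ yₚ ∷ l₂
      inside : last h l₁ ∷ mₚ ∷ʳ yₚ ≡ X' ++ s ∷ t ∷ Y'
      left   : X ≡ init h l₁ ++ X'
      right  : Y ≡ Y' ++ l₂
      kept   : k ≡ k₁ ++ yₚ ∷ k₂
      unvis  : u ↭ u₁ ++ (mₚ ++ iₚ) ++ u₂

  -- An arc edge with both ends kept has a pocket too, namely a digon; so no edge of the arc is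
  -- exceptional.
  pockets-at : Pockets h l k u → ∀ X → h ∷ l ≡ X ++ s ∷ t ∷ Y → PocketAt h l k u X s t Y
  pockets-at nil (_ ∷ []) ()
  pockets-at nil (_ ∷ _ ∷ _) ()
  pockets-at {h = h} {s = s} {t} {Y} (cons {y = y} {m = m} {i} {u = v'} D p refl g) X e with pair-side (h ∷ m) X e
  ... | inj₁ (Y' , e₁ , e₂) = pocketAt nil D p refl e₁ refl e₂ refl (↭-trans g (↭-reflexive (sym (Lₚ.++-assoc m i _))))
  ... | inj₂ (X' , e₁ , refl) with pockets-at p X' e₁
  ... | pocketAt {y'} {l₁} {m'} {iₘ} {l₂} {u₁ = u₁} {u₂} {X''} {Y''} B D' A refl ins refl refl refl g' =
     pocketAt (cons D B refl ↭-refl) (subst (λ v → Disk y' v m' iₘ) (sym (last-++ h m)) D') A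
       (sym (Lₚ.++-assoc m _ _)) (trans (cong (λ v → v ∷ m' ∷ʳ y') (last-++ h m)) ins)
       (trans (sym (Lₚ.++-assoc (h ∷ m) _ X'')) (cong (_++ X'') (init-++ h m y l₁))) refl refl
       (lin (g ⊹ g') (prove (# 0 ⊕ ((# 1 ⊕ # 2 ⊕ # 3) ⊕ (# 4 ⊕ (# 5 ⊕ # 6) ⊕ # 7))) (((# 1 ⊕ # 2 ⊕ # 4) ⊕ (# 5 ⊕ # 6) ⊕ # 7) ⊕ (# 0 ⊕ # 3)) (_ ∷ m ∷ i ∷ v' ∷ u₁ ∷ m' ∷ iₘ ∷ u₂ ∷ [])))
    where
    init-++ : ∀ h m y l → (h ∷ m) ++ init y l ≡ init h (m ++ y ∷ l)
    init-++ h [] y l = refl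
    init-++ h (x ∷ m) y l = cong (h ∷_) (init-++ x m y l)

  -- Paths and pairs of paths

  data Trail : V → Ls → V → Set where
    stop : Trail x [] x
    step : Adj x y → Trail y d z → Trail x (y ∷ d) z

  trail-++ : Trail x d y → Trail y e z → Trail x (d ++ e) z
  trail-++ stop T = T
  trail-++ (step h S) T = step h (trail-++ S T)

  trail-rev : Trail x d y → ∃[ e ] Trail y e x × x ∷ d ↭ y ∷ e
  trail-rev stop = [] , stop , ↭-refl
  trail-rev {x} {y = y} (step {y = w} {d = d} h T) with trail-rev T
  ... | e , S , g = e ∷ʳ x , trail-++ S (step (adj-sym h) stop) ,
    lin g (prove ((# 0 ⊕ # 1 ⊕ # 2) ⊕ (# 3 ⊕ # 4)) ((# 3 ⊕ # 4 ⊕ # 0) ⊕ (# 1 ⊕ # 2)) ([ x ] ∷ [ w ] ∷ d ∷ [ y ] ∷ e ∷ []))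

  trail-end-∈ : Trail x d y → y ∈ x ∷ d
  trail-end-∈ stop = here refl
  trail-end-∈ (step _ T) = there (trail-end-∈ T)

  -- A path together with the multiset of its vertices.
  Path : V → V → Ls → Set
  Path x y c = ∃[ d ] Trail x d y × x ∷ d ↭ c

  path-perm : Path x y d → d ↭ e → Path x y e
  path-perm (d , T , g) h = d , T , ↭-trans g h

  path-here : Path x x [ x ]
  path-here = [] , stop , ↭-refl

  path-rev : Path x y e → Path y x e
  path-rev (d , T , g) with trail-rev T
  ... | d' , T' , g' = d' , T' , ↭-trans (↭-sym g') g

  path-join : Path x y e → Adj y z → Path z w f → Path x w (e ++ f)
  path-join (d , T , g) h (d' , T' , g') = d ++ _ ∷ d' , trail-++ T (step h T') , ++⁺ g g'

  -- The junction `y` occurs in both contents, and one copy is dropped.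
  path-glue : Path x y e → Path y w f → e ++ f ↭ y ∷ cs → Path x w cs
  path-glue {x} {y} {e} {w} {f} {cs} (d , T , g) (d' , T' , g') h = d ++ d' , trail-++ T T' ,
    lin (g ⊹ g' ⊹ h) (prove ((# 0 ⊕ # 1 ⊕ # 2) ⊕ (# 3 ⊕ # 4 ⊕ # 5 ⊕ # 6)) (# 6 ⊕ (# 0 ⊕ # 1) ⊕ (# 5 ⊕ # 2) ⊕ # 3 ⊕ # 4) ([ x ] ∷ d ∷ d' ∷ e ∷ f ∷ [ y ] ∷ cs ∷ []))

  path-∈ˡ : Path x y e → x ∈ e
  path-∈ˡ (d , T , g) = ∈-resp-↭ g (here refl)

  path-∈ʳ : Path x y e → y ∈ e
  path-∈ʳ (d , T , g) = ∈-resp-↭ g (trail-end-∈ T)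

  path-self : Path x x e → Unique e → e ↭ [ x ]
  path-self (_ , stop , g) U = ↭-sym g
  path-self {x} {e} (_ , step {d = d} h T , g) U = ⊥-elim (Unique-clash {xs = [ x ]} (↭-sym g) U (here refl) (trail-end-∈ T))

  -- The two paths are disjoint when c has no repetitions.
  Two : V → V → V → V → Ls → Set
  Two x y z a c = ∃[ c₁ ] ∃[ c₂ ] c ↭ c₁ ++ c₂ × ((Path x z c₁ × Path y a c₂) ⊎ (Path x a c₁ × Path y z c₂))

  two-perm : Two x y z a e → e ↭ f → Two x y z a f
  two-perm (c₁ , c₂ , g , P) h = c₁ , c₂ , ↭-trans (↭-sym h) g , P

  two-swap : Two x y z a e → Two y x z a e
  two-swap (c₁ , c₂ , g , inj₁ (P , Q)) = c₂ , c₁ , ↭-trans g (prove (# 0 ⊕ # 1) (# 1 ⊕ # 0) (c₁ ∷ c₂ ∷ [])) , inj₂ (Q , P)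
  two-swap (c₁ , c₂ , g , inj₂ (P , Q)) = c₂ , c₁ , ↭-trans g (prove (# 0 ⊕ # 1) (# 1 ⊕ # 0) (c₁ ∷ c₂ ∷ [])) , inj₁ (Q , P)

  two-swap′ : Two x y z a e → Two x y a z e
  two-swap′ (c₁ , c₂ , g , inj₁ P) = c₁ , c₂ , g , inj₂ P
  two-swap′ (c₁ , c₂ , g , inj₂ P) = c₁ , c₂ , g , inj₁ P

  -- A path from `a` to `z` and one from `y` to `a` would share `a`. So the pairing is the other
  -- one, the path at `a` is trivial, and the remaining path misses `a`. This is how a path avoiding
  -- a prescribed vertex is obtained from a pair of paths.
  two-fix : Two a y z a e → Unique e → ∃[ f ] Path y z f × e ↭ a ∷ f
  two-fix (c₁ , c₂ , g , inj₁ (P , Q)) U = ⊥-elim (Unique-clash g U (path-∈ˡ P) (path-∈ʳ Q))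
  two-fix (c₁ , c₂ , g , inj₂ (P , Q)) U = c₂ , Q , ↭-trans g (++⁺ʳ c₂ (path-self P (Unique-++ˡ c₁ (Unique-↭ g U))))

  two-join : Two x y z a e → Adj z a → Path x y e
  two-join (c₁ , c₂ , g , inj₁ (P , Q)) h = path-perm (path-join P h (path-rev Q)) (↭-sym g)
  two-join (c₁ , c₂ , g , inj₂ (P , Q)) h = path-perm (path-join P (adj-sym h) (path-rev Q)) (↭-sym g)

  two-glueʳ : Two x t z a e → Path t y f → e ++ f ↭ t ∷ cs → Two x y z a cs
  two-glueʳ {t = t} {e = e} {f = f} {cs} (c₁ , c₂ , g , inj₁ (P , Q)) R h with path-∈ʳ (path-rev Q)
  ... | m with ∈-split m
  ... | xs , ys , refl = c₁ , xs ++ ys ++ f , lem , inj₁ (P , path-glue (path-rev R) Q lem')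
    where
    lem : cs ↭ c₁ ++ xs ++ ys ++ f
    lem = lin (g ⊹ ↭-sym h) (prove (# 0 ⊕ ((# 1 ⊕ (# 2 ⊕ # 3 ⊕ # 4)) ⊕ (# 6 ⊕ # 5))) ((# 1 ⊕ # 2 ⊕ # 4 ⊕ # 5) ⊕ (# 6 ⊕ # 3 ⊕ # 0)) (cs ∷ c₁ ∷ xs ∷ [ t ] ∷ ys ∷ f ∷ e ∷ []))
    lem' : f ++ xs ++ t ∷ ys ↭ t ∷ xs ++ ys ++ f
    lem' = prove (# 0 ⊕ # 1 ⊕ # 2 ⊕ # 3) (# 2 ⊕ # 1 ⊕ # 3 ⊕ # 0) (f ∷ xs ∷ [ t ] ∷ ys ∷ [])
  two-glueʳ {t = t} {e = e} {f = f} {cs} (c₁ , c₂ , g , inj₂ (P , Q)) R h with two-glueʳ (c₁ , c₂ , g , inj₁ (P , Q)) R h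
  ... | c₁' , c₂' , g' , inj₁ PQ = c₁' , c₂' , g' , inj₂ PQ
  ... | c₁' , c₂' , g' , inj₂ PQ = c₁' , c₂' , g' , inj₁ PQ

  two-glueˡ : Two t y z a e → Path t x f → e ++ f ↭ t ∷ cs → Two x y z a cs
  two-glueˡ T R h = two-swap (two-glueʳ (two-swap T) R h)

  two-∈ˡ : Two x y z a e → x ∈ e
  two-∈ˡ (c₁ , c₂ , g , inj₁ (P , Q)) = ∈-resp-↭ (↭-sym g) (∈ₚ.∈-++⁺ˡ (path-∈ˡ P))
  two-∈ˡ (c₁ , c₂ , g , inj₂ (P , Q)) = ∈-resp-↭ (↭-sym g) (∈ₚ.∈-++⁺ˡ (path-∈ˡ P))

  two-∈ʳ : Two x y z a e → y ∈ e
  two-∈ʳ T = two-∈ˡ (two-swap T)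

  two-endˡ : Two x y z a e → z ∈ e
  two-endˡ (c₁ , c₂ , g , inj₁ (P , Q)) = ∈-resp-↭ (↭-sym g) (∈ₚ.∈-++⁺ˡ (path-∈ʳ P))
  two-endˡ (c₁ , c₂ , g , inj₂ (P , Q)) = ∈-resp-↭ (↭-sym g) (∈ₚ.∈-++⁺ʳ c₁ (path-∈ʳ Q))

  two-endʳ : Two x y z a e → a ∈ e
  two-endʳ T = two-endˡ (two-swap′ T)

  single-pocket : Pockets z [ a ] k u → k ≡ [ a ] × Disk a z [] u
  single-pocket (cons {m = []} {i} D nil refl g) = refl , permute (↭-sym (↭-trans g (↭-reflexive (Lₚ.++-identityʳ i)))) D
  single-pocket (cons {m = []} D (cons {m = m} _ _ e _) refl g) = ⊥-elim (∷ʳ-≢[] m (sym e))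
  single-pocket (cons {m = _ ∷ m} D p e g) = ⊥-elim (∷ʳ-≢[] m (sym (Lₚ.∷-injectiveʳ e)))

  -- The two paths visit all of the disk but the interiors of pockets along the boundary without the root edge.
  record Out (z a : V) (r i : Ls) (x y : V) : Set where
    constructor out
    field
      {kept unv ins} : Ls
      pockets : Pockets a (r ∷ʳ z) kept unv
      two     : Two x y z a (a ∷ kept ++ ins)
      content : z ∷ a ∷ r ++ i ↭ (a ∷ kept ++ ins) ++ unv
      -- `kept` ends with `z`; the bound says that another vertex of the arc is kept as well, so
      -- that the disk is not a single pocket at its root edge.
      long    : 2 ≤ length kept

  SameEnds : V → V → V → V → Set
  SameEnds x y z a = (x ≡ z × y ≡ a) ⊎ (x ≡ a × y ≡ z)

  -- For the excluded `SameEnds` the only disjoint paths are the trivial ones at `z` and `a`, which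
  -- visit nothing else.
  Solver : ℕ → Set
  Solver N = ∀ {z a r i x y} → Disk z a r i → r ≢ [] → length (z ∷ a ∷ r ++ i) < N → Unique (z ∷ a ∷ r ++ i) →
    x ∈ z ∷ a ∷ r ++ i → y ∈ z ∷ a ∷ r ++ i → x ≢ y → ¬ SameEnds x y z a → Out z a r i x y

  -- The darts of the triangles of a disk, each triangle lying to the left of its darts.
  dartsOf : Disk z a r i → List Dart
  dartsOf (edge _) = []
  dartsOf {z} {a} (inner {t = t} _ D _) = triangle z a t ++ dartsOf D
  dartsOf {z} {a} (split {t = t} _ D E _ _) = triangle z a t ++ dartsOf D ++ dartsOf E

  darts-length : (D : Disk z a r i) → length (dartsOf D) ≡ 3 * (length r + (length i + length i))
  darts-length (edge _) = refl
  darts-length {z} {r = r} (inner {i = i'} _ D h) rewrite darts-length D | ↭-length h | Lₚ.length-++ r {[ z ]} = lem (length r) (length i')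
    where
    lem : ∀ r i → 3 + 3 * (r + 1 + (i + i)) ≡ 3 * (r + (suc i + suc i))
    lem = solve-∀
  darts-length (split {t = t} {xs} {i} {ys} {k} _ D E refl h)
    rewrite Lₚ.length-++ (dartsOf D) {dartsOf E} | darts-length D | darts-length E | ↭-length h | Lₚ.length-++ i {k} | Lₚ.length-++ xs {t ∷ ys} =
    lem (length xs) (length i) (length ys) (length k)
    where
    lem : ∀ x i y k → 3 + (3 * (x + (i + i)) + 3 * (y + (k + k))) ≡ 3 * (x + suc y + (i + k + (i + k)))
    lem = solve-∀

  boundary-darts : (D : Disk z a r i) → r ≢ [] → ∀ {d} → d ∈ boundary z a r → d ∈ dartsOf D
  boundary-darts (edge _) ne = ⊥-elim (ne refl)
  boundary-darts (inner _ D _) ne (here refl) = here refl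
  boundary-darts {z} {a} {r} (inner {t = t} _ D _) ne {d} (there m) = there (there (there (boundary-darts D (∷ʳ-≢[] r) (there (subst (d ∈_) (sym (trans (cong (pairs a) (snoc-++ r)) (pairs-++ a r))) (∈ₚ.∈-++⁺ˡ m))))))
  boundary-darts (split _ D E refl _) ne (here refl) = here refl
  boundary-darts {z} {a} (split {t = t} {xs} {ys = ys} _ D E refl _) ne {d} (there m)
    with ∈ₚ.∈-++⁻ (pairs a (xs ∷ʳ t)) (subst (d ∈_) (trans (cong (pairs a) (snoc-++ xs)) (pairs-++ a xs)) m)
  ... | inj₁ m' with xs
  boundary-darts (split _ D E refl _) ne (there m) | inj₁ (here refl) | [] = there (here refl)
  ... | _ ∷ _ = there (there (there (∈ₚ.∈-++⁺ˡ (boundary-darts D (λ ()) (there m')))))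
  boundary-darts (split {ys = ys} _ D E refl _) ne (there m) | inj₂ m' with ys
  boundary-darts (split _ D E refl _) ne (there m) | inj₂ (here refl) | [] = there (there (here refl))
  ... | _ ∷ _ = there (there (there (∈ₚ.∈-++⁺ʳ (dartsOf D) (boundary-darts E (λ ()) (there m')))))

  root-dart : (D : Disk z a r i) → r ≡ [] ⊎ (z , a) ∈ dartsOf D
  root-dart (edge _) = inj₁ refl
  root-dart (inner _ _ _) = inj₂ (here refl)
  root-dart (split _ _ _ _ _) = inj₂ (here refl)

  -- A boundary dart of a part is either on the boundary of the whole disk or the reverse of a side
  -- of the root triangle.
  darts-reverse : (D : Disk z a r i) → (x , y) ∈ dartsOf D → (y , x) ∈ dartsOf D ⊎ (x , y) ∈ boundary z a r
  darts-reverse (inner _ D _) (here refl) = inj₂ (here refl)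
  darts-reverse {r = r} (inner _ D _) (there (here refl)) = inj₁ (there (there (there (boundary-darts D (∷ʳ-≢[] r) (here refl)))))
  darts-reverse {z} {a} {r} (inner {t = t} _ D _) (there (there (here refl))) = inj₁ (there (there (there (boundary-darts D (∷ʳ-≢[] r)
    (there (subst ((z , t) ∈_) (sym (trans (cong (pairs a) (snoc-++ r)) (pairs-++ a r))) (∈ₚ.∈-++⁺ʳ (pairs a (r ∷ʳ z)) (here refl))))))))
  darts-reverse {z} {a} {r} {x = x} {y} (inner {t = t} _ D _) (there (there (there m))) with darts-reverse D m
  ... | inj₁ m' = inj₁ (there (there (there m')))
  ... | inj₂ (here refl) = inj₁ (there (here refl))
  ... | inj₂ (there m') with ∈ₚ.∈-++⁻ (pairs a (r ∷ʳ z)) (subst ((x , y) ∈_) (trans (cong (pairs a) (snoc-++ r)) (pairs-++ a r)) m')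
  ... | inj₁ m'' = inj₂ (there m'')
  ... | inj₂ (here refl) = inj₁ (there (there (here refl)))
  darts-reverse {z} {a} {x = x} {y} (split {t = t} {xs} {ys = ys} _ D E refl _) m = go m
    where
    left : ∀ {d} → d ∈ pairs a (xs ∷ʳ t) → d ∈ boundary z a (xs ++ t ∷ ys)
    left {d} m = there (subst (d ∈_) (sym (trans (cong (pairs a) (snoc-++ xs)) (pairs-++ a xs))) (∈ₚ.∈-++⁺ˡ m))
    right : ∀ {d} → d ∈ pairs t (ys ∷ʳ z) → d ∈ boundary z a (xs ++ t ∷ ys)
    right {d} m = there (subst (d ∈_) (sym (trans (cong (pairs a) (snoc-++ xs)) (pairs-++ a xs))) (∈ₚ.∈-++⁺ʳ (pairs a (xs ∷ʳ t)) m))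
    all = triangle z a t ++ dartsOf D ++ dartsOf E
    go : (x , y) ∈ all → (y , x) ∈ all ⊎ (x , y) ∈ boundary z a (xs ++ t ∷ ys)
    go (here refl) = inj₂ (here refl)
    go (there (here refl)) with root-dart D
    ... | inj₁ refl = inj₂ (there (here refl))
    ... | inj₂ m = inj₁ (there (there (there (∈ₚ.∈-++⁺ˡ m))))
    go (there (there (here refl))) with root-dart E
    ... | inj₁ refl = inj₂ (right (here refl))
    ... | inj₂ m = inj₁ (there (there (there (∈ₚ.∈-++⁺ʳ (dartsOf D) m))))
    go (there (there (there m))) with ∈ₚ.∈-++⁻ (dartsOf D) m
    ... | inj₁ m' with darts-reverse D m'
    ... | inj₁ m'' = inj₁ (there (there (there (∈ₚ.∈-++⁺ˡ m''))))
    ... | inj₂ (here refl) = inj₁ (there (here refl))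
    ... | inj₂ (there m'') = inj₂ (left m'')
    go (there (there (there m))) | inj₂ m' with darts-reverse E m'
    ... | inj₁ m'' = inj₁ (there (there (there (∈ₚ.∈-++⁺ʳ (dartsOf D) m''))))
    ... | inj₂ (here refl) = inj₁ (there (there (here refl)))
    ... | inj₂ (there m'') = inj₂ (right m'')

  darts-face : (D : Disk z a r i) → (x , y) ∈ dartsOf D → ∃[ w ] Face x y w × (y , w) ∈ dartsOf D
  darts-face (inner {t = t} f D _) (here refl) = t , f , there (here refl)
  darts-face {z} (inner f D _) (there (here refl)) = z , face-rot f , there (there (here refl))
  darts-face {a = a} (inner f D _) (there (there (here refl))) = a , face-rot (face-rot f) , here refl
  darts-face (inner f D _) (there (there (there m))) with darts-face D m
  ... | w , g , m' = w , g , there (there (there m'))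
  darts-face (split {t = t} f D E _ _) (here refl) = t , f , there (here refl)
  darts-face {z} (split f D E _ _) (there (here refl)) = z , face-rot f , there (there (here refl))
  darts-face {a = a} (split f D E _ _) (there (there (here refl))) = a , face-rot (face-rot f) , here refl
  darts-face (split f D E _ _) (there (there (there m))) with ∈ₚ.∈-++⁻ (dartsOf D) m
  ... | inj₁ m' with darts-face D m'
  ... | w , g , m'' = w , g , there (there (there (∈ₚ.∈-++⁺ˡ m'')))
  darts-face (split f D E _ _) (there (there (there m))) | inj₂ m' with darts-face E m'
  ... | w , g , m'' = w , g , there (there (there (∈ₚ.∈-++⁺ʳ (dartsOf D) m'')))

  inner-dart : (D : Disk z a r i) → w ∈ i → ∃[ s ] (s , w) ∈ dartsOf D
  inner-dart {a = a} (inner f D h) m with ∈-resp-↭ h m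
  ... | here refl = a , there (here refl)
  ... | there m' with inner-dart D m'
  ... | s , m'' = s , there (there (there m''))
  inner-dart (split {i = i} f D E _ h) m with ∈ₚ.∈-++⁻ i (∈-resp-↭ h m)
  ... | inj₁ m' with inner-dart D m'
  ... | s , m'' = s , there (there (there (∈ₚ.∈-++⁺ˡ m'')))
  inner-dart (split f D E _ h) m | inj₂ m' with inner-dart E m'
  ... | s , m'' = s , there (there (there (∈ₚ.∈-++⁺ʳ (dartsOf D) m'')))

  dart-source : (D : Disk z a r i) → (x , y) ∈ dartsOf D → x ∈ z ∷ a ∷ r ++ i
  dart-source {z} {a} {r} {i} {x} (inner {t = t} {i = i'} f D h) = go
    where
    cover : t ∷ a ∷ (r ∷ʳ z) ++ i' ↭ z ∷ a ∷ r ++ i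
    cover = (lin {as = ([ t ] ++ ([ a ] ++ ((r ++ [ z ]) ++ i')))} {bs = ([ z ] ++ ([ a ] ++ (r ++ i)))} ((↭-sym h)) (prove ((# 0 ⊕ # 1 ⊕ (# 2 ⊕ # 3) ⊕ # 4) ⊕ # 5) ((# 3 ⊕ # 1 ⊕ # 2 ⊕ # 5) ⊕ # 0 ⊕ # 4) ([ t ] ∷ [ a ] ∷ r ∷ [ z ] ∷ i' ∷ i ∷  [])))
    go : (x , y) ∈ triangle z a t ++ dartsOf D → x ∈ z ∷ a ∷ r ++ i
    go (here refl) = here refl
    go (there (here refl)) = there (here refl)
    go (there (there (here refl))) = ∈-resp-↭ cover (here refl)
    go (there (there (there m))) = ∈-resp-↭ cover (dart-source D m)
  dart-source {z} {a} {i = i} {x} (split {t = t} {xs} {i₁} {ys} {k} f D E refl h) = go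
    where
    coverˡ : (t ∷ a ∷ xs ++ i₁) ++ z ∷ ys ++ k ↭ z ∷ a ∷ (xs ++ t ∷ ys) ++ i
    coverˡ = (lin {as = (([ t ] ++ ([ a ] ++ (xs ++ i₁))) ++ ([ z ] ++ (ys ++ k)))} {bs = ([ z ] ++ ([ a ] ++ ((xs ++ ([ t ] ++ ys)) ++ i)))} ((↭-sym h)) (prove (((# 0 ⊕ # 1 ⊕ # 2 ⊕ # 3) ⊕ # 4 ⊕ # 5 ⊕ # 6) ⊕ # 7) ((# 4 ⊕ # 1 ⊕ (# 2 ⊕ # 0 ⊕ # 5) ⊕ # 7) ⊕ # 3 ⊕ # 6) ([ t ] ∷ [ a ] ∷ xs ∷ i₁ ∷ [ z ] ∷ ys ∷ k ∷ i ∷  [])))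
    coverʳ : (z ∷ t ∷ ys ++ k) ++ a ∷ xs ++ i₁ ↭ z ∷ a ∷ (xs ++ t ∷ ys) ++ i
    coverʳ = (lin {as = (([ z ] ++ ([ t ] ++ (ys ++ k))) ++ ([ a ] ++ (xs ++ i₁)))} {bs = ([ z ] ++ ([ a ] ++ ((xs ++ ([ t ] ++ ys)) ++ i)))} ((↭-sym h)) (prove (((# 0 ⊕ # 1 ⊕ # 2 ⊕ # 3) ⊕ # 4 ⊕ # 5 ⊕ # 6) ⊕ # 7) ((# 0 ⊕ # 4 ⊕ (# 5 ⊕ # 1 ⊕ # 2) ⊕ # 7) ⊕ # 6 ⊕ # 3) ([ z ] ∷ [ t ] ∷ ys ∷ k ∷ [ a ] ∷ xs ∷ i₁ ∷ i ∷  [])))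
    go : (x , y) ∈ triangle z a t ++ dartsOf D ++ dartsOf E → x ∈ z ∷ a ∷ (xs ++ t ∷ ys) ++ i
    go (here refl) = here refl
    go (there (here refl)) = there (here refl)
    go (there (there (here refl))) = ∈-resp-↭ coverˡ (here refl)
    go (there (there (there m))) with ∈ₚ.∈-++⁻ (dartsOf D) m
    ... | inj₁ m' = ∈-resp-↭ coverˡ (∈ₚ.∈-++⁺ˡ (dart-source D m'))
    ... | inj₂ m' = ∈-resp-↭ coverʳ (∈ₚ.∈-++⁺ˡ (dart-source E m'))

-- This is all that the induction on disks uses of 3-connectivity and of the hypothesis on
-- separating triangles.
record Tight (𝒮 : Surface) : Set where
  open Surface 𝒮
  open Disks 𝒮
  field
    no-digon : ∀ {z a i} → Disk z a [] i → Unique (z ∷ a ∷ i) → i ≡ []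
    no-triangle : ∀ {z a b i} → Disk z a (b ∷ []) i → Unique (z ∷ a ∷ b ∷ i) → i ≡ []

-- The induction on disks: the data of a step

module Solutions (𝒮 : Surface) (tight : Tight 𝒮) where

  open Surface 𝒮
  open Lists V _≟_
  open Disks 𝒮
  open Tight tight

  private variable
    x y z a b p w τ α β : V
    r r' i i' j k u u' xs ys l l' d e f cs ps : Ls

  -- The version with a single path, which arises when the root edge joins the two paths. It exists
  -- for all pairs of distinct end vertices, also for the ends of the root edge.
  record Joined (z a : V) (r i : Ls) (x y : V) : Set where
    constructor joined
    field
      {kept unv ins} : Ls
      pockets : Pockets a (r ∷ʳ z) kept unv
      path    : Path x y (a ∷ kept ++ ins)
      content : z ∷ a ∷ r ++ i ↭ (a ∷ kept ++ ins) ++ unv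

  ∈→↭ : x ∈ xs → ∃[ ys ] xs ↭ x ∷ ys
  ∈→↭ m with ∈-split m
  ... | as , bs , refl = as ++ bs , shift _ as bs

  -- When the prescribed end vertices are those of the root edge, another boundary edge is used as the root.
  join-ends : ∀ {N} → Solver N → Disk z a (b ∷ r) i → length (z ∷ a ∷ b ∷ r ++ i) < N → Unique (z ∷ a ∷ b ∷ r ++ i) →
    SameEnds x y z a → Joined z a (b ∷ r) i x y
  join-ends {z} {a} {b} {r} {i} {x} {y} {N} S D lt U se = finish (S E (∷ʳ-≢[] r) (subst (_< N) (↭-length turn) lt) U' (mx se) (my se) (x≢y se) (noEnds se))
    where
    E : Disk a b (r ∷ʳ z) i
    E = rotate D refl
    turn : z ∷ a ∷ b ∷ r ++ i ↭ a ∷ b ∷ (r ∷ʳ z) ++ i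
    turn = (prove (# 0 ⊕ # 1 ⊕ # 2 ⊕ # 3 ⊕ # 4) (# 1 ⊕ # 2 ⊕ (# 3 ⊕ # 0) ⊕ # 4) ([ z ] ∷ [ a ] ∷ [ b ] ∷ r ∷ i ∷  []))
    U' = Unique-↭ turn U
    z≢a : z ≢ a
    z≢a = Unique-≢ ↭-refl U
    z≢b : z ≢ b
    z≢b = Unique-≢ (prep z (swap a b ↭-refl)) U
    a≢b : a ≢ b
    a≢b = Unique-≢ ↭-refl U'
    zin : z ∈ a ∷ b ∷ (r ∷ʳ z) ++ i
    zin = there (there (∈ₚ.∈-++⁺ˡ (∈-mid r)))
    mx : SameEnds x y z a → x ∈ a ∷ b ∷ (r ∷ʳ z) ++ i
    mx (inj₁ (refl , _)) = zin
    mx (inj₂ (refl , _)) = here refl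
    my : SameEnds x y z a → y ∈ a ∷ b ∷ (r ∷ʳ z) ++ i
    my (inj₁ (_ , refl)) = here refl
    my (inj₂ (_ , refl)) = zin
    x≢y : SameEnds x y z a → x ≢ y
    x≢y (inj₁ (refl , refl)) e = z≢a e
    x≢y (inj₂ (refl , refl)) e = z≢a (sym e)
    noEnds : SameEnds x y z a → ¬ SameEnds x y a b
    noEnds (inj₁ (refl , refl)) (inj₁ (e , _)) = z≢a e
    noEnds (inj₁ (refl , refl)) (inj₂ (e , _)) = z≢b e
    noEnds (inj₂ (refl , refl)) (inj₁ (_ , e)) = z≢b e
    noEnds (inj₂ (refl , refl)) (inj₂ (e , _)) = a≢b e
    zvis : ∀ {c} → SameEnds x y z a → Two x y a b c → z ∈ c
    zvis (inj₁ (refl , _)) T = two-∈ˡ T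
    zvis (inj₂ (_ , refl)) T = two-∈ʳ T
    finish : Out a b (r ∷ʳ z) i x y → Joined z a (b ∷ r) i x y
    finish (out {kept} {unv} {ins} pk two ct _)
      with pockets-split pk r (snoc-++ r) (Unique-clash ct U' (zvis se two))
    ... | keepSplit {k₁} {k₂} {u₁} {u₂} L R refl g with single-pocket R
    ... | refl , D₂ with no-digon D₂ (Unique-sub {ys = u₁ ++ b ∷ k₁ ++ ins} (lin {as = (([ a ] ++ ([ z ] ++ u₂)) ++ (u₁ ++ ([ b ] ++ (k₁ ++ ins))))} {bs = ([ a ] ++ ([ b ] ++ ((r ++ [ z ]) ++ i)))} ((↭-sym ct) ⊹ (↭-sym g)) (prove (((# 0 ⊕ # 1 ⊕ # 2) ⊕ # 3 ⊕ # 4 ⊕ # 5 ⊕ # 6) ⊕ (# 0 ⊕ # 4 ⊕ (# 7 ⊕ # 1) ⊕ # 8) ⊕ # 9) ((# 0 ⊕ # 4 ⊕ (# 7 ⊕ # 1) ⊕ # 8) ⊕ ((# 4 ⊕ (# 5 ⊕ # 1 ⊕ # 0) ⊕ # 6) ⊕ # 9) ⊕ # 3 ⊕ # 2) ([ a ] ∷ [ z ] ∷ u₂ ∷ u₁ ∷ [ b ] ∷ k₁ ∷ ins ∷ r ∷ i ∷ unv ∷  []))) U')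
    ... | refl = joined {ins = ins} (pockets-++ (pockets-edge (root-adj E)) refl L)
         (path-perm (two-join two (root-adj E)) (prove (# 0 ⊕ (# 1 ⊕ # 2 ⊕ # 3) ⊕ # 4) (# 3 ⊕ (# 0 ⊕ # 1 ⊕ # 2) ⊕ # 4) ([ b ] ∷ k₁ ∷ [ z ] ∷ [ a ] ∷ ins ∷  [])))
         (lin {as = ([ z ] ++ ([ a ] ++ ([ b ] ++ (r ++ i))))} {bs = (([ a ] ++ (([ b ] ++ (k₁ ++ [ z ])) ++ ins)) ++ u₁)} (ct ⊹ g) (prove ((# 0 ⊕ # 1 ⊕ # 2 ⊕ # 3 ⊕ # 4) ⊕ ((# 2 ⊕ (# 5 ⊕ # 0 ⊕ # 1) ⊕ # 6) ⊕ # 7) ⊕ # 8 ⊕ ε) (((# 1 ⊕ (# 2 ⊕ # 5 ⊕ # 0) ⊕ # 6) ⊕ # 8) ⊕ (# 1 ⊕ # 2 ⊕ (# 3 ⊕ # 0) ⊕ # 4) ⊕ # 7) ([ z ] ∷ [ a ] ∷ [ b ] ∷ r ∷ i ∷ k₁ ∷ ins ∷ unv ∷ u₁ ∷  [])))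

  join : ∀ {N} → Solver N → Disk z a r i → length (z ∷ a ∷ r ++ i) < N → Unique (z ∷ a ∷ r ++ i) →
    x ∈ z ∷ a ∷ r ++ i → y ∈ z ∷ a ∷ r ++ i → x ≢ y → Joined z a r i x y
  join {z} {a} {[]} {i} S D lt U mx my n with no-digon D U
  join {z} {a} {[]} {x = x} {y} S D lt U mx my n | refl = joined {ins = []} (pockets-edge (adj-sym (root-adj D))) (go mx my) (swap z a ↭-refl)
    where
    go : x ∈ z ∷ a ∷ [] → y ∈ z ∷ a ∷ [] → Path x y (a ∷ z ∷ [])
    go (here refl) (here refl) = ⊥-elim (n refl)
    go (here refl) (there (here refl)) = path-perm (path-join path-here (root-adj D) path-here) (swap z a ↭-refl)
    go (there (here refl)) (here refl) = path-join path-here (adj-sym (root-adj D)) path-here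
    go (there (here refl)) (there (here refl)) = ⊥-elim (n refl)
  join {z} {a} {b ∷ r} {i} {x} {y} {N} S D lt U mx my n with x ≟ z | y ≟ a | x ≟ a | y ≟ z
  ... | no nz | _ | no na | _ = let open Out (S D (λ ()) lt U mx my n λ { (inj₁ (e , _)) → nz e ; (inj₂ (e , _)) → na e }) in
        joined pockets (two-join two (root-adj D)) content
  ... | no nz | _ | yes _ | no ny = let open Out (S D (λ ()) lt U mx my n λ { (inj₁ (e , _)) → nz e ; (inj₂ (_ , e)) → ny e }) in
        joined pockets (two-join two (root-adj D)) content
  ... | yes _ | no ny | no na | _ = let open Out (S D (λ ()) lt U mx my n λ { (inj₁ (_ , e)) → ny e ; (inj₂ (e , _)) → na e }) in
        joined pockets (two-join two (root-adj D)) content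
  ... | yes refl | _ | yes refl | _ = ⊥-elim (Unique-≢ ↭-refl U refl)
  ... | yes refl | yes refl | no _ | _ = join-ends S D lt U (inj₁ (refl , refl))
  ... | no _ | _ | yes refl | yes refl = join-ends S D lt U (inj₂ (refl , refl))

  -- How a disk with root (z', a') sits inside one with root (z, a) from which it was obtained by peeling
  -- the root triangle: every disk that agrees with the smaller one from w on can be put in its place.
  record Step (z a : V) (r i : Ls) (z' a' : V) (r' i' : Ls) : Set₁ where
    field
      pre ex : Ls
      -- `w`, the vertex from which on the boundaries agree, must be on the larger boundary as well.
      -- This excludes the apex of an `inner` step, which lies on the smaller one only.
      Ok     : V → Set
      ints   : i ↭ i' ++ ex
      lift   : ∀ S {w Y'} → Ok w → a' ∷ r' ∷ʳ z' ≡ S ++ w ∷ Y' →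
               ∃[ Y ] a ∷ r ∷ʳ z ≡ pre ++ S ++ w ∷ Y ×
               (∀ {R' j} S' → Disk z' a' R' j → a' ∷ R' ∷ʳ z' ≡ S' ++ w ∷ Y' → ∀ {R} → a ∷ R ∷ʳ z ≡ pre ++ S' ++ w ∷ Y →
                  Disk z a R (j ++ ex) × (R ≢ [] ⊎ j ++ ex ≢ []))

  step-inner : Face z a τ → i ↭ τ ∷ i' → Step z a r i τ a (r ∷ʳ z) i'
  step-inner {z} {a} {t} {i} {i'} {r} f h = record
    { pre = [] ; ex = [ t ] ; Ok = _≢ t ; ints = (lin {as = i} {bs = (i' ++ [ t ])} (h) (prove (# 0 ⊕ # 1 ⊕ # 2) ((# 2 ⊕ # 1) ⊕ # 0) (i ∷ [ t ] ∷ i' ∷  []))) ; lift = lft }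
    where
    lft : ∀ S {w Y'} → w ≢ t → a ∷ (r ∷ʳ z) ∷ʳ t ≡ S ++ w ∷ Y' →
               ∃[ Y ] a ∷ r ∷ʳ z ≡ S ++ w ∷ Y ×
               (∀ {R' j} S' → Disk t a R' j → a ∷ R' ∷ʳ t ≡ S' ++ w ∷ Y' → ∀ {R} → a ∷ R ∷ʳ z ≡ S' ++ w ∷ Y →
                  Disk z a R (j ++ [ t ]) × (R ≢ [] ⊎ j ++ [ t ] ≢ []))
    lft S {w} {Y'} n e with unsnoc Y'
    ... | inj₁ refl = ⊥-elim (n (sym (proj₂ (∷ʳ-inj (a ∷ r ∷ʳ z) S e))))
    ... | inj₂ (Y , t' , refl) with ∷ʳ-inj (a ∷ r ∷ʳ z) (S ++ w ∷ Y) (trans e (sym (snoc-++ S)))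
    ... | e₁ , refl = Y , e₁ , λ {R'} {j} S' D e' e'' →
        inner f (subst (λ l → Disk t a l j) (Lₚ.∷-injectiveʳ (trans (proj₁ (∷ʳ-inj (a ∷ R') _ (trans e' (sym (snoc-++ S'))))) (sym e''))) D)
          (prove (# 0 ⊕ # 1) (# 1 ⊕ # 0) (j ∷ [ t ] ∷  [])) , inj₂ (∷ʳ-≢[] j)

  step-next : Face z a p → i ↭ i' → Step z a (p ∷ r) i z p r i'
  step-next {z} {a} {p} {i} {i'} {r} f h = record
    { pre = [ a ] ; ex = [] ; Ok = λ _ → ⊤ ; ints = (lin {as = i} {bs = (i' ++ [])} (h) (prove (# 0 ⊕ # 1) ((# 1 ⊕ ε) ⊕ # 0) (i ∷ i' ∷  [])))
    ; lift = λ S {w} {Y'} _ e → Y' , cong (a ∷_) e , λ {R'} {j} S' D e' e'' →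
        lem D (Lₚ.∷-injectiveʳ (trans e'' (cong (a ∷_) (sym e')))) }
    where
    lem : ∀ {R R' j} → Disk z p R' j → R ∷ʳ z ≡ p ∷ R' ∷ʳ z → Disk z a R (j ++ []) × (R ≢ [] ⊎ j ++ [] ≢ [])
    lem {R} {R'} {j} D e with ∷ʳ-inj R (p ∷ R') e
    ... | refl , _ = split f (edge (adj-sym (face-adj₂ f))) D refl (prove (# 0 ⊕ ε) (# 0) (j ∷  [])) , inj₁ λ ()

  step-pocket : Face z a τ → Disk z τ ys k → i ↭ i' ++ k → Step z a (r ++ τ ∷ ys) i τ a r i'
  step-pocket {z} {a} {t} {ys} {k} {i} {i'} {r} f E h = record
    { pre = [] ; ex = k ; Ok = λ _ → ⊤ ; ints = h
    ; lift = λ S {w} {Y'} _ e → Y' ++ ys ∷ʳ z , trans (cong (a ∷_) (trans (snoc-++ r) (sym (Lₚ.++-assoc r [ t ] _)))) (trans (cong (_++ ys ∷ʳ z) e) (Lₚ.++-assoc S _ _)) ,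
        λ {R'} {j} S' D e' {R} e'' → lem D (∷-∷ʳ-inj (trans e'' (trans (sym (Lₚ.++-assoc S' _ _)) (trans (cong (_++ ys ∷ʳ z) (sym e')) (cong (a ∷_) (trans (Lₚ.++-assoc R' _ _) (sym (snoc-++ R')))))))) }
    where
    lem : ∀ {R R' j} → Disk t a R' j → R ≡ R' ++ t ∷ ys → Disk z a R (j ++ k) × (R ≢ [] ⊎ j ++ k ≢ [])
    lem {R' = R'} D refl = split f D E refl ↭-refl , inj₁ (∷ʳ-≢[] R')

  -- A chord from a vertex of the arc a ∷ ps cuts the disk into DA, which contains the root, and DB.
  record Chord (O : Ls) (z a : V) (ps r i : Ls) : Set where
    field
      {s t} : V
      {X Y mid rA iA iB} : Ls
      DA     : Disk z a rA iA
      DB     : Disk t s mid iB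
      arc    : a ∷ r ∷ʳ z ≡ X ++ s ∷ mid ++ t ∷ Y
      short  : a ∷ rA ∷ʳ z ≡ X ++ s ∷ t ∷ Y
      mid≢[] : mid ≢ []
      ints   : i ↭ iA ++ iB
      -- The part at the root is more than a bare edge, so the chord is not the root edge itself.
      proper : rA ≢ [] ⊎ iA ≢ []
      s∈     : s ∈ a ∷ ps
      t∈     : t ∈ (a ∷ ps) ++ O

  -- The 2-path ph, q, pj cuts the disk into F, containing x and y, and E, containing the root.
  record Cut (O : Ls) (z a : V) (ps r i : Ls) (x y : V) : Set where
    field
      {q ph pj} : V
      {X Y mid rE iE iF} : Ls
      F    : Disk q ph (mid ∷ʳ pj) iF
      E    : Disk z a rE iE
      arc  : a ∷ r ∷ʳ z ≡ X ++ ph ∷ mid ++ pj ∷ Y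
      arcE : a ∷ rE ∷ʳ z ≡ X ++ ph ∷ q ∷ pj ∷ Y
      ints : i ↭ q ∷ iF ++ iE
      -- `F` may be exchanged for any disk on the same 2-path. In this way a leftover part of `F` is
      -- handed back to the outer side.
      fill : ∀ R {j R'} → Disk q ph (R ∷ʳ pj) j → a ∷ R' ∷ʳ z ≡ X ++ ph ∷ R ++ pj ∷ Y → Disk z a R' (q ∷ j ++ iE)
      x∈   : x ∈ q ∷ iF
      y∈   : y ∈ q ∷ iF
      x∉O  : x ∉ O
      y∉O  : y ∉ O
      q∉O  : q ∉ O
      pj∈  : pj ∈ a ∷ ps

  module _ {O z a r i z' a' r' i' ps ps'} (S : Step z a r i z' a' r' i')
    (ok : ∀ {w} → w ∈ (a' ∷ ps') ++ O → Step.Ok S w) (sub : ∀ {w} → w ∈ a' ∷ ps' → w ∈ a ∷ ps) where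
    open Step S

    up-chord : Chord O z' a' ps' r' i' → Chord O z a ps r i
    up-chord C with lift (C.X ++ C.s ∷ C.mid) (ok C.t∈) (trans C.arc (sym (Lₚ.++-assoc C.X _ _)))
      where module C = Chord C
    ... | Y , e , fn = go (reframe (pre ++ C.X) C.mid e' [])
      where
      module C = Chord C
      e' : a ∷ r ∷ʳ z ≡ (pre ++ C.X) ++ C.s ∷ C.mid ++ C.t ∷ Y
      e' = trans e (trans (cong (pre ++_) (Lₚ.++-assoc C.X _ _)) (sym (Lₚ.++-assoc pre _ _)))
      go : ∃[ R ] a ∷ R ∷ʳ z ≡ (pre ++ C.X) ++ C.s ∷ C.t ∷ Y → Chord O z a ps r i
      go (R , e₁) with fn (C.X ∷ʳ C.s) C.DA (trans C.short (sym (Lₚ.++-assoc C.X _ _))) {R} (trans e₁ (trans (Lₚ.++-assoc pre _ _) (cong (pre ++_) (sym (Lₚ.++-assoc C.X _ _)))))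
      ... | D , ne = record { DA = D ; DB = C.DB ; arc = e' ; short = e₁ ; mid≢[] = C.mid≢[]
            ; ints = (lin {as = i} {bs = ((C.iA ++ ex) ++ C.iB)} (ints ⊹ C.ints) (prove (# 0 ⊕ (# 1 ⊕ # 2) ⊕ # 3 ⊕ # 4) (((# 3 ⊕ # 2) ⊕ # 4) ⊕ # 0 ⊕ # 1) (i ∷ i' ∷ ex ∷ C.iA ∷ C.iB ∷  []))) ; proper = ne ; s∈ = sub C.s∈ ; t∈ = mem (∈ₚ.∈-++⁻ (a' ∷ ps') C.t∈) }
        where
        mem : C.t ∈ a' ∷ ps' ⊎ C.t ∈ O → C.t ∈ (a ∷ ps) ++ O
        mem (inj₁ m) = ∈ₚ.∈-++⁺ˡ (sub m)
        mem (inj₂ m) = ∈ₚ.∈-++⁺ʳ (a ∷ ps) m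

    up-cut : ∀ {x y} → Cut O z' a' ps' r' i' x y → Cut O z a ps r i x y
    up-cut C with lift (C.X ++ C.ph ∷ C.mid) (ok (∈ₚ.∈-++⁺ˡ C.pj∈)) (trans C.arc (sym (Lₚ.++-assoc C.X _ _)))
      where module C = Cut C
    ... | Y , e , fn = go (reframe (pre ++ C.X) C.mid e' [ C.q ])
      where
      module C = Cut C
      e' : a ∷ r ∷ʳ z ≡ (pre ++ C.X) ++ C.ph ∷ C.mid ++ C.pj ∷ Y
      e' = trans e (trans (cong (pre ++_) (Lₚ.++-assoc C.X _ _)) (sym (Lₚ.++-assoc pre _ _)))
      reassoc : ∀ R {R'} → a ∷ R' ∷ʳ z ≡ (pre ++ C.X) ++ C.ph ∷ R ++ C.pj ∷ Y → a ∷ R' ∷ʳ z ≡ pre ++ (C.X ++ C.ph ∷ R) ++ C.pj ∷ Y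
      reassoc R e = trans e (trans (Lₚ.++-assoc pre _ _) (cong (pre ++_) (sym (Lₚ.++-assoc C.X _ _))))
      fill' : ∀ R {j R'} → Disk C.q C.ph (R ∷ʳ C.pj) j → a ∷ R' ∷ʳ z ≡ (pre ++ C.X) ++ C.ph ∷ R ++ C.pj ∷ Y → Disk z a R' (C.q ∷ j ++ C.iE ++ ex)
      fill' R {j} D e'' with reframe C.X C.mid C.arc R
      ... | R₀ , e₀ = permute (prove ((# 0 ⊕ # 1 ⊕ # 2) ⊕ # 3) (# 0 ⊕ # 1 ⊕ # 2 ⊕ # 3) ([ C.q ] ∷ j ∷ C.iE ∷ ex ∷  []))
              (proj₁ (fn (C.X ++ C.ph ∷ R) (C.fill R D e₀) (trans e₀ (sym (Lₚ.++-assoc C.X _ _))) (reassoc R e'')))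
      go : ∃[ R ] a ∷ R ∷ʳ z ≡ (pre ++ C.X) ++ C.ph ∷ C.q ∷ C.pj ∷ Y → Cut O z a ps r i _ _
      go (R , e₁) = record { F = C.F ; E = proj₁ (fn (C.X ++ C.ph ∷ [ C.q ]) C.E (trans C.arcE (sym (Lₚ.++-assoc C.X _ _))) {R} (reassoc [ C.q ] e₁)) ; arc = e' ; arcE = e₁
        ; ints = (lin {as = i} {bs = ([ C.q ] ++ (C.iF ++ (C.iE ++ ex)))} (ints ⊹ C.ints) (prove (# 0 ⊕ (# 1 ⊕ # 2) ⊕ # 3 ⊕ # 4 ⊕ # 5) ((# 3 ⊕ # 4 ⊕ # 5 ⊕ # 2) ⊕ # 0 ⊕ # 1) (i ∷ i' ∷ ex ∷ [ C.q ] ∷ C.iF ∷ C.iE ∷  [])))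
        ; fill = fill' ; x∈ = C.x∈ ; y∈ = C.y∈ ; x∉O = C.x∉O ; y∉O = C.y∉O ; q∉O = C.q∉O ; pj∈ = sub C.pj∈ }

  -- A path along a ∷ ps that visits everything in the region attached to it, except for pockets.
  record Sweep (a : V) (ps i : Ls) : Set where
    constructor sweep
    field
      {kept unv vis ins} : Ls
      pockets : Pockets a ps kept unv
      path    : Path a (last a ps) vis
      keeps   : vis ↭ (a ∷ kept) ++ ins
      content : a ∷ ps ++ i ↭ vis ++ unv

  -- The pockets run once around the cycle, back to `q₀`, since the remaining disk may be solved
  -- with another root than the edge `z q₀`; hence `z` itself may be skipped.
  record Final (Sol : V → V → Ls → Set) (q₀ z : V) (ys i : Ls) (x y : V) : Set where
    constructor final
    field
      {kept unv vis ins} : Ls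
      pockets : Pockets q₀ (ys ++ z ∷ q₀ ∷ []) kept unv
      sol     : Sol x y vis
      keeps   : vis ↭ kept ++ ins
      content : z ∷ q₀ ∷ ys ++ i ↭ vis ++ unv

  -- An end vertex behind a cutvertex is replaced by the cutvertex during the run, which can happen
  -- only if the original end vertex is off `O`. A task with `x₀` in `O` thus knows that its end
  -- vertex is still `x₀`.
  Orig : Ls → V → V → Set
  Orig O x₀ x = x ≡ x₀ ⊎ (x₀ ∉ O × x ∉ O)

  two-of : x ∈ xs → y ∈ xs → x ≢ y → xs ↭ z ∷ ys → ∃[ w ] ∃[ ws ] ys ↭ w ∷ ws
  two-of {ys = w ∷ ws} mx my n g = w , ws , ↭-refl
  two-of {ys = []} mx my n g with ∈-resp-↭ g mx | ∈-resp-↭ g my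
  ... | here refl | here refl = ⊥-elim (n refl)

  -- The data of a run: the path along the removed arc ends at m₀; the remaining arc starts with the original
  -- vertices q₀ ∷ O'; what is left when the arc is removed is handed to finish.
  record Task (N : ℕ) : Set₁ where
    field
      solve : Solver N
      q₀ : V
      O' : Ls
      m₀ : V
      ps₀ : Ls
      x₀ y₀ : V
      -- What is wanted in the remaining disk, one path or two. The run only needs that it can be
      -- prolonged at either end vertex.
      Sol : V → V → Ls → Set
      sol-extʳ : ∀ {x t y c d e} → Sol x t c → Path t y d → c ++ d ↭ t ∷ e → Sol x y e
      sol-extˡ : ∀ {x t y c d e} → Sol t y c → Path t x d → c ++ d ↭ t ∷ e → Sol x y e
      sol-∈ˡ : ∀ {x y c} → Sol x y c → x ∈ c
      sol-∈ʳ : ∀ {x y c} → Sol x y c → y ∈ c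
      -- A corner attached at one visited vertex. The premise `b ∈ ps₀` makes both absorptions
      -- vacuous for tasks that remove a single vertex.
      absorb₁ : ∀ {α a b ps i} → b ∈ ps₀ → Disk α a (b ∷ ps) i → length (α ∷ a ∷ b ∷ ps ++ i) < N →
        Unique (α ∷ a ∷ b ∷ ps ++ i) → Sweep a (b ∷ ps) i
      -- A corner attached at an edge. The two end vertices may be just the ends of this edge, so no
      -- vertex outside is guaranteed and the bound is not strict.
      absorb₂ : ∀ {α a b ps β i} → b ∈ ps₀ → Disk α a (b ∷ ps ∷ʳ β) i → length (α ∷ a ∷ (b ∷ ps ∷ʳ β) ++ i) ≤ N →
        Unique (α ∷ a ∷ (b ∷ ps ∷ʳ β) ++ i) → Sweep a (b ∷ ps) i
      finish : ∀ {z ys i x y L} → Disk z q₀ ys i → ys ∷ʳ z ≡ O' ++ L → Orig (q₀ ∷ O') x₀ x → Orig (q₀ ∷ O') y₀ y →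
        x ≢ y → x ∈ z ∷ q₀ ∷ ys ++ i → y ∈ z ∷ q₀ ∷ ys ++ i → Unique (z ∷ q₀ ∷ ys ++ i) →
        length (z ∷ q₀ ∷ ys ++ i) < N → Adj z m₀ → Final Sol q₀ z ys i x y

  -- The possible outcomes of removing an arc

  module Run {N : ℕ} (task : Task N) where
    open Task task

    O : Ls
    O = q₀ ∷ O'

    record None (z a : V) (ps L r i : Ls) (x y : V) : Set where
      constructor none
      field
        {kP uP cP kQ uQ cS cR cI} : Ls
        pkP     : Pockets a ps kP uP
        pathP   : Path a m₀ cP
        pkQ     : Pockets q₀ (O' ++ L) kQ uQ
        sol     : Sol x y cS
        vis     : cS ↭ (q₀ ∷ kQ) ++ cR
        visP    : cP ↭ (a ∷ kP) ++ cI
        content : z ∷ a ∷ r ++ i ↭ cP ++ uP ++ cS ++ uQ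

    -- How an unvisited corner hangs on the visited part: at a cutvertex of what the removed arc
    -- leaves, or at a chord `α β` that closes a pocket of the solution. In both cases `α` is the
    -- last vertex reached on the remaining arc.
    data Kind : V → Ls → Set where
      cutvertex : ∀ {α} → α ∉ O → Kind α [ α ]
      cutedge   : ∀ {α β} → Kind α (β ∷ α ∷ [])

    -- The part of the disk at the root that the paths have not visited so far.
    record Corner (z a : V) (ps L r i : Ls) (x y : V) : Set where
      constructor corner
      field
        {ps₁ ps₂ Qv Qu B iZ kP uP cP kQ uQ cS cR cB cI} : Ls
        psE     : ps ≡ ps₁ ++ ps₂
        pkP     : Pockets (last a ps₁) ps₂ kP uP
        pathP   : Path (last a ps₁) m₀ cP
        QE      : O' ++ L ≡ Qv ++ Qu ∷ʳ z
        pkQ     : Pockets q₀ Qv kQ uQ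
        sol     : Sol x y cS
        vis     : cS ↭ (q₀ ∷ kQ) ++ cR
        visP    : cP ↭ (last a ps₁ ∷ kP) ++ cI
        kind    : Kind (last q₀ Qv) B
        visB    : cS ↭ B ++ cB
        Z       : Disk z a (ps₁ ++ B ++ Qu) iZ
        content : z ∷ a ∷ r ++ i ↭ cP ++ uP ++ cS ++ uQ ++ init a ps₁ ++ (Qu ∷ʳ z) ++ iZ

    -- Both end vertices lie in `F`, which shares with the rest only an edge from the removed arc to
    -- a vertex off `O`. That vertex is the root vertex `z` in `at-end` and a later boundary vertex
    -- `q` in `at-mid`; putting triangles back moves the root towards it.
    data Both (z a : V) (ps Qi i : Ls) (x y : V) : Set where
      at-end : ∀ {ps₁ ps₂ iF iR} → ps ≡ ps₁ ++ ps₂ → Disk z a ps₁ iF → Disk z (last a ps₁) (ps₂ ++ Qi) iR → i ↭ iF ++ iR →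
        x ∈ z ∷ iF → y ∈ z ∷ iF → z ∉ O → x ∉ O → y ∉ O → Both z a ps Qi i x y
      at-mid : ∀ {ps₁ ps₂ Q₁ q Q₂ iF iR} → ps ≡ ps₁ ++ ps₂ → Qi ≡ Q₁ ++ q ∷ Q₂ → Disk z a (ps₁ ++ q ∷ Q₂) iF →
        Disk q (last a ps₁) (ps₂ ++ Q₁) iR → i ↭ iF ++ iR →
        x ∈ q ∷ Q₂ ++ z ∷ iF → y ∈ q ∷ Q₂ ++ z ∷ iF → q ∉ O → x ∉ O → y ∉ O → Both z a ps Qi i x y

    data Res (z a : V) (ps Qi L r i : Ls) (x y : V) : Set where
      r-none   : None z a ps L r i x y → Res z a ps Qi L r i x y
      r-corner : Corner z a ps L r i x y → Res z a ps Qi L r i x y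
      r-chord  : Chord O z a ps r i → Res z a ps Qi L r i x y
      r-both   : Both z a ps Qi i x y → Res z a ps Qi L r i x y
      r-cut    : Cut O z a ps r i x y → Res z a ps Qi L r i x y

  -- Peeling off the triangles along the arc and putting them back

  module Loop {N : ℕ} (task : Task N) where
    open Task task
    open Run task

    -- In the case `at-end` the apex `t` becomes interior, and the side `a t` of the triangle
    -- together with the edge from `t` to the arc is the 2-path of a `Cut`. Were `F` a digon, then
    -- both end vertices would be `t`.
    up-both-inner : ∀ {z a t ps Qi i i' x y} → Face z a t → i ↭ t ∷ i' → Unique (z ∷ a ∷ (ps ++ Qi) ++ i) → x ≢ y →
      Both t a ps (Qi ∷ʳ z) i' x y → Both z a ps Qi i x y ⊎ Cut O z a ps (ps ++ Qi) i x y
    up-both-inner {z} {a} {t} {ps} {Qi} {i} {i'} {x} {y} f h U n (at-end {ps₁} {ps₂} {iF} {iR} refl F R g mx my nz nx ny) with unsnoc ps₁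
    ... | inj₁ refl with no-digon F (Unique-sub {ys = z ∷ (ps₂ ++ Qi) ++ iR} (lin {as = (([ t ] ++ ([ a ] ++ iF)) ++ ([ z ] ++ ((ps₂ ++ Qi) ++ iR)))} {bs = ([ z ] ++ ([ a ] ++ ((ps₂ ++ Qi) ++ i)))} ((↭-sym h) ⊹ (↭-sym g)) (prove (((# 0 ⊕ # 1 ⊕ # 2) ⊕ # 3 ⊕ (# 4 ⊕ # 5) ⊕ # 6) ⊕ # 7 ⊕ # 8) ((# 3 ⊕ # 1 ⊕ (# 4 ⊕ # 5) ⊕ # 7) ⊕ (# 0 ⊕ # 8) ⊕ # 2 ⊕ # 6) ([ t ] ∷ [ a ] ∷ iF ∷ [ z ] ∷ ps₂ ∷ Qi ∷ iR ∷ i ∷ i' ∷  []))) U)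
    up-both-inner {x = x} {y} f h U n (at-end {iF = []} refl F R g (here refl) (here refl) nz nx ny) | inj₁ refl | refl = ⊥-elim (n refl)
    up-both-inner {z} {a} {t} {ps} {Qi} {i} {i'} {x} {y} f h U n (at-end {ps₂ = ps₂} {iF} {iR} refl F R g mx my nz nx ny) | inj₂ (mid , pj , refl) = inj₂ (record
      { X = [] ; F = F ; E = split f (edge (adj-sym (face-adj₂ f))) R' refl ↭-refl ; arc = e₁ ; arcE = refl
      ; ints = (lin {as = i} {bs = ([ t ] ++ (iF ++ iR))} (h ⊹ g) (prove (# 0 ⊕ (# 1 ⊕ # 2) ⊕ # 3 ⊕ # 4) ((# 1 ⊕ # 3 ⊕ # 4) ⊕ # 0 ⊕ # 2) (i ∷ [ t ] ∷ i' ∷ iF ∷ iR ∷  [])))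
      ; fill = fill ; x∈ = mx ; y∈ = my ; x∉O = nx ; y∉O = ny ; q∉O = nz ; pj∈ = there (∈ₚ.∈-++⁺ˡ (∈-mid mid)) })
      where
      R₀ : Disk t pj (ps₂ ++ Qi ∷ʳ z) iR
      R₀ = subst (λ v → Disk t v (ps₂ ++ Qi ∷ʳ z) iR) (last-∷ʳ a mid) R
      R' : Disk z t (pj ∷ ps₂ ++ Qi) iR
      R' = rotate∘ (t ∷ pj ∷ ps₂ ++ Qi) [ z ] (subst (λ l → Disk t pj l iR) (sym (snoc-++ ps₂)) R₀)
      e₁ : a ∷ ((mid ∷ʳ pj ++ ps₂) ++ Qi) ∷ʳ z ≡ a ∷ mid ++ pj ∷ (ps₂ ++ Qi) ∷ʳ z
      e₁ = cong (a ∷_) (trans (cong (_∷ʳ z) (trans (Lₚ.++-assoc (mid ∷ʳ pj) _ _) (Lₚ.++-assoc mid _ _))) (snoc-++ mid))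
      fill : ∀ S {j S'} → Disk t a (S ∷ʳ pj) j → a ∷ S' ∷ʳ z ≡ a ∷ S ++ pj ∷ (ps₂ ++ Qi) ∷ʳ z → Disk z a S' (t ∷ j ++ iR)
      fill S {j} {S'} D e' = inner f (pasteAt D (a ∷ S) (cong (a ∷_) (snoc-++ S)) R₀
        (trans (cong (_∷ʳ t) e') (cong (a ∷_) (trans (snoc-++ S) (cong (λ l → S ++ pj ∷ l) (cong (_∷ʳ t) (snoc-++ ps₂)))))))
        ↭-refl
    up-both-inner {z} {a} {t} {ps} {Qi} {i} {i'} {x} {y} f h U n (at-mid {ps₁} {ps₂} {Q₁} {q} {Q₂} {iF} {iR} refl e D R g mx my nq nx ny) with unsnoc Q₂
    ... | inj₁ refl with ∷ʳ-inj Qi Q₁ e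
    ... | refl , refl = inj₁ (at-end {iF = t ∷ iF} refl (inner f D ↭-refl) R (lin {as = i} {bs = (([ t ] ++ iF) ++ iR)} (h ⊹ g) (prove (# 0 ⊕ (# 1 ⊕ # 2) ⊕ # 3 ⊕ # 4) (((# 1 ⊕ # 3) ⊕ # 4) ⊕ # 0 ⊕ # 2) (i ∷ [ t ] ∷ i' ∷ iF ∷ iR ∷  []))) mx my nq nx ny)
    up-both-inner {z} {a} {t} {ps} {Qi} {i} {i'} {x} {y} f h U n (at-mid {ps₁} {ps₂} {Q₁} {q} {Q₂} {iF} {iR} refl e D R g mx my nq nx ny) | inj₂ (Q₂' , z' , refl)
      with ∷ʳ-inj Qi (Q₁ ++ q ∷ Q₂') (trans e (sym (snoc-++ Q₁)))
    ... | refl , refl = inj₁ (at-mid {iF = t ∷ iF} refl refl (inner f (subst (λ l → Disk t a l iF) (sym (snoc-++ ps₁)) D) ↭-refl) R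
         (lin {as = i} {bs = (([ t ] ++ iF) ++ iR)} (h ⊹ g) (prove (# 0 ⊕ (# 1 ⊕ # 2) ⊕ # 3 ⊕ # 4) (((# 1 ⊕ # 3) ⊕ # 4) ⊕ # 0 ⊕ # 2) (i ∷ [ t ] ∷ i' ∷ iF ∷ iR ∷  []))) (mem mx) (mem my) nq nx ny)
      where
      mem : ∀ {v} → v ∈ q ∷ (Q₂' ∷ʳ z) ++ t ∷ iF → v ∈ q ∷ Q₂' ++ z ∷ t ∷ iF
      mem = ∈-resp-↭ (prove (# 0 ⊕ (# 1 ⊕ # 2) ⊕ # 3 ⊕ # 4) (# 0 ⊕ # 1 ⊕ # 2 ⊕ # 3 ⊕ # 4) ([ q ] ∷ Q₂' ∷ [ z ] ∷ [ t ] ∷ iF ∷  []))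

    last-of : ∀ {h l Q z} → Q ∷ʳ z ≡ h ∷ l → last h l ≡ z
    last-of {h} {l} {[]} refl = refl
    last-of {h} {l} {_ ∷ Q} refl = last-∷ʳ h Q

    -- Removing the root triangle merges the last pocket, if it is not trivial, with the root.
    up-inner-none : ∀ {z a t ps Qi L r i i' x y} → Face z a t → i ↭ t ∷ i' → Unique (z ∷ a ∷ r ++ i) → Qi ∷ʳ z ≡ q₀ ∷ O' ++ L →
      None t a ps (L ∷ʳ t) (r ∷ʳ z) i' x y → Res z a ps Qi L r i x y
    up-inner-none {z} {a} {t} {ps} {Qi} {L} {r} {i} {i'} f h U e (none {kP} {uP} {cP} {kQ} {uQ} {cS} {cR} {cI} pkP pathP pkQ sol vis visP ct)
      with pockets-last-pocket {l = O' ++ L} pkQ (sym (snoc-++ O'))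
    ... | lastPocket {l₁} {m} {iₗ} {k₁} {u₁} P D el refl g with unsnoc m
    -- The pocket is the empty digon at `z t`. The apex is not on the larger boundary, so it moves
    -- from the kept vertices to the other visited ones.
    ... | inj₁ refl = r-none (none {cR = t ∷ cR} pkP pathP (subst (λ l → Pockets q₀ l k₁ u₁) l₁≡ P) sol (lin {as = cS} {bs = (([ q₀ ] ++ k₁) ++ ([ t ] ++ cR))} (vis) (prove (# 0 ⊕ (# 1 ⊕ # 2 ⊕ # 3) ⊕ # 4) (((# 1 ⊕ # 2) ⊕ # 3 ⊕ # 4) ⊕ # 0) (cS ∷ [ q₀ ] ∷ k₁ ∷ [ t ] ∷ cR ∷  []))) visP ct')
      where
      l₁≡ : l₁ ≡ O' ++ L
      l₁≡ = trans (sym (Lₚ.++-identityʳ l₁)) (sym el)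
      D' : Disk t z [] iₗ
      D' = subst (λ v → Disk t v [] iₗ) (trans (cong (last q₀) l₁≡) (last-of {Q = Qi} e)) D
      z∈ : z ∈ q₀ ∷ k₁
      z∈ = subst (_∈ q₀ ∷ k₁) (trans (pockets-last P) (trans (cong (last q₀) l₁≡) (last-of {Q = Qi} e))) (last-∈ q₀ k₁)
      iₗ≡ : iₗ ≡ []
      iₗ≡ with ∈→↭ z∈
      ... | ks , gk = no-digon D' (Unique-sub {ys = cP ++ uP ++ ks ++ cR ++ u₁} (lin {as = (([ t ] ++ ([ z ] ++ iₗ)) ++ (cP ++ (uP ++ (ks ++ (cR ++ u₁)))))} {bs = ([ z ] ++ ([ a ] ++ (r ++ i)))} ((↭-sym h) ⊹ (↭-sym ct) ⊹ (↭-sym vis) ⊹ (↭-sym g) ⊹ (↭-sym gk)) (prove (((# 0 ⊕ # 1 ⊕ # 2) ⊕ # 3 ⊕ # 4 ⊕ # 5 ⊕ # 6 ⊕ # 7) ⊕ # 8 ⊕ (# 0 ⊕ # 9 ⊕ (# 10 ⊕ # 1) ⊕ # 11) ⊕ # 12 ⊕ # 13 ⊕ # 14 ⊕ # 15) ((# 1 ⊕ # 9 ⊕ # 10 ⊕ # 8) ⊕ (# 0 ⊕ # 11) ⊕ (# 3 ⊕ # 4 ⊕ # 12 ⊕ # 13) ⊕ ((# 14 ⊕ # 15 ⊕ # 0) ⊕ # 6) ⊕ (# 7 ⊕ ε ⊕ # 2) ⊕ # 1 ⊕ # 5) ([ t ] ∷ [ z ] ∷ iₗ ∷ cP ∷ uP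 ∷ ks ∷ cR ∷ u₁ ∷ i ∷ [ a ] ∷ r ∷ i' ∷ cS ∷ uQ ∷ [ q₀ ] ∷ k₁ ∷  []))) U)
      g' : uQ ↭ u₁
      g' = ↭-trans g (↭-trans (++⁺ˡ u₁ (↭-reflexive iₗ≡)) (↭-reflexive (Lₚ.++-identityʳ u₁)))
      ct' : z ∷ a ∷ r ++ i ↭ cP ++ uP ++ cS ++ u₁
      ct' = (lin {as = ([ z ] ++ ([ a ] ++ (r ++ i)))} {bs = (cP ++ (uP ++ (cS ++ u₁)))} (h ⊹ ct ⊹ g') (prove ((# 0 ⊕ # 1 ⊕ # 2 ⊕ # 3) ⊕ (# 4 ⊕ # 5) ⊕ (# 6 ⊕ # 7 ⊕ # 8 ⊕ # 9) ⊕ # 10) ((# 6 ⊕ # 7 ⊕ # 8 ⊕ # 10) ⊕ # 3 ⊕ (# 4 ⊕ # 1 ⊕ (# 2 ⊕ # 0) ⊕ # 5) ⊕ # 9) ([ z ] ∷ [ a ] ∷ r ∷ i ∷ [ t ] ∷ i' ∷ cP ∷ uP ∷ cS ∷ uQ ∷ u₁ ∷  [])))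
    ... | inj₂ (m' , z' , refl) with trans (sym (last-of {Q = Qi} e)) (trans (cong (last q₀) (trans el (sym (Lₚ.++-assoc l₁ m' [ z' ])))) (last-∷ʳ q₀ (l₁ ++ m')))
    -- Here `z` is skipped. The pocket and the root triangle form a disk at the root, attached to
    -- the visited part at the chord from `h'` to `t`.
    ... | refl = r-corner (corner {ps₁ = []} {Qv = l₁} {m'} {t ∷ h' ∷ []} {cB = init q₀ k₁ ++ cR} refl pkP pathP el P sol (lin {as = cS} {bs = (([ q₀ ] ++ k₁) ++ ([ t ] ++ cR))} (vis) (prove (# 0 ⊕ (# 1 ⊕ # 2 ⊕ # 3) ⊕ # 4) (((# 1 ⊕ # 2) ⊕ # 3 ⊕ # 4) ⊕ # 0) (cS ∷ [ q₀ ] ∷ k₁ ∷ [ t ] ∷ cR ∷  []))) visP cutedge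
          (lin {as = cS} {bs = (([ t ] ++ ([ h' ] ++ [])) ++ ((init q₀ k₁) ++ cR))} (vis ⊹ gk) (prove (# 0 ⊕ ((# 1 ⊕ # 2 ⊕ # 3) ⊕ # 4) ⊕ # 5 ⊕ # 6) (((# 3 ⊕ # 6 ⊕ ε) ⊕ # 5 ⊕ # 4) ⊕ # 0 ⊕ # 1 ⊕ # 2) (cS ∷ [ q₀ ] ∷ k₁ ∷ [ t ] ∷ cR ∷ init q₀ k₁ ∷ [ h' ] ∷  [])))
          (split {xs = []} f (edge (adj-sym (face-adj₂ f))) (rotate∘ (t ∷ h' ∷ m') [ z ] D) refl ↭-refl)
          (lin {as = ([ z ] ++ ([ a ] ++ (r ++ i)))} {bs = (cP ++ (uP ++ (cS ++ (u₁ ++ ([] ++ ((m' ++ [ z ]) ++ iₗ))))))} (h ⊹ ct ⊹ g) (prove ((# 0 ⊕ # 1 ⊕ # 2 ⊕ # 3) ⊕ (# 4 ⊕ # 5) ⊕ (# 6 ⊕ # 7 ⊕ # 8 ⊕ # 9) ⊕ # 10 ⊕ (# 11 ⊕ # 0) ⊕ # 12) ((# 6 ⊕ # 7 ⊕ # 8 ⊕ # 10 ⊕ ε ⊕ (# 11 ⊕ # 0) ⊕ # 12) ⊕ # 3 ⊕ (# 4 ⊕ # 1 ⊕ (# 2 ⊕ # 0) ⊕ # 5) ⊕ # 9) ([ z ] ∷ [ a ] ∷ r ∷ i ∷ [ t ] ∷ i' ∷ cP ∷ uP ∷ cS ∷ uQ ∷ u₁ ∷ m' ∷ iₗ ∷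  []))))
      where
      h' = last q₀ l₁
      gk : q₀ ∷ k₁ ↭ init q₀ k₁ ∷ʳ h'
      gk = ↭-reflexive (trans (init-last q₀ k₁) (cong (init q₀ k₁ ∷ʳ_) (pockets-last P)))

    -- An unvisited corner that has become attached to the removed arc only is swept by the path along that arc.
    absorb : ∀ {z a t ps L r i i' x y ps₁ ps₂ B iZ kP uP cP kQ uQ cS cR cB cI} → Face z a t → i ↭ t ∷ i' → Unique (z ∷ a ∷ r ++ i) →
      length (z ∷ a ∷ r ++ i) ≤ N → (∀ {v} → v ∈ ps → v ∈ ps₀) → x ≢ y → last q₀ (O' ++ L) ≡ z →
      ps ≡ ps₁ ++ ps₂ → Pockets (last a ps₁) ps₂ kP uP → Path (last a ps₁) m₀ cP →
      Pockets q₀ (O' ++ L) kQ uQ → Sol x y cS → cS ↭ (q₀ ∷ kQ) ++ cR → cP ↭ (last a ps₁ ∷ kP) ++ cI → Kind z B → cS ↭ B ++ cB →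
      Disk t a (ps₁ ++ B) iZ → t ∷ a ∷ (r ∷ʳ z) ++ i' ↭ cP ++ uP ++ cS ++ uQ ++ init a ps₁ ++ t ∷ iZ →
      None z a ps L r i x y
    absorb {z} {a} {t} {L = L} {r} {i} {i'} {ps₁ = ps₁} {ps₂} {B} {iZ} {kP} {uP} {cP} {kQ} {uQ} {cS} {cR} {cB} {cI} f h U len sub n el refl pkP pathP pkQ sol vis visP kind visB Z ct
      = go ps₁ refl kind Z visB
      where
      ct₀ : z ∷ a ∷ r ++ i ↭ cP ++ uP ++ cS ++ uQ ++ init a ps₁ ++ t ∷ iZ
      ct₀ = (lin {as = ([ z ] ++ ([ a ] ++ (r ++ i)))} {bs = (cP ++ (uP ++ (cS ++ (uQ ++ ((init a ps₁) ++ ([ t ] ++ iZ))))))} (h ⊹ ct) (prove ((# 0 ⊕ # 1 ⊕ # 2 ⊕ # 3) ⊕ (# 4 ⊕ # 5) ⊕ # 6 ⊕ # 7 ⊕ # 8 ⊕ # 9 ⊕ # 10 ⊕ # 4 ⊕ # 11) ((# 6 ⊕ # 7 ⊕ # 8 ⊕ # 9 ⊕ # 10 ⊕ # 4 ⊕ # 11) ⊕ # 3 ⊕ # 4 ⊕ # 1 ⊕ (# 2 ⊕ # 0) ⊕ # 5) ([ z ] ∷ [ a ] ∷ r ∷ i ∷ [ t ] ∷ i' ∷ cP ∷ uP ∷ cS ∷ uQ ∷ init a ps₁ ∷ iZ ∷  [])))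
      cP' : Ls
      cP' = proj₁ (∈→↭ (path-∈ˡ pathP))
      gP : cP ↭ last a ps₁ ∷ cP'
      gP = proj₂ (∈→↭ (path-∈ˡ pathP))
      gi : a ∷ ps₁ ↭ init a ps₁ ∷ʳ last a ps₁
      gi = ↭-reflexive (init-last a ps₁)
      done : Sweep a ps₁ (t ∷ iZ) → None z a (ps₁ ++ ps₂) L r i _ _
      done (sweep {kA} {uA} {cA} {iA} pkA pathA keepA cA=) = none {uP = uA ++ uP} {cP = cA ++ cP'} (pockets-++ pkA refl pkP)
         (path-glue pathA pathP (lin {as = (cA ++ cP)} {bs = ([ last a ps₁ ] ++ (cA ++ cP'))} (gP) (prove ((# 0 ⊕ # 1) ⊕ # 2 ⊕ # 3) ((# 2 ⊕ # 0 ⊕ # 3) ⊕ # 1) (cA ∷ cP ∷ [ last a ps₁ ] ∷ cP' ∷  [])))) pkQ sol vis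
         (lin {as = (cA ++ cP')} {bs = (([ a ] ++ (kA ++ kP)) ++ (iA ++ cI))} (keepA ⊹ visP ⊹ (↭-sym gP)) (prove ((# 0 ⊕ # 1) ⊕ ((# 2 ⊕ # 3) ⊕ # 4) ⊕ ((# 5 ⊕ # 6) ⊕ # 7) ⊕ # 8) (((# 2 ⊕ # 3 ⊕ # 6) ⊕ # 4 ⊕ # 7) ⊕ # 0 ⊕ # 8 ⊕ # 5 ⊕ # 1) (cA ∷ cP' ∷ [ a ] ∷ kA ∷ iA ∷ [ last a ps₁ ] ∷ kP ∷ cI ∷ cP ∷  [])))
         (lin {as = ([ z ] ++ ([ a ] ++ (r ++ i)))} {bs = ((cA ++ cP') ++ ((uA ++ uP) ++ (cS ++ uQ)))} (ct₀ ⊹ gP ⊹ (↭-sym gi) ⊹ cA=) (prove ((# 0 ⊕ # 1 ⊕ # 2 ⊕ # 3) ⊕ (# 4 ⊕ # 5 ⊕ # 6 ⊕ # 7 ⊕ # 8 ⊕ # 9 ⊕ # 10) ⊕ (# 11 ⊕ # 12) ⊕ (# 1 ⊕ # 13) ⊕ # 14 ⊕ # 15) (((# 14 ⊕ # 12) ⊕ (# 15 ⊕ # 5) ⊕ # 6 ⊕ # 7) ⊕ (# 0 ⊕ # 1 ⊕ # 2 ⊕ # 3) ⊕ # 4 ⊕ (# 8 ⊕ # 11) ⊕ # 1 ⊕ # 13 ⊕ # 9 ⊕ # 10) ([ z ] ∷ [ a ] ∷ r ∷ i ∷ cP ∷ uP ∷ cS ∷ uQ ∷ init a ps₁ ∷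 [ t ] ∷ iZ ∷ [ last a ps₁ ] ∷ cP' ∷ ps₁ ∷ cA ∷ uA ∷  [])))
      go : ∀ qs → qs ≡ ps₁ → ∀ {B} → Kind z B → Disk t a (qs ++ B) iZ → cS ↭ B ++ cB → None z a (ps₁ ++ ps₂) L r i _ _
      -- Without a further arc vertex the corner is a digon, or in the next clause a triangle; but
      -- it has `t` in its interior.
      go [] refl (cutvertex _) D vB with no-digon (inner f D ↭-refl) (Unique-sub {ys = cB ++ cP' ++ uP ++ uQ} (lin {as = (([ z ] ++ ([ a ] ++ ([ t ] ++ iZ))) ++ (cB ++ (cP' ++ (uP ++ uQ))))} {bs = ([ z ] ++ ([ a ] ++ (r ++ i)))} ((↭-sym ct₀) ⊹ (↭-sym gP) ⊹ (↭-sym vB)) (prove (((# 0 ⊕ # 1 ⊕ # 2 ⊕ # 3) ⊕ # 4 ⊕ # 5 ⊕ # 6 ⊕ # 7) ⊕ (# 0 ⊕ # 1 ⊕ # 8 ⊕ # 9) ⊕ # 10 ⊕ # 11) ((# 0 ⊕ # 1 ⊕ # 8 ⊕ # 9) ⊕ (# 10 ⊕ # 6 ⊕ # 11 ⊕ # 7 ⊕ ε ⊕ # 2 ⊕ # 3) ⊕ (# 1 ⊕ # 5) ⊕ # 0 ⊕ # 4) ([ z ] ∷ [ a ] ∷ [ t ] ∷ iZ ∷ cB ∷ cP' ∷ uP ∷ uQ ∷ r ∷ i ∷ cP ∷ cS ∷  []))) U)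
      ... | ()
      go [] refl (cutedge {β = β}) D vB with no-triangle (inner f D ↭-refl) (Unique-sub {ys = cB ++ cP' ++ uP ++ uQ} (lin {as = (([ z ] ++ ([ a ] ++ ([ β ] ++ ([ t ] ++ iZ)))) ++ (cB ++ (cP' ++ (uP ++ uQ))))} {bs = ([ z ] ++ ([ a ] ++ (r ++ i)))} ((↭-sym ct₀) ⊹ (↭-sym gP) ⊹ (↭-sym vB)) (prove (((# 0 ⊕ # 1 ⊕ # 2 ⊕ # 3 ⊕ # 4) ⊕ # 5 ⊕ # 6 ⊕ # 7 ⊕ # 8) ⊕ (# 0 ⊕ # 1 ⊕ # 9 ⊕ # 10) ⊕ # 11 ⊕ # 12) ((# 0 ⊕ # 1 ⊕ # 9 ⊕ # 10) ⊕ (# 11 ⊕ # 7 ⊕ # 12 ⊕ # 8 ⊕ ε ⊕ # 3 ⊕ # 4) ⊕ (# 1 ⊕ # 6) ⊕ # 2 ⊕ # 0 ⊕ # 5) ([ z ] ∷ [ a ] ∷ [ β ] ∷ [ t ] ∷ iZ ∷ cB ∷ cP' ∷ uP ∷ uQ ∷ r ∷ i ∷ cP ∷ cS ∷  []))) U)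
      ... | ()
      -- The end vertices are distinct and visited, so a visited vertex `w` other than `z` lies
      -- outside the corner and makes it smaller than the disk.
      go (p ∷ qs) refl (cutvertex _) D vB with two-of (sol-∈ˡ sol) (sol-∈ʳ sol) n vB
      ... | w , ws , gw = done (absorb₁ (sub (here refl)) (inner f D ↭-refl)
           (ℕₚ.<-≤-trans (length-↭-< {xs = z ∷ a ∷ p ∷ qs ++ t ∷ iZ} {ys = ws ++ cP' ++ uP ++ uQ} gZ) len) (Unique-sub {ys = w ∷ ws ++ cP' ++ uP ++ uQ} (lin {as = (([ z ] ++ ([ a ] ++ ([ p ] ++ (qs ++ ([ t ] ++ iZ))))) ++ ([ w ] ++ (ws ++ (cP' ++ (uP ++ uQ)))))} {bs = ([ z ] ++ ([ a ] ++ (r ++ i)))} ((↭-sym gZ)) (prove (((# 0 ⊕ # 1 ⊕ # 2 ⊕ # 3 ⊕ # 4 ⊕ # 5) ⊕ # 6 ⊕ # 7 ⊕ # 8 ⊕ # 9 ⊕ # 10) ⊕ # 0 ⊕ # 1 ⊕ # 11 ⊕ # 12) ((# 0 ⊕ # 1 ⊕ # 11 ⊕ # 12) ⊕ # 6 ⊕ (# 0 ⊕ # 1 ⊕ # 2 ⊕ # 3 ⊕ # 4 ⊕ # 5) ⊕ # 7 ⊕ # 8 ⊕ # 9 ⊕ # 10) ([ z ] ∷ [ a ] ∷ [ p ] ∷ qs ∷ [ t ] ∷ iZ ∷ [ w ] ∷ ws ∷ cP' ∷ uP ∷ uQ ∷ r ∷ i ∷  []))) U))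
        where
        gZ : z ∷ a ∷ r ++ i ↭ w ∷ (z ∷ a ∷ p ∷ qs ++ t ∷ iZ) ++ ws ++ cP' ++ uP ++ uQ
        gZ = (lin {as = ([ z ] ++ ([ a ] ++ (r ++ i)))} {bs = ([ w ] ++ (([ z ] ++ ([ a ] ++ ([ p ] ++ (qs ++ ([ t ] ++ iZ))))) ++ (ws ++ (cP' ++ (uP ++ uQ)))))} (ct₀ ⊹ gP ⊹ (↭-sym gi) ⊹ vB ⊹ gw) (prove ((# 0 ⊕ # 1 ⊕ # 2 ⊕ # 3) ⊕ (# 4 ⊕ # 5 ⊕ # 6 ⊕ # 7 ⊕ # 8 ⊕ # 9 ⊕ # 10) ⊕ (# 11 ⊕ # 12) ⊕ (# 1 ⊕ # 13 ⊕ # 14) ⊕ (# 0 ⊕ # 15) ⊕ # 16 ⊕ # 17) ((# 16 ⊕ (# 0 ⊕ # 1 ⊕ # 13 ⊕ # 14 ⊕ # 9 ⊕ # 10) ⊕ # 17 ⊕ # 12 ⊕ # 5 ⊕ # 7) ⊕ (# 0 ⊕ # 1 ⊕ # 2 ⊕ # 3) ⊕ # 4 ⊕ (# 8 ⊕ # 11) ⊕ # 6 ⊕ # 15) ([ z ] ∷ [ a ] ∷ r ∷ i ∷ cP ∷ uP ∷ cS ∷ uQ ∷ init a ([ p ] ++ qs) ∷ [ t ] ∷ iZ ∷ [ last a ([ p ] ++ qs) ] ∷ cP' ∷ [ p ] ∷ qs ∷ cB ∷ [ w ] ∷ ws ∷  [])))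
      go (p ∷ qs) refl (cutedge {β = β}) D vB = done (absorb₂ (sub (here refl))
           (inner f (subst (λ l → Disk t a l iZ) (sym (snoc-++ (p ∷ qs))) D) ↭-refl)
           (ℕₚ.≤-trans le len) (Unique-sub {ys = cB ++ cP' ++ uP ++ uQ} gZ U))
        where
        gZ : (z ∷ a ∷ (p ∷ qs ∷ʳ β) ++ t ∷ iZ) ++ cB ++ cP' ++ uP ++ uQ ↭ z ∷ a ∷ r ++ i
        gZ = (lin {as = (([ z ] ++ ([ a ] ++ (([ p ] ++ (qs ++ [ β ])) ++ ([ t ] ++ iZ)))) ++ (cB ++ (cP' ++ (uP ++ uQ))))} {bs = ([ z ] ++ ([ a ] ++ (r ++ i)))} ((↭-sym ct₀) ⊹ (↭-sym gP) ⊹ gi ⊹ (↭-sym vB)) (prove (((# 0 ⊕ # 1 ⊕ (# 2 ⊕ # 3 ⊕ # 4) ⊕ # 5 ⊕ # 6) ⊕ # 7 ⊕ # 8 ⊕ # 9 ⊕ # 10) ⊕ (# 0 ⊕ # 1 ⊕ # 11 ⊕ # 12) ⊕ # 13 ⊕ (# 14 ⊕ # 15) ⊕ # 16) ((# 0 ⊕ # 1 ⊕ # 11 ⊕ # 12) ⊕ (# 13 ⊕ # 9 ⊕ # 16 ⊕ # 10 ⊕ # 14 ⊕ # 5 ⊕ # 6) ⊕ (# 15 ⊕ # 8) ⊕ (# 1 ⊕ # 2 ⊕ # 3) ⊕ # 4 ⊕ # 0 ⊕ # 7) ([ z ] ∷ [ a ] ∷ [ p ] ∷ qs ∷ [ β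 ] ∷ [ t ] ∷ iZ ∷ cB ∷ cP' ∷ uP ∷ uQ ∷ r ∷ i ∷ cP ∷ init a ([ p ] ++ qs) ∷ [ last a ([ p ] ++ qs) ] ∷ cS ∷  [])))
        le : length (z ∷ a ∷ (p ∷ qs ∷ʳ β) ++ t ∷ iZ) ≤ length (z ∷ a ∷ r ++ i)
        le = subst (length (z ∷ a ∷ (p ∷ qs ∷ʳ β) ++ t ∷ iZ) ≤_) (trans (sym (Lₚ.length-++ (z ∷ a ∷ (p ∷ qs ∷ʳ β) ++ t ∷ iZ))) (↭-length gZ)) (ℕₚ.m≤m+n _ _)

    -- The root triangle joins the corner. If `t` was its only unvisited vertex on the remaining
    -- arc, then `z` is visited and the corner can be absorbed; otherwise it is a corner at `z`
    -- again.
    up-inner-corner : ∀ {z a t ps Qi L r i i' x y} → Face z a t → i ↭ t ∷ i' → Unique (z ∷ a ∷ r ++ i) →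
      length (z ∷ a ∷ r ++ i) ≤ N → (∀ {v} → v ∈ ps → v ∈ ps₀) → x ≢ y → Qi ∷ʳ z ≡ q₀ ∷ O' ++ L →
      Corner t a ps (L ∷ʳ t) (r ∷ʳ z) i' x y → Res z a ps Qi L r i x y
    up-inner-corner {z} {a} {t} {ps} {Qi} {L} {r} {i} {i'} f h U len sub n e
        (corner {ps₁} {ps₂} {Qv} {Qu} {B} {iZ} {kP} {uP} {cP} {kQ} {uQ} {cS} {cR} {cB} {cI} psE pkP pathP QE pkQ sol vis visP kind visB Z ct)
      with ∷ʳ-inj (O' ++ L) (Qv ++ Qu) (trans (snoc-++ O') (trans QE (sym (snoc-++ Qv)))) | unsnoc Qu
    ... | eQ , _ | inj₁ refl = r-none (absorb f h U len sub n (last-of {Q = Qi} e) psE pkP pathP (subst (λ l → Pockets q₀ l kQ uQ) Qv≡ pkQ) sol vis visP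
          (subst (λ v → Kind v B) (trans (cong (last q₀) Qv≡) (last-of {Q = Qi} e)) kind) visB (subst (λ l → Disk t a (ps₁ ++ l) iZ) (Lₚ.++-identityʳ B) Z) ct)
      where
      Qv≡ : Qv ≡ O' ++ L
      Qv≡ = trans (sym (Lₚ.++-identityʳ Qv)) (sym eQ)
    ... | eQ , _ | inj₂ (Qu' , z' , refl) with trans (sym (last-of {Q = Qi} e)) (trans (cong (last q₀) (trans eQ (sym (Lₚ.++-assoc Qv Qu' [ z' ])))) (last-∷ʳ q₀ (Qv ++ Qu')))
    ... | refl = r-corner (corner {Qv = Qv} {Qu'} {B} psE pkP pathP eQ pkQ sol vis visP kind visB
          (inner f (subst (λ l → Disk t a l iZ) (trans (cong (ps₁ ++_) (sym (snoc-++ B))) (sym (snoc-++ ps₁))) Z) ↭-refl)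
          (lin {as = ([ z ] ++ ([ a ] ++ (r ++ i)))} {bs = (cP ++ (uP ++ (cS ++ (uQ ++ ((init a ps₁) ++ ((Qu' ++ [ z ]) ++ ([ t ] ++ iZ)))))))} (h ⊹ ct) (prove ((# 0 ⊕ # 1 ⊕ # 2 ⊕ # 3) ⊕ (# 4 ⊕ # 5) ⊕ # 6 ⊕ # 7 ⊕ # 8 ⊕ # 9 ⊕ # 10 ⊕ ((# 11 ⊕ # 0) ⊕ # 4) ⊕ # 12) ((# 6 ⊕ # 7 ⊕ # 8 ⊕ # 9 ⊕ # 10 ⊕ (# 11 ⊕ # 0) ⊕ # 4 ⊕ # 12) ⊕ # 3 ⊕ # 4 ⊕ # 1 ⊕ (# 2 ⊕ # 0) ⊕ # 5) ([ z ] ∷ [ a ] ∷ r ∷ i ∷ [ t ] ∷ i' ∷ cP ∷ uP ∷ cS ∷ uQ ∷ init a ps₁ ∷ Qu' ∷ iZ ∷  []))))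

    fresh : ∀ {z a t ps Qi L i i' w} → Face z a t → i ↭ t ∷ i' → Unique (z ∷ a ∷ (ps ++ Qi) ++ i) → Qi ∷ʳ z ≡ q₀ ∷ O' ++ L →
      w ∈ (a ∷ ps) ++ O → w ≢ t
    fresh {z} {a} {t} {ps} {Qi} {i = i} f h U e m refl with ∈ₚ.∈-++⁻ (a ∷ ps) m
    ... | inj₁ m' = Unique-clash {xs = z ∷ a ∷ ps ++ Qi} ↭-refl U (there (∈ₚ.∈-++⁺ˡ m')) (∈-resp-↭ (↭-sym h) (here refl))
    ... | inj₂ m' = Unique-clash {xs = a ∷ ps ++ Qi ∷ʳ z} {ys = i} (prove (# 0 ⊕ # 1 ⊕ (# 2 ⊕ # 3) ⊕ # 4) ((# 1 ⊕ # 2 ⊕ # 3 ⊕ # 0) ⊕ # 4) ([ z ] ∷ [ a ] ∷ ps ∷ Qi ∷ i ∷  [])) U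
              (there (∈ₚ.∈-++⁺ʳ ps (subst (t ∈_) (sym e) (∈ₚ.∈-++⁺ˡ m')))) (∈-resp-↭ (↭-sym h) (here refl))

    up-inner : ∀ {z a t ps Qi L i i' x y} → Face z a t → i ↭ t ∷ i' → Unique (z ∷ a ∷ (ps ++ Qi) ++ i) →
      length (z ∷ a ∷ (ps ++ Qi) ++ i) ≤ N → (∀ {v} → v ∈ ps → v ∈ ps₀) → x ≢ y → Qi ∷ʳ z ≡ q₀ ∷ O' ++ L →
      Res t a ps (Qi ∷ʳ z) (L ∷ʳ t) ((ps ++ Qi) ∷ʳ z) i' x y → Res z a ps Qi L (ps ++ Qi) i x y
    up-inner f h U len sub n e (r-none R) = up-inner-none f h U e R
    up-inner f h U len sub n e (r-corner R) = up-inner-corner f h U len sub n e R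
    up-inner {a = a} {ps = ps} f h U len sub n e (r-chord R) = r-chord (up-chord (step-inner f h) (λ m q → fresh f h U e m q) (λ m → m) R)
    up-inner f h U len sub n e (r-both R) with up-both-inner f h U n R
    ... | inj₁ R' = r-both R'
    ... | inj₂ R' = r-cut R'
    up-inner f h U len sub n e (r-cut R) = r-cut (up-cut (step-inner f h) (λ m q → fresh f h U e m q) (λ m → m) R)

    up-next : ∀ {z a p ps Qi L i k x y} → Face z a p → i ↭ k →
      Res z p ps Qi L (ps ++ Qi) k x y → Res z a (p ∷ ps) Qi L (p ∷ ps ++ Qi) i x y
    up-next {z} {a} {p} {ps} {Qi} {L} {i} {k} f h (r-none (none {kP} {uP} {cP} {kQ} {uQ} {cS} {cI = cI} pkP pathP pkQ sol vis visP ct)) =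
      r-none (none {cP = a ∷ cP} (pockets-++ (pockets-edge (face-adj₂ f)) refl pkP) (path-join path-here (face-adj₂ f) pathP) pkQ sol vis (lin {as = ([ a ] ++ cP)} {bs = (([ a ] ++ ([ p ] ++ kP)) ++ cI)} (visP) (prove ((# 0 ⊕ # 1) ⊕ (# 2 ⊕ # 3) ⊕ # 4) (((# 0 ⊕ # 2 ⊕ # 3) ⊕ # 4) ⊕ # 1) ([ a ] ∷ cP ∷ [ p ] ∷ kP ∷ cI ∷  [])))
        (lin {as = ([ z ] ++ ([ a ] ++ (([ p ] ++ (ps ++ Qi)) ++ i)))} {bs = (([ a ] ++ cP) ++ (uP ++ (cS ++ uQ)))} (h ⊹ ct) (prove ((# 0 ⊕ # 1 ⊕ (# 2 ⊕ # 3 ⊕ # 4) ⊕ # 5) ⊕ # 6 ⊕ # 7 ⊕ # 8 ⊕ # 9 ⊕ # 10) (((# 1 ⊕ # 7) ⊕ # 8 ⊕ # 9 ⊕ # 10) ⊕ # 5 ⊕ # 0 ⊕ # 2 ⊕ (# 3 ⊕ # 4) ⊕ # 6) ([ z ] ∷ [ a ] ∷ [ p ] ∷ ps ∷ Qi ∷ i ∷ k ∷ cP ∷ uP ∷ cS ∷ uQ ∷  []))))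
    up-next {z} {a} {p} {ps} {Qi} {L} {i} {k} f h (r-corner (corner {ps₁} {ps₂} {Qv} {Qu} {B} {iZ} {kP} {uP} {cP} {kQ} {uQ} {cS} {cR} {cB} {cI} psE pkP pathP QE pkQ sol vis visP kind visB Z ct)) =
      r-corner (corner {ps₁ = p ∷ ps₁} {B = B} (cong (p ∷_) psE) pkP pathP QE pkQ sol vis visP kind visB
        (split {xs = []} f (edge (adj-sym (face-adj₂ f))) Z refl ↭-refl)
        (lin {as = ([ z ] ++ ([ a ] ++ (([ p ] ++ (ps ++ Qi)) ++ i)))} {bs = (cP ++ (uP ++ (cS ++ (uQ ++ (([ a ] ++ (init p ps₁)) ++ ((Qu ++ [ z ]) ++ iZ))))))} (h ⊹ ct) (prove ((# 0 ⊕ # 1 ⊕ (# 2 ⊕ # 3 ⊕ # 4) ⊕ # 5) ⊕ # 6 ⊕ # 7 ⊕ # 8 ⊕ # 9 ⊕ # 10 ⊕ # 11 ⊕ (# 12 ⊕ # 0) ⊕ # 13) ((# 7 ⊕ # 8 ⊕ # 9 ⊕ # 10 ⊕ (# 1 ⊕ # 11) ⊕ (# 12 ⊕ # 0) ⊕ # 13) ⊕ # 5 ⊕ # 0 ⊕ # 2 ⊕ (# 3 ⊕ # 4) ⊕ # 6) ([ z ] ∷ [ a ] ∷ [ p ] ∷ ps ∷ Qi ∷ i ∷ k ∷ cP ∷ uP ∷ cS ∷ uQ ∷ init p ps₁ ∷ Qu ∷ iZ ∷  []))))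
    up-next f h (r-chord R) = r-chord (up-chord (step-next f h) _ there R)
    up-next f h (r-cut R) = r-cut (up-cut (step-next f h) _ there R)
    up-next f h (r-both (at-end refl D R g mx my nz nx ny)) = r-both (at-end refl (split {xs = []} f (edge (adj-sym (face-adj₂ f))) D refl ↭-refl) R (↭-trans h g) mx my nz nx ny)
    up-next f h (r-both (at-mid refl e D R g mx my nz nx ny)) = r-both (at-mid refl e (split {xs = []} f (edge (adj-sym (face-adj₂ f))) D refl ↭-refl) R (↭-trans h g) mx my nz nx ny)

    -- No end vertex lies behind `t`, so `E` stays unvisited: it is a new corner at the cutvertex
    -- `t`, or it is joined to an existing corner by the root triangle.
    up-pocket : ∀ {z a t ps Q₁ ys L₁ L₂ i i₁ k x y} → Face z a t → Disk z t ys k → i ↭ i₁ ++ k → t ∉ O → Q₁ ∷ʳ t ≡ q₀ ∷ O' ++ L₁ → L₂ ≡ L₁ ++ ys ∷ʳ z →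
      Res t a ps Q₁ L₁ (ps ++ Q₁) i₁ x y → Res z a ps (Q₁ ++ t ∷ ys) L₂ (ps ++ Q₁ ++ t ∷ ys) i x y
    up-pocket {z} {a} {t} {ps} {Q₁} {ys} {L₁} {i = i} {i₁} {k} f E h nt e refl (r-none (none {kP} {uP} {cP} {kQ} {uQ} {cS} {cR} {cI} pkP pathP pkQ sol vis visP ct)) =
      r-corner (corner {ps₁ = []} {Qv = O' ++ L₁} {ys} {t ∷ []} {cB = init q₀ kQ ++ cR} refl pkP pathP (sym (Lₚ.++-assoc O' L₁ _)) pkQ sol vis visP
        (subst (λ v → Kind v [ t ]) (sym (last-of {Q = Q₁} e)) (cutvertex nt))
        (lin {as = cS} {bs = ([ t ] ++ ((init q₀ kQ) ++ cR))} (vis ⊹ gk) (prove (# 0 ⊕ ((# 1 ⊕ # 2) ⊕ # 3) ⊕ # 4 ⊕ # 5) ((# 5 ⊕ # 4 ⊕ # 3) ⊕ # 0 ⊕ # 1 ⊕ # 2) (cS ∷ [ q₀ ] ∷ kQ ∷ cR ∷ init q₀ kQ ∷ [ t ] ∷  [])))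
        (split {xs = []} f (edge (adj-sym (face-adj₂ f))) E refl ↭-refl)
        (lin {as = ([ z ] ++ ([ a ] ++ ((ps ++ (Q₁ ++ ([ t ] ++ ys))) ++ i)))} {bs = (cP ++ (uP ++ (cS ++ (uQ ++ ([] ++ ((ys ++ [ z ]) ++ k))))))} (h ⊹ ct) (prove ((# 0 ⊕ # 1 ⊕ (# 2 ⊕ # 3 ⊕ # 4 ⊕ # 5) ⊕ # 6) ⊕ (# 7 ⊕ # 8) ⊕ # 9 ⊕ # 10 ⊕ # 11 ⊕ # 12) ((# 9 ⊕ # 10 ⊕ # 11 ⊕ # 12 ⊕ ε ⊕ (# 5 ⊕ # 0) ⊕ # 8) ⊕ # 6 ⊕ # 4 ⊕ # 1 ⊕ (# 2 ⊕ # 3) ⊕ # 7) ([ z ] ∷ [ a ] ∷ ps ∷ Q₁ ∷ [ t ] ∷ ys ∷ i ∷ i₁ ∷ k ∷ cP ∷ uP ∷ cS ∷ uQ ∷  []))))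
      where
      gk : q₀ ∷ kQ ↭ init q₀ kQ ∷ʳ t
      gk = ↭-reflexive (trans (init-last q₀ kQ) (cong (init q₀ kQ ∷ʳ_) (trans (pockets-last pkQ) (last-of {Q = Q₁} e))))
    up-pocket {z} {a} {t} {ps} {Q₁} {ys} {L₁} {i = i} {i₁} {k} f E h nt e refl (r-corner (corner {ps₁} {ps₂} {Qv} {Qu} {B} {iZ} {kP} {uP} {cP} {kQ} {uQ} {cS} {cR} {cB} {cI} psE pkP pathP QE pkQ sol vis visP kind visB Z ct)) =
      r-corner (corner {ps₁ = ps₁} {Qv = Qv} {Qu ++ t ∷ ys} {B} psE pkP pathP QE' pkQ sol vis visP kind visB
        (split f Z E (trans (cong (ps₁ ++_) (sym (Lₚ.++-assoc B Qu _))) (sym (Lₚ.++-assoc ps₁ _ _))) ↭-refl)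
        (lin {as = ([ z ] ++ ([ a ] ++ ((ps ++ (Q₁ ++ ([ t ] ++ ys))) ++ i)))} {bs = (cP ++ (uP ++ (cS ++ (uQ ++ ((init a ps₁) ++ (((Qu ++ ([ t ] ++ ys)) ++ [ z ]) ++ (iZ ++ k)))))))} (h ⊹ ct) (prove ((# 0 ⊕ # 1 ⊕ (# 2 ⊕ # 3 ⊕ # 4 ⊕ # 5) ⊕ # 6) ⊕ (# 7 ⊕ # 8) ⊕ # 9 ⊕ # 10 ⊕ # 11 ⊕ # 12 ⊕ # 13 ⊕ (# 14 ⊕ # 4) ⊕ # 15) ((# 9 ⊕ # 10 ⊕ # 11 ⊕ # 12 ⊕ # 13 ⊕ ((# 14 ⊕ # 4 ⊕ # 5) ⊕ # 0) ⊕ # 15 ⊕ # 8) ⊕ # 6 ⊕ # 4 ⊕ # 1 ⊕ (# 2 ⊕ # 3) ⊕ # 7) ([ z ] ∷ [ a ] ∷ ps ∷ Q₁ ∷ [ t ] ∷ ys ∷ i ∷ i₁ ∷ k ∷ cP ∷ uP ∷ cS ∷ uQ ∷ init a ps₁ ∷ Qu ∷ iZ ∷  []))))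
      where
      QE' : O' ++ L₁ ++ ys ∷ʳ z ≡ Qv ++ (Qu ++ t ∷ ys) ∷ʳ z
      QE' = trans (sym (Lₚ.++-assoc O' L₁ _)) (trans (cong (_++ ys ∷ʳ z) QE) (trans (Lₚ.++-assoc Qv _ _) (cong (Qv ++_) (trans (Lₚ.++-assoc Qu _ _) (sym (snoc-++ Qu))))))
    up-pocket {z} {a} {t} {ps} {Q₁} {ys} {i = i} {i₁} {k} {x} {y} f E h nt e refl (r-chord R) = r-chord (subst (λ l → Chord O z a ps l i) (Lₚ.++-assoc ps Q₁ _) (up-chord (step-pocket f E h) _ (λ m → m) R))
    up-pocket {z} {a} {t} {ps} {Q₁} {ys} {i = i} {i₁} {k} {x} {y} f E h nt e refl (r-cut R) = r-cut (subst (λ l → Cut O z a ps l i x y) (Lₚ.++-assoc ps Q₁ _) (up-cut (step-pocket f E h) _ (λ m → m) R))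
    up-pocket {z} {a} {t} {ps} {Q₁} {ys} {L₁} {i = i} {i₁} {k} f E h nt e refl (r-both (at-end {ps₁} {ps₂} {iF} {iR} refl D R g mx my nz nx ny)) =
      r-both (at-mid {iF = iF ++ k} refl refl (split f D E refl ↭-refl) R (lin {as = i} {bs = ((iF ++ k) ++ iR)} (h ⊹ g) (prove (# 0 ⊕ (# 1 ⊕ # 2) ⊕ # 3 ⊕ # 4) (((# 3 ⊕ # 2) ⊕ # 4) ⊕ # 0 ⊕ # 1) (i ∷ i₁ ∷ k ∷ iF ∷ iR ∷  []))) (mem mx) (mem my) nz nx ny)
      where
      mem : ∀ {v} → v ∈ t ∷ iF → v ∈ t ∷ ys ++ z ∷ iF ++ k
      mem m = ∈-resp-↭ (prove ((# 0 ⊕ # 1) ⊕ # 2 ⊕ # 3 ⊕ # 4) (# 0 ⊕ # 2 ⊕ # 3 ⊕ # 1 ⊕ # 4) ([ t ] ∷ iF ∷ ys ∷ [ z ] ∷ k ∷  [])) (∈ₚ.∈-++⁺ˡ m)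
    up-pocket {z} {a} {t} {ps} {Q₁} {ys} {L₁} {i = i} {i₁} {k} f E h nt e refl (r-both (at-mid {ps₁} {ps₂} {Q₀} {q} {Q₂} {iF} {iR} refl refl D R g mx my nz nx ny)) =
      r-both (at-mid {Q₂ = Q₂ ++ t ∷ ys} {iF = iF ++ k} refl (Lₚ.++-assoc Q₀ _ _) (split f D E (sym (Lₚ.++-assoc ps₁ _ _)) ↭-refl) R (lin {as = i} {bs = ((iF ++ k) ++ iR)} (h ⊹ g) (prove (# 0 ⊕ (# 1 ⊕ # 2) ⊕ # 3 ⊕ # 4) (((# 3 ⊕ # 2) ⊕ # 4) ⊕ # 0 ⊕ # 1) (i ∷ i₁ ∷ k ∷ iF ∷ iR ∷  []))) (mem mx) (mem my) nz nx ny)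
      where
      mem : ∀ {v} → v ∈ q ∷ Q₂ ++ t ∷ iF → v ∈ q ∷ (Q₂ ++ t ∷ ys) ++ z ∷ iF ++ k
      mem m = ∈-resp-↭ (prove ((# 0 ⊕ # 1 ⊕ # 2 ⊕ # 3) ⊕ # 4 ⊕ # 5 ⊕ # 6) (# 0 ⊕ (# 1 ⊕ # 2 ⊕ # 4) ⊕ # 5 ⊕ # 3 ⊕ # 6) ([ q ] ∷ Q₂ ∷ [ t ] ∷ iF ∷ ys ∷ [ z ] ∷ k ∷  [])) (∈ₚ.∈-++⁺ˡ m)

    -- The pocket cut off by the vertex τ contains w, which is reached from τ.
    up-pocket-one : ∀ {z a t ps Q₁ ys L₁ L₂ i i₁ k x' y' x y w} → Face z a t → Disk z t ys k → i ↭ i₁ ++ k → t ∉ O → Q₁ ∷ʳ t ≡ q₀ ∷ O' ++ L₁ → L₂ ≡ L₁ ++ ys ∷ʳ z →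
      Unique (z ∷ a ∷ (ps ++ Q₁ ++ t ∷ ys) ++ i) → length (z ∷ a ∷ (ps ++ Q₁ ++ t ∷ ys) ++ i) ≤ N → w ∈ ys ++ z ∷ k → w ∉ O →
      (∀ {c d e} → Sol x' y' c → Path t w d → c ++ d ↭ t ∷ e → Sol x y e) →
      ((P : V → Set) → P x' → P y' → P w → P x × P y) → ((P : V → Set) → P x' → P y' → P t) →
      Res t a ps Q₁ L₁ (ps ++ Q₁) i₁ x' y' → Res z a ps (Q₁ ++ t ∷ ys) L₂ (ps ++ Q₁ ++ t ∷ ys) i x y
    up-pocket-one {z} {a} {t} {ps} {Q₁} {ys} {L₁} {_} {i} {i₁} {k} {x'} {y'} {x} {y} {w} f E h nt e refl U len mw nw ext sel selt = go
      where
      vE : z ∷ a ∷ (ps ++ Q₁ ++ t ∷ ys) ++ i ↭ a ∷ (z ∷ t ∷ ys ++ k) ++ ps ++ Q₁ ++ i₁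
      vE = (lin {as = ([ z ] ++ ([ a ] ++ ((ps ++ (Q₁ ++ ([ t ] ++ ys))) ++ i)))} {bs = ([ a ] ++ (([ z ] ++ ([ t ] ++ (ys ++ k))) ++ (ps ++ (Q₁ ++ i₁))))} (h) (prove ((# 0 ⊕ # 1 ⊕ (# 2 ⊕ # 3 ⊕ # 4 ⊕ # 5) ⊕ # 6) ⊕ # 7 ⊕ # 8) ((# 1 ⊕ (# 0 ⊕ # 4 ⊕ # 5 ⊕ # 8) ⊕ # 2 ⊕ # 3 ⊕ # 7) ⊕ # 6) ([ z ] ∷ [ a ] ∷ ps ∷ Q₁ ∷ [ t ] ∷ ys ∷ i ∷ i₁ ∷ k ∷  [])))
      UE : Unique (z ∷ t ∷ ys ++ k)
      UE = Unique-sub {ys = a ∷ ps ++ Q₁ ++ i₁} (lin {as = (([ z ] ++ ([ t ] ++ (ys ++ k))) ++ ([ a ] ++ (ps ++ (Q₁ ++ i₁))))} {bs = ([ z ] ++ ([ a ] ++ ((ps ++ (Q₁ ++ ([ t ] ++ ys))) ++ i)))} ((↭-sym h)) (prove (((# 0 ⊕ # 1 ⊕ # 2 ⊕ # 3) ⊕ # 4 ⊕ # 5 ⊕ # 6 ⊕ # 7) ⊕ # 8) ((# 0 ⊕ # 4 ⊕ (# 5 ⊕ # 6 ⊕ # 1 ⊕ # 2) ⊕ # 8) ⊕ # 7 ⊕ # 3) ([ z ] ∷ [ t ] ∷ ys ∷ k ∷ [ a ] ∷ ps ∷ Q₁ ∷ i₁ ∷ i ∷  []))) U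
      U₁ : Unique (t ∷ a ∷ (ps ++ Q₁) ++ i₁)
      U₁ = Unique-sub {ys = z ∷ ys ++ k} (lin {as = (([ t ] ++ ([ a ] ++ ((ps ++ Q₁) ++ i₁))) ++ ([ z ] ++ (ys ++ k)))} {bs = ([ z ] ++ ([ a ] ++ ((ps ++ (Q₁ ++ ([ t ] ++ ys))) ++ i)))} ((↭-sym h)) (prove (((# 0 ⊕ # 1 ⊕ (# 2 ⊕ # 3) ⊕ # 4) ⊕ # 5 ⊕ # 6 ⊕ # 7) ⊕ # 8) ((# 5 ⊕ # 1 ⊕ (# 2 ⊕ # 3 ⊕ # 0 ⊕ # 6) ⊕ # 8) ⊕ # 4 ⊕ # 7) ([ t ] ∷ [ a ] ∷ ps ∷ Q₁ ∷ i₁ ∷ [ z ] ∷ ys ∷ k ∷ i ∷  []))) U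
      J : Joined z t ys k t w
      J = join solve E (ℕₚ.<-≤-trans (length-↭-< {xs = z ∷ t ∷ ys ++ k} {ys = ps ++ Q₁ ++ i₁} vE) len) UE (there (here refl))
            (∈-resp-↭ (prove (# 0 ⊕ # 1 ⊕ # 2 ⊕ # 3) (# 2 ⊕ # 0 ⊕ # 1 ⊕ # 3) ([ t ] ∷ ys ∷ [ z ] ∷ k ∷  [])) (there mw))
            (λ { refl → Unique-clash {xs = [ t ]} {ys = ys ++ z ∷ k} (prove (# 0 ⊕ # 1 ⊕ # 2 ⊕ # 3) (# 1 ⊕ # 2 ⊕ # 0 ⊕ # 3) ([ z ] ∷ [ t ] ∷ ys ∷ k ∷  [])) UE (here refl) mw })
      go : Res t a ps Q₁ L₁ (ps ++ Q₁) i₁ x' y' → Res z a ps (Q₁ ++ t ∷ ys) (L₁ ++ ys ∷ʳ z) (ps ++ Q₁ ++ t ∷ ys) i x y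
      go (r-none (none {kP} {uP} {cP} {kQ} {uQ} {cS} {cR} pkP pathP pkQ sol vis visP ct)) with J
      ... | joined {kJ} {uJ} {iJ} pkJ pathJ ctJ = r-none (none {kQ = kQ ++ kJ} {uQ ++ uJ} {cS ++ kJ ++ iJ} {cR ++ iJ} pkP pathP
             (subst (λ l → Pockets q₀ l (kQ ++ kJ) (uQ ++ uJ)) (Lₚ.++-assoc O' L₁ _) (pockets-++ pkQ (last-of {Q = Q₁} e) pkJ))
             (ext sol pathJ (prove (# 0 ⊕ # 1 ⊕ # 2 ⊕ # 3) (# 1 ⊕ # 0 ⊕ # 2 ⊕ # 3) (cS ∷ [ t ] ∷ kJ ∷ iJ ∷  []))) (lin {as = (cS ++ (kJ ++ iJ))} {bs = (([ q₀ ] ++ (kQ ++ kJ)) ++ (cR ++ iJ))} (vis) (prove ((# 0 ⊕ # 1 ⊕ # 2) ⊕ (# 3 ⊕ # 4) ⊕ # 5) (((# 3 ⊕ # 4 ⊕ # 1) ⊕ # 5 ⊕ # 2) ⊕ # 0) (cS ∷ kJ ∷ iJ ∷ [ q₀ ] ∷ kQ ∷ cR ∷  []))) visP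
             (lin {as = ([ z ] ++ ([ a ] ++ ((ps ++ (Q₁ ++ ([ t ] ++ ys))) ++ i)))} {bs = (cP ++ (uP ++ ((cS ++ (kJ ++ iJ)) ++ (uQ ++ uJ))))} (h ⊹ ct ⊹ ctJ) (prove ((# 0 ⊕ # 1 ⊕ (# 2 ⊕ # 3 ⊕ # 4 ⊕ # 5) ⊕ # 6) ⊕ (# 7 ⊕ # 8) ⊕ (# 9 ⊕ # 10 ⊕ # 11 ⊕ # 12) ⊕ (# 4 ⊕ # 13 ⊕ # 14) ⊕ # 15) ((# 9 ⊕ # 10 ⊕ (# 11 ⊕ # 13 ⊕ # 14) ⊕ # 12 ⊕ # 15) ⊕ # 6 ⊕ (# 4 ⊕ # 1 ⊕ (# 2 ⊕ # 3) ⊕ # 7) ⊕ # 0 ⊕ # 4 ⊕ # 5 ⊕ # 8) ([ z ] ∷ [ a ] ∷ ps ∷ Q₁ ∷ [ t ] ∷ ys ∷ i ∷ i₁ ∷ k ∷ cP ∷ uP ∷ cS ∷ uQ ∷ kJ ∷ iJ ∷ uJ ∷  []))))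
      -- A corner leaves the root vertex unvisited, but this is `t`, which now is an end vertex of
      -- the solution.
      go (r-corner (corner {ps₁} {ps₂} {Qv} {Qu} {B} {iZ} {kP} {uP} {cP} {kQ} {uQ} {cS} {cR} {cB} psE pkP pathP QE pkQ sol vis visP kind visB Z ct)) =
        ⊥-elim (Unique-clash {xs = cS} {ys = (Qu ∷ʳ t) ++ cP ++ uP ++ uQ ++ init a ps₁ ++ iZ} (lin {as = ([ t ] ++ ([ a ] ++ ((ps ++ Q₁) ++ i₁)))} {bs = (cS ++ ((Qu ++ [ t ]) ++ (cP ++ (uP ++ (uQ ++ ((init a ps₁) ++ iZ))))))} (ct) (prove ((# 0 ⊕ # 1 ⊕ (# 2 ⊕ # 3) ⊕ # 4) ⊕ # 5 ⊕ # 6 ⊕ # 7 ⊕ # 8 ⊕ # 9 ⊕ (# 10 ⊕ # 0) ⊕ # 11) ((# 7 ⊕ (# 10 ⊕ # 0) ⊕ # 5 ⊕ # 6 ⊕ # 8 ⊕ # 9 ⊕ # 11) ⊕ # 0 ⊕ # 1 ⊕ (# 2 ⊕ # 3) ⊕ # 4) ([ t ] ∷ [ a ] ∷ ps ∷ Q₁ ∷ i₁ ∷ cP ∷ uP ∷ cS ∷ uQ ∷ init a ps₁ ∷ Qu ∷ iZ ∷  []))) U₁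
           (selt (_∈ cS) (sol-∈ˡ sol) (sol-∈ʳ sol)) (∈ₚ.∈-++⁺ˡ (∈-mid Qu)))
      go (r-chord R) = r-chord (subst (λ l → Chord O z a ps l i) (Lₚ.++-assoc ps Q₁ _) (up-chord (step-pocket f E h) _ (λ m → m) R))
      go (r-cut R) = ⊥-elim (Unique-clash {xs = [ t ]} {ys = a ∷ (ps ++ Q₁) ++ i₁} ↭-refl U₁ (here refl)
          (there (∈ₚ.∈-++⁺ʳ (ps ++ Q₁) (∈-resp-↭ (↭-sym C.ints) (∈ₚ.∈-++⁺ˡ (selt (_∈ C.q ∷ C.iF) C.x∈ C.y∈))))))
        where module C = Cut R
      go (r-both (at-end {ps₁} {ps₂} {iF} {iR} refl D R g mx my nz nx ny)) =
        r-both (at-mid {iF = iF ++ k} refl refl (split f D E refl ↭-refl) R (lin {as = i} {bs = ((iF ++ k) ++ iR)} (h ⊹ g) (prove (# 0 ⊕ (# 1 ⊕ # 2) ⊕ # 3 ⊕ # 4) (((# 3 ⊕ # 2) ⊕ # 4) ⊕ # 0 ⊕ # 1) (i ∷ i₁ ∷ k ∷ iF ∷ iR ∷  []))) (proj₁ ms) (proj₂ ms) nz (proj₁ ns) (proj₂ ns))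
        where
        mem : ∀ {v} → v ∈ t ∷ iF → v ∈ t ∷ ys ++ z ∷ iF ++ k
        mem m = ∈-resp-↭ (prove ((# 0 ⊕ # 1) ⊕ # 2 ⊕ # 3 ⊕ # 4) (# 0 ⊕ # 2 ⊕ # 3 ⊕ # 1 ⊕ # 4) ([ t ] ∷ iF ∷ ys ∷ [ z ] ∷ k ∷  [])) (∈ₚ.∈-++⁺ˡ m)
        ms = sel (_∈ t ∷ ys ++ z ∷ iF ++ k) (mem mx) (mem my) (∈-resp-↭ (prove ((# 0 ⊕ # 1) ⊕ # 2 ⊕ # 3 ⊕ # 4) (# 0 ⊕ # 2 ⊕ # 3 ⊕ # 1 ⊕ # 4) ([ t ] ∷ iF ∷ ys ∷ [ z ] ∷ k ∷  [])) (∈ₚ.∈-++⁺ʳ (t ∷ iF) mw))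
        ns = sel (_∉ O) nx ny nw
      go (r-both (at-mid {ps₁} {ps₂} {Q₀} {q} {Q₂} {iF} {iR} refl refl D R g mx my nz nx ny)) =
        r-both (at-mid {Q₂ = Q₂ ++ t ∷ ys} {iF = iF ++ k} refl (Lₚ.++-assoc Q₀ _ _) (split f D E (sym (Lₚ.++-assoc ps₁ _ _)) ↭-refl) R (lin {as = i} {bs = ((iF ++ k) ++ iR)} (h ⊹ g) (prove (# 0 ⊕ (# 1 ⊕ # 2) ⊕ # 3 ⊕ # 4) (((# 3 ⊕ # 2) ⊕ # 4) ⊕ # 0 ⊕ # 1) (i ∷ i₁ ∷ k ∷ iF ∷ iR ∷  []))) (proj₁ ms) (proj₂ ms) nz (proj₁ ns) (proj₂ ns))
        where
        mem : ∀ {v} → v ∈ q ∷ Q₂ ++ t ∷ iF → v ∈ q ∷ (Q₂ ++ t ∷ ys) ++ z ∷ iF ++ k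
        mem m = ∈-resp-↭ (prove ((# 0 ⊕ # 1 ⊕ # 2 ⊕ # 3) ⊕ # 4 ⊕ # 5 ⊕ # 6) (# 0 ⊕ (# 1 ⊕ # 2 ⊕ # 4) ⊕ # 5 ⊕ # 3 ⊕ # 6) ([ q ] ∷ Q₂ ∷ [ t ] ∷ iF ∷ ys ∷ [ z ] ∷ k ∷  [])) (∈ₚ.∈-++⁺ˡ m)
        ms = sel (_∈ q ∷ (Q₂ ++ t ∷ ys) ++ z ∷ iF ++ k) (mem mx) (mem my) (∈-resp-↭ (prove ((# 0 ⊕ # 1 ⊕ # 2 ⊕ # 3) ⊕ # 4 ⊕ # 5 ⊕ # 6) (# 0 ⊕ (# 1 ⊕ # 2 ⊕ # 4) ⊕ # 5 ⊕ # 3 ⊕ # 6) ([ q ] ∷ Q₂ ∷ [ t ] ∷ iF ∷ ys ∷ [ z ] ∷ k ∷  [])) (∈ₚ.∈-++⁺ʳ (q ∷ Q₂ ++ t ∷ iF) mw))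
        ns = sel (_∉ O) nx ny nw

    -- The arc is used up. The part `D₁` is an empty digon, and `E` contains all of `O`; it is the
    -- block that is passed to `finish`.
    run-base : ∀ {z a ys L i i₁ k x y} → Face z a q₀ → Disk q₀ a [] i₁ → Disk z q₀ ys k → i ↭ i₁ ++ k →
      Unique (z ∷ a ∷ (q₀ ∷ ys) ++ i) → length (z ∷ a ∷ (q₀ ∷ ys) ++ i) ≤ N → ys ∷ʳ z ≡ O' ++ L → a ≡ m₀ →
      Orig O x₀ x → Orig O y₀ y → x ≢ y → x ∈ (q₀ ∷ ys) ++ z ∷ i → y ∈ (q₀ ∷ ys) ++ z ∷ i →
      Res z a [] (q₀ ∷ ys) L (q₀ ∷ ys) i x y
    run-base {z} {a} {ys} {L} {i} {i₁} {k} {x} {y} f D₁ E h₀ U len e refl ox oy n mx my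
      with no-digon D₁ (Unique-sub {ys = z ∷ ys ++ k} (lin {as = (([ q₀ ] ++ ([ a ] ++ i₁)) ++ ([ z ] ++ (ys ++ k)))} {bs = ([ z ] ++ ([ a ] ++ (([ q₀ ] ++ ys) ++ i)))} ((↭-sym h₀)) (prove (((# 0 ⊕ # 1 ⊕ # 2) ⊕ # 3 ⊕ # 4 ⊕ # 5) ⊕ # 6) ((# 3 ⊕ # 1 ⊕ (# 0 ⊕ # 4) ⊕ # 6) ⊕ # 2 ⊕ # 5) ([ q₀ ] ∷ [ a ] ∷ i₁ ∷ [ z ] ∷ ys ∷ k ∷ i ∷  []))) U)
    ... | refl = go (finish E e ox oy n (mem mx) (mem my) UE (ℕₚ.<-≤-trans (length-↭-< {xs = z ∷ q₀ ∷ ys ++ k} {ys = []} vE) len) (face-adj f))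
      where
      h : i ↭ k
      h = h₀
      vE : z ∷ a ∷ (q₀ ∷ ys) ++ i ↭ a ∷ (z ∷ q₀ ∷ ys ++ k) ++ []
      vE = (lin {as = ([ z ] ++ ([ a ] ++ (([ q₀ ] ++ ys) ++ i)))} {bs = ([ a ] ++ (([ z ] ++ ([ q₀ ] ++ (ys ++ k))) ++ []))} (h) (prove ((# 0 ⊕ # 1 ⊕ (# 2 ⊕ # 3) ⊕ # 4) ⊕ # 5) ((# 1 ⊕ (# 0 ⊕ # 2 ⊕ # 3 ⊕ # 5) ⊕ ε) ⊕ # 4) ([ z ] ∷ [ a ] ∷ [ q₀ ] ∷ ys ∷ i ∷ k ∷  [])))
      UE : Unique (z ∷ q₀ ∷ ys ++ k)
      UE = Unique-sub {ys = [ a ]} (lin {as = (([ z ] ++ ([ q₀ ] ++ (ys ++ k))) ++ [ a ])} {bs = ([ z ] ++ ([ a ] ++ (([ q₀ ] ++ ys) ++ i)))} ((↭-sym h)) (prove (((# 0 ⊕ # 1 ⊕ # 2 ⊕ # 3) ⊕ # 4) ⊕ # 5) ((# 0 ⊕ # 4 ⊕ (# 1 ⊕ # 2) ⊕ # 5) ⊕ # 3) ([ z ] ∷ [ q₀ ] ∷ ys ∷ k ∷ [ a ] ∷ i ∷  []))) U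
      mem : ∀ {v} → v ∈ (q₀ ∷ ys) ++ z ∷ i → v ∈ z ∷ q₀ ∷ ys ++ k
      mem = ∈-resp-↭ (lin {as = (([ q₀ ] ++ ys) ++ ([ z ] ++ i))} {bs = ([ z ] ++ ([ q₀ ] ++ (ys ++ k)))} (h) (prove (((# 0 ⊕ # 1) ⊕ # 2 ⊕ # 3) ⊕ # 4) ((# 2 ⊕ # 0 ⊕ # 1 ⊕ # 4) ⊕ # 3) ([ q₀ ] ∷ ys ∷ [ z ] ∷ i ∷ k ∷  [])))
      go : Final Sol q₀ z ys k x y → Res z a [] (q₀ ∷ ys) L (q₀ ∷ ys) i x y
      go (final {kF} {uF} {cF} {iF} pk sol keeps ct) with pockets-last-pocket {l = ys ∷ʳ z} pk (sym (snoc-++ ys))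
      ... | lastPocket {l₁} {m} {iₗ} {k₁} {u₁} P D el refl g with unsnoc m
      ... | inj₁ refl = r-none (none {uP = []} {cP = [ a ]} {kQ = k₁} {u₁} {cF} {iF} nil path-here (subst (λ l → Pockets q₀ l k₁ u₁) (trans l₁≡ e) P) sol
             (lin {as = cF} {bs = (([ q₀ ] ++ k₁) ++ iF)} (keeps) (prove (# 0 ⊕ (# 1 ⊕ # 2) ⊕ # 3) (((# 2 ⊕ # 1) ⊕ # 3) ⊕ # 0) (cF ∷ k₁ ∷ [ q₀ ] ∷ iF ∷  []))) (↭-refl {x = [ a ] ++ []})
             (lin {as = ([ z ] ++ ([ a ] ++ (([ q₀ ] ++ ys) ++ i)))} {bs = ([ a ] ++ ([] ++ (cF ++ u₁)))} (h ⊹ ct ⊹ g') (prove ((# 0 ⊕ # 1 ⊕ (# 2 ⊕ # 3) ⊕ # 4) ⊕ # 5 ⊕ (# 6 ⊕ # 7) ⊕ # 8) ((# 1 ⊕ ε ⊕ # 6 ⊕ # 8) ⊕ # 4 ⊕ (# 0 ⊕ # 2 ⊕ # 3 ⊕ # 5) ⊕ # 7) ([ z ] ∷ [ a ] ∷ [ q₀ ] ∷ ys ∷ i ∷ k ∷ cF ∷ uF ∷ u₁ ∷  []))))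
        where
        l₁≡ : l₁ ≡ ys ∷ʳ z
        l₁≡ = trans (sym (Lₚ.++-identityʳ l₁)) (sym el)
        l≡z : last q₀ l₁ ≡ z
        l≡z = trans (cong (last q₀) l₁≡) (last-∷ʳ q₀ ys)
        D' : Disk q₀ z [] iₗ
        D' = subst (λ v → Disk q₀ v [] iₗ) l≡z D
        ne : l₁ ≢ []
        ne le = ∷ʳ-≢[] ys (trans (sym l₁≡) le)
        z∈ : z ∈ k₁
        z∈ with last-∈ q₀ k₁ | pockets-last P
        ... | here eq | eq' = ⊥-elim (adj-irrefl (subst (Adj q₀) (trans (sym l≡z) (trans (sym eq') eq)) (root-adj D')))
        ... | there mm | eq' = subst (_∈ k₁) (trans eq' l≡z) mm
        iₗ≡ : iₗ ≡ []
        iₗ≡ with ∈→↭ z∈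
        ... | ks , gk = no-digon D' (Unique-sub {ys = ks ++ iF ++ u₁} (lin {as = (([ q₀ ] ++ ([ z ] ++ iₗ)) ++ (ks ++ (iF ++ u₁)))} {bs = ([ z ] ++ ([ q₀ ] ++ (ys ++ k)))} ((↭-sym ct) ⊹ (↭-sym keeps) ⊹ (↭-sym gk) ⊹ (↭-sym g)) (prove (((# 0 ⊕ # 1 ⊕ # 2) ⊕ # 3 ⊕ # 4 ⊕ # 5) ⊕ (# 1 ⊕ # 0 ⊕ # 6 ⊕ # 7) ⊕ # 8 ⊕ # 9 ⊕ # 10) ((# 1 ⊕ # 0 ⊕ # 6 ⊕ # 7) ⊕ (# 8 ⊕ # 10) ⊕ ((# 9 ⊕ # 0) ⊕ # 4) ⊕ (# 1 ⊕ # 3) ⊕ # 5 ⊕ ε ⊕ # 2) ([ q₀ ] ∷ [ z ] ∷ iₗ ∷ ks ∷ iF ∷ u₁ ∷ ys ∷ k ∷ cF ∷ k₁ ∷ uF ∷  []))) UE)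
        g' : uF ↭ u₁
        g' = ↭-trans g (↭-trans (++⁺ˡ u₁ (↭-reflexive iₗ≡)) (↭-reflexive (Lₚ.++-identityʳ u₁)))
      ... | inj₂ (m' , z' , refl) with ∷ʳ-inj ys (l₁ ++ m') (trans el (sym (Lₚ.++-assoc l₁ m' _))) | last-∈ q₀ k₁ | pockets-last P
      ... | eys , refl | here eq | eq' = ⊥-elim (adj-irrefl (subst (Adj q₀) (trans (sym eq') eq) (root-adj D)))
      ... | eys , refl | there mm | eq' with ∈→↭ (subst (_∈ k₁) eq' mm)
      ... | ks , gk = r-corner (corner {ps₁ = []} {Qv = l₁} {m'} {q₀ ∷ last q₀ l₁ ∷ []} {uP = []} {cP = [ a ]} {kQ = k₁} {u₁} {cF} {iF} {cB = ks ++ iF} refl nil path-here (trans (sym e) el) P sol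
            (lin {as = cF} {bs = (([ q₀ ] ++ k₁) ++ iF)} (keeps) (prove (# 0 ⊕ (# 1 ⊕ # 2) ⊕ # 3) (((# 2 ⊕ # 1) ⊕ # 3) ⊕ # 0) (cF ∷ k₁ ∷ [ q₀ ] ∷ iF ∷  []))) (↭-refl {x = [ a ] ++ []}) cutedge
            (lin {as = cF} {bs = (([ q₀ ] ++ ([ last q₀ l₁ ] ++ [])) ++ (ks ++ iF))} (keeps ⊹ gk) (prove (# 0 ⊕ ((# 1 ⊕ # 2) ⊕ # 3) ⊕ # 4 ⊕ # 5) (((# 2 ⊕ # 4 ⊕ ε) ⊕ # 5 ⊕ # 3) ⊕ # 0 ⊕ # 1) (cF ∷ k₁ ∷ [ q₀ ] ∷ iF ∷ [ last q₀ l₁ ] ∷ ks ∷  [])))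
            (split {xs = []} f (edge (adj-sym (face-adj₂ f))) (rotate∘ (q₀ ∷ last q₀ l₁ ∷ m') [ z ] D) refl ↭-refl)
            (lin {as = ([ z ] ++ ([ a ] ++ (([ q₀ ] ++ ys) ++ i)))} {bs = ([ a ] ++ ([] ++ (cF ++ (u₁ ++ ([] ++ ((m' ++ [ z ]) ++ iₗ))))))} (h ⊹ ct ⊹ g) (prove ((# 0 ⊕ # 1 ⊕ (# 2 ⊕ # 3) ⊕ # 4) ⊕ # 5 ⊕ (# 6 ⊕ # 7) ⊕ # 8 ⊕ (# 9 ⊕ # 0) ⊕ # 10) ((# 1 ⊕ ε ⊕ # 6 ⊕ # 8 ⊕ ε ⊕ (# 9 ⊕ # 0) ⊕ # 10) ⊕ # 4 ⊕ (# 0 ⊕ # 2 ⊕ # 3 ⊕ # 5) ⊕ # 7) ([ z ] ∷ [ a ] ∷ [ q₀ ] ∷ ys ∷ i ∷ k ∷ cF ∷ uF ∷ u₁ ∷ m' ∷ iₗ ∷  []))))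

    -- Once the arc is deleted, `t` separates the block `E` from the rest. A single end vertex in
    -- `E` is traded for `t`. If both are in `E`, where `t` counts too once the other one is behind
    -- it, the outcome is `Both`.
    run-pocket : ∀ {z a t ps Q₁ ys cs L₁ L₂ i i₁ k x y} → Face z a t → Disk t a (ps ++ Q₁) i₁ → Disk z t ys k → i ↭ i₁ ++ k → t ∉ O →
      Q₁ ≡ O ++ cs → Q₁ ∷ʳ t ≡ q₀ ∷ O' ++ L₁ → L₂ ≡ L₁ ++ ys ∷ʳ z →
      Unique (z ∷ a ∷ (ps ++ Q₁ ++ t ∷ ys) ++ i) → length (z ∷ a ∷ (ps ++ Q₁ ++ t ∷ ys) ++ i) ≤ N →
      Orig O x₀ x → Orig O y₀ y → x ≢ y → x ∈ (Q₁ ++ t ∷ ys) ++ z ∷ i → y ∈ (Q₁ ++ t ∷ ys) ++ z ∷ i →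
      (∀ {x y} → Orig O x₀ x → Orig O y₀ y → x ≢ y → x ∈ Q₁ ++ t ∷ i₁ → y ∈ Q₁ ++ t ∷ i₁ → Res t a ps Q₁ L₁ (ps ++ Q₁) i₁ x y) →
      Res z a ps (Q₁ ++ t ∷ ys) L₂ (ps ++ Q₁ ++ t ∷ ys) i x y
    run-pocket {z} {a} {t} {ps} {Q₁} {ys} {cs} {L₁} {L₂} {i} {i₁} {k} {x} {y} f D E h nt eQ e eL U len ox oy n mx my rec = go (x ∈? (ys ++ z ∷ k)) (y ∈? (ys ++ z ∷ k)) (x ≟ t) (y ≟ t)
      where
      orig : ∀ {v v₀} → Orig O v₀ v → v ∉ O → Orig O v₀ t
      orig (inj₁ refl) nv = inj₂ (nv , nt)
      orig (inj₂ (n₀ , _)) _ = inj₂ (n₀ , nt)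
      out-of : ∀ {v} → v ∈ (Q₁ ++ t ∷ ys) ++ z ∷ i → v ∉ ys ++ z ∷ k → v ∈ Q₁ ++ t ∷ i₁
      out-of m nm with ∈ₚ.∈-++⁻ (Q₁ ++ t ∷ i₁) (∈-resp-↭ (lin {as = ((Q₁ ++ ([ t ] ++ ys)) ++ ([ z ] ++ i))} {bs = ((Q₁ ++ ([ t ] ++ i₁)) ++ (ys ++ ([ z ] ++ k)))} (h) (prove (((# 0 ⊕ # 1 ⊕ # 2) ⊕ # 3 ⊕ # 4) ⊕ # 5 ⊕ # 6) (((# 0 ⊕ # 1 ⊕ # 5) ⊕ # 2 ⊕ # 3 ⊕ # 6) ⊕ # 4) (Q₁ ∷ [ t ] ∷ ys ∷ [ z ] ∷ i ∷ i₁ ∷ k ∷  []))) m)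
      ... | inj₁ m' = m'
      ... | inj₂ m' = ⊥-elim (nm m')
      notO : ∀ {v} → v ∈ ys ++ z ∷ k → v ∉ O
      notO {v} m mO = Unique-clash {xs = Q₁} {ys = (ys ++ z ∷ k) ++ a ∷ ps ++ t ∷ i₁} (lin {as = ([ z ] ++ ([ a ] ++ ((ps ++ (Q₁ ++ ([ t ] ++ ys))) ++ i)))} {bs = (Q₁ ++ ((ys ++ ([ z ] ++ k)) ++ ([ a ] ++ (ps ++ ([ t ] ++ i₁)))))} (h) (prove ((# 0 ⊕ # 1 ⊕ (# 2 ⊕ # 3 ⊕ # 4 ⊕ # 5) ⊕ # 6) ⊕ # 7 ⊕ # 8) ((# 3 ⊕ (# 5 ⊕ # 0 ⊕ # 8) ⊕ # 1 ⊕ # 2 ⊕ # 4 ⊕ # 7) ⊕ # 6) ([ z ] ∷ [ a ] ∷ ps ∷ Q₁ ∷ [ t ] ∷ ys ∷ i ∷ i₁ ∷ k ∷  []))) U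
        (subst (v ∈_) (sym eQ) (∈ₚ.∈-++⁺ˡ mO)) (∈ₚ.∈-++⁺ˡ m)
      both : x ∈ t ∷ ys ++ z ∷ k → y ∈ t ∷ ys ++ z ∷ k → x ∉ O → y ∉ O → Res z a ps (Q₁ ++ t ∷ ys) L₂ (ps ++ Q₁ ++ t ∷ ys) i x y
      both mx my nx ny = r-both (at-mid {ps₁ = []} {ps₂ = ps} {Q₁} {t} {ys} refl refl (split {xs = []} f (edge (adj-sym (face-adj₂ f))) E refl ↭-refl) D
        (lin {as = i} {bs = (k ++ i₁)} (h) (prove (# 0 ⊕ # 1 ⊕ # 2) ((# 2 ⊕ # 1) ⊕ # 0) (i ∷ i₁ ∷ k ∷  []))) mx my nt nx ny)
      go : Dec (x ∈ ys ++ z ∷ k) → Dec (y ∈ ys ++ z ∷ k) → Dec (x ≡ t) → Dec (y ≡ t) → Res z a ps (Q₁ ++ t ∷ ys) L₂ (ps ++ Q₁ ++ t ∷ ys) i x y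
      go (no nx) (no ny) _ _ = up-pocket f E h nt e eL (rec ox oy n (out-of mx nx) (out-of my ny))
      go (no nx) (yes py) (no xt) _ = up-pocket-one f E h nt e eL U len py (notO py) sol-extʳ (λ P px pt pw → px , pw) (λ P px pt → pt)
        (rec ox (orig oy (notO py)) xt (out-of mx nx) (∈-mid Q₁))
      go (yes px) (no ny) _ (no yt) = up-pocket-one f E h nt e eL U len px (notO px) sol-extˡ (λ P pt py pw → pw , py) (λ P pt py → pt)
        (rec (orig ox (notO px)) oy (λ q → yt (sym q)) (∈-mid Q₁) (out-of my ny))
      go (no nx) (yes py) (yes refl) _ = both (here refl) (there py) nt (notO py)
      go (yes px) (no ny) _ (yes refl) = both (there px) (here refl) (notO px) nt
      go (yes px) (yes py) _ _ = both (there px) (there py) (notO px) (notO py)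

    -- The apex of the root triangle decides. An interior apex becomes exposed and is appended to
    -- `L`. On the removed arc it is the next vertex or the end of a chord. On the remaining
    -- boundary it is `q₀` at the end of the run, the end of a chord into `O`, or an exposed vertex,
    -- which is then a cutvertex.
    run : ∀ {z a ps Qi L r i x y} → Disk z a r i → r ≡ ps ++ Qi → Qi ∷ʳ z ≡ q₀ ∷ O' ++ L → last a ps ≡ m₀ → (∀ {v} → v ∈ ps → v ∈ ps₀) →
      Unique (z ∷ a ∷ r ++ i) → length (z ∷ a ∷ r ++ i) ≤ N → Orig O x₀ x → Orig O y₀ y → x ≢ y → x ∈ Qi ++ z ∷ i → y ∈ Qi ++ z ∷ i →
      Res z a ps Qi L r i x y
    run {ps = []} {[]} (edge h) refl e em sub U len ox oy n (here refl) (here refl) = ⊥-elim (n refl)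
    run {z} {a} {ps} {Qi} {L} {_} {i} (inner {t = t} {i = i'} f D h) refl e em sub U len ox oy n mx my =
      up-inner f h U len sub n e (run {ps = ps} {Qi ∷ʳ z} {L ∷ʳ t} D (snoc-++ ps) (trans (cong (_∷ʳ t) e) (cong (q₀ ∷_) (snoc-++ O'))) em sub
        (Unique-↭ vD U) (subst (_≤ N) (↭-length vD) len) ox oy n (mem mx) (mem my))
      where
      vD : z ∷ a ∷ (ps ++ Qi) ++ i ↭ t ∷ a ∷ ((ps ++ Qi) ∷ʳ z) ++ i'
      vD = (lin {as = ([ z ] ++ ([ a ] ++ ((ps ++ Qi) ++ i)))} {bs = ([ t ] ++ ([ a ] ++ (((ps ++ Qi) ++ [ z ]) ++ i')))} (h) (prove ((# 0 ⊕ # 1 ⊕ (# 2 ⊕ # 3) ⊕ # 4) ⊕ # 5 ⊕ # 6) ((# 5 ⊕ # 1 ⊕ ((# 2 ⊕ # 3) ⊕ # 0) ⊕ # 6) ⊕ # 4) ([ z ] ∷ [ a ] ∷ ps ∷ Qi ∷ i ∷ [ t ] ∷ i' ∷  [])))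
      mem : ∀ {v} → v ∈ Qi ++ z ∷ i → v ∈ (Qi ∷ʳ z) ++ t ∷ i'
      mem = ∈-resp-↭ (lin {as = (Qi ++ ([ z ] ++ i))} {bs = ((Qi ++ [ z ]) ++ ([ t ] ++ i'))} (h) (prove ((# 0 ⊕ # 1 ⊕ # 2) ⊕ # 3 ⊕ # 4) (((# 0 ⊕ # 1) ⊕ # 3 ⊕ # 4) ⊕ # 2) (Qi ∷ [ z ] ∷ i ∷ [ t ] ∷ i' ∷  [])))
    run {z} {a} {ps} {Qi} {L} {_} {i} {x} {y} (split {t = t} {xs} {i₁} {ys} {k} f D E refl h) er e em sub U len ox oy n mx my
      with ++-compare xs ps er
    run {z} {a} {_} {Qi} {L} {_} {i} {x} {y} (split {t = t} {xs} {i₁} {ys} {k} f D E refl h) er e em sub U len ox oy n mx my | inj₁ (cs , refl , refl)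
      with unsnoc xs
    ... | inj₁ refl
      with no-digon D (Unique-sub {ys = z ∷ cs ++ Qi ++ k} (lin {as = (([ t ] ++ ([ a ] ++ i₁)) ++ ([ z ] ++ (cs ++ (Qi ++ k))))} {bs = ([ z ] ++ ([ a ] ++ (([ t ] ++ (cs ++ Qi)) ++ i)))} ((↭-sym h)) (prove (((# 0 ⊕ # 1 ⊕ # 2) ⊕ # 3 ⊕ # 4 ⊕ # 5 ⊕ # 6) ⊕ # 7) ((# 3 ⊕ # 1 ⊕ (# 0 ⊕ # 4 ⊕ # 5) ⊕ # 7) ⊕ # 2 ⊕ # 6) ([ t ] ∷ [ a ] ∷ i₁ ∷ [ z ] ∷ cs ∷ Qi ∷ k ∷ i ∷  []))) U)
    ... | refl = (up-next f h' (run {ps = cs} {Qi} {L} E refl e em (λ m → sub (there m)) U' (ℕₚ.≤-trans (ℕₚ.<⇒≤ (length-↭-< {xs = z ∷ t ∷ (cs ++ Qi) ++ k} {ys = []} vE)) len) ox oy n (mem mx) (mem my)))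
      where
      h' : i ↭ k
      h' = h
      vE : z ∷ a ∷ (t ∷ cs ++ Qi) ++ i ↭ a ∷ (z ∷ t ∷ (cs ++ Qi) ++ k) ++ []
      vE = (lin {as = ([ z ] ++ ([ a ] ++ (([ t ] ++ (cs ++ Qi)) ++ i)))} {bs = ([ a ] ++ (([ z ] ++ ([ t ] ++ ((cs ++ Qi) ++ k))) ++ []))} (h') (prove ((# 0 ⊕ # 1 ⊕ (# 2 ⊕ # 3 ⊕ # 4) ⊕ # 5) ⊕ # 6) ((# 1 ⊕ (# 0 ⊕ # 2 ⊕ (# 3 ⊕ # 4) ⊕ # 6) ⊕ ε) ⊕ # 5) ([ z ] ∷ [ a ] ∷ [ t ] ∷ cs ∷ Qi ∷ i ∷ k ∷  [])))
      U' : Unique (z ∷ t ∷ (cs ++ Qi) ++ k)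
      U' = Unique-sub {ys = [ a ]} (lin {as = (([ z ] ++ ([ t ] ++ ((cs ++ Qi) ++ k))) ++ [ a ])} {bs = ([ z ] ++ ([ a ] ++ (([ t ] ++ (cs ++ Qi)) ++ i)))} ((↭-sym h')) (prove (((# 0 ⊕ # 1 ⊕ (# 2 ⊕ # 3) ⊕ # 4) ⊕ # 5) ⊕ # 6) ((# 0 ⊕ # 5 ⊕ (# 1 ⊕ # 2 ⊕ # 3) ⊕ # 6) ⊕ # 4) ([ z ] ∷ [ t ] ∷ cs ∷ Qi ∷ k ∷ [ a ] ∷ i ∷  []))) U
      mem : ∀ {v} → v ∈ Qi ++ z ∷ i → v ∈ Qi ++ z ∷ k
      mem = ∈-resp-↭ (lin {as = (Qi ++ ([ z ] ++ i))} {bs = (Qi ++ ([ z ] ++ k))} (h') (prove ((# 0 ⊕ # 1 ⊕ # 2) ⊕ # 3) ((# 0 ⊕ # 1 ⊕ # 3) ⊕ # 2) (Qi ∷ [ z ] ∷ i ∷ k ∷  [])))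
    run {z} {a} {_} {Qi} {L} {_} {i} {x} {y} (split {t = t} {xs} {i₁} {ys} {k} f D E refl h) er e em sub U len ox oy n mx my | inj₁ (cs , refl , refl) | inj₂ (xs' , _ , refl) =
      r-chord (record { X = [] ; DA = split {xs = []} f (edge (adj-sym (face-adj₂ f))) E refl ↭-refl ; DB = D ; arc = cong (a ∷_) (snoc-++ xs) ; short = refl
        ; mid≢[] = ∷ʳ-≢[] xs' ; ints = (lin {as = i} {bs = (k ++ i₁)} (h) (prove (# 0 ⊕ # 1 ⊕ # 2) ((# 2 ⊕ # 1) ⊕ # 0) (i ∷ i₁ ∷ k ∷  []))) ; proper = inj₁ λ () ; s∈ = here refl ; t∈ = there (∈ₚ.∈-++⁺ˡ (∈-mid xs)) })
    run {z} {a} {ps} {_} {L} {_} {i} {x} {y} (split {t = t} {_} {i₁} {ys} {k} f D E refl h) er e em sub U len ox oy n mx my | inj₂ (Q₁ , refl , refl)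
      with unsnoc (ps ++ Q₁) | t ∈? O
    ... | inj₁ e₀ | _ = run-start (Lₚ.++-conicalˡ ps Q₁ e₀) (Lₚ.++-conicalʳ ps Q₁ e₀) D e em U len mx my
      where
      run-start : ∀ {ps Q₁} → ps ≡ [] → Q₁ ≡ [] → Disk t a (ps ++ Q₁) i₁ → (Q₁ ++ t ∷ ys) ∷ʳ z ≡ q₀ ∷ O' ++ L → last a ps ≡ m₀ →
        Unique (z ∷ a ∷ ((ps ++ Q₁) ++ t ∷ ys) ++ i) → length (z ∷ a ∷ ((ps ++ Q₁) ++ t ∷ ys) ++ i) ≤ N → x ∈ (Q₁ ++ t ∷ ys) ++ z ∷ i → y ∈ (Q₁ ++ t ∷ ys) ++ z ∷ i → Res z a ps (Q₁ ++ t ∷ ys) L ((ps ++ Q₁) ++ t ∷ ys) i x y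
      run-start refl refl D e em U len mx my with Lₚ.∷-injective e
      ... | refl , e' = run-base f D E h U len e' em ox oy n mx my
    ... | inj₂ (xs' , w , e₀) | yes tO = r-chord (record { X = [] ; DA = split {xs = []} f (edge (adj-sym (face-adj₂ f))) E refl ↭-refl ; DB = D ; arc = cong (a ∷_) (snoc-++ (ps ++ Q₁)) ; short = refl
        ; mid≢[] = λ e' → ∷ʳ-≢[] xs' (trans (sym e₀) e') ; ints = (lin {as = i} {bs = (k ++ i₁)} (h) (prove (# 0 ⊕ # 1 ⊕ # 2) ((# 2 ⊕ # 1) ⊕ # 0) (i ∷ i₁ ∷ k ∷  []))) ; proper = inj₁ λ () ; s∈ = here refl ; t∈ = ∈ₚ.∈-++⁺ʳ (a ∷ ps) tO })
    ... | inj₂ _ | no tO with ++-compare Q₁ O (trans (sym (snoc-++ Q₁)) e)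
    ... | inj₁ (cs , e₁ , _) = ⊥-elim (tO (subst (t ∈_) (sym e₁) (∈-mid Q₁)))
    ... | inj₂ (cs , e₁ , refl) = subst (λ l → Res z a ps (Q₁ ++ t ∷ ys) (cs ++ t ∷ ys ∷ʳ z) l i x y) (sym (Lₚ.++-assoc ps Q₁ _))
      (run-pocket f D E h tO e₁ e₂ (sym (Lₚ.++-assoc cs [ t ] _)) U' (subst (_≤ N) (↭-length v') len) ox oy n mx my
        (λ ox oy n mx my → run {ps = ps} {Q₁} {cs ∷ʳ t} D refl e₂ em sub U₁ (ℕₚ.≤-trans (ℕₚ.<⇒≤ (length-↭-< {xs = t ∷ a ∷ (ps ++ Q₁) ++ i₁} {ys = ys ++ k} v₁)) len) ox oy n mx my))
      where
      e₂ : Q₁ ∷ʳ t ≡ q₀ ∷ O' ++ cs ∷ʳ t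
      e₂ = trans (cong (_∷ʳ t) e₁) (snoc-++ O)
      v' : z ∷ a ∷ ((ps ++ Q₁) ++ t ∷ ys) ++ i ↭ z ∷ a ∷ (ps ++ Q₁ ++ t ∷ ys) ++ i
      v' = (prove (# 0 ⊕ # 1 ⊕ ((# 2 ⊕ # 3) ⊕ # 4 ⊕ # 5) ⊕ # 6) (# 0 ⊕ # 1 ⊕ (# 2 ⊕ # 3 ⊕ # 4 ⊕ # 5) ⊕ # 6) ([ z ] ∷ [ a ] ∷ ps ∷ Q₁ ∷ [ t ] ∷ ys ∷ i ∷  []))
      U' = Unique-↭ v' U
      v₁ : z ∷ a ∷ ((ps ++ Q₁) ++ t ∷ ys) ++ i ↭ z ∷ (t ∷ a ∷ (ps ++ Q₁) ++ i₁) ++ ys ++ k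
      v₁ = (lin {as = ([ z ] ++ ([ a ] ++ (((ps ++ Q₁) ++ ([ t ] ++ ys)) ++ i)))} {bs = ([ z ] ++ (([ t ] ++ ([ a ] ++ ((ps ++ Q₁) ++ i₁))) ++ (ys ++ k)))} (h) (prove ((# 0 ⊕ # 1 ⊕ ((# 2 ⊕ # 3) ⊕ # 4 ⊕ # 5) ⊕ # 6) ⊕ # 7 ⊕ # 8) ((# 0 ⊕ (# 4 ⊕ # 1 ⊕ (# 2 ⊕ # 3) ⊕ # 7) ⊕ # 5 ⊕ # 8) ⊕ # 6) ([ z ] ∷ [ a ] ∷ ps ∷ Q₁ ∷ [ t ] ∷ ys ∷ i ∷ i₁ ∷ k ∷  [])))
      U₁ : Unique (t ∷ a ∷ (ps ++ Q₁) ++ i₁)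
      U₁ = Unique-sub {ys = z ∷ ys ++ k} (lin {as = (([ t ] ++ ([ a ] ++ ((ps ++ Q₁) ++ i₁))) ++ ([ z ] ++ (ys ++ k)))} {bs = ([ z ] ++ ([ a ] ++ (((ps ++ Q₁) ++ ([ t ] ++ ys)) ++ i)))} ((↭-sym h)) (prove (((# 0 ⊕ # 1 ⊕ (# 2 ⊕ # 3) ⊕ # 4) ⊕ # 5 ⊕ # 6 ⊕ # 7) ⊕ # 8) ((# 5 ⊕ # 1 ⊕ ((# 2 ⊕ # 3) ⊕ # 0 ⊕ # 6) ⊕ # 8) ⊕ # 4 ⊕ # 7) ([ t ] ∷ [ a ] ∷ ps ∷ Q₁ ∷ i₁ ∷ [ z ] ∷ ys ∷ k ∷ i ∷  []))) U

  -- Sweeping along an arc and detours around a boundary vertex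

  pockets-nil : Pockets a [] k u → k ≡ [] × u ≡ []
  pockets-nil nil = refl , refl
  pockets-nil (cons {m = m} _ _ e _) = ⊥-elim (∷ʳ-≢[] m (sym e))

  -- With `p`, the end of the arc, the disk is rooted at `p α` and solved for the end vertices `α`
  -- and `a`. By `two-fix` one path is trivial at `α`, and the other leads from `a` to `p` and
  -- misses `α`, which is visited elsewhere.
  absorb-vertex : ∀ {N} → Solver N → Disk α a (b ∷ ps) i → length (α ∷ a ∷ b ∷ ps ++ i) < N → Unique (α ∷ a ∷ b ∷ ps ++ i) → Sweep a (b ∷ ps) i
  absorb-vertex {α} {a} {b} {ps} {i} {N} S D lt U = go (init b ps) (last b ps) (init-last b ps)
    where
    go : ∀ m p → b ∷ ps ≡ m ∷ʳ p → Sweep a (b ∷ ps) i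
    go m p e = fin (S E (λ ()) (subst (_< N) (↭-length v) lt) U' (there (here refl)) (there (there (here refl))) α≢a noEnds)
      where
      E : Disk p α (a ∷ m) i
      E = rotate∘ (α ∷ a ∷ m) [ p ] (subst (λ l → Disk α a l i) e D)
      ge : b ∷ ps ↭ m ∷ʳ p
      ge = ↭-reflexive e
      v : α ∷ a ∷ b ∷ ps ++ i ↭ p ∷ α ∷ (a ∷ m) ++ i
      v = (lin {as = ([ α ] ++ ([ a ] ++ ([ b ] ++ (ps ++ i))))} {bs = ([ p ] ++ ([ α ] ++ (([ a ] ++ m) ++ i)))} (ge) (prove ((# 0 ⊕ # 1 ⊕ # 2 ⊕ # 3 ⊕ # 4) ⊕ # 5 ⊕ # 6) ((# 6 ⊕ # 0 ⊕ (# 1 ⊕ # 5) ⊕ # 4) ⊕ # 2 ⊕ # 3) ([ α ] ∷ [ a ] ∷ [ b ] ∷ ps ∷ i ∷ m ∷ [ p ] ∷  [])))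
      U' = Unique-↭ v U
      α≢a : α ≢ a
      α≢a = Unique-≢ ↭-refl U
      noEnds : ¬ SameEnds α a p α
      noEnds (inj₁ (q , _)) = Unique-≢ ↭-refl U' (sym q)
      noEnds (inj₂ (_ , q)) = Unique-≢ {xs = α ∷ m ++ i} (prove (# 0 ⊕ # 1 ⊕ (# 2 ⊕ # 3) ⊕ # 4) (# 2 ⊕ # 0 ⊕ # 1 ⊕ # 3 ⊕ # 4) ([ p ] ∷ [ α ] ∷ [ a ] ∷ m ∷ i ∷  [])) U' q
      fin : Out p α (a ∷ m) i α a → Sweep a (b ∷ ps) i
      fin (out {kept} {unv} {ins} pk two ct _) with two-fix two (Unique-sub {ys = unv} (↭-sym ct) U') | pockets-split pk [] refl (Unique-clash ct U' (two-∈ʳ two))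
      ... | f , P , gf | keepSplit {k₁} {k₂} {u₁} {u₂} L R refl g with single-pocket L
      ... | ek , D₁ with no-digon D₁ (Unique-sub {ys = k₁ ++ k₂ ++ ins ++ u₂} (lin {as = (([ a ] ++ ([ α ] ++ u₁)) ++ (k₁ ++ (k₂ ++ (ins ++ u₂))))} {bs = ([ p ] ++ ([ α ] ++ (([ a ] ++ m) ++ i)))} ((↭-sym ct) ⊹ (↭-sym g)) (prove (((# 0 ⊕ # 1 ⊕ # 2) ⊕ # 3 ⊕ # 4 ⊕ # 5 ⊕ # 6) ⊕ (# 7 ⊕ # 1 ⊕ (# 0 ⊕ # 8) ⊕ # 9) ⊕ # 10) ((# 7 ⊕ # 1 ⊕ (# 0 ⊕ # 8) ⊕ # 9) ⊕ ((# 1 ⊕ (# 3 ⊕ # 0 ⊕ # 4) ⊕ # 5) ⊕ # 10) ⊕ # 2 ⊕ # 6) ([ a ] ∷ [ α ] ∷ u₁ ∷ k₁ ∷ k₂ ∷ ins ∷ u₂ ∷ [ p ] ∷ m ∷ i ∷ unv ∷  []))) U')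
      ... | refl with ∷ʳ-inj k₁ [] ek
      ... | refl , _ = sweep (subst (λ l → Pockets a l k₂ u₂) (sym e) R) (subst (λ v → Path a v f) (sym (trans (cong (last a) e) (last-∷ʳ a m))) P)
            (lin {as = f} {bs = (([ a ] ++ k₂) ++ ins)} ((↭-sym gf)) (prove (# 0 ⊕ # 1 ⊕ (# 2 ⊕ # 3) ⊕ # 4) (((# 2 ⊕ # 3) ⊕ # 4) ⊕ # 1 ⊕ # 0) (f ∷ [ α ] ∷ [ a ] ∷ k₂ ∷ ins ∷  [])))
            (lin {as = ([ a ] ++ ([ b ] ++ (ps ++ i)))} {bs = (f ++ u₂)} (ge ⊹ ct ⊹ gf ⊹ g) (prove ((# 0 ⊕ # 1 ⊕ # 2 ⊕ # 3) ⊕ (# 4 ⊕ # 5) ⊕ ((# 6 ⊕ (# 0 ⊕ # 7) ⊕ # 8) ⊕ # 9) ⊕ (# 6 ⊕ # 10) ⊕ ε ⊕ # 11) ((# 10 ⊕ # 11) ⊕ (# 1 ⊕ # 2) ⊕ (# 5 ⊕ # 6 ⊕ (# 0 ⊕ # 4) ⊕ # 3) ⊕ (# 6 ⊕ (# 0 ⊕ # 7) ⊕ # 8) ⊕ # 9) ([ a ] ∷ [ b ] ∷ ps ∷ i ∷ m ∷ [ p ] ∷ [ α ] ∷ k₂ ∷ ins ∷ unv ∷ f ∷ u₂ ∷  [])))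

  absorb-arc : ∀ {N} → Solver N → Disk α a ps i → ps ≢ [] → length (α ∷ a ∷ ps ++ i) < N → Unique (α ∷ a ∷ ps ++ i) → Sweep a ps i
  absorb-arc {ps = []} S D n = ⊥-elim (n refl)
  absorb-arc {ps = _ ∷ _} S D n = absorb-vertex S D

  -- Two paths from the neighbours p, q of the removed boundary vertex β to the ends of the root edge.
  record Detour (z a : V) (X : Ls) (p β q : V) (Y r i : Ls) : Set where
    constructor detour
    field
      {lp kL uL kR uR vis ins} : Ls
      first   : X ∷ʳ p ≡ a ∷ lp
      left    : Pockets a lp kL uL
      right   : Pockets q Y kR uR
      two     : Two p q z a vis
      keeps   : vis ↭ (a ∷ kL) ++ (q ∷ kR) ++ ins
      content : z ∷ a ∷ r ++ i ↭ β ∷ vis ++ uL ++ uR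

  split-first : ∀ X {m} → a ∷ l ≡ X ++ p ∷ m → ∃[ lp ] X ∷ʳ p ≡ a ∷ lp × l ≡ lp ++ m
  split-first [] refl = [] , refl , refl
  split-first (x ∷ X) refl = X ∷ʳ _ , refl , sym (Lₚ.++-assoc X _ _)

  split-last : ∀ X Y → l ∷ʳ z ≡ X ++ p ∷ Y → p ∷ Y ≡ init p Y ∷ʳ z
  split-last {l} {z} {p} X Y e with ∷ʳ-inj l (X ++ init p Y) (trans e (trans (cong (X ++_) (init-last p Y)) (sym (Lₚ.++-assoc X _ _))))
  ... | _ , refl = init-last p Y

  rerooted : ∀ X {Y z a r} → a ∷ r ∷ʳ z ≡ X ++ Y → Disk z a r i → Disk∘ (Y ++ X) i
  rerooted {i} X {Y} {z} {a} {r} e D = rotate∘ X Y (subst (λ l → Disk∘ l i) e (rotate∘ [ z ] (a ∷ r) D))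

  unrerooted : ∀ X {Y z a r} → a ∷ r ∷ʳ z ≡ X ++ Y → Disk∘ (Y ++ X) i → Disk z a r i
  unrerooted {i} X {Y} {z} {a} {r} e D = rotate∘ (a ∷ r) [ z ] (subst (λ l → Disk∘ l i) (sym e) (rotate∘ Y X D))

  module _ {N : ℕ} (S : Solver N) where

    -- The chord case, in which β has a neighbour t other than p and q on the boundary.
    DetourIH : ℕ → Set
    DetourIH M = ∀ {z a X p β q Y r i} → Disk z a r i → a ∷ r ∷ʳ z ≡ X ++ p ∷ β ∷ q ∷ Y → length (z ∷ a ∷ r ++ i) < M →
      Unique (z ∷ a ∷ r ++ i) → Detour z a X p β q Y r i

    -- On the root side the detour has `t` in the role of `q`. On the other side a sweep from `q` to
    -- `t` that misses `β` prolongs the path at `t`.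
    detour-chordʳ : ∀ {z a X p β q t Y m cs r i iA iB} → DetourIH (length (z ∷ a ∷ r ++ i)) → length (z ∷ a ∷ r ++ i) ≤ N → Unique (z ∷ a ∷ r ++ i) →
      a ∷ r ∷ʳ z ≡ X ++ p ∷ β ∷ q ∷ Y → Y ≡ m ++ t ∷ cs → Disk p β (t ∷ cs ++ X) iA → Disk t β (q ∷ m) iB → i ↭ iA ++ iB → Detour z a X p β q Y r i
    detour-chordʳ {z} {a} {X} {p} {β} {q} {t} {_} {m} {cs} {r} {i} {iA} {iB} IH len U e refl DA DB gi with reframe X (β ∷ q ∷ m) e [ β ]
    ... | r' , e' = go (IH (unrerooted X e' DA) e' (ℕₚ.<-≤-trans (length-↭-< {xs = z ∷ a ∷ r' ++ iA} {ys = m ++ iB} vA) ℕₚ.≤-refl) (Unique-sub {ys = q ∷ m ++ iB} (lin {as = (([ z ] ++ ([ a ] ++ (r' ++ iA))) ++ ([ q ] ++ (m ++ iB)))} {bs = ([ z ] ++ ([ a ] ++ (r ++ i)))} ((↭-sym vA)) (prove (((# 0 ⊕ # 1 ⊕ # 2 ⊕ # 3) ⊕ # 4 ⊕ # 5 ⊕ # 6) ⊕ # 0 ⊕ # 1 ⊕ # 7 ⊕ # 8) ((# 0 ⊕ # 1 ⊕ # 7 ⊕ # 8) ⊕ # 4 ⊕ (# 0 ⊕ # 1 ⊕ # 2 ⊕ # 3) ⊕ # 5 ⊕ # 6) ([ z ] ∷ [ a ] ∷ r' ∷ iA ∷ [ q ] ∷ m ∷ iB ∷ r ∷ i ∷  [])))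 U))
                       (absorb-arc S (rotate∘ [ t ] (β ∷ q ∷ m) DB) (∷ʳ-≢[] m) (ℕₚ.<-≤-trans (length-↭-< {xs = β ∷ q ∷ (m ∷ʳ t) ++ iB} {ys = cs ++ X ++ iA} vB) len)
                         (Unique-sub {ys = p ∷ cs ++ X ++ iA} (lin {as = (([ β ] ++ ([ q ] ++ ((m ++ [ t ]) ++ iB))) ++ ([ p ] ++ (cs ++ (X ++ iA))))} {bs = ([ z ] ++ ([ a ] ++ (r ++ i)))} ((↭-sym vB)) (prove (((# 0 ⊕ # 1 ⊕ (# 2 ⊕ # 3) ⊕ # 4) ⊕ # 5 ⊕ # 6 ⊕ # 7 ⊕ # 8) ⊕ # 9 ⊕ # 10 ⊕ # 11 ⊕ # 12) ((# 9 ⊕ # 10 ⊕ # 11 ⊕ # 12) ⊕ # 5 ⊕ (# 0 ⊕ # 1 ⊕ (# 2 ⊕ # 3) ⊕ # 4) ⊕ # 6 ⊕ # 7 ⊕ # 8) ([ β ] ∷ [ q ] ∷ m ∷ [ t ] ∷ iB ∷ [ p ] ∷ cs ∷ X ∷ iA ∷ [ z ] ∷ [ a ] ∷ r ∷ i ∷  []))) U))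
      where
      ge' : a ∷ r' ∷ʳ z ↭ X ++ p ∷ β ∷ t ∷ cs
      ge' = ↭-reflexive e'
      ge : a ∷ r ∷ʳ z ↭ X ++ p ∷ β ∷ q ∷ m ++ t ∷ cs
      ge = ↭-reflexive e
      v₁ : z ∷ a ∷ r ++ i ↭ p ∷ β ∷ (q ∷ (m ++ t ∷ cs) ++ X) ++ i
      v₁ = (lin {as = ([ z ] ++ ([ a ] ++ (r ++ i)))} {bs = ([ p ] ++ ([ β ] ++ (([ q ] ++ ((m ++ ([ t ] ++ cs)) ++ X)) ++ i)))} (ge) (prove ((# 0 ⊕ # 1 ⊕ # 2 ⊕ # 3) ⊕ # 4 ⊕ # 5 ⊕ # 6 ⊕ # 7 ⊕ # 8 ⊕ # 9 ⊕ # 10) ((# 5 ⊕ # 6 ⊕ (# 7 ⊕ (# 8 ⊕ # 9 ⊕ # 10) ⊕ # 4) ⊕ # 3) ⊕ # 1 ⊕ # 2 ⊕ # 0) ([ z ] ∷ [ a ] ∷ r ∷ i ∷ X ∷ [ p ] ∷ [ β ] ∷ [ q ] ∷ m ∷ [ t ] ∷ cs ∷  [])))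
      vA : z ∷ a ∷ r ++ i ↭ q ∷ (z ∷ a ∷ r' ++ iA) ++ m ++ iB
      vA = (lin {as = ([ z ] ++ ([ a ] ++ (r ++ i)))} {bs = ([ q ] ++ (([ z ] ++ ([ a ] ++ (r' ++ iA))) ++ (m ++ iB)))} (v₁ ⊹ (↭-sym ge') ⊹ gi) (prove ((# 0 ⊕ # 1 ⊕ # 2 ⊕ # 3) ⊕ (# 4 ⊕ # 5 ⊕ (# 6 ⊕ (# 7 ⊕ # 8 ⊕ # 9) ⊕ # 10) ⊕ # 3) ⊕ (# 1 ⊕ # 11 ⊕ # 0) ⊕ # 12 ⊕ # 13) ((# 6 ⊕ (# 0 ⊕ # 1 ⊕ # 11 ⊕ # 12) ⊕ # 7 ⊕ # 13) ⊕ (# 0 ⊕ # 1 ⊕ # 2 ⊕ # 3) ⊕ (# 10 ⊕ # 4 ⊕ # 5 ⊕ # 8 ⊕ # 9) ⊕ # 3) ([ z ] ∷ [ a ] ∷ r ∷ i ∷ [ p ] ∷ [ β ] ∷ [ q ] ∷ m ∷ [ t ] ∷ cs ∷ X ∷ r' ∷ iA ∷ iB ∷  [])))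
      vB : z ∷ a ∷ r ++ i ↭ p ∷ (β ∷ q ∷ (m ∷ʳ t) ++ iB) ++ cs ++ X ++ iA
      vB = (lin {as = ([ z ] ++ ([ a ] ++ (r ++ i)))} {bs = ([ p ] ++ (([ β ] ++ ([ q ] ++ ((m ++ [ t ]) ++ iB))) ++ (cs ++ (X ++ iA))))} (v₁ ⊹ gi) (prove ((# 0 ⊕ # 1 ⊕ # 2 ⊕ # 3) ⊕ (# 4 ⊕ # 5 ⊕ (# 6 ⊕ (# 7 ⊕ # 8 ⊕ # 9) ⊕ # 10) ⊕ # 3) ⊕ # 11 ⊕ # 12) ((# 4 ⊕ (# 5 ⊕ # 6 ⊕ (# 7 ⊕ # 8) ⊕ # 12) ⊕ # 9 ⊕ # 10 ⊕ # 11) ⊕ (# 0 ⊕ # 1 ⊕ # 2 ⊕ # 3) ⊕ # 3) ([ z ] ∷ [ a ] ∷ r ∷ i ∷ [ p ] ∷ [ β ] ∷ [ q ] ∷ m ∷ [ t ] ∷ cs ∷ X ∷ iA ∷ iB ∷  [])))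
      go : Detour z a X p β t cs r' iA → Sweep q (m ∷ʳ t) iB → Detour z a X p β q (m ++ t ∷ cs) r i
      go (detour {lp} {kL} {uL} {kR} {uR} {c} {ins} first left right two keeps ct) (sweep {kS} {uS} {cS} {iS} pkS pathS keepS ctS) =
        detour {kL = kL} {uL} {kS ++ kR} {uS ++ uR} {(a ∷ kL) ++ kR ++ ins ++ cS} {ins ++ iS} first left
          (subst (λ l → Pockets q l (kS ++ kR) (uS ++ uR)) (Lₚ.++-assoc m _ _) (pockets-++ pkS (last-∷ʳ q m) right))
          (two-glueʳ two (path-rev (subst (λ v → Path q v cS) (last-∷ʳ q m) pathS)) (lin {as = (c ++ cS)} {bs = ([ t ] ++ (([ a ] ++ kL) ++ (kR ++ (ins ++ cS))))} (keeps) (prove ((# 0 ⊕ # 1) ⊕ (# 2 ⊕ # 3) ⊕ (# 4 ⊕ # 5) ⊕ # 6) ((# 4 ⊕ (# 2 ⊕ # 3) ⊕ # 5 ⊕ # 6 ⊕ # 1) ⊕ # 0) (c ∷ cS ∷ [ a ] ∷ kL ∷ [ t ] ∷ kR ∷ ins ∷  []))))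
          (lin {as = (([ a ] ++ kL) ++ (kR ++ (ins ++ cS)))} {bs = (([ a ] ++ kL) ++ (([ q ] ++ (kS ++ kR)) ++ (ins ++ iS)))} (keepS) (prove (((# 0 ⊕ # 1) ⊕ # 2 ⊕ # 3 ⊕ # 4) ⊕ (# 5 ⊕ # 6) ⊕ # 7) (((# 0 ⊕ # 1) ⊕ (# 5 ⊕ # 6 ⊕ # 2) ⊕ # 3 ⊕ # 7) ⊕ # 4) ([ a ] ∷ kL ∷ kR ∷ ins ∷ cS ∷ [ q ] ∷ kS ∷ iS ∷  [])))
          (lin {as = ([ z ] ++ ([ a ] ++ (r ++ i)))} {bs = ([ β ] ++ ((([ a ] ++ kL) ++ (kR ++ (ins ++ cS))) ++ (uL ++ (uS ++ uR))))} (vA ⊹ ct ⊹ keeps ⊹ ctS) (prove ((# 0 ⊕ # 1 ⊕ # 2 ⊕ # 3) ⊕ (# 4 ⊕ (# 0 ⊕ # 1 ⊕ # 5 ⊕ # 6) ⊕ # 7 ⊕ # 8) ⊕ (# 9 ⊕ # 10 ⊕ # 11 ⊕ # 12) ⊕ ((# 1 ⊕ # 13) ⊕ (# 14 ⊕ # 15) ⊕ # 16) ⊕ # 17 ⊕ # 18) ((# 9 ⊕ ((# 1 ⊕ # 13) ⊕ # 15 ⊕ # 16 ⊕ # 17) ⊕ # 11 ⊕ # 18 ⊕ # 12) ⊕ (# 0 ⊕ # 1 ⊕ # 2 ⊕ # 3) ⊕ (# 0 ⊕ # 1 ⊕ # 5 ⊕ # 6) ⊕ # 10 ⊕ # 4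 ⊕ (# 7 ⊕ # 14) ⊕ # 8) ([ z ] ∷ [ a ] ∷ r ∷ i ∷ [ q ] ∷ r' ∷ iA ∷ m ∷ iB ∷ [ β ] ∷ c ∷ uL ∷ uR ∷ kL ∷ [ t ] ∷ kR ∷ ins ∷ cS ∷ uS ∷  [])))

    detour-chordˡ : ∀ {z a X p β q t Y cs X₂ r i iA iB} → DetourIH (length (z ∷ a ∷ r ++ i)) → length (z ∷ a ∷ r ++ i) ≤ N → Unique (z ∷ a ∷ r ++ i) →
      a ∷ r ∷ʳ z ≡ X ++ p ∷ β ∷ q ∷ Y → X ≡ cs ++ t ∷ X₂ → Disk p β (t ∷ X₂) iA → Disk t β (q ∷ Y ++ cs) iB → i ↭ iA ++ iB → Detour z a X p β q Y r i
    detour-chordˡ {z} {a} {_} {p} {β} {q} {t} {Y} {cs} {X₂} {r} {i} {iA} {iB} IH len U e refl DA DB gi with reframe cs (X₂ ∷ʳ p) (trans e (trans (Lₚ.++-assoc cs _ _) (cong (λ l → cs ++ t ∷ l) (sym (Lₚ.++-assoc X₂ _ _))))) []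
    ... | r' , e' = go (IH (unrerooted cs e' DB) e' (ℕₚ.<-≤-trans (length-↭-< {xs = z ∷ a ∷ r' ++ iB} {ys = X₂ ++ iA} vB) ℕₚ.≤-refl) (Unique-sub {ys = p ∷ X₂ ++ iA} (lin {as = (([ z ] ++ ([ a ] ++ (r' ++ iB))) ++ ([ p ] ++ (X₂ ++ iA)))} {bs = ([ z ] ++ ([ a ] ++ (r ++ i)))} ((↭-sym vB)) (prove (((# 0 ⊕ # 1 ⊕ # 2 ⊕ # 3) ⊕ # 4 ⊕ # 5 ⊕ # 6) ⊕ # 0 ⊕ # 1 ⊕ # 7 ⊕ # 8) ((# 0 ⊕ # 1 ⊕ # 7 ⊕ # 8) ⊕ # 4 ⊕ (# 0 ⊕ # 1 ⊕ # 2 ⊕ # 3) ⊕ # 5 ⊕ # 6) ([ z ] ∷ [ a ] ∷ r' ∷ iB ∷ [ p ] ∷ X₂ ∷ iA ∷ r ∷ i ∷  []))) U))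
                       (absorb-arc S (rotate∘ [ p ] (β ∷ t ∷ X₂) DA) (∷ʳ-≢[] X₂) (ℕₚ.<-≤-trans (length-↭-< {xs = β ∷ t ∷ (X₂ ∷ʳ p) ++ iA} {ys = Y ++ cs ++ iB} vA) len)
                         (Unique-sub {ys = q ∷ Y ++ cs ++ iB} (lin {as = (([ β ] ++ ([ t ] ++ ((X₂ ++ [ p ]) ++ iA))) ++ ([ q ] ++ (Y ++ (cs ++ iB))))} {bs = ([ z ] ++ ([ a ] ++ (r ++ i)))} ((↭-sym vA)) (prove (((# 0 ⊕ # 1 ⊕ (# 2 ⊕ # 3) ⊕ # 4) ⊕ # 5 ⊕ # 6 ⊕ # 7 ⊕ # 8) ⊕ # 9 ⊕ # 10 ⊕ # 11 ⊕ # 12) ((# 9 ⊕ # 10 ⊕ # 11 ⊕ # 12) ⊕ # 5 ⊕ (# 0 ⊕ # 1 ⊕ (# 2 ⊕ # 3) ⊕ # 4) ⊕ # 6 ⊕ # 7 ⊕ # 8) ([ β ] ∷ [ t ] ∷ X₂ ∷ [ p ] ∷ iA ∷ [ q ] ∷ Y ∷ cs ∷ iB ∷ [ z ] ∷ [ a ] ∷ r ∷ i ∷  []))) U))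
      where
      ge' : a ∷ r' ∷ʳ z ↭ cs ++ t ∷ β ∷ q ∷ Y
      ge' = ↭-reflexive e'
      ge : a ∷ r ∷ʳ z ↭ (cs ++ t ∷ X₂) ++ p ∷ β ∷ q ∷ Y
      ge = ↭-reflexive e
      v₁ : z ∷ a ∷ r ++ i ↭ p ∷ β ∷ (q ∷ Y ++ (cs ++ t ∷ X₂)) ++ i
      v₁ = (lin {as = ([ z ] ++ ([ a ] ++ (r ++ i)))} {bs = ([ p ] ++ ([ β ] ++ (([ q ] ++ (Y ++ (cs ++ ([ t ] ++ X₂)))) ++ i)))} (ge) (prove ((# 0 ⊕ # 1 ⊕ # 2 ⊕ # 3) ⊕ (# 4 ⊕ # 5 ⊕ # 6) ⊕ # 7 ⊕ # 8 ⊕ # 9 ⊕ # 10) ((# 7 ⊕ # 8 ⊕ (# 9 ⊕ # 10 ⊕ # 4 ⊕ # 5 ⊕ # 6) ⊕ # 3) ⊕ # 1 ⊕ # 2 ⊕ # 0) ([ z ] ∷ [ a ] ∷ r ∷ i ∷ cs ∷ [ t ] ∷ X₂ ∷ [ p ] ∷ [ β ] ∷ [ q ] ∷ Y ∷  [])))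
      vB : z ∷ a ∷ r ++ i ↭ p ∷ (z ∷ a ∷ r' ++ iB) ++ X₂ ++ iA
      vB = (lin {as = ([ z ] ++ ([ a ] ++ (r ++ i)))} {bs = ([ p ] ++ (([ z ] ++ ([ a ] ++ (r' ++ iB))) ++ (X₂ ++ iA)))} (v₁ ⊹ (↭-sym ge') ⊹ gi) (prove ((# 0 ⊕ # 1 ⊕ # 2 ⊕ # 3) ⊕ (# 4 ⊕ # 5 ⊕ (# 6 ⊕ # 7 ⊕ # 8 ⊕ # 9 ⊕ # 10) ⊕ # 3) ⊕ (# 1 ⊕ # 11 ⊕ # 0) ⊕ # 12 ⊕ # 13) ((# 4 ⊕ (# 0 ⊕ # 1 ⊕ # 11 ⊕ # 13) ⊕ # 10 ⊕ # 12) ⊕ (# 0 ⊕ # 1 ⊕ # 2 ⊕ # 3) ⊕ (# 8 ⊕ # 9 ⊕ # 5 ⊕ # 6 ⊕ # 7) ⊕ # 3) ([ z ] ∷ [ a ] ∷ r ∷ i ∷ [ p ] ∷ [ β ] ∷ [ q ] ∷ Y ∷ cs ∷ [ t ] ∷ X₂ ∷ r' ∷ iA ∷ iB ∷  [])))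
      vA : z ∷ a ∷ r ++ i ↭ q ∷ (β ∷ t ∷ (X₂ ∷ʳ p) ++ iA) ++ Y ++ cs ++ iB
      vA = (lin {as = ([ z ] ++ ([ a ] ++ (r ++ i)))} {bs = ([ q ] ++ (([ β ] ++ ([ t ] ++ ((X₂ ++ [ p ]) ++ iA))) ++ (Y ++ (cs ++ iB))))} (v₁ ⊹ gi) (prove ((# 0 ⊕ # 1 ⊕ # 2 ⊕ # 3) ⊕ (# 4 ⊕ # 5 ⊕ (# 6 ⊕ # 7 ⊕ # 8 ⊕ # 9 ⊕ # 10) ⊕ # 3) ⊕ # 11 ⊕ # 12) ((# 6 ⊕ (# 5 ⊕ # 9 ⊕ (# 10 ⊕ # 4) ⊕ # 11) ⊕ # 7 ⊕ # 8 ⊕ # 12) ⊕ (# 0 ⊕ # 1 ⊕ # 2 ⊕ # 3) ⊕ # 3) ([ z ] ∷ [ a ] ∷ r ∷ i ∷ [ p ] ∷ [ β ] ∷ [ q ] ∷ Y ∷ cs ∷ [ t ] ∷ X₂ ∷ iA ∷ iB ∷  [])))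
      go : Detour z a cs t β q Y r' iB → Sweep t (X₂ ∷ʳ p) iA → Detour z a (cs ++ t ∷ X₂) p β q Y r i
      go (detour {lp} {kL} {uL} {kR} {uR} {c} {ins} first left right two keeps ct) (sweep {kS} {uS} {cS} {iS} pkS pathS keepS ctS) =
        detour {lp = lp ++ X₂ ∷ʳ p} {kL = kL ++ kS} {uL ++ uS} {kR} {uR} {c ++ kS ++ iS} {ins ++ iS} first'
          (pockets-++ left lastt pkS) right
          (two-glueˡ two (subst (λ v → Path t v cS) (last-∷ʳ t X₂) pathS) (lin {as = (c ++ cS)} {bs = ([ t ] ++ (c ++ (kS ++ iS)))} (keepS) (prove ((# 0 ⊕ # 1) ⊕ (# 2 ⊕ # 3) ⊕ # 4) ((# 2 ⊕ # 0 ⊕ # 3 ⊕ # 4) ⊕ # 1) (c ∷ cS ∷ [ t ] ∷ kS ∷ iS ∷  []))))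
          (lin {as = (c ++ (kS ++ iS))} {bs = (([ a ] ++ (kL ++ kS)) ++ (([ q ] ++ kR) ++ (ins ++ iS)))} (keeps) (prove ((# 0 ⊕ # 1 ⊕ # 2) ⊕ (# 3 ⊕ # 4) ⊕ (# 5 ⊕ # 6) ⊕ # 7) (((# 3 ⊕ # 4 ⊕ # 1) ⊕ (# 5 ⊕ # 6) ⊕ # 7 ⊕ # 2) ⊕ # 0) (c ∷ kS ∷ iS ∷ [ a ] ∷ kL ∷ [ q ] ∷ kR ∷ ins ∷  [])))
          (lin {as = ([ z ] ++ ([ a ] ++ (r ++ i)))} {bs = ([ β ] ++ ((c ++ (kS ++ iS)) ++ ((uL ++ uS) ++ uR)))} (vB ⊹ ct ⊹ keepS ⊹ ctS) (prove ((# 0 ⊕ # 1 ⊕ # 2 ⊕ # 3) ⊕ (# 4 ⊕ (# 0 ⊕ # 1 ⊕ # 5 ⊕ # 6) ⊕ # 7 ⊕ # 8) ⊕ (# 9 ⊕ # 10 ⊕ # 11 ⊕ # 12) ⊕ ((# 13 ⊕ # 14) ⊕ # 15) ⊕ # 16 ⊕ # 17) ((# 9 ⊕ (# 10 ⊕ # 14 ⊕ # 15) ⊕ (# 11 ⊕ # 17) ⊕ # 12) ⊕ (# 0 ⊕ # 1 ⊕ # 2 ⊕ # 3) ⊕ (# 0 ⊕ # 1 ⊕ # 5 ⊕ # 6) ⊕ # 16 ⊕ # 13 ⊕ (# 7 ⊕ # 4) ⊕ # 8) ([ z ] ∷ [ a ] ∷ r ∷ i ∷ [ p ] ∷ r'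 ∷ iB ∷ X₂ ∷ iA ∷ [ β ] ∷ c ∷ uL ∷ uR ∷ [ t ] ∷ kS ∷ iS ∷ cS ∷ uS ∷  [])))
        where
        first' : (cs ++ t ∷ X₂) ∷ʳ p ≡ a ∷ lp ++ X₂ ∷ʳ p
        first' = trans (snoc-++ cs) (trans (sym (Lₚ.++-assoc cs [ t ] _)) (cong (_++ X₂ ∷ʳ p) first))
        lastt : last a lp ≡ t
        lastt = proj₂ (∷ʳ-inj (init a lp) cs (trans (sym (init-last a lp)) (sym first)))

    -- The removed arc is `β` alone, so the chord starts there. It does not end at `p`, since then
    -- the root part would be a digon with nonempty interior.
    detour-chord : ∀ {z a X p β q Y r i} → DetourIH (length (z ∷ a ∷ r ++ i)) → length (z ∷ a ∷ r ++ i) ≤ N → Unique (z ∷ a ∷ r ++ i) →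
      a ∷ r ∷ʳ z ≡ X ++ p ∷ β ∷ q ∷ Y → Chord (q ∷ (Y ++ X) ∷ʳ p) p β [] (q ∷ Y ++ X) i → Detour z a X p β q Y r i
    detour-chord {z} {a} {X} {p} {β} {q} {Y} {r} {i} IH len U e C = start C.s∈ C.X C.arc C.short C.DB
      where
      module C = Chord C
      open C using (t; mid; iA; iB)
      ge : a ∷ r ∷ʳ z ↭ X ++ p ∷ β ∷ q ∷ Y
      ge = ↭-reflexive e
      v₀ : z ∷ a ∷ r ++ i ↭ p ∷ β ∷ (q ∷ Y ++ X) ++ i
      v₀ = (lin {as = ([ z ] ++ ([ a ] ++ (r ++ i)))} {bs = ([ p ] ++ ([ β ] ++ (([ q ] ++ (Y ++ X)) ++ i)))} (ge) (prove ((# 0 ⊕ # 1 ⊕ # 2 ⊕ # 3) ⊕ # 4 ⊕ # 5 ⊕ # 6 ⊕ # 7 ⊕ # 8) ((# 5 ⊕ # 6 ⊕ (# 7 ⊕ # 8 ⊕ # 4) ⊕ # 3) ⊕ # 1 ⊕ # 2 ⊕ # 0) ([ z ] ∷ [ a ] ∷ r ∷ i ∷ X ∷ [ p ] ∷ [ β ] ∷ [ q ] ∷ Y ∷  [])))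
      start : ∀ {s} → s ∈ [ β ] → ∀ X' → β ∷ (q ∷ Y ++ X) ∷ʳ p ≡ X' ++ s ∷ mid ++ t ∷ C.Y → β ∷ C.rA ∷ʳ p ≡ X' ++ s ∷ t ∷ C.Y → Disk t s mid iB → Detour z a X p β q Y r i
      start (here refl) (x ∷ X') e₁ _ _ with Lₚ.∷-injective e₁
      ... | refl , e₂ = ⊥-elim (Unique-clash {xs = [ β ]} {ys = ((q ∷ Y ++ X) ∷ʳ p) ++ i} (lin {as = ([ z ] ++ ([ a ] ++ (r ++ i)))} {bs = ([ β ] ++ ((([ q ] ++ (Y ++ X)) ++ [ p ]) ++ i))} (v₀) (prove ((# 0 ⊕ # 1 ⊕ # 2 ⊕ # 3) ⊕ # 4 ⊕ # 5 ⊕ (# 6 ⊕ # 7 ⊕ # 8) ⊕ # 3) ((# 5 ⊕ ((# 6 ⊕ # 7 ⊕ # 8) ⊕ # 4) ⊕ # 3) ⊕ # 0 ⊕ # 1 ⊕ # 2 ⊕ # 3) ([ z ] ∷ [ a ] ∷ r ∷ i ∷ [ p ] ∷ [ β ] ∷ [ q ] ∷ Y ∷ X ∷  []))) U (here refl)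
             (∈ₚ.∈-++⁺ˡ (subst (β ∈_) (sym e₂) (∈-mid X'))))
      start (here refl) [] e₁ e₂ DB = body mid C.mid≢[] (Lₚ.∷-injectiveʳ e₁) DB
        where
        body : ∀ mid → mid ≢ [] → (q ∷ Y ++ X) ∷ʳ p ≡ mid ++ t ∷ C.Y → Disk t β mid iB → Detour z a X p β q Y r i
        body [] n _ _ = ⊥-elim (n refl)
        body (_ ∷ m) _ e₃ DB with Lₚ.∷-injective e₃
        ... | refl , e₄ with ++-compare m Y (sym (trans (sym (snoc-++ Y)) e₄))
        ... | inj₁ (cs , eY , eY') = detour-chordʳ IH len U e eY (subst (λ l → Disk p β l iA) (proj₁ (∷ʳ-inj C.rA (t ∷ cs ++ X) (trans (Lₚ.∷-injectiveʳ e₂) (trans (cong (t ∷_) eY') (cong (t ∷_) (sym (snoc-++ cs))))))) C.DA) DB C.ints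
        ... | inj₂ (cs , refl , eX) with unsnoc C.Y
        ... | inj₁ eY = ⊥-elim (digon C.proper (∷ʳ-inj C.rA [] (trans (Lₚ.∷-injectiveʳ e₂) (cong (t ∷_) eY))) C.DA)
          where
          digon : ∀ {rA} → rA ≢ [] ⊎ iA ≢ [] → rA ≡ [] × p ≡ t → Disk p β rA iA → ⊥
          digon (inj₁ n) (er , _) _ = n er
          digon (inj₂ n) (refl , _) D = n (no-digon D (Unique-sub {ys = (q ∷ Y ++ X) ++ iB} (lin {as = (([ p ] ++ ([ β ] ++ iA)) ++ (([ q ] ++ (Y ++ X)) ++ iB))} {bs = ([ z ] ++ ([ a ] ++ (r ++ i)))} ((↭-sym v₀) ⊹ (↭-sym C.ints)) (prove (((# 0 ⊕ # 1 ⊕ # 2) ⊕ (# 3 ⊕ # 4 ⊕ # 5) ⊕ # 6) ⊕ (# 7 ⊕ # 8 ⊕ # 9 ⊕ # 10) ⊕ # 10) ((# 7 ⊕ # 8 ⊕ # 9 ⊕ # 10) ⊕ (# 0 ⊕ # 1 ⊕ (# 3 ⊕ # 4 ⊕ # 5) ⊕ # 10) ⊕ # 2 ⊕ # 6) ([ p ] ∷ [ β ] ∷ iA ∷ [ q ] ∷ Y ∷ X ∷ iB ∷ [ z ] ∷ [ a ] ∷ r ∷ i ∷  []))) U))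
        ... | inj₂ (X₂ , p' , eY) with ∷ʳ-inj X (cs ++ t ∷ X₂) (trans eX (trans (cong (λ l → cs ++ t ∷ l) eY) (sym (snoc-++ cs))))
        ... | eX' , refl = detour-chordˡ IH len U e eX' (subst (λ l → Disk p β l iA) (proj₁ (∷ʳ-inj C.rA (t ∷ X₂) (trans (Lₚ.∷-injectiveʳ e₂) (cong (t ∷_) eY)))) C.DA) DB C.ints

    -- The arc consists of `β`, and `O` is the rest of the boundary, so `p` and `q` remain the end
    -- vertices. What is left after deleting `β` is solved with the root `z a`; this is why `p`, `q`
    -- must not be the pair `a`, `z`.
    module DetourRun {z a X p β q Y r i} (D : Disk z a r i) (e : a ∷ r ∷ʳ z ≡ X ++ p ∷ β ∷ q ∷ Y) (len : length (z ∷ a ∷ r ++ i) ≤ N)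
      (U : Unique (z ∷ a ∷ r ++ i)) (ne : ¬ (p ≡ a × q ≡ z)) where
      O₁ : Ls
      O₁ = (Y ++ X) ∷ʳ p
      lp : Ls
      lp = proj₁ (split-first X e)
      elp : X ∷ʳ p ≡ a ∷ lp
      elp = proj₁ (proj₂ (split-first X e))
      W : Ls
      W = init q Y
      eW : q ∷ Y ≡ W ∷ʳ z
      eW = split-last {l = a ∷ r} (X ++ p ∷ β ∷ []) Y (trans e (sym (Lₚ.++-assoc X _ _)))
      ge : a ∷ r ∷ʳ z ↭ X ++ p ∷ β ∷ q ∷ Y
      ge = ↭-reflexive e
      D₀ : Disk p β (q ∷ Y ++ X) i
      D₀ = rerooted X e D
      v₀ : z ∷ a ∷ r ++ i ↭ p ∷ β ∷ (q ∷ Y ++ X) ++ i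
      v₀ = (lin {as = ([ z ] ++ ([ a ] ++ (r ++ i)))} {bs = ([ p ] ++ ([ β ] ++ (([ q ] ++ (Y ++ X)) ++ i)))} (ge) (prove ((# 0 ⊕ # 1 ⊕ # 2 ⊕ # 3) ⊕ # 4 ⊕ # 5 ⊕ # 6 ⊕ # 7 ⊕ # 8) ((# 5 ⊕ # 6 ⊕ (# 7 ⊕ # 8 ⊕ # 4) ⊕ # 3) ⊕ # 1 ⊕ # 2 ⊕ # 0) ([ z ] ∷ [ a ] ∷ r ∷ i ∷ X ∷ [ p ] ∷ [ β ] ∷ [ q ] ∷ Y ∷  [])))
      U₀ : Unique (p ∷ β ∷ (q ∷ Y ++ X) ++ i)
      U₀ = Unique-↭ v₀ U
      p≢q : p ≢ q
      p≢q = Unique-≢ {xs = β ∷ (Y ++ X) ++ i} (prove (# 0 ⊕ # 1 ⊕ (# 2 ⊕ # 3 ⊕ # 4) ⊕ # 5) (# 0 ⊕ # 2 ⊕ # 1 ⊕ (# 3 ⊕ # 4) ⊕ # 5) ([ p ] ∷ [ β ] ∷ [ q ] ∷ Y ∷ X ∷ i ∷  [])) U₀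
      z≢a : z ≢ a
      z≢a = Unique-≢ ↭-refl U
      noEnds : ¬ SameEnds p q z a
      noEnds (inj₂ pq) = ne pq
      noEnds (inj₁ (refl , _)) = Unique-clash {xs = [ z ]} {ys = β ∷ (q ∷ Y ++ X) ++ i} ↭-refl U₀ (here refl)
        (there (∈ₚ.∈-++⁺ˡ (∈ₚ.∈-++⁺ˡ (subst (z ∈_) (sym eW) (∈-mid W)))))
      p∈O : p ∈ q ∷ O₁
      p∈O = there (∈-mid (Y ++ X))

      fin : ∀ {zf ys iK x y L} → Disk zf q ys iK → ys ∷ʳ zf ≡ O₁ ++ L → Orig (q ∷ O₁) p x → Orig (q ∷ O₁) q y →
        x ≢ y → x ∈ zf ∷ q ∷ ys ++ iK → y ∈ zf ∷ q ∷ ys ++ iK → Unique (zf ∷ q ∷ ys ++ iK) →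
        length (zf ∷ q ∷ ys ++ iK) < N → Adj zf β → Final (λ x y c → Two x y z a c) q zf ys iK x y
      fin K eK (inj₂ (n , _)) _ _ _ _ _ _ _ = ⊥-elim (n p∈O)
      fin K eK (inj₁ _) (inj₂ (n , _)) _ _ _ _ _ _ = ⊥-elim (n (here refl))
      fin {zf} {ys} {iK} {L = L} K eK (inj₁ refl) (inj₁ refl) n mx my UK lt _ = go (S K' ne' (subst (_< N) (↭-length vK) lt) UK' (∈-resp-↭ vK mx) (∈-resp-↭ vK my) n noEnds)
        where
        eL : q ∷ ys ∷ʳ zf ≡ W ++ z ∷ a ∷ lp ++ L
        eL = trans (cong (q ∷_) eK) (trans (cong (λ l → q ∷ l ++ L) (snoc-++ Y)) (trans (cong (q ∷_) (Lₚ.++-assoc Y _ L))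
               (trans (cong₂ (λ l m → l ++ m ++ L) eW elp) (Lₚ.++-assoc W _ _))))
        K' : Disk z a ((lp ++ L) ++ W) iK
        K' = rerooted W eL K
        gL : q ∷ ys ∷ʳ zf ↭ W ++ z ∷ a ∷ lp ++ L
        gL = ↭-reflexive eL
        vK : zf ∷ q ∷ ys ++ iK ↭ z ∷ a ∷ ((lp ++ L) ++ W) ++ iK
        vK = (lin {as = ([ zf ] ++ ([ q ] ++ (ys ++ iK)))} {bs = ([ z ] ++ ([ a ] ++ (((lp ++ L) ++ W) ++ iK)))} (gL) (prove ((# 0 ⊕ # 1 ⊕ # 2 ⊕ # 3) ⊕ # 4 ⊕ # 5 ⊕ # 6 ⊕ # 7 ⊕ # 8) ((# 5 ⊕ # 6 ⊕ ((# 7 ⊕ # 8) ⊕ # 4) ⊕ # 3) ⊕ # 1 ⊕ # 2 ⊕ # 0) ([ zf ] ∷ [ q ] ∷ ys ∷ iK ∷ W ∷ [ z ] ∷ [ a ] ∷ lp ∷ L ∷  [])))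
        UK' = Unique-↭ vK UK
        ne' : (lp ++ L) ++ W ≢ []
        ne' q₀ = ne (pa (trans elp (cong (a ∷_) (Lₚ.++-conicalˡ lp L (Lₚ.++-conicalˡ (lp ++ L) W q₀)))) , qz (trans eW (cong (_∷ʳ z) (Lₚ.++-conicalʳ (lp ++ L) W q₀))))
          where
          pa : X ∷ʳ p ≡ a ∷ [] → p ≡ a
          pa q₁ = proj₂ (∷ʳ-inj X [] q₁)
          qz : q ∷ Y ≡ z ∷ [] → q ≡ z
          qz refl = refl
        go : Out z a ((lp ++ L) ++ W) iK p q → Final (λ x y c → Two x y z a c) q zf ys iK p q
        go (out {kept} {unv} {ins} pk two ct _) with pockets-split pk (lp ++ L) (trans (snoc-++ (lp ++ L)) (cong ((lp ++ L) ++_) (sym eW))) (Unique-clash ct UK' (two-∈ʳ two))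
        ... | keepSplit {k₁} {k₂} {u₁} {u₂} Lf Rg refl g = final {kept = k₂ ++ a ∷ k₁ ∷ʳ q} {u₂ ++ u₁} {ins = ins}
              (subst (λ l → Pockets q l (k₂ ++ a ∷ k₁ ∷ʳ q) (u₂ ++ u₁)) eF (pockets-++ Rg lastq (pockets-++ (pockets-edge (root-adj K')) refl Lf))) two
              (prove (# 0 ⊕ (# 1 ⊕ # 2 ⊕ # 3) ⊕ # 4) ((# 3 ⊕ # 0 ⊕ # 1 ⊕ # 2) ⊕ # 4) ([ a ] ∷ k₁ ∷ [ q ] ∷ k₂ ∷ ins ∷  []))
              (lin {as = ([ zf ] ++ ([ q ] ++ (ys ++ iK)))} {bs = (([ a ] ++ ((k₁ ++ ([ q ] ++ k₂)) ++ ins)) ++ (u₂ ++ u₁))} (vK ⊹ ct ⊹ g) (prove ((# 0 ⊕ # 1 ⊕ # 2 ⊕ # 3) ⊕ (# 4 ⊕ # 5 ⊕ ((# 6 ⊕ # 7) ⊕ # 8) ⊕ # 3) ⊕ ((# 5 ⊕ (# 9 ⊕ # 1 ⊕ # 10) ⊕ # 11) ⊕ # 12) ⊕ # 13 ⊕ # 14) (((# 5 ⊕ (# 9 ⊕ # 1 ⊕ # 10) ⊕ # 11) ⊕ # 14 ⊕ # 13) ⊕ (# 0 ⊕ # 1 ⊕ # 2 ⊕ # 3) ⊕ (# 4 ⊕ # 5 ⊕ ((# 6 ⊕ # 7) ⊕ # 8) ⊕ # 3) ⊕ # 12) ([ zf ] ∷ [ q ] ∷ ys ∷ iK ∷ [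 z ] ∷ [ a ] ∷ lp ∷ L ∷ W ∷ k₁ ∷ k₂ ∷ ins ∷ unv ∷ u₁ ∷ u₂ ∷  [])))
          where
          lastq : last q Y ≡ z
          lastq = proj₂ (∷ʳ-inj (init q Y) W (trans (sym (init-last q Y)) eW))
          eF : Y ++ a ∷ (lp ++ L) ∷ʳ q ≡ ys ++ zf ∷ q ∷ []
          eF = trans (cong (λ l → Y ++ l) (trans (cong (_∷ʳ q) (cong (_++ L) (sym elp))) refl)) (trans (sym (Lₚ.++-assoc Y _ [ q ])) (trans (cong (_∷ʳ q) (trans (sym (Lₚ.++-assoc Y (X ∷ʳ p) L)) (trans (cong (_++ L) (sym (snoc-++ Y))) (sym eK)))) (snoc-++ ys)))

      task : Task N
      task = record { solve = S ; q₀ = q ; O' = O₁ ; m₀ = β ; ps₀ = [] ; x₀ = p ; y₀ = q ; Sol = λ x y c → Two x y z a c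
        ; sol-extʳ = two-glueʳ ; sol-extˡ = two-glueˡ ; sol-∈ˡ = two-∈ˡ ; sol-∈ʳ = two-∈ʳ ; absorb₁ = λ () ; absorb₂ = λ () ; finish = fin }

      open Run task
      open Loop task

      result : Res p β [] (q ∷ Y ++ X) [] (q ∷ Y ++ X) i p q
      result = run {ps = []} {q ∷ Y ++ X} {[]} D₀ refl (cong (q ∷_) (sym (Lₚ.++-identityʳ O₁))) refl (λ ()) U₀ (subst (_≤ N) (↭-length v₀) len) (inj₁ refl) (inj₁ refl) p≢q (∈-mid (q ∷ Y ++ X)) (here refl)

      from-none : None p β [] [] (q ∷ Y ++ X) i p q → Detour z a X p β q Y r i
      from-none (none {kP} {uP} {cP} {kQ} {uQ} {cS} {cR} pkP pathP pkQ two vis _ ct) with pockets-nil pkP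
      ... | refl , refl with path-self pathP (Unique-sub {ys = cS ++ uQ} (lin {as = (cP ++ (cS ++ uQ))} {bs = ([ p ] ++ ([ β ] ++ (([ q ] ++ (Y ++ X)) ++ i)))} ((↭-sym ct)) (prove ((# 0 ⊕ # 1 ⊕ # 2) ⊕ # 3 ⊕ # 4 ⊕ (# 5 ⊕ # 6 ⊕ # 7) ⊕ # 8) ((# 3 ⊕ # 4 ⊕ (# 5 ⊕ # 6 ⊕ # 7) ⊕ # 8) ⊕ # 0 ⊕ ε ⊕ # 1 ⊕ # 2) (cP ∷ cS ∷ uQ ∷ [ p ] ∷ [ β ] ∷ [ q ] ∷ Y ∷ X ∷ i ∷  []))) U₀)
      ... | gP = go (pockets-split pkQ Y (trans (Lₚ.++-identityʳ O₁) (trans (snoc-++ Y) (cong (Y ++_) elp))) (clash (two-endʳ two)))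
        where
        UQ : Unique (cS ++ uQ)
        UQ = Unique-sub {ys = [ β ]} (lin {as = ((cS ++ uQ) ++ [ β ])} {bs = ([ p ] ++ ([ β ] ++ (([ q ] ++ (Y ++ X)) ++ i)))} ((↭-sym ct) ⊹ (↭-sym gP)) (prove (((# 0 ⊕ # 1) ⊕ # 2) ⊕ (# 3 ⊕ # 2 ⊕ (# 4 ⊕ # 5 ⊕ # 6) ⊕ # 7) ⊕ # 8) ((# 3 ⊕ # 2 ⊕ (# 4 ⊕ # 5 ⊕ # 6) ⊕ # 7) ⊕ (# 8 ⊕ ε ⊕ # 0 ⊕ # 1) ⊕ # 2) (cS ∷ uQ ∷ [ β ] ∷ [ p ] ∷ [ q ] ∷ Y ∷ X ∷ i ∷ cP ∷  []))) U₀
        clash : ∀ {v} → v ∈ cS → v ∉ uQ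
        clash = Unique-clash {xs = cS} {ys = uQ} ↭-refl UQ
        -- The pocket at the root edge is trivial, since both its ends are visited.
        trim : ∀ {k u} → Pockets q (Y ∷ʳ a) k u → (∀ {v} → v ∈ u → v ∈ uQ) → ∃[ k' ] ∃[ u' ] Pockets q Y k' u' × ∃[ u'' ] Disk a z [] u'' × k ≡ k' ∷ʳ a × u ↭ u' ++ u''
        trim P sub with pockets-last-pocket P refl
        ... | lastPocket {l₁} {m} {iₗ} {k₁} {u₁} B E el ek g with unsnoc m
        ... | inj₁ refl = k₁ , u₁ , subst (λ l → Pockets q l k₁ u₁) l≡ B , iₗ , subst (λ v → Disk a v [] iₗ) (trans (cong (last q) l≡) lastq) E , ek , g
          where
          l≡ : l₁ ≡ Y
          l≡ = trans (sym (Lₚ.++-identityʳ l₁)) (sym el)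
          lastq : last q Y ≡ z
          lastq = proj₂ (∷ʳ-inj (init q Y) W (trans (sym (init-last q Y)) eW))
        ... | inj₂ (m' , z' , refl) with trans (sym (last-∷ʳ q (l₁ ++ m'))) (trans (cong (last q) (trans (Lₚ.++-assoc l₁ m' [ z' ]) (sym el))) (proj₂ (∷ʳ-inj (init q Y) W (trans (sym (init-last q Y)) eW))))
        ... | refl = ⊥-elim (clash (two-endˡ two) (sub (∈-resp-↭ (↭-sym g) (∈ₚ.∈-++⁺ʳ u₁ (∈ₚ.∈-++⁺ˡ (∈-mid m'))))))
        go : KeepSplit q Y a lp kQ uQ → Detour z a X p β q Y r i
        go (keepSplit {k₁} {k₂} {u₁} {u₂} Lf Rg ekQ g) with trim Lf (λ m → ∈-resp-↭ (↭-sym g) (∈ₚ.∈-++⁺ˡ m))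
        ... | k' , u' , P , u'' , E , ek , gu with ∈→↭ (two-endˡ two) | ∷ʳ-inj k₁ k' ek
        ... | cz , gz | refl , _ with ∈→↭ {xs = cz} (a∈ gz)
          where
          a∈ : cS ↭ z ∷ cz → a ∈ cz
          a∈ gz with ∈-resp-↭ gz (two-endʳ two)
          ... | here eq = ⊥-elim (z≢a (sym eq))
          ... | there m = m
        ... | cz' , gz' with no-digon E (Unique-sub {ys = cz' ++ u' ++ u₂} (lin {as = (([ a ] ++ ([ z ] ++ u'')) ++ (cz' ++ (u' ++ u₂)))} {bs = (cS ++ uQ)} ((↭-sym gz) ⊹ (↭-sym gz') ⊹ (↭-sym g) ⊹ (↭-sym gu)) (prove (((# 0 ⊕ # 1 ⊕ # 2) ⊕ # 3 ⊕ # 4 ⊕ # 5) ⊕ # 6 ⊕ # 7 ⊕ # 8 ⊕ # 9) ((# 6 ⊕ # 8) ⊕ (# 1 ⊕ # 7) ⊕ (# 0 ⊕ # 3) ⊕ (# 9 ⊕ # 5) ⊕ # 4 ⊕ # 2) ([ a ] ∷ [ z ] ∷ u'' ∷ cz' ∷ u' ∷ u₂ ∷ cS ∷ cz ∷ uQ ∷ u₁ ∷  []))) UQ)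
        ... | refl = detour {lp = lp} {kL = k₂} {u₂} {k'} {u'} {cS} {cR} elp Rg P two
               (lin {as = cS} {bs = (([ a ] ++ k₂) ++ (([ q ] ++ k') ++ cR))} (vis ⊹ gk) (prove (# 0 ⊕ ((# 1 ⊕ # 2) ⊕ # 3) ⊕ # 4 ⊕ # 5 ⊕ # 6) (((# 5 ⊕ # 6) ⊕ (# 1 ⊕ # 4) ⊕ # 3) ⊕ # 0 ⊕ # 2) (cS ∷ [ q ] ∷ kQ ∷ cR ∷ k' ∷ [ a ] ∷ k₂ ∷  [])))
               (lin {as = ([ z ] ++ ([ a ] ++ (r ++ i)))} {bs = ([ β ] ++ (cS ++ (u₂ ++ u')))} (v₀ ⊹ ct ⊹ gP ⊹ g ⊹ gu) (prove ((# 0 ⊕ # 1 ⊕ # 2 ⊕ # 3) ⊕ (# 4 ⊕ # 5 ⊕ (# 6 ⊕ # 7 ⊕ # 8) ⊕ # 3) ⊕ (# 9 ⊕ ε ⊕ # 10 ⊕ # 11) ⊕ # 5 ⊕ (# 12 ⊕ # 13) ⊕ # 14 ⊕ ε) ((# 5 ⊕ # 10 ⊕ # 13 ⊕ # 14) ⊕ (# 0 ⊕ # 1 ⊕ # 2 ⊕ # 3) ⊕ (# 4 ⊕ # 5 ⊕ (# 6 ⊕ # 7 ⊕ # 8) ⊕ # 3) ⊕ # 9 ⊕ # 11 ⊕ # 12) ([ z ] ∷ [ a ] ∷ r ∷ i ∷ [ p ] ∷ [ β ] ∷ [ q ] ∷ Y ∷ X ∷ cP ∷ cS ∷ uQ ∷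 u₁ ∷ u₂ ∷ u' ∷  [])))
          where
          gk : kQ ↭ k' ++ a ∷ k₂
          gk = ↭-reflexive ekQ

      from : DetourIH (length (z ∷ a ∷ r ++ i)) → Res p β [] (q ∷ Y ++ X) [] (q ∷ Y ++ X) i p q → Detour z a X p β q Y r i
      from IH (r-none R) = from-none R
      from IH (r-corner (corner {ps₁} {ps₂} {Qv} {Qu} {B} {iZ} {kP} {uP} {cP} {kQ} {uQ} {cS} {cR} {cB} psE pkP pathP QE pkQ sol vis _ kind visB Z ct)) =
        ⊥-elim (Unique-clash {xs = cS} {ys = (Qu ∷ʳ p) ++ cP ++ uP ++ uQ ++ init β ps₁ ++ iZ} (lin {as = ([ p ] ++ ([ β ] ++ (([ q ] ++ (Y ++ X)) ++ i)))} {bs = (cS ++ ((Qu ++ [ p ]) ++ (cP ++ (uP ++ (uQ ++ ((init β ps₁) ++ iZ))))))} (ct) (prove ((# 0 ⊕ # 1 ⊕ (# 2 ⊕ # 3 ⊕ # 4) ⊕ # 5) ⊕ # 6 ⊕ # 7 ⊕ # 8 ⊕ # 9 ⊕ # 10 ⊕ (# 11 ⊕ # 0) ⊕ # 12) ((# 8 ⊕ (# 11 ⊕ # 0) ⊕ # 6 ⊕ # 7 ⊕ # 9 ⊕ # 10 ⊕ # 12) ⊕ # 0 ⊕ # 1 ⊕ (# 2 ⊕ # 3 ⊕ # 4) ⊕ # 5) ([ p ] ∷ [ β ] ∷ [ q ] ∷ Y ∷ X ∷ i ∷ cP ∷ uP ∷ cS ∷ uQ ∷ init β ps₁ ∷ Qu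 ∷ iZ ∷  []))) U₀
          (two-∈ˡ sol) (∈ₚ.∈-++⁺ˡ (∈-mid Qu)))
      from IH (r-chord C) = detour-chord IH len U e C
      from IH (r-both (at-end _ _ _ _ _ _ _ n _)) = ⊥-elim (n p∈O)
      from IH (r-both (at-mid _ _ _ _ _ _ _ _ n _)) = ⊥-elim (n p∈O)
      from IH (r-cut C) = ⊥-elim (Cut.x∉O C p∈O)

    make-detour′ : ∀ M → M ≤ N → DetourIH (suc M)
    make-detour′ zero le D e (s≤s ()) U
    make-detour′ (suc M) le {z} {a} {X} {p} {β} {q} {Y} {r} {i} D e lt U = go (p ≟ a) (q ≟ z)
      where
      IH : DetourIH (length (z ∷ a ∷ r ++ i))
      IH D' e' lt' U' = make-detour′ M (ℕₚ.≤-trans (ℕₚ.n≤1+n M) le) D' e' (ℕₚ.≤-trans lt' (ℕₚ.≤-pred lt)) U'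
      main : ¬ (p ≡ a × q ≡ z) → Detour z a X p β q Y r i
      main n = from IH result
        where open DetourRun D e (ℕₚ.≤-trans (ℕₚ.≤-pred lt) le) U n
      -- The whole disk is the triangle `a`, `β`, `z`, which is empty, and both paths are trivial.
      base : ∀ X Y {r} → a ∷ r ∷ʳ z ≡ X ++ a ∷ β ∷ z ∷ Y → Disk z a r i → Unique (z ∷ a ∷ r ++ i) → Detour z a X a β z Y r i
      base (x ∷ X) Y {r} e D U with Lₚ.∷-injective e
      ... | refl , e' = ⊥-elim (Unique-clash {xs = [ a ]} {ys = (r ∷ʳ z) ++ i} (prove (# 0 ⊕ # 1 ⊕ # 2 ⊕ # 3) (# 1 ⊕ (# 2 ⊕ # 0) ⊕ # 3) ([ z ] ∷ [ a ] ∷ r ∷ i ∷  [])) U (here refl) (∈ₚ.∈-++⁺ˡ (subst (a ∈_) (sym e') (∈-mid X))))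
      base [] Y {r} e D U with unsnoc Y
      ... | inj₂ (Y' , w , refl) with ∷ʳ-inj r (β ∷ z ∷ Y') (Lₚ.∷-injectiveʳ e)
      ... | refl , refl = ⊥-elim (Unique-clash {xs = [ z ]} ↭-refl U (here refl) (there (there (here refl))))
      base [] Y {r} e D U | inj₁ refl with ∷ʳ-inj r [ β ] (Lₚ.∷-injectiveʳ e)
      ... | refl , _ with no-triangle D U
      ... | refl = detour {lp = []} {vis = a ∷ z ∷ []} {ins = []} refl nil nil ([ a ] , [ z ] , ↭-refl , inj₂ (path-here , path-here)) ↭-refl (prove (# 0 ⊕ # 1 ⊕ # 2 ⊕ ε) (# 2 ⊕ (# 1 ⊕ # 0 ⊕ ε) ⊕ ε ⊕ ε) ([ z ] ∷ [ a ] ∷ [ β ] ∷  []))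
      go : Dec (p ≡ a) → Dec (q ≡ z) → Detour z a X p β q Y r i
      go (yes refl) (yes refl) = base X Y e D U
      go (no n) _ = main (λ { (pe , _) → n pe })
      go (yes _) (no n) = main (λ { (_ , qe) → n qe })

    make-detour : ∀ {z a X p β q Y r i} → Disk z a r i → a ∷ r ∷ʳ z ≡ X ++ p ∷ β ∷ q ∷ Y → length (z ∷ a ∷ r ++ i) ≤ N →
      Unique (z ∷ a ∷ r ++ i) → Detour z a X p β q Y r i
    make-detour D e le = make-detour′ N ℕₚ.≤-refl D e (s≤s le)

    -- A detour around `α` with the root `p β`, where `p` ends the arc. The neighbours of `α` are
    -- `β` and `a`; the path from `β` is trivial, so the other one goes from `a` to `p` and avoids
    -- both attachments `α` and `β`.
    absorb-edge : ∀ {α a b ps β i} → Disk α a (b ∷ ps ∷ʳ β) i → length (α ∷ a ∷ (b ∷ ps ∷ʳ β) ++ i) ≤ N →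
      Unique (α ∷ a ∷ (b ∷ ps ∷ʳ β) ++ i) → Sweep a (b ∷ ps) i
    absorb-edge {α} {a} {b} {ps} {β} {i} D len U = go (init b ps) (last b ps) (init-last b ps)
      where
      go : ∀ m p → b ∷ ps ≡ m ∷ʳ p → Sweep a (b ∷ ps) i
      go m p e = fin (make-detour {X = []} E refl (subst (_≤ N) (↭-length v) len) U')
        where
        E : Disk p β (α ∷ a ∷ m) i
        E = rotate∘ (α ∷ a ∷ m) (p ∷ [ β ]) (subst (λ l → Disk α a l i) (trans (cong (_∷ʳ β) e) (Lₚ.++-assoc m _ _)) D)
        ge : b ∷ ps ↭ m ∷ʳ p
        ge = ↭-reflexive e
        v : α ∷ a ∷ (b ∷ ps ∷ʳ β) ++ i ↭ p ∷ β ∷ (α ∷ a ∷ m) ++ i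
        v = (lin {as = ([ α ] ++ ([ a ] ++ (([ b ] ++ (ps ++ [ β ])) ++ i)))} {bs = ([ p ] ++ ([ β ] ++ (([ α ] ++ ([ a ] ++ m)) ++ i)))} (ge) (prove ((# 0 ⊕ # 1 ⊕ (# 2 ⊕ # 3 ⊕ # 4) ⊕ # 5) ⊕ # 6 ⊕ # 7) ((# 7 ⊕ # 4 ⊕ (# 0 ⊕ # 1 ⊕ # 6) ⊕ # 5) ⊕ # 2 ⊕ # 3) ([ α ] ∷ [ a ] ∷ [ b ] ∷ ps ∷ [ β ] ∷ i ∷ m ∷ [ p ] ∷  [])))
        U' = Unique-↭ v U
        fin : Detour p β [] β α a (m ∷ʳ p) (α ∷ a ∷ m) i → Sweep a (b ∷ ps) i
        fin (detour {lp} {kL} {uL} {kR} {uR} {c} {ins} refl left right two keeps ct) with pockets-nil left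
        ... | refl , refl with two-fix two (Unique-sub {ys = α ∷ uR} (lin {as = (c ++ ([ α ] ++ uR))} {bs = ([ p ] ++ ([ β ] ++ (([ α ] ++ ([ a ] ++ m)) ++ i)))} ((↭-sym ct)) (prove ((# 0 ⊕ # 1 ⊕ # 2) ⊕ # 3 ⊕ # 4 ⊕ (# 1 ⊕ # 5 ⊕ # 6) ⊕ # 7) ((# 3 ⊕ # 4 ⊕ (# 1 ⊕ # 5 ⊕ # 6) ⊕ # 7) ⊕ # 1 ⊕ # 0 ⊕ ε ⊕ # 2) (c ∷ [ α ] ∷ uR ∷ [ p ] ∷ [ β ] ∷ [ a ] ∷ m ∷ i ∷  []))) U')
        ... | f , P , gf = sweep (subst (λ l → Pockets a l kR uR) (sym e) right) (subst (λ v → Path a v f) (sym (trans (cong (last a) e) (last-∷ʳ a m))) P)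
               (lin {as = f} {bs = (([ a ] ++ kR) ++ ins)} ((↭-sym gf) ⊹ keeps) (prove (# 0 ⊕ # 1 ⊕ # 2 ⊕ (# 3 ⊕ # 4) ⊕ # 5) (((# 3 ⊕ # 4) ⊕ # 5) ⊕ (# 2 ⊕ # 0) ⊕ # 1) (f ∷ c ∷ [ β ] ∷ [ a ] ∷ kR ∷ ins ∷  [])))
               (lin {as = ([ a ] ++ ([ b ] ++ (ps ++ i)))} {bs = (f ++ uR)} (ge ⊹ ct ⊹ gf) (prove ((# 0 ⊕ # 1 ⊕ # 2 ⊕ # 3) ⊕ (# 4 ⊕ # 5) ⊕ (# 6 ⊕ # 7 ⊕ ε ⊕ # 8) ⊕ # 9 ⊕ # 10) ((# 10 ⊕ # 8) ⊕ (# 1 ⊕ # 2) ⊕ (# 5 ⊕ # 9 ⊕ (# 6 ⊕ # 0 ⊕ # 4) ⊕ # 3) ⊕ # 7) ([ a ] ∷ [ b ] ∷ ps ∷ i ∷ m ∷ [ p ] ∷ [ α ] ∷ c ∷ uR ∷ [ β ] ∷ f ∷  [])))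

  -- Disks with a chord

  boundary-adj : Disk z a r i → ∀ X {s t Y} → a ∷ r ∷ʳ z ≡ X ++ s ∷ t ∷ Y → Adj s t
  boundary-adj D X e = root-adj (rerooted X e D)

  -- Inserting a disk at an edge of the arc enlarges the pocket at that edge.
  merge-list : ∀ {a l₁ y l₂ l' X X' s t Y' mid m'} → X ≡ init a l₁ ++ X' → a ∷ l' ≡ X ++ s ∷ mid ++ t ∷ Y' ++ l₂ →
    last a l₁ ∷ m' ∷ʳ y ≡ X' ++ s ∷ mid ++ t ∷ Y' → l' ≡ l₁ ++ m' ++ y ∷ l₂
  merge-list {a} {l₁} {y} {l₂} {l'} {_} {X'} {s} {t} {Y'} {mid} {m'} refl e e' = Lₚ.∷-injectiveʳ (trans e (trans (Lₚ.++-assoc (init a l₁) X' _)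
    (trans (cong (init a l₁ ++_) (trans (cong (λ l → X' ++ s ∷ l) (sym (Lₚ.++-assoc mid (t ∷ Y') l₂))) (trans (sym (Lₚ.++-assoc X' _ l₂)) (cong (_++ l₂) (sym e')))))
    (trans (sym (Lₚ.++-assoc (init a l₁) [ last a l₁ ] _)) (trans (cong (_++ ((m' ∷ʳ y) ++ l₂)) (sym (init-last a l₁))) (cong (λ l → a ∷ l₁ ++ l) (Lₚ.++-assoc m' _ _)))))))

  -- If the paths visited only two vertices, the pairs `x`, `y` and `z`, `a` would coincide. The
  -- third vertex lies outside a pocket with ends `b` and `w` and makes that pocket small enough for
  -- the induction.
  third : Two x y z a cs → Unique cs → x ≢ y → z ≢ a → ¬ SameEnds x y z a → cs ↭ b ∷ w ∷ ys → ∃[ v ] ∃[ vs ] ys ↭ v ∷ vs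
  third {ys = v ∷ vs} T U n m ne g = v , vs , ↭-refl
  third {x} {y} {z} {a} {b = b} {w = w} {ys = []} T U n m ne g = ⊥-elim (ne (go (∈-resp-↭ g (two-∈ˡ T)) (∈-resp-↭ g (two-∈ʳ T)) (∈-resp-↭ g (two-endˡ T)) (∈-resp-↭ g (two-endʳ T))))
    where
    go : x ∈ b ∷ w ∷ [] → y ∈ b ∷ w ∷ [] → z ∈ b ∷ w ∷ [] → a ∈ b ∷ w ∷ [] → SameEnds x y z a
    go (here refl) (here refl) _ _ = ⊥-elim (n refl)
    go (there (here refl)) (there (here refl)) _ _ = ⊥-elim (n refl)
    go _ _ (here refl) (here refl) = ⊥-elim (m refl)
    go _ _ (there (here refl)) (there (here refl)) = ⊥-elim (m refl)
    go (here refl) (there (here refl)) (here refl) (there (here refl)) = inj₁ (refl , refl)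
    go (here refl) (there (here refl)) (there (here refl)) (here refl) = inj₂ (refl , refl)
    go (there (here refl)) (here refl) (here refl) (there (here refl)) = inj₂ (refl , refl)
    go (there (here refl)) (here refl) (there (here refl)) (here refl) = inj₁ (refl , refl)

  -- The inner paths arrive at `s` and `t`, from which the outer paths start, so either inner
  -- pairing can be continued.
  two-two : ∀ {s t} → Two s t z a d → Two x y t s e → d ++ e ↭ s ∷ t ∷ f → Two x y z a f
  two-two {d = d} {e = e} {f = f} {s} {t} T (c₁ , c₂ , g , inj₁ (P , Q)) h with ∈→↭ (two-∈ˡ T)
  ... | d' , gd = two-swap (two-glueʳ (two-glueˡ T (path-rev Q) (lin {as = (d ++ c₂)} {bs = ([ s ] ++ (d' ++ c₂))} (gd) (prove ((# 0 ⊕ # 1) ⊕ # 2 ⊕ # 3) ((# 2 ⊕ # 3 ⊕ # 1) ⊕ # 0) (d ∷ c₂ ∷ [ s ] ∷ d' ∷  [])))) (path-rev P)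
        (lin {as = ((d' ++ c₂) ++ c₁)} {bs = ([ t ] ++ f)} ((↭-sym gd) ⊹ (↭-sym g) ⊹ h) (prove (((# 0 ⊕ # 1) ⊕ # 2) ⊕ # 3 ⊕ # 4 ⊕ # 5 ⊕ # 6 ⊕ # 7) ((# 6 ⊕ # 7) ⊕ (# 5 ⊕ # 0) ⊕ (# 2 ⊕ # 1) ⊕ # 3 ⊕ # 4) (d' ∷ c₂ ∷ c₁ ∷ d ∷ e ∷ [ s ] ∷ [ t ] ∷ f ∷  []))))
  two-two {d = d} {e = e} {f = f} {s} {t} T (c₁ , c₂ , g , inj₂ (P , Q)) h with ∈→↭ (two-∈ˡ T)
  ... | d' , gd = two-glueʳ (two-glueˡ T (path-rev P) (lin {as = (d ++ c₁)} {bs = ([ s ] ++ (d' ++ c₁))} (gd) (prove ((# 0 ⊕ # 1) ⊕ # 2 ⊕ # 3) ((# 2 ⊕ # 3 ⊕ # 1) ⊕ # 0) (d ∷ c₁ ∷ [ s ] ∷ d' ∷  [])))) (path-rev Q)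
        (lin {as = ((d' ++ c₁) ++ c₂)} {bs = ([ t ] ++ f)} ((↭-sym gd) ⊹ (↭-sym g) ⊹ h) (prove (((# 0 ⊕ # 1) ⊕ # 2) ⊕ # 3 ⊕ # 4 ⊕ # 5 ⊕ # 6 ⊕ # 7) ((# 6 ⊕ # 7) ⊕ (# 5 ⊕ # 0) ⊕ (# 1 ⊕ # 2) ⊕ # 3 ⊕ # 4) (d' ∷ c₁ ∷ c₂ ∷ d ∷ e ∷ [ s ] ∷ [ t ] ∷ f ∷  [])))

  out-swap : Out z a r i x y → Out z a r i y x
  out-swap (out pk two ct l) = out pk (two-swap two) ct l

  module ChordCase {N : ℕ} (S : Solver N) {z a s t : V} {r i X Y mid rA iA iB : Ls} (len : length (z ∷ a ∷ r ++ i) ≤ N) (U : Unique (z ∷ a ∷ r ++ i))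
    (DA : Disk z a rA iA) (DB : Disk t s mid iB) (arc : a ∷ r ∷ʳ z ≡ X ++ s ∷ mid ++ t ∷ Y) (short : a ∷ rA ∷ʳ z ≡ X ++ s ∷ t ∷ Y)
    (mid≢[] : mid ≢ []) (gi : i ↭ iA ++ iB) (proper : rA ≢ [] ⊎ iA ≢ []) where

    garc : a ∷ r ∷ʳ z ↭ X ++ s ∷ mid ++ t ∷ Y
    garc = ↭-reflexive arc
    gshort : a ∷ rA ∷ʳ z ↭ X ++ s ∷ t ∷ Y
    gshort = ↭-reflexive short
    vA : z ∷ a ∷ r ++ i ↭ (z ∷ a ∷ rA ++ iA) ++ mid ++ iB
    vA = (lin {as = ([ z ] ++ ([ a ] ++ (r ++ i)))} {bs = (([ z ] ++ ([ a ] ++ (rA ++ iA))) ++ (mid ++ iB))} (garc ⊹ (↭-sym gshort) ⊹ gi) (prove ((# 0 ⊕ # 1 ⊕ # 2 ⊕ # 3) ⊕ (# 4 ⊕ # 5 ⊕ # 6 ⊕ # 7 ⊕ # 8) ⊕ (# 1 ⊕ # 9 ⊕ # 0) ⊕ # 10 ⊕ # 11) (((# 0 ⊕ # 1 ⊕ # 9 ⊕ # 10) ⊕ # 6 ⊕ # 11) ⊕ (# 1 ⊕ # 2 ⊕ # 0) ⊕ (# 4 ⊕ # 5 ⊕ # 7 ⊕ # 8) ⊕ # 3) ([ z ] ∷ [ a ] ∷ r ∷ i ∷ X ∷ [ s ] ∷ mid ∷ [ t ] ∷ Y ∷ rA ∷ iA ∷ iB ∷  [])))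
    UA : Unique (z ∷ a ∷ rA ++ iA)
    UA = Unique-sub {ys = mid ++ iB} (↭-sym vA) U
    z≢a : z ≢ a
    z≢a = Unique-≢ ↭-refl U
    rA≢[] : rA ≢ []
    rA≢[] = go proper DA UA
      where
      go : ∀ {rA} → rA ≢ [] ⊎ iA ≢ [] → Disk z a rA iA → Unique (z ∷ a ∷ rA ++ iA) → rA ≢ []
      go (inj₁ n) _ _ = n
      go (inj₂ n) D U refl = n (no-digon D U)
    lenA : length (z ∷ a ∷ rA ++ iA) < N
    lenA = go mid mid≢[] vA
      where
      go : ∀ mid → mid ≢ [] → z ∷ a ∷ r ++ i ↭ (z ∷ a ∷ rA ++ iA) ++ mid ++ iB → length (z ∷ a ∷ rA ++ iA) < N
      go [] n _ = ⊥-elim (n refl)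
      go (m ∷ ms) n g = ℕₚ.<-≤-trans (length-↭-< {xs = z ∷ a ∷ rA ++ iA} {ys = ms ++ iB} (lin {as = ([ z ] ++ ([ a ] ++ (r ++ i)))} {bs = ([ m ] ++ (([ z ] ++ ([ a ] ++ (rA ++ iA))) ++ (ms ++ iB)))} (g) (prove ((# 0 ⊕ # 1 ⊕ # 2 ⊕ # 3) ⊕ (# 0 ⊕ # 1 ⊕ # 4 ⊕ # 5) ⊕ (# 6 ⊕ # 7) ⊕ # 8) ((# 6 ⊕ (# 0 ⊕ # 1 ⊕ # 4 ⊕ # 5) ⊕ # 7 ⊕ # 8) ⊕ # 0 ⊕ # 1 ⊕ # 2 ⊕ # 3) ([ z ] ∷ [ a ] ∷ r ∷ i ∷ rA ∷ iA ∷ [ m ] ∷ ms ∷ iB ∷  [])))) len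
    s≢t : s ≢ t
    s≢t = Unique-≢ {xs = X ++ Y ++ iA} (lin {as = ([ z ] ++ ([ a ] ++ (rA ++ iA)))} {bs = ([ s ] ++ ([ t ] ++ (X ++ (Y ++ iA))))} (gshort) (prove ((# 0 ⊕ # 1 ⊕ # 2 ⊕ # 3) ⊕ # 4 ⊕ # 5 ⊕ # 6 ⊕ # 7) ((# 5 ⊕ # 6 ⊕ # 4 ⊕ # 7 ⊕ # 3) ⊕ # 1 ⊕ # 2 ⊕ # 0) ([ z ] ∷ [ a ] ∷ rA ∷ iA ∷ X ∷ [ s ] ∷ [ t ] ∷ Y ∷  []))) UA
    s∈A : s ∈ z ∷ a ∷ rA ++ iA
    s∈A = ∈-resp-↭ (lin {as = ([ s ] ++ ([ t ] ++ (X ++ (Y ++ iA))))} {bs = ([ z ] ++ ([ a ] ++ (rA ++ iA)))} ((↭-sym gshort)) (prove ((# 0 ⊕ # 1 ⊕ # 2 ⊕ # 3 ⊕ # 4) ⊕ # 5 ⊕ # 6 ⊕ # 7) ((# 7 ⊕ # 5 ⊕ # 6 ⊕ # 4) ⊕ # 2 ⊕ # 0 ⊕ # 1 ⊕ # 3) ([ s ] ∷ [ t ] ∷ X ∷ Y ∷ iA ∷ [ a ] ∷ rA ∷ [ z ] ∷  []))) (here refl)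
    t∈A : t ∈ z ∷ a ∷ rA ++ iA
    t∈A = ∈-resp-↭ (lin {as = ([ s ] ++ ([ t ] ++ (X ++ (Y ++ iA))))} {bs = ([ z ] ++ ([ a ] ++ (rA ++ iA)))} ((↭-sym gshort)) (prove ((# 0 ⊕ # 1 ⊕ # 2 ⊕ # 3 ⊕ # 4) ⊕ # 5 ⊕ # 6 ⊕ # 7) ((# 7 ⊕ # 5 ⊕ # 6 ⊕ # 4) ⊕ # 2 ⊕ # 0 ⊕ # 1 ⊕ # 3) ([ s ] ∷ [ t ] ∷ X ∷ Y ∷ iA ∷ [ a ] ∷ rA ∷ [ z ] ∷  []))) (there (here refl))
    st≢ : ¬ (s ≡ a × t ≡ z)
    st≢ (refl , refl) = go X Y short
      where
      go : ∀ X Y → a ∷ rA ∷ʳ z ≡ X ++ a ∷ z ∷ Y → ⊥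
      go (x ∷ X) Y e with Lₚ.∷-injective e
      ... | refl , e' = Unique-clash {xs = [ a ]} {ys = (rA ∷ʳ z) ++ iA} (prove (# 0 ⊕ # 1 ⊕ # 2 ⊕ # 3) (# 1 ⊕ (# 2 ⊕ # 0) ⊕ # 3) ([ z ] ∷ [ a ] ∷ rA ∷ iA ∷  [])) UA (here refl) (∈ₚ.∈-++⁺ˡ (subst (a ∈_) (sym e') (∈-mid X)))
      go [] Y e with unsnoc Y
      ... | inj₁ refl = rA≢[] (proj₁ (∷ʳ-inj rA [] (Lₚ.∷-injectiveʳ e)))
      ... | inj₂ (Y' , _ , refl) with ∷ʳ-inj rA (z ∷ Y') (Lₚ.∷-injectiveʳ e)
      ... | er , _ = Unique-clash {xs = [ z ]} ↭-refl UA (here refl) (there (∈ₚ.∈-++⁺ˡ (subst (z ∈_) (sym er) (here refl))))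
    t≢a : t ≢ a
    t≢a refl = go X short
      where
      go : ∀ X → a ∷ rA ∷ʳ z ≡ X ++ s ∷ a ∷ Y → ⊥
      go [] e with Lₚ.∷-injective e
      ... | refl , _ = s≢t refl
      go (x ∷ X) e with Lₚ.∷-injective e
      ... | refl , e' = Unique-clash {xs = [ a ]} {ys = (rA ∷ʳ z) ++ iA} (prove (# 0 ⊕ # 1 ⊕ # 2 ⊕ # 3) (# 1 ⊕ (# 2 ⊕ # 0) ⊕ # 3) ([ z ] ∷ [ a ] ∷ rA ∷ iA ∷  [])) UA (here refl) (∈ₚ.∈-++⁺ˡ (subst (a ∈_) (sym e') (∈ₚ.∈-++⁺ʳ X (there (here refl)))))
    st-ends : ¬ SameEnds s t z a
    st-ends (inj₁ (_ , e)) = t≢a e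
    st-ends (inj₂ (e , e')) = st≢ (e , e')

    -- The pocket of DA at the chord, with DB glued to it.
    record Glued (kept unv : Ls) : Set where
      constructor glued
      field
        {yₚ} : V
        {l₁ mₚ iₚ l₂ k₁ k₂ u₁ u₂ m'} : Ls
        before : Pockets a l₁ k₁ u₁
        disk   : Disk yₚ (last a l₁) m' (iₚ ++ iB)
        after  : Pockets yₚ l₂ k₂ u₂
        st     : (s ∈ last a l₁ ∷ mₚ ∷ʳ yₚ) × (t ∈ last a l₁ ∷ mₚ ∷ʳ yₚ)
        alone  : s ∉ mₚ → t ∉ mₚ → mₚ ≡ [] × last a l₁ ≡ s × yₚ ≡ t × m' ≡ mid
        list   : r ∷ʳ z ≡ l₁ ++ m' ++ yₚ ∷ l₂
        kept≡  : kept ≡ k₁ ++ yₚ ∷ k₂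
        unvis  : unv ↭ u₁ ++ (mₚ ++ iₚ) ++ u₂
        small  : Disk yₚ (last a l₁) mₚ iₚ
        sizes  : m' ↭ mₚ ++ mid

    glue : ∀ {kept unv} → Pockets a (rA ∷ʳ z) kept unv → Glued kept unv
    glue pk with pockets-at pk X short
    ... | pocketAt {yₚ} {l₁} {m} {iₘ} {l₂} {k₁} {k₂} {u₁} {u₂} {X'} {Y'} B D A el ins eX refl ek g with reframe X' [] ins mid
    ... | m' , em' = glued {m' = m'} B (pasteAt D X' ins DB em') A (subst (s ∈_) (sym ins) (∈-mid X') , subst (t ∈_) (sym ins) (∈ₚ.∈-++⁺ʳ X' (there (here refl))))
            (al X' Y' ins em') (merge-list {l₁ = l₁} {X' = X'} {mid = mid} eX arc em') ek g D
            (lin {as = m'} {bs = (m ++ mid)} ((↭-sym gins) ⊹ gem) (prove (# 0 ⊕ (# 1 ⊕ # 2 ⊕ # 3) ⊕ # 4 ⊕ # 5 ⊕ # 6 ⊕ # 7 ⊕ # 8) ((# 2 ⊕ # 6) ⊕ (# 4 ⊕ # 5 ⊕ # 7 ⊕ # 8) ⊕ # 1 ⊕ # 0 ⊕ # 3) (m' ∷ [ last a l₁ ] ∷ m ∷ [ yₚ ] ∷ X' ∷ [ s ] ∷ mid ∷ [ t ] ∷ Y' ∷  [])))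
      where
      gins : last a l₁ ∷ m ∷ʳ yₚ ↭ X' ++ s ∷ t ∷ Y'
      gins = ↭-reflexive ins
      gem : last a l₁ ∷ m' ∷ʳ yₚ ↭ X' ++ s ∷ mid ++ t ∷ Y'
      gem = ↭-reflexive em'
      al : ∀ X' Y' → last a l₁ ∷ m ∷ʳ yₚ ≡ X' ++ s ∷ t ∷ Y' → last a l₁ ∷ m' ∷ʳ yₚ ≡ X' ++ s ∷ mid ++ t ∷ Y' → s ∉ m → t ∉ m → m ≡ [] × last a l₁ ≡ s × yₚ ≡ t × m' ≡ mid
      al (v ∷ X') Y' e _ ns _ with Lₚ.∷-injectiveʳ e | unsnoc (t ∷ Y')
      ... | e' | inj₁ ()
      ... | e' | inj₂ (Y'' , w , eY) with ∷ʳ-inj m (X' ++ s ∷ Y'') (trans e' (trans (cong (λ l → X' ++ s ∷ l) eY) (sym (snoc-++ X'))))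
      ... | refl , _ = ⊥-elim (ns (∈-mid X'))
      al [] Y' e e'' _ nt with Lₚ.∷-injective e | unsnoc Y'
      ... | refl , e' | inj₁ refl with ∷ʳ-inj m [] e'
      ... | refl , refl = refl , refl , refl , proj₁ (∷ʳ-inj m' mid (Lₚ.∷-injectiveʳ e''))
      al [] Y' e e'' _ nt | refl , e' | inj₂ (Y'' , w , refl) with ∷ʳ-inj m (t ∷ Y'') e'
      ... | refl , _ = ⊥-elim (nt (here refl))

    neither : x ∈ z ∷ a ∷ rA ++ iA → y ∈ z ∷ a ∷ rA ++ iA → x ≢ y → ¬ SameEnds x y z a → Out z a r i x y
    neither mx my n ne with S DA rA≢[] lenA UA mx my n ne
    ... | out {kept} {unv} {ins} pk two ct long with glue pk
    ... | glued {yₚ} {l₁} {m} {iₚ} {l₂} {k₁} {k₂} {u₁} {u₂} {m'} B W A _ _ el refl g _ gm = out {kept = k₁ ++ yₚ ∷ k₂} {u₁ ++ m' ++ (iₚ ++ iB) ++ u₂} {ins}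
          (subst (λ l → Pockets a l (k₁ ++ yₚ ∷ k₂) (u₁ ++ m' ++ (iₚ ++ iB) ++ u₂)) (sym el) (pockets-++ B refl (cons W A refl ↭-refl))) two
          (lin {as = ([ z ] ++ ([ a ] ++ (r ++ i)))} {bs = (([ a ] ++ ((k₁ ++ ([ yₚ ] ++ k₂)) ++ ins)) ++ (u₁ ++ (m' ++ ((iₚ ++ iB) ++ u₂))))} (vA ⊹ ct ⊹ g ⊹ (↭-sym gm)) (prove ((# 0 ⊕ # 1 ⊕ # 2 ⊕ # 3) ⊕ ((# 0 ⊕ # 1 ⊕ # 4 ⊕ # 5) ⊕ # 6 ⊕ # 7) ⊕ ((# 1 ⊕ (# 8 ⊕ # 9 ⊕ # 10) ⊕ # 11) ⊕ # 12) ⊕ (# 13 ⊕ (# 14 ⊕ # 15) ⊕ # 16) ⊕ # 17) (((# 1 ⊕ (# 8 ⊕ # 9 ⊕ # 10) ⊕ # 11) ⊕ # 13 ⊕ # 17 ⊕ (# 15 ⊕ # 7) ⊕ # 16) ⊕ (# 0 ⊕ # 1 ⊕ # 2 ⊕ # 3) ⊕ (# 0 ⊕ # 1 ⊕ # 4 ⊕ # 5) ⊕ # 12 ⊕ # 14 ⊕ # 6) ([ z ] ∷ [ a ] ∷ r ∷ i ∷ rA ∷ iA ∷ mid ∷ iB ∷ k₁ ∷ [ yₚ ] ∷ k₂ ∷ ins ∷ unv ∷ u₁ ∷ m ∷ iₚ ∷ u₂ ∷ m' ∷  []))) long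

    -- Only y lies behind the chord: the path in DA ends at an end y' of the chord and is continued to y.
    one : x ∈ z ∷ a ∷ rA ++ iA → y ∈ mid ++ iB → ∀ y' → y' ≡ s ⊎ y' ≡ t → x ≢ y' → ¬ SameEnds x y' z a → Out z a r i x y
    one {x} {y} mx my y' st n ne with S DA rA≢[] lenA UA mx (y'∈A st) n ne
      where
      y'∈A : y' ≡ s ⊎ y' ≡ t → y' ∈ z ∷ a ∷ rA ++ iA
      y'∈A (inj₁ refl) = s∈A
      y'∈A (inj₂ refl) = t∈A
    ... | out {kept} {unv} {ins} pk two ct long with glue pk
    ... | glued {yₚ} {l₁} {m} {iₚ} {l₂} {k₁} {k₂} {u₁} {u₂} {m'} B W A sts _ el refl g _ gm = pick st
      where
      h = last a l₁
      c : Ls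
      c = a ∷ (k₁ ++ yₚ ∷ k₂) ++ ins
      gk : a ∷ k₁ ↭ init a k₁ ∷ʳ h
      gk = ↭-reflexive (trans (init-last a k₁) (cong (init a k₁ ∷ʳ_) (pockets-last B)))
      gc : c ↭ h ∷ yₚ ∷ init a k₁ ++ k₂ ++ ins
      gc = (lin {as = ([ a ] ++ ((k₁ ++ ([ yₚ ] ++ k₂)) ++ ins))} {bs = ([ h ] ++ ([ yₚ ] ++ ((init a k₁) ++ (k₂ ++ ins))))} (gk) (prove ((# 0 ⊕ (# 1 ⊕ # 2 ⊕ # 3) ⊕ # 4) ⊕ # 5 ⊕ # 6) ((# 6 ⊕ # 2 ⊕ # 5 ⊕ # 3 ⊕ # 4) ⊕ # 0 ⊕ # 1) ([ a ] ∷ k₁ ∷ [ yₚ ] ∷ k₂ ∷ ins ∷ init a k₁ ∷ [ h ] ∷  [])))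
      Uc : Unique c
      Uc = Unique-sub {ys = unv} (↭-sym ct) UA
      vW : (yₚ ∷ h ∷ m' ++ iₚ ++ iB) ++ (init a k₁ ++ k₂ ++ ins) ++ u₁ ++ u₂ ↭ z ∷ a ∷ r ++ i
      vW = (lin {as = (([ yₚ ] ++ ([ h ] ++ (m' ++ (iₚ ++ iB)))) ++ (((init a k₁) ++ (k₂ ++ ins)) ++ (u₁ ++ u₂)))} {bs = ([ z ] ++ ([ a ] ++ (r ++ i)))} ((↭-sym vA) ⊹ (↭-sym ct) ⊹ (↭-sym g) ⊹ gm ⊹ (↭-sym gk)) (prove (((# 0 ⊕ # 1 ⊕ # 2 ⊕ # 3 ⊕ # 4) ⊕ (# 5 ⊕ # 6 ⊕ # 7) ⊕ # 8 ⊕ # 9) ⊕ (# 10 ⊕ # 11 ⊕ # 12 ⊕ # 13) ⊕ (# 10 ⊕ # 11 ⊕ # 14 ⊕ # 15) ⊕ # 16 ⊕ (# 17 ⊕ # 18) ⊕ # 11 ⊕ # 19) ((# 10 ⊕ # 11 ⊕ # 12 ⊕ # 13) ⊕ ((# 10 ⊕ # 11 ⊕ # 14 ⊕ # 15) ⊕ # 18 ⊕ # 4) ⊕ ((# 11 ⊕ (# 19 ⊕ # 0 ⊕ # 6) ⊕ # 7) ⊕ # 16) ⊕ (# 8 ⊕ (# 17 ⊕ # 3) ⊕ # 9) ⊕ # 2 ⊕ # 5 ⊕ # 1) ([ yₚ ] ∷ [ h ] ∷ m' ∷ iₚ ∷ iB ∷ init a k₁ ∷ k₂ ∷ ins ∷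 u₁ ∷ u₂ ∷ [ z ] ∷ [ a ] ∷ r ∷ i ∷ rA ∷ iA ∷ unv ∷ m ∷ mid ∷ k₁ ∷  [])))
      UW : Unique (yₚ ∷ h ∷ m' ++ iₚ ++ iB)
      UW = Unique-sub vW U
      lenW : length (yₚ ∷ h ∷ m' ++ iₚ ++ iB) < N
      lenW with third two Uc n z≢a ne gc
      ... | v , vs , gv = ℕₚ.<-≤-trans (length-↭-< {xs = yₚ ∷ h ∷ m' ++ iₚ ++ iB} {ys = vs ++ u₁ ++ u₂} (lin {as = ([ z ] ++ ([ a ] ++ (r ++ i)))} {bs = ([ v ] ++ (([ yₚ ] ++ ([ h ] ++ (m' ++ (iₚ ++ iB)))) ++ (vs ++ (u₁ ++ u₂))))} ((↭-sym vW) ⊹ gv) (prove ((# 0 ⊕ # 1 ⊕ # 2 ⊕ # 3) ⊕ ((# 4 ⊕ # 5 ⊕ # 6 ⊕ # 7 ⊕ # 8) ⊕ (# 9 ⊕ # 10 ⊕ # 11) ⊕ # 12 ⊕ # 13) ⊕ # 14 ⊕ # 15) ((# 14 ⊕ (# 4 ⊕ # 5 ⊕ # 6 ⊕ # 7 ⊕ # 8) ⊕ # 15 ⊕ # 12 ⊕ # 13) ⊕ (# 0 ⊕ # 1 ⊕ # 2 ⊕ # 3) ⊕ # 9 ⊕ # 10 ⊕ # 11) ([ z ] ∷ [ a ] ∷ r ∷ i ∷ [ yₚ ] ∷ [ h ] ∷ m' ∷ iₚ ∷ iB ∷ init a k₁ ∷ k₂ ∷ ins ∷ u₁ ∷ u₂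 ∷ [ v ] ∷ vs ∷  [])))) len
      yW : y ∈ m' ++ iₚ ++ iB
      yW = ∈-resp-↭ (lin {as = ((mid ++ iB) ++ (m ++ iₚ))} {bs = (m' ++ (iₚ ++ iB))} ((↭-sym gm)) (prove (((# 0 ⊕ # 1) ⊕ # 2 ⊕ # 3) ⊕ # 4) ((# 4 ⊕ # 3 ⊕ # 1) ⊕ # 2 ⊕ # 0) (mid ∷ iB ∷ m ∷ iₚ ∷ m' ∷  []))) (∈ₚ.∈-++⁺ˡ my)
      y≢ : ∀ {v} → v ∈ yₚ ∷ h ∷ [] → y ≢ v
      y≢ m refl = Unique-clash {xs = yₚ ∷ h ∷ []} {ys = m' ++ iₚ ++ iB} ↭-refl UW m yW
      m'≢[] : m' ≢ []
      m'≢[] refl = mid≢[] (Lₚ.++-conicalʳ m mid (↭-empty-inv (↭-sym gm)))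
      -- `o` is the pocket end other than `y'`. It is used both as end vertex and as root end in the
      -- enlarged pocket, so that the path between `y` and `y'` misses `o`, which the outer paths
      -- visit already.
      finish : ∀ {o o'} → (o ≡ h × o' ≡ yₚ) ⊎ (o ≡ yₚ × o' ≡ h) → y' ≡ o' → Out yₚ h m' (iₚ ++ iB) o y → Out z a r i x y
      finish {o} {o'} oo refl (out {kW} {uW} {iW} pkW twoW ctW longW) with conn oo twoW
        where
        conn : ∀ {o o'} → (o ≡ h × o' ≡ yₚ) ⊎ (o ≡ yₚ × o' ≡ h) → Two o y yₚ h (h ∷ kW ++ iW) → ∃[ f ] Path y o' f × h ∷ kW ++ iW ↭ o ∷ f
        conn (inj₁ (refl , refl)) T = two-fix T (Unique-sub {ys = uW} (↭-sym ctW) UW)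
        conn (inj₂ (refl , refl)) T = two-fix (two-swap′ T) (Unique-sub {ys = uW} (↭-sym ctW) UW)
      ... | f , P , gf = out {kept = k₁ ++ kW ++ k₂} {u₁ ++ uW ++ u₂} {ins ++ iW}
             (subst (λ l → Pockets a l (k₁ ++ kW ++ k₂) (u₁ ++ uW ++ u₂)) (trans (cong (l₁ ++_) (Lₚ.++-assoc m' _ _)) (sym el)) (pockets-++ B refl (pockets-++ pkW (last-∷ʳ h m') A)))
             (two-glueʳ two (path-rev P) (lin {as = (([ a ] ++ ((k₁ ++ ([ yₚ ] ++ k₂)) ++ ins)) ++ f)} {bs = ([ o' ] ++ ([ a ] ++ ((k₁ ++ (kW ++ k₂)) ++ (ins ++ iW))))} ((↭-sym gf) ⊹ (↭-sym (go oo))) (prove (((# 0 ⊕ (# 1 ⊕ # 2 ⊕ # 3) ⊕ # 4) ⊕ # 5) ⊕ (# 6 ⊕ # 7 ⊕ # 8) ⊕ # 9 ⊕ # 10) ((# 10 ⊕ # 0 ⊕ (# 1 ⊕ # 7 ⊕ # 3) ⊕ # 4 ⊕ # 8) ⊕ (# 9 ⊕ # 5) ⊕ # 6 ⊕ # 2) ([ a ] ∷ k₁ ∷ [ yₚ ] ∷ k₂ ∷ ins ∷ f ∷ [ h ] ∷ kW ∷ iW ∷ [ o ] ∷ [ o' ] ∷  []))))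
             (lin {as = ([ z ] ++ ([ a ] ++ (r ++ i)))} {bs = (([ a ] ++ ((k₁ ++ (kW ++ k₂)) ++ (ins ++ iW))) ++ (u₁ ++ (uW ++ u₂)))} ((↭-sym vW) ⊹ ctW ⊹ (↭-sym gk)) (prove ((# 0 ⊕ # 1 ⊕ # 2 ⊕ # 3) ⊕ ((# 4 ⊕ # 5 ⊕ # 6 ⊕ # 7 ⊕ # 8) ⊕ (# 9 ⊕ # 10 ⊕ # 11) ⊕ # 12 ⊕ # 13) ⊕ ((# 5 ⊕ # 14 ⊕ # 15) ⊕ # 16) ⊕ # 1 ⊕ # 17) (((# 1 ⊕ (# 17 ⊕ # 14 ⊕ # 10) ⊕ # 11 ⊕ # 15) ⊕ # 12 ⊕ # 16 ⊕ # 13) ⊕ (# 0 ⊕ # 1 ⊕ # 2 ⊕ # 3) ⊕ (# 4 ⊕ # 5 ⊕ # 6 ⊕ # 7 ⊕ # 8) ⊕ # 9 ⊕ # 5) ([ z ] ∷ [ a ] ∷ r ∷ i ∷ [ yₚ ] ∷ [ h ] ∷ m' ∷ iₚ ∷ iB ∷ init a k₁ ∷ k₂ ∷ ins ∷ u₁ ∷ u₂ ∷ kW ∷ iW ∷ uW ∷ k₁ ∷  [])))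
             (ℕₚ.≤-trans longW (ℕₚ.≤-trans (ℕₚ.m≤m+n _ (length k₂)) (subst (_≤ length (k₁ ++ kW ++ k₂)) (Lₚ.length-++ kW) (subst (length (kW ++ k₂) ≤_) (sym (Lₚ.length-++ k₁)) (ℕₚ.m≤n+m _ (length k₁))))))
        where
        go : ∀ {o o'} → (o ≡ h × o' ≡ yₚ) ⊎ (o ≡ yₚ × o' ≡ h) → o ∷ [ o' ] ↭ h ∷ [ yₚ ]
        go (inj₁ (refl , refl)) = ↭-refl
        go (inj₂ (refl , refl)) = swap _ _ ↭-refl
      -- A visited vertex on the boundary of a pocket must be one of its two ends.
      y'vis : y' ∉ m
      y'vis mm = Unique-clash ct UA (two-∈ʳ two) (∈-resp-↭ (↭-sym g) (∈ₚ.∈-++⁺ʳ u₁ (∈ₚ.∈-++⁺ˡ (∈ₚ.∈-++⁺ˡ mm))))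
      at-ends : y' ∈ h ∷ m ∷ʳ yₚ → Out z a r i x y
      at-ends (here e) = finish (inj₂ (refl , refl)) e (S W m'≢[] lenW UW (here refl) (there (there yW)) (λ q → y≢ (here refl) (sym q))
          (λ { (inj₁ (_ , q)) → y≢ (there (here refl)) q ; (inj₂ (_ , q)) → y≢ (here refl) q }))
      at-ends (there mm) with ∈ₚ.∈-++⁻ m mm
      ... | inj₁ mm' = ⊥-elim (y'vis mm')
      ... | inj₂ (here e) = finish (inj₁ (refl , refl)) e (S W m'≢[] lenW UW (there (here refl)) (there (there yW)) (λ q → y≢ (there (here refl)) (sym q))
          (λ { (inj₁ (_ , q)) → y≢ (there (here refl)) q ; (inj₂ (_ , q)) → y≢ (here refl) q }))
      pick : y' ≡ s ⊎ y' ≡ t → Out z a r i x y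
      pick (inj₁ e) = at-ends (subst (_∈ h ∷ m ∷ʳ yₚ) (sym e) (proj₁ sts))
      pick (inj₂ e) = at-ends (subst (_∈ h ∷ m ∷ʳ yₚ) (sym e) (proj₂ sts))

    -- Both end vertices lie behind the chord: the edge st of a path in DB is replaced by a path in DA.
    both : x ∈ mid ++ iB → y ∈ mid ++ iB → x ≢ y → Out z a r i x y
    both {x} {y} mx my n = go (S DA rA≢[] lenA UA s∈A t∈A s≢t st-ends)
      where
      UB : Unique (t ∷ s ∷ mid ++ iB)
      UB = Unique-sub {ys = X ++ Y ++ iA} (lin {as = (([ t ] ++ ([ s ] ++ (mid ++ iB))) ++ (X ++ (Y ++ iA)))} {bs = ([ z ] ++ ([ a ] ++ (r ++ i)))} ((↭-sym garc) ⊹ (↭-sym gi)) (prove (((# 0 ⊕ # 1 ⊕ # 2 ⊕ # 3) ⊕ # 4 ⊕ # 5 ⊕ # 6) ⊕ (# 7 ⊕ # 8 ⊕ # 9) ⊕ # 10) ((# 9 ⊕ # 7 ⊕ # 8 ⊕ # 10) ⊕ (# 4 ⊕ # 1 ⊕ # 2 ⊕ # 0 ⊕ # 5) ⊕ # 6 ⊕ # 3) ([ t ] ∷ [ s ] ∷ mid ∷ iB ∷ X ∷ Y ∷ iA ∷ [ a ] ∷ r ∷ [ z ] ∷ i ∷  []))) U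
      clash : ∀ {v} → v ∈ mid ++ iB → v ∈ t ∷ s ∷ [] → ⊥
      clash m m' = Unique-clash {xs = t ∷ s ∷ []} {ys = mid ++ iB} ↭-refl UB m' m
      go : Out z a rA iA s t → Out z a r i x y
      go (out {kept} {unv} {ins} pk two ct long) with glue pk
      ... | glued {yₚ} {l₁} {m} {iₚ} {l₂} {k₁} {k₂} {u₁} {u₂} {m'} B _ A _ al el refl g D _ with al (vis (two-∈ˡ two)) (vis (two-∈ʳ two))
        where
        vis : ∀ {v} → v ∈ a ∷ (k₁ ++ yₚ ∷ k₂) ++ ins → v ∉ m
        vis mv mm = Unique-clash ct UA mv (∈-resp-↭ (↭-sym g) (∈ₚ.∈-++⁺ʳ u₁ (∈ₚ.∈-++⁺ˡ (∈ₚ.∈-++⁺ˡ mm))))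
      ... | refl , lh , refl , refl = fin (S DB mid≢[] lenB UB (there (there mx)) (there (there my)) n
            (λ { (inj₁ (q , _)) → clash mx (here q) ; (inj₂ (q , _)) → clash mx (there (here q)) }))
        where
        gk : a ∷ k₁ ↭ init a k₁ ∷ʳ s
        gk = ↭-reflexive (trans (init-last a k₁) (cong (init a k₁ ∷ʳ_) (trans (pockets-last B) lh)))
        D' : Disk t s [] iₚ
        D' = subst (λ v → Disk t v [] iₚ) lh D
        iₚ≡ : iₚ ≡ []
        iₚ≡ = no-digon D' (Unique-sub {ys = (init a k₁ ++ k₂ ++ ins) ++ u₁ ++ u₂} (lin {as = (([ t ] ++ ([ s ] ++ iₚ)) ++ (((init a k₁) ++ (k₂ ++ ins)) ++ (u₁ ++ u₂)))} {bs = ([ z ] ++ ([ a ] ++ (rA ++ iA)))} ((↭-sym ct) ⊹ (↭-sym g) ⊹ (↭-sym gk)) (prove (((# 0 ⊕ # 1 ⊕ # 2) ⊕ (# 3 ⊕ # 4 ⊕ # 5) ⊕ # 6 ⊕ # 7) ⊕ (# 8 ⊕ # 9 ⊕ # 10 ⊕ # 11) ⊕ # 12 ⊕ # 9 ⊕ # 13) ((# 8 ⊕ # 9 ⊕ # 10 ⊕ # 11) ⊕ ((# 9 ⊕ (# 13 ⊕ # 0 ⊕ # 4) ⊕ # 5) ⊕ # 12) ⊕ (# 6 ⊕ (ε ⊕ # 2) ⊕ # 7) ⊕ # 3 ⊕ # 1) ([ t ] ∷ [ s ] ∷ iₚ ∷ init a k₁ ∷ k₂ ∷ ins ∷ u₁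 ∷ u₂ ∷ [ z ] ∷ [ a ] ∷ rA ∷ iA ∷ unv ∷ k₁ ∷  []))) UA)
        gp : iₚ ↭ []
        gp = ↭-reflexive iₚ≡
        lenB : length (t ∷ s ∷ mid ++ iB) < N
        lenB with third two (Unique-sub {ys = unv} (↭-sym ct) UA) s≢t z≢a st-ends (lin {as = ([ a ] ++ ((k₁ ++ ([ t ] ++ k₂)) ++ ins))} {bs = ([ s ] ++ ([ t ] ++ ((init a k₁) ++ (k₂ ++ ins))))} (gk) (prove ((# 0 ⊕ (# 1 ⊕ # 2 ⊕ # 3) ⊕ # 4) ⊕ # 5 ⊕ # 6) ((# 6 ⊕ # 2 ⊕ # 5 ⊕ # 3 ⊕ # 4) ⊕ # 0 ⊕ # 1) ([ a ] ∷ k₁ ∷ [ t ] ∷ k₂ ∷ ins ∷ init a k₁ ∷ [ s ] ∷  [])))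
        ... | v , vs , gv = ℕₚ.<-≤-trans (length-↭-< {xs = t ∷ s ∷ mid ++ iB} {ys = vs ++ unv} (lin {as = ([ z ] ++ ([ a ] ++ (r ++ i)))} {bs = ([ v ] ++ (([ t ] ++ ([ s ] ++ (mid ++ iB))) ++ (vs ++ unv)))} (vA ⊹ ct ⊹ gk ⊹ gv) (prove ((# 0 ⊕ # 1 ⊕ # 2 ⊕ # 3) ⊕ ((# 0 ⊕ # 1 ⊕ # 4 ⊕ # 5) ⊕ # 6 ⊕ # 7) ⊕ ((# 1 ⊕ (# 8 ⊕ # 9 ⊕ # 10) ⊕ # 11) ⊕ # 12) ⊕ (# 13 ⊕ # 14) ⊕ # 15 ⊕ # 16) ((# 15 ⊕ (# 9 ⊕ # 14 ⊕ # 6 ⊕ # 7) ⊕ # 16 ⊕ # 12) ⊕ (# 0 ⊕ # 1 ⊕ # 2 ⊕ # 3) ⊕ (# 0 ⊕ # 1 ⊕ # 4 ⊕ # 5) ⊕ (# 1 ⊕ # 8) ⊕ # 13 ⊕ # 10 ⊕ # 11) ([ z ] ∷ [ a ] ∷ r ∷ i ∷ rA ∷ iA ∷ mid ∷ iB ∷ k₁ ∷ [ t ] ∷ k₂ ∷ ins ∷ unv ∷ init a k₁ ∷ [ s ] ∷ [ v ] ∷ vs ∷  [])))) len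
        fin : Out t s mid iB x y → Out z a r i x y
        fin (out {kB} {uB} {jB} pkB twoB ctB longB) = out {kept = k₁ ++ kB ++ k₂} {u₁ ++ uB ++ u₂} {ins ++ jB}
             (subst (λ l → Pockets a l (k₁ ++ kB ++ k₂) (u₁ ++ uB ++ u₂)) (trans (cong (l₁ ++_) (Lₚ.++-assoc mid _ _)) (sym el)) (pockets-++ B lh (pockets-++ pkB (last-∷ʳ s mid) A)))
             (two-two two twoB (prove ((# 0 ⊕ (# 1 ⊕ # 2 ⊕ # 3) ⊕ # 4) ⊕ # 5 ⊕ # 6 ⊕ # 7) (# 5 ⊕ # 2 ⊕ # 0 ⊕ (# 1 ⊕ # 6 ⊕ # 3) ⊕ # 4 ⊕ # 7) ([ a ] ∷ k₁ ∷ [ t ] ∷ k₂ ∷ ins ∷ [ s ] ∷ kB ∷ jB ∷  [])))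
             (lin {as = ([ z ] ++ ([ a ] ++ (r ++ i)))} {bs = (([ a ] ++ ((k₁ ++ (kB ++ k₂)) ++ (ins ++ jB))) ++ (u₁ ++ (uB ++ u₂)))} (vA ⊹ ct ⊹ g ⊹ gp ⊹ ctB) (prove ((# 0 ⊕ # 1 ⊕ # 2 ⊕ # 3) ⊕ ((# 0 ⊕ # 1 ⊕ # 4 ⊕ # 5) ⊕ # 6 ⊕ # 7) ⊕ ((# 1 ⊕ (# 8 ⊕ # 9 ⊕ # 10) ⊕ # 11) ⊕ # 12) ⊕ (# 13 ⊕ (ε ⊕ # 14) ⊕ # 15) ⊕ ε ⊕ (# 16 ⊕ # 17 ⊕ # 18) ⊕ # 19) (((# 1 ⊕ (# 8 ⊕ # 17 ⊕ # 10) ⊕ # 11 ⊕ # 18) ⊕ # 13 ⊕ # 19 ⊕ # 15) ⊕ (# 0 ⊕ # 1 ⊕ # 2 ⊕ # 3) ⊕ (# 0 ⊕ # 1 ⊕ # 4 ⊕ # 5) ⊕ # 12 ⊕ # 14 ⊕ # 9 ⊕ # 16 ⊕ # 6 ⊕ # 7) ([ z ] ∷ [ a ] ∷ r ∷ i ∷ rA ∷ iA ∷ mid ∷ iB ∷ k₁ ∷ [ t ] ∷ k₂ ∷ ins ∷ unv ∷ u₁ ∷ iₚ ∷ u₂ ∷ [ s ] ∷ kB ∷ jB ∷ uB ∷  [])))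
             (ℕₚ.≤-trans longB (ℕₚ.≤-trans (ℕₚ.m≤m+n _ (length k₂)) (subst (_≤ length (k₁ ++ kB ++ k₂)) (Lₚ.length-++ kB) (subst (length (kB ++ k₂) ≤_) (sym (Lₚ.length-++ k₁)) (ℕₚ.m≤n+m _ (length k₁))))))

    -- The chord end for the outer solution is `s`, unless it equals `x` or forms with `x` the pair
    -- of root ends; in these cases `t` is admissible.
    one-end : x ∈ z ∷ a ∷ rA ++ iA → y ∈ mid ++ iB → Out z a r i x y
    one-end {x} mx my with s ≟ x | s ≟ a | x ≟ z
    ... | yes refl | _ | _ = one mx my t (inj₂ refl) s≢t st-ends
    ... | no n | yes refl | yes refl = one mx my t (inj₂ refl) (λ q → st≢ (refl , sym q)) (λ { (inj₁ (_ , q)) → t≢a q ; (inj₂ (q , _)) → z≢a q })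
    ... | no n | no sa | _ = one mx my s (inj₁ refl) (λ q → n (sym q)) (λ { (inj₁ (_ , q)) → sa q ; (inj₂ (q , q')) → sz q q' })
      where
      sz : x ≡ a → s ≡ z → ⊥
      sz _ refl = go X Y short
        where
        go : ∀ X Y → a ∷ rA ∷ʳ z ≡ X ++ z ∷ t ∷ Y → ⊥
        go X Y e with unsnoc (t ∷ Y)
        ... | inj₂ (Y' , w , eY) with ∷ʳ-inj (a ∷ rA) (X ++ z ∷ Y') (trans e (trans (cong (λ l → X ++ z ∷ l) eY) (sym (snoc-++ X))))
        ... | e' , _ = Unique-clash {xs = [ z ]} ↭-refl UA (here refl) (∈ₚ.∈-++⁺ˡ {xs = a ∷ rA} (subst (z ∈_) (sym e') (∈-mid X)))
    ... | no n | yes refl | no xz = one mx my s (inj₁ refl) (λ q → n (sym q)) (λ { (inj₁ (q , _)) → xz q ; (inj₂ (q , _)) → n (sym q) })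

    chord-case : x ∈ z ∷ a ∷ r ++ i → y ∈ z ∷ a ∷ r ++ i → x ≢ y → ¬ SameEnds x y z a → Out z a r i x y
    chord-case {x} {y} mx my n ne = go (x ∈? (mid ++ iB)) (y ∈? (mid ++ iB))
      where
      inA : ∀ {v} → v ∈ z ∷ a ∷ r ++ i → v ∉ mid ++ iB → v ∈ z ∷ a ∷ rA ++ iA
      inA m nm with ∈ₚ.∈-++⁻ (z ∷ a ∷ rA ++ iA) (∈-resp-↭ vA m)
      ... | inj₁ m' = m'
      ... | inj₂ m' = ⊥-elim (nm m')
      go : Dec (x ∈ mid ++ iB) → Dec (y ∈ mid ++ iB) → Out z a r i x y
      go (no nx) (no ny) = neither (inA mx nx) (inA my ny) n ne
      go (no nx) (yes py) = one-end (inA mx nx) py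
      go (yes px) (no ny) = out-swap (one-end (inA my ny) px)
      go (yes px) (yes py) = both px py n

  -- An end vertex on the boundary

  two-extend : ∀ {t m} → Two x y t z cs → Adj t m → Path m a d → Two x y z a (cs ++ d)
  two-extend {cs = cs} {d = d} (c₁ , c₂ , g , inj₁ (P , Q)) h R = c₁ ++ d , c₂ , (lin {as = (cs ++ d)} {bs = ((c₁ ++ d) ++ c₂)} (g) (prove ((# 0 ⊕ # 1) ⊕ # 2 ⊕ # 3) (((# 2 ⊕ # 1) ⊕ # 3) ⊕ # 0) (cs ∷ d ∷ c₁ ∷ c₂ ∷  []))) , inj₂ (path-join P h R , Q)
  two-extend {cs = cs} {d = d} (c₁ , c₂ , g , inj₂ (P , Q)) h R = c₁ , c₂ ++ d , (lin {as = (cs ++ d)} {bs = (c₁ ++ (c₂ ++ d))} (g) (prove ((# 0 ⊕ # 1) ⊕ # 2 ⊕ # 3) ((# 2 ⊕ # 3 ⊕ # 1) ⊕ # 0) (cs ∷ d ∷ c₁ ∷ c₂ ∷  []))) , inj₁ (P , path-join Q h R)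

  chord-of : ∀ {N O} → Solver N → length (z ∷ a ∷ r ++ i) ≤ N → Unique (z ∷ a ∷ r ++ i) → Chord O z a ps r i →
    x ∈ z ∷ a ∷ r ++ i → y ∈ z ∷ a ∷ r ++ i → x ≢ y → ¬ SameEnds x y z a → Out z a r i x y
  chord-of S len U C = ChordCase.chord-case S len U C.DA C.DB C.arc C.short C.mid≢[] C.ints C.proper
    where module C = Chord C

  ≤-++ˡ : ∀ (xs : Ls) {ys} → length xs ≤ length (xs ++ ys)
  ≤-++ˡ xs = subst (length xs ≤_) (sym (Lₚ.length-++ xs)) (ℕₚ.m≤m+n _ _)

  -- One end vertex is the last vertex of the arc a ∷ ps: the path follows this arc and the root edge.
  module ArcRun {N : ℕ} (S : Solver N) {z a : V} {ps Qi i : Ls} {y : V} (D : Disk z a (ps ++ Qi) i) (len : length (z ∷ a ∷ (ps ++ Qi) ++ i) ≤ N)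
    (U : Unique (z ∷ a ∷ (ps ++ Qi) ++ i)) (ne : ps ++ Qi ≢ []) (y∈ : y ∈ z ∷ a ∷ (ps ++ Qi) ++ i) (y∉ : y ∉ a ∷ ps) (y≢z : y ≢ z)
    {q₀ : V} {O' : Ls} (eQ : Qi ∷ʳ z ≡ q₀ ∷ O') where
    m : V
    m = last a ps

    fin : ∀ {zf ys iK x y' L} → Disk zf q₀ ys iK → ys ∷ʳ zf ≡ O' ++ L → Orig (q₀ ∷ O') z x → Orig (q₀ ∷ O') y y' →
        x ≢ y' → x ∈ zf ∷ q₀ ∷ ys ++ iK → y' ∈ zf ∷ q₀ ∷ ys ++ iK → Unique (zf ∷ q₀ ∷ ys ++ iK) →
        length (zf ∷ q₀ ∷ ys ++ iK) < N → Adj zf m → Final Path q₀ zf ys iK x y'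
    fin {zf} {ys} {iK} K _ _ _ n mx my UK lt _ with join S K lt UK mx my n
    ... | joined {kept} {unv} {ins} pk path ct = final {kept = kept ∷ʳ q₀} {ins = ins}
          (subst (λ l → Pockets q₀ l (kept ∷ʳ q₀) unv) (snoc-++ ys) (pockets-perm (pockets-++ pk (last-∷ʳ q₀ ys) (pockets-edge (root-adj K))) (prove (# 0 ⊕ ε) (# 0) (unv ∷  []))))
          path (prove (# 0 ⊕ # 1 ⊕ # 2) ((# 1 ⊕ # 0) ⊕ # 2) ([ q₀ ] ∷ kept ∷ ins ∷  [])) ct

    task : Task N
    task = record { solve = S ; q₀ = q₀ ; O' = O' ; m₀ = m ; ps₀ = ps ; x₀ = z ; y₀ = y ; Sol = Path
        ; sol-extʳ = path-glue ; sol-extˡ = λ {x} {t} {y} {c} {d} {e} P R h → path-glue (path-rev R) P (lin {as = (d ++ c)} {bs = ([ t ] ++ e)} (h) (prove ((# 0 ⊕ # 1) ⊕ # 2 ⊕ # 3) ((# 2 ⊕ # 3) ⊕ # 1 ⊕ # 0) (d ∷ c ∷ [ t ] ∷ e ∷  [])))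
        ; sol-∈ˡ = path-∈ˡ ; sol-∈ʳ = path-∈ʳ ; absorb₁ = λ _ → absorb-vertex S ; absorb₂ = λ _ → absorb-edge S ; finish = fin }

    open Run task using (Res; r-none; r-corner; r-chord; r-both; r-cut; none; corner; at-end; at-mid)

    z∈O : z ∈ q₀ ∷ O'
    z∈O = subst (z ∈_) eQ (∈-mid Qi)

    y∈Q : y ∈ Qi ++ z ∷ i
    y∈Q with ∈ₚ.∈-++⁻ (a ∷ ps) (∈-resp-↭ (prove (# 0 ⊕ # 1 ⊕ (# 2 ⊕ # 3) ⊕ # 4) ((# 1 ⊕ # 2) ⊕ # 3 ⊕ # 0 ⊕ # 4) ([ z ] ∷ [ a ] ∷ ps ∷ Qi ∷ i ∷  [])) y∈)
    ... | inj₁ m = ⊥-elim (y∉ m)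
    ... | inj₂ m = m

    result : Res z a ps Qi [] (ps ++ Qi) i z y
    result = Loop.run task D refl (trans eQ (cong (q₀ ∷_) (sym (Lₚ.++-identityʳ O')))) refl (λ m → m) U len (inj₁ refl) (inj₁ refl) (λ q → y≢z (sym q)) (∈-mid Qi) y∈Q

    m≢y : m ≢ y
    m≢y q = y∉ (subst (_∈ a ∷ ps) q (last-∈ a ps))

    edge-mq : Adj m q₀
    edge-mq = boundary-adj D (init a ps) (trans (cong (a ∷_) (snoc-++ ps)) (trans (cong₂ _++_ (init-last a ps) eQ) (Lₚ.++-assoc (init a ps) [ m ] _)))

    from : Res z a ps Qi [] (ps ++ Qi) i z y → Out z a (ps ++ Qi) i m y
    from (r-none (none {kP} {uP} {cP} {kQ} {uQ} {cS} {cR} {cI} pkP pathP pkQ sol vis visP ct)) = out {kept = kP ++ q₀ ∷ kQ} {uP ++ uQ} {cI ++ cR}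
        (subst (λ l → Pockets a l (kP ++ q₀ ∷ kQ) (uP ++ uQ)) eL (pockets-++ pkP refl (pockets-++ (pockets-edge edge-mq) refl pkQ)))
        (cP , cS , (lin {as = ([ a ] ++ ((kP ++ ([ q₀ ] ++ kQ)) ++ (cI ++ cR)))} {bs = (cP ++ cS)} ((↭-sym vis) ⊹ (↭-sym visP)) (prove ((# 0 ⊕ (# 1 ⊕ # 2 ⊕ # 3) ⊕ # 4 ⊕ # 5) ⊕ # 6 ⊕ # 7) ((# 7 ⊕ # 6) ⊕ ((# 2 ⊕ # 3) ⊕ # 5) ⊕ (# 0 ⊕ # 1) ⊕ # 4) ([ a ] ∷ kP ∷ [ q₀ ] ∷ kQ ∷ cI ∷ cR ∷ cS ∷ cP ∷  []))) , inj₂ (path-rev pathP , path-rev sol))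
        (lin {as = ([ z ] ++ ([ a ] ++ ((ps ++ Qi) ++ i)))} {bs = (([ a ] ++ ((kP ++ ([ q₀ ] ++ kQ)) ++ (cI ++ cR))) ++ (uP ++ uQ))} (ct ⊹ vis ⊹ visP) (prove ((# 0 ⊕ # 1 ⊕ (# 2 ⊕ # 3) ⊕ # 4) ⊕ (# 5 ⊕ # 6 ⊕ # 7 ⊕ # 8) ⊕ ((# 9 ⊕ # 10) ⊕ # 11) ⊕ (# 1 ⊕ # 12) ⊕ # 13) (((# 1 ⊕ (# 12 ⊕ # 9 ⊕ # 10) ⊕ # 13 ⊕ # 11) ⊕ # 6 ⊕ # 8) ⊕ (# 0 ⊕ # 1 ⊕ (# 2 ⊕ # 3) ⊕ # 4) ⊕ # 7 ⊕ # 5) ([ z ] ∷ [ a ] ∷ ps ∷ Qi ∷ i ∷ cP ∷ uP ∷ cS ∷ uQ ∷ [ q₀ ] ∷ kQ ∷ cR ∷ kP ∷ cI ∷  [])))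
        (long ps Qi eQ ne pkP pkQ)
      where
      eL : ps ++ q₀ ∷ O' ++ [] ≡ (ps ++ Qi) ∷ʳ z
      eL = trans (cong (ps ++_) (trans (cong (q₀ ∷_) (Lₚ.++-identityʳ O')) (sym eQ))) (sym (snoc-++ ps))
      long : ∀ ps Qi → Qi ∷ʳ z ≡ q₀ ∷ O' → ps ++ Qi ≢ [] → Pockets a ps kP uP → Pockets q₀ (O' ++ []) kQ uQ → 2 ≤ length (kP ++ q₀ ∷ kQ)
      long [] [] _ ne _ _ = ⊥-elim (ne refl)
      long (_ ∷ _) _ _ _ (cons {k = k} _ _ _ _) _ = s≤s (subst (1 ≤_) (sym (Lₚ.length-++ k)) (ℕₚ.≤-trans (s≤s z≤n) (ℕₚ.m≤n+m _ (length k))))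
      long [] (q ∷ Qi) eQ _ pkP pkQ with pockets-nil pkP
      ... | refl , _ = s≤s (go pkQ (λ q → ∷ʳ-≢[] Qi (trans (Lₚ.∷-injectiveʳ eQ) (trans (sym (Lₚ.++-identityʳ O')) q))))
        where
        go : ∀ {l k u} → Pockets q₀ l k u → l ≢ [] → 1 ≤ length k
        go nil n = ⊥-elim (n refl)
        go (cons _ _ _ _) _ = s≤s z≤n
    -- Impossible, since a corner leaves the root vertex `z` unvisited and `z` is an end vertex
    -- here. As `z` is in `O`, `Both` and `Cut` are impossible too.
    from (r-corner (corner {ps₁} {ps₂} {Qv} {Qu} {B} {iZ} {kP} {uP} {cP} {kQ} {uQ} {cS} {cR} {cB} psE pkP pathP QE pkQ sol vis _ kind visB Z ct)) =
      ⊥-elim (Unique-clash {xs = cS} {ys = (Qu ∷ʳ z) ++ cP ++ uP ++ uQ ++ init a ps₁ ++ iZ} (lin {as = ([ z ] ++ ([ a ] ++ ((ps ++ Qi) ++ i)))} {bs = (cS ++ ((Qu ++ [ z ]) ++ (cP ++ (uP ++ (uQ ++ ((init a ps₁) ++ iZ))))))} (ct) (prove ((# 0 ⊕ # 1 ⊕ (# 2 ⊕ # 3) ⊕ # 4) ⊕ # 5 ⊕ # 6 ⊕ # 7 ⊕ # 8 ⊕ # 9 ⊕ (# 10 ⊕ # 0) ⊕ # 11) ((# 7 ⊕ (# 10 ⊕ # 0) ⊕ # 5 ⊕ # 6 ⊕ # 8 ⊕ # 9 ⊕ # 11) ⊕ # 0 ⊕ # 1 ⊕ (# 2 ⊕ #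 3) ⊕ # 4) ([ z ] ∷ [ a ] ∷ ps ∷ Qi ∷ i ∷ cP ∷ uP ∷ cS ∷ uQ ∷ init a ps₁ ∷ Qu ∷ iZ ∷  []))) U
          (path-∈ˡ sol) (∈ₚ.∈-++⁺ˡ (∈-mid Qu)))
    from (r-chord C) = chord-of S len U C (there (∈ₚ.∈-++⁺ˡ {xs = a ∷ ps ++ Qi} (∈ₚ.∈-++⁺ˡ {xs = a ∷ ps} (last-∈ a ps)))) y∈ m≢y
      (λ { (inj₁ (q , _)) → Unique-clash {xs = [ z ]} ↭-refl U (here refl) (∈ₚ.∈-++⁺ˡ {xs = a ∷ ps ++ Qi} (∈ₚ.∈-++⁺ˡ {xs = a ∷ ps} (subst (_∈ a ∷ ps) q (last-∈ a ps)))) ; (inj₂ (_ , q)) → y≢z q })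
    from (r-both (at-end _ _ _ _ _ _ _ n _)) = ⊥-elim (n z∈O)
    from (r-both (at-mid _ _ _ _ _ _ _ _ n _)) = ⊥-elim (n z∈O)
    from (r-cut C) = ⊥-elim (Cut.x∉O C z∈O)

    arc-run : Out z a (ps ++ Qi) i m y
    arc-run = from result

  arc-case : ∀ {N} → Solver N → ∀ ps Qi → Disk z a (ps ++ Qi) i → length (z ∷ a ∷ (ps ++ Qi) ++ i) ≤ N → Unique (z ∷ a ∷ (ps ++ Qi) ++ i) → ps ++ Qi ≢ [] →
    y ∈ z ∷ a ∷ (ps ++ Qi) ++ i → y ∉ a ∷ ps → y ≢ z → Out z a (ps ++ Qi) i (last a ps) y
  arc-case S ps [] D len U ne my ny nz = ArcRun.arc-run S {ps = ps} {Qi = []} D len U ne my ny nz refl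
  arc-case S ps (q ∷ Q) D len U ne my ny nz = ArcRun.arc-run S {ps = ps} {Qi = q ∷ Q} D len U ne my ny nz refl

  -- One end vertex is the end z of the root edge.
  module RootRun {N : ℕ} (S : Solver N) {z a w y : V} {r' i : Ls} (D : Disk z a (r' ∷ʳ w) i) (len : length (z ∷ a ∷ (r' ∷ʳ w) ++ i) ≤ N)
    (U : Unique (z ∷ a ∷ (r' ∷ʳ w) ++ i)) (y∈ : y ∈ z ∷ a ∷ (r' ∷ʳ w) ++ i) (y≢z : y ≢ z) (y≢a : y ≢ a) where

    D₀ : Disk w z (a ∷ r') i
    D₀ = rotate∘ (z ∷ a ∷ r') [ w ] D
    v₀ : z ∷ a ∷ (r' ∷ʳ w) ++ i ↭ w ∷ z ∷ (a ∷ r') ++ i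
    v₀ = (prove (# 0 ⊕ # 1 ⊕ (# 2 ⊕ # 3) ⊕ # 4) (# 3 ⊕ # 0 ⊕ (# 1 ⊕ # 2) ⊕ # 4) ([ z ] ∷ [ a ] ∷ r' ∷ [ w ] ∷ i ∷  []))
    U₀ : Unique (w ∷ z ∷ (a ∷ r') ++ i)
    U₀ = Unique-↭ v₀ U

    -- The deleted vertex `z` is a trivial path, and the other path joins `a` and `y`. It is also
    -- required to visit `w`, the root vertex of the run: this excludes a corner, for which there
    -- would be no arc to absorb it.
    Sol : V → V → Ls → Set
    Sol x y c = Path x y c × w ∈ c

    still : ∀ {t c d e} → w ∈ c → t ∈ c → t ∈ d → c ++ d ↭ t ∷ e → w ∈ e
    still {t} {c} {d} {e} mw mt md h with ∈→↭ mt
    ... | c' , gc = go (∈-resp-↭ gc mw)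
      where
      g : c' ++ d ↭ e
      g = (lin {as = (c' ++ d)} {bs = e} ((↭-sym gc) ⊹ h) (prove ((# 0 ⊕ # 1) ⊕ # 2 ⊕ # 3 ⊕ # 4) (# 4 ⊕ (# 3 ⊕ # 0) ⊕ # 2 ⊕ # 1) (c' ∷ d ∷ c ∷ [ t ] ∷ e ∷  [])))
      go : w ∈ t ∷ c' → w ∈ e
      go (here refl) = ∈-resp-↭ g (∈ₚ.∈-++⁺ʳ c' md)
      go (there m) = ∈-resp-↭ g (∈ₚ.∈-++⁺ˡ m)

    fin : ∀ {zf ys iK x y' L} → Disk zf a ys iK → ys ∷ʳ zf ≡ (r' ∷ʳ w) ++ L → Orig (a ∷ r' ∷ʳ w) a x → Orig (a ∷ r' ∷ʳ w) y y' →
        x ≢ y' → x ∈ zf ∷ a ∷ ys ++ iK → y' ∈ zf ∷ a ∷ ys ++ iK → Unique (zf ∷ a ∷ ys ++ iK) →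
        length (zf ∷ a ∷ ys ++ iK) < N → Adj zf z → Final Sol a zf ys iK x y'
    fin _ _ (inj₂ (n , _)) _ _ _ _ _ _ _ = ⊥-elim (n (here refl))
    fin {zf} {ys} {iK} {L = []} K eK (inj₁ refl) _ n mx my UK lt _ with join S K lt UK mx my n
    ... | joined {kept} {unv} {ins} pk path ct = final {kept = kept ∷ʳ a} {ins = ins}
          (subst (λ l → Pockets a l (kept ∷ʳ a) unv) (snoc-++ ys) (pockets-perm (pockets-++ pk (last-∷ʳ a ys) (pockets-edge (root-adj K))) (prove (# 0 ⊕ ε) (# 0) (unv ∷  []))))
          (path , ∈ₚ.∈-++⁺ˡ {xs = a ∷ kept} (subst (_∈ a ∷ kept) (trans (pockets-last pk) (trans (cong (last a) (trans eK (Lₚ.++-identityʳ _))) (last-∷ʳ a r'))) (last-∈ a kept)))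
          (prove (# 0 ⊕ # 1 ⊕ # 2) ((# 1 ⊕ # 0) ⊕ # 2) ([ a ] ∷ kept ∷ ins ∷  [])) ct
    -- With the root moved to the edge `w l` the vertex `w` ends the pocket arc and is therefore
    -- kept.
    fin {zf} {ys} {iK} {y' = y'} {L = l ∷ L} K eK (inj₁ refl) _ n mx my UK lt _ = go (join S K' (subst (_< N) (↭-length vK) lt) UK' (∈-resp-↭ vK mx) (∈-resp-↭ vK my) n)
      where
      eL : a ∷ ys ∷ʳ zf ≡ (a ∷ r') ++ w ∷ l ∷ L
      eL = cong (a ∷_) (trans eK (Lₚ.++-assoc r' _ _))
      gL : a ∷ ys ∷ʳ zf ↭ (a ∷ r') ++ w ∷ l ∷ L
      gL = ↭-reflexive eL
      K' : Disk w l (L ++ a ∷ r') iK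
      K' = rerooted (a ∷ r') eL K
      vK : zf ∷ a ∷ ys ++ iK ↭ w ∷ l ∷ (L ++ a ∷ r') ++ iK
      vK = (lin {as = ([ zf ] ++ ([ a ] ++ (ys ++ iK)))} {bs = ([ w ] ++ ([ l ] ++ ((L ++ ([ a ] ++ r')) ++ iK)))} (gL) (prove ((# 0 ⊕ # 1 ⊕ # 2 ⊕ # 3) ⊕ (# 1 ⊕ # 4) ⊕ # 5 ⊕ # 6 ⊕ # 7) ((# 5 ⊕ # 6 ⊕ (# 7 ⊕ # 1 ⊕ # 4) ⊕ # 3) ⊕ # 1 ⊕ # 2 ⊕ # 0) ([ zf ] ∷ [ a ] ∷ ys ∷ iK ∷ r' ∷ [ w ] ∷ [ l ] ∷ L ∷  [])))
      UK' = Unique-↭ vK UK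
      go : Joined w l (L ++ a ∷ r') iK a y' → Final Sol a zf ys iK a y'
      go (joined {kept} {unv} {ins} pk path ct) with pockets-split pk L (snoc-++ L) (Unique-clash ct UK' (path-∈ˡ path))
      ... | keepSplit {k₁} {k₂} {u₁} {u₂} Lf Rg refl g = final {kept = k₂ ++ l ∷ k₁ ∷ʳ a} {u₂ ++ u₁} {ins = ins}
            (subst (λ l' → Pockets a l' (k₂ ++ l ∷ k₁ ∷ʳ a) (u₂ ++ u₁)) eF (pockets-++ Rg (last-∷ʳ a r') (pockets-++ (pockets-edge (root-adj K')) refl Lf)))
            (path , ∈-resp-↭ (prove ((# 0 ⊕ # 1) ⊕ # 2 ⊕ # 3 ⊕ # 4) (# 2 ⊕ (# 3 ⊕ # 0 ⊕ # 1) ⊕ # 4) ([ a ] ∷ k₂ ∷ [ l ] ∷ k₁ ∷ ins ∷  [])) (∈ₚ.∈-++⁺ˡ {xs = a ∷ k₂} (subst (_∈ a ∷ k₂) (trans (pockets-last Rg) (last-∷ʳ a r')) (last-∈ a k₂))))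
            (prove (# 0 ⊕ (# 1 ⊕ # 2 ⊕ # 3) ⊕ # 4) ((# 3 ⊕ # 0 ⊕ # 1 ⊕ # 2) ⊕ # 4) ([ l ] ∷ k₁ ∷ [ a ] ∷ k₂ ∷ ins ∷  []))
            (lin {as = ([ zf ] ++ ([ a ] ++ (ys ++ iK)))} {bs = (([ l ] ++ ((k₁ ++ ([ a ] ++ k₂)) ++ ins)) ++ (u₂ ++ u₁))} (vK ⊹ ct ⊹ g) (prove ((# 0 ⊕ # 1 ⊕ # 2 ⊕ # 3) ⊕ (# 4 ⊕ # 5 ⊕ (# 6 ⊕ # 1 ⊕ # 7) ⊕ # 3) ⊕ ((# 5 ⊕ (# 8 ⊕ # 1 ⊕ # 9) ⊕ # 10) ⊕ # 11) ⊕ # 12 ⊕ # 13) (((# 5 ⊕ (# 8 ⊕ # 1 ⊕ # 9) ⊕ # 10) ⊕ # 13 ⊕ # 12) ⊕ (# 0 ⊕ # 1 ⊕ # 2 ⊕ # 3) ⊕ (# 4 ⊕ # 5 ⊕ (# 6 ⊕ # 1 ⊕ # 7) ⊕ # 3) ⊕ # 11) ([ zf ] ∷ [ a ] ∷ ys ∷ iK ∷ [ w ] ∷ [ l ] ∷ L ∷ r' ∷ k₁ ∷ k₂ ∷ ins ∷ unv ∷ u₁ ∷ u₂ ∷  [])))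
        where
        eF : (r' ∷ʳ w) ++ l ∷ L ∷ʳ a ≡ ys ++ zf ∷ a ∷ []
        eF = trans (sym (Lₚ.++-assoc (r' ∷ʳ w) (l ∷ L) [ a ])) (trans (cong (_∷ʳ a) (sym eK)) (snoc-++ ys))

    task : Task N
    task = record { solve = S ; q₀ = a ; O' = r' ∷ʳ w ; m₀ = z ; ps₀ = [] ; x₀ = a ; y₀ = y ; Sol = Sol
        ; sol-extʳ = λ (P , mw) R h → path-glue P R h , still mw (path-∈ʳ P) (path-∈ˡ R) h
        ; sol-extˡ = λ {x} {t} {y} {c} {d} {e} (P , mw) R h → path-glue (path-rev R) P (lin {as = (d ++ c)} {bs = ([ t ] ++ e)} (h) (prove ((# 0 ⊕ # 1) ⊕ # 2 ⊕ # 3) ((# 2 ⊕ # 3) ⊕ # 1 ⊕ # 0) (d ∷ c ∷ [ t ] ∷ e ∷  []))) , still mw (path-∈ˡ P) (path-∈ˡ R) h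
        ; sol-∈ˡ = λ (P , _) → path-∈ˡ P ; sol-∈ʳ = λ (P , _) → path-∈ʳ P ; absorb₁ = λ () ; absorb₂ = λ () ; finish = fin }

    open Run task using (Res; r-none; r-corner; r-chord; r-both; r-cut; none; corner; at-end; at-mid)

    result : Res w z [] (a ∷ r') [] (a ∷ r') i a y
    result = Loop.run task {ps = []} {a ∷ r'} {[]} D₀ refl (cong (a ∷_) (sym (Lₚ.++-identityʳ (r' ∷ʳ w)))) refl (λ ()) U₀ (subst (_≤ N) (↭-length v₀) len) (inj₁ refl) (inj₁ refl)
       (λ q → y≢a (sym q)) (here refl) (yQ (∈-resp-↭ (prove (# 0 ⊕ # 1 ⊕ (# 2 ⊕ # 3) ⊕ # 4) (# 0 ⊕ (# 1 ⊕ # 2) ⊕ # 3 ⊕ # 4) ([ z ] ∷ [ a ] ∷ r' ∷ [ w ] ∷ i ∷  [])) y∈))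
      where
      yQ : y ∈ z ∷ (a ∷ r') ++ w ∷ i → y ∈ (a ∷ r') ++ w ∷ i
      yQ (here e) = ⊥-elim (y≢z e)
      yQ (there m) = m

    -- The run was rooted at `w z`, but the root of the disk is `z a`, which lies in the other part;
    -- hence the two parts of the chord exchange their roles.
    chord : Chord (a ∷ r' ∷ʳ w) w z [] (a ∷ r') i → Out z a (r' ∷ʳ w) i z y
    chord C = start C.s∈ C.X C.arc C.short C.DB
      where
      module C = Chord C
      open C using (t; mid; iA; iB; Y)
      body : ∀ mid → mid ≢ [] → (a ∷ r') ∷ʳ w ≡ mid ++ t ∷ Y → C.rA ∷ʳ w ≡ t ∷ Y → Disk t z mid iB → Out z a (r' ∷ʳ w) i z y
      body [] n _ _ _ = ⊥-elim (n refl)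
      body (_ ∷ m) _ e e' DB with Lₚ.∷-injective e
      ... | refl , e'' = ChordCase.chord-case S {X = a ∷ m} {Y = []} {mid = Y} len U (rotate∘ [ t ] (z ∷ a ∷ m) DB) (rotate C.DA e')
             (cong (a ∷_) (trans (cong (_∷ʳ z) e'') (snoc-++ m))) (cong (a ∷_) (snoc-++ m)) Y≢[] (lin {as = i} {bs = (iB ++ iA)} (C.ints) (prove (# 0 ⊕ # 1 ⊕ # 2) ((# 2 ⊕ # 1) ⊕ # 0) (i ∷ iA ∷ iB ∷  []))) (inj₁ (∷ʳ-≢[] m))
             (here refl) y∈ (λ q → y≢z (sym q)) (λ { (inj₁ (_ , q)) → y≢a q ; (inj₂ (_ , q)) → y≢z q })
        where
        Y≢[] : Y ≢ []
        Y≢[] q = digon C.proper (proj₁ (∷ʳ-inj C.rA [] (trans e' (cong (t ∷_) q)))) C.DA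
          where
          digon : ∀ {rA} → rA ≢ [] ⊎ iA ≢ [] → rA ≡ [] → Disk w z rA iA → ⊥
          digon (inj₁ n) er _ = n er
          digon (inj₂ n) refl E = n (no-digon E (Unique-sub {ys = (a ∷ r') ++ iB} (lin {as = (([ w ] ++ ([ z ] ++ iA)) ++ (([ a ] ++ r') ++ iB))} {bs = ([ w ] ++ ([ z ] ++ (([ a ] ++ r') ++ i)))} ((↭-sym C.ints)) (prove (((# 0 ⊕ # 1 ⊕ # 2) ⊕ (# 3 ⊕ # 4) ⊕ # 5) ⊕ # 6) ((# 0 ⊕ # 1 ⊕ (# 3 ⊕ # 4) ⊕ # 6) ⊕ # 2 ⊕ # 5) ([ w ] ∷ [ z ] ∷ iA ∷ [ a ] ∷ r' ∷ iB ∷ i ∷  []))) U₀))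
      start : ∀ {s} → s ∈ [ z ] → ∀ X → z ∷ (a ∷ r') ∷ʳ w ≡ X ++ s ∷ mid ++ t ∷ Y → z ∷ C.rA ∷ʳ w ≡ X ++ s ∷ t ∷ Y → Disk t s mid iB → Out z a (r' ∷ʳ w) i z y
      start (here refl) [] e e' DB = body mid C.mid≢[] (Lₚ.∷-injectiveʳ e) (Lₚ.∷-injectiveʳ e') DB
      start (here refl) (x ∷ X) e _ _ with Lₚ.∷-injective e
      ... | refl , e' = ⊥-elim (Unique-clash {xs = [ z ]} {ys = ((a ∷ r') ∷ʳ w) ++ i} (prove (# 0 ⊕ # 1 ⊕ (# 2 ⊕ # 3) ⊕ # 4) (# 0 ⊕ ((# 1 ⊕ # 2) ⊕ # 3) ⊕ # 4) ([ z ] ∷ [ a ] ∷ r' ∷ [ w ] ∷ i ∷  [])) U (here refl) (∈ₚ.∈-++⁺ˡ (subst (z ∈_) (sym e') (∈-mid X))))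

    from : Res w z [] (a ∷ r') [] (a ∷ r') i a y → Out z a (r' ∷ʳ w) i z y
    from (r-none (none {kP} {uP} {cP} {kQ} {uQ} {cS} {cR} {cI} pkP pathP pkQ (sol , _) vis visP ct)) with pockets-nil pkP
    ... | refl , refl with path-self pathP (Unique-sub {ys = cS ++ uQ} (lin {as = (cP ++ (cS ++ uQ))} {bs = ([ w ] ++ ([ z ] ++ (([ a ] ++ r') ++ i)))} ((↭-sym ct)) (prove ((# 0 ⊕ # 1 ⊕ # 2) ⊕ # 3 ⊕ # 4 ⊕ (# 5 ⊕ # 6) ⊕ # 7) ((# 3 ⊕ # 4 ⊕ (# 5 ⊕ # 6) ⊕ # 7) ⊕ # 0 ⊕ ε ⊕ # 1 ⊕ # 2) (cP ∷ cS ∷ uQ ∷ [ w ] ∷ [ z ] ∷ [ a ] ∷ r' ∷ i ∷  []))) U₀)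
    ... | gP = out {kept = kQ ∷ʳ z} {uQ} {cR}
          (subst (λ l → Pockets a (l ∷ʳ z) (kQ ∷ʳ z) uQ) (Lₚ.++-identityʳ (r' ∷ʳ w)) (pockets-perm (pockets-++ pkQ (trans (cong (last a) (Lₚ.++-identityʳ (r' ∷ʳ w))) (last-∷ʳ a r')) (pockets-edge (root-adj D₀))) (prove (# 0 ⊕ ε) (# 0) (uQ ∷  []))))
          ([ z ] , cS , (lin {as = ([ a ] ++ ((kQ ++ [ z ]) ++ cR))} {bs = ([ z ] ++ cS)} ((↭-sym vis)) (prove ((# 0 ⊕ (# 1 ⊕ # 2) ⊕ # 3) ⊕ # 4) ((# 2 ⊕ # 4) ⊕ (# 0 ⊕ # 1) ⊕ # 3) ([ a ] ∷ kQ ∷ [ z ] ∷ cR ∷ cS ∷  []))) , inj₁ (path-here , path-rev sol))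
          (lin {as = ([ z ] ++ ([ a ] ++ ((r' ++ [ w ]) ++ i)))} {bs = (([ a ] ++ ((kQ ++ [ z ]) ++ cR)) ++ uQ)} (ct ⊹ gP ⊹ vis) (prove ((# 0 ⊕ # 1 ⊕ (# 2 ⊕ # 3) ⊕ # 4) ⊕ (# 5 ⊕ ε ⊕ # 6 ⊕ # 7) ⊕ # 0 ⊕ (# 1 ⊕ # 8) ⊕ # 9) (((# 1 ⊕ (# 8 ⊕ # 0) ⊕ # 9) ⊕ # 7) ⊕ (# 3 ⊕ # 0 ⊕ (# 1 ⊕ # 2) ⊕ # 4) ⊕ # 5 ⊕ # 6) ([ z ] ∷ [ a ] ∷ r' ∷ [ w ] ∷ i ∷ cP ∷ cS ∷ uQ ∷ kQ ∷ cR ∷  [])))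
          (long pkQ (λ q → ∷ʳ-≢[] r' (trans (sym (Lₚ.++-identityʳ _)) q)))
      where
      long : ∀ {l k u} → Pockets a l k u → l ≢ [] → 2 ≤ length (k ∷ʳ z)
      long nil n = ⊥-elim (n refl)
      long (cons {k = k} _ _ _ _) _ = s≤s (subst (1 ≤_) (sym (Lₚ.length-++ k)) (ℕₚ.m≤n+m 1 (length k)))
    from (r-corner (corner {ps₁} {ps₂} {Qv} {Qu} {B} {iZ} {kP} {uP} {cP} {kQ} {uQ} {cS} {cR} {cB} psE pkP pathP QE pkQ (_ , mw) vis _ kind visB Z ct)) =
      ⊥-elim (Unique-clash {xs = cS} {ys = (Qu ∷ʳ w) ++ cP ++ uP ++ uQ ++ init z ps₁ ++ iZ} (lin {as = ([ w ] ++ ([ z ] ++ (([ a ] ++ r') ++ i)))} {bs = (cS ++ ((Qu ++ [ w ]) ++ (cP ++ (uP ++ (uQ ++ ((init z ps₁) ++ iZ))))))} (ct) (prove ((# 0 ⊕ # 1 ⊕ (# 2 ⊕ # 3) ⊕ # 4) ⊕ # 5 ⊕ # 6 ⊕ # 7 ⊕ # 8 ⊕ # 9 ⊕ (# 10 ⊕ # 0) ⊕ # 11) ((# 7 ⊕ (# 10 ⊕ # 0) ⊕ # 5 ⊕ # 6 ⊕ # 8 ⊕ # 9 ⊕ # 11) ⊕ # 0 ⊕ # 1 ⊕ (# 2 ⊕ # 3) ⊕ # 4) ([ w ] ∷ [ z ] ∷ [ a ] ∷ r' ∷ i ∷ cP ∷ uP ∷ cS ∷ uQ ∷ init z ps₁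 ∷ Qu ∷ iZ ∷  []))) U₀
          mw (∈ₚ.∈-++⁺ˡ (∈-mid Qu)))
    from (r-chord C) = chord C
    from (r-both (at-end _ _ _ _ _ _ _ n _)) = ⊥-elim (n (here refl))
    from (r-both (at-mid _ _ _ _ _ _ _ _ n _)) = ⊥-elim (n (here refl))
    from (r-cut C) = ⊥-elim (Cut.x∉O C (here refl))

    root-run : Out z a (r' ∷ʳ w) i z y
    root-run = from result

  root-case : ∀ {N} → Solver N → Disk z a r i → r ≢ [] → length (z ∷ a ∷ r ++ i) ≤ N → Unique (z ∷ a ∷ r ++ i) →
    y ∈ z ∷ a ∷ r ++ i → y ≢ z → y ≢ a → Out z a r i z y
  root-case {r = r} S D ne len U my nz na with unsnoc r
  ... | inj₁ e = ⊥-elim (ne e)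
  ... | inj₂ (r' , w , refl) = RootRun.root-run S D len U my nz na

  -- Both end vertices are off the boundary: the whole boundary except q₀ is removed.
  module InnerTask {N : ℕ} (S : Solver N) (q₀ m : V) (ps₀ : Ls) (x₀ y₀ : V) (nx : x₀ ∉ [ q₀ ]) (ny : y₀ ∉ [ q₀ ]) where

    -- One path ends at the vertex `q₀` that was not removed. The other ends at a neighbour `t` of
    -- `m`, from where it can go on along the removed arc.
    Sol : V → V → Ls → Set
    Sol x y c = ∃[ t ] Adj t m × Two x y t q₀ c

    off : ∀ {v₀ v} → v₀ ∉ [ q₀ ] → Orig [ q₀ ] v₀ v → v ≢ q₀
    off n (inj₁ refl) e = n (here e)
    off n (inj₂ (_ , n')) e = n' (here e)

    fin : ∀ {zf ys iK x y L} → Disk zf q₀ ys iK → ys ∷ʳ zf ≡ L → Orig [ q₀ ] x₀ x → Orig [ q₀ ] y₀ y →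
        x ≢ y → x ∈ zf ∷ q₀ ∷ ys ++ iK → y ∈ zf ∷ q₀ ∷ ys ++ iK → Unique (zf ∷ q₀ ∷ ys ++ iK) →
        length (zf ∷ q₀ ∷ ys ++ iK) < N → Adj zf m → Final Sol q₀ zf ys iK x y
    fin {zf} {[]} {iK} {x} {y} K _ ox oy n mx my UK lt _ with no-digon K UK
    ... | refl = ⊥-elim (n (trans (is mx (off nx ox)) (sym (is my (off ny oy)))))
      where
      is : ∀ {v} → v ∈ zf ∷ q₀ ∷ [] → v ≢ q₀ → v ≡ zf
      is (here e) _ = e
      is (there (here e)) ne = ⊥-elim (ne e)
    fin {zf} {b ∷ ys} {iK} K _ ox oy n mx my UK lt h with S K (λ ()) lt UK mx my n (λ { (inj₁ (_ , q)) → off ny oy q ; (inj₂ (q , _)) → off nx ox q })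
    ... | out {kept} {unv} {ins} pk two ct _ = final {kept = kept ∷ʳ q₀} {ins = ins}
          (subst (λ l → Pockets q₀ l (kept ∷ʳ q₀) unv) (snoc-++ (b ∷ ys)) (pockets-perm (pockets-++ pk (last-∷ʳ q₀ (b ∷ ys)) (pockets-edge (root-adj K))) (prove (# 0 ⊕ ε) (# 0) (unv ∷  []))))
          (zf , h , two) (prove (# 0 ⊕ # 1 ⊕ # 2) ((# 1 ⊕ # 0) ⊕ # 2) ([ q₀ ] ∷ kept ∷ ins ∷  [])) ct

    task : Task N
    task = record { solve = S ; q₀ = q₀ ; O' = [] ; m₀ = m ; ps₀ = ps₀ ; x₀ = x₀ ; y₀ = y₀ ; Sol = Sol
        ; sol-extʳ = λ (t , h , T) P g → t , h , two-glueʳ T P g ; sol-extˡ = λ (t , h , T) P g → t , h , two-glueˡ T P g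
        ; sol-∈ˡ = λ (_ , _ , T) → two-∈ˡ T ; sol-∈ʳ = λ (_ , _ , T) → two-∈ʳ T ; absorb₁ = λ _ → absorb-vertex S ; absorb₂ = λ _ → absorb-edge S ; finish = fin }

  -- The pieces of a solution on both sides of the 2-path ph, q, pj are put together.
  assemble : ∀ {X₁ pi β pj Y rD iD ps₂ m kP uP cP cI t cS kQ cR} → Detour z a X₁ pi β pj Y rD iD →
    Pockets pi ps₂ kP uP → Path pi m cP → cP ↭ (pi ∷ kP) ++ cI → Adj t m → Adj m pj → last pi ps₂ ≡ m → Two x y t pj cS → cS ↭ (pj ∷ kQ) ++ cR →
    a ∷ r ∷ʳ z ≡ X₁ ++ pi ∷ ps₂ ++ pj ∷ Y → Y ≢ [] →
    (∀ {cE uL uR} → z ∷ a ∷ rD ++ iD ↭ β ∷ cE ++ uL ++ uR → (z ∷ a ∷ r ++ i) ++ pi ∷ pj ∷ [] ↭ (cE ++ uL ++ uR) ++ (cP ++ uP) ++ cS) →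
    Out z a r i x y
  assemble {z} {a} {r = r} {i} {X₁} {pi} {β} {pj} {Y} {ps₂ = ps₂} {m} {kP} {uP} {cP} {cI} {t} {cS} {kQ} {cR}
    (detour {lp} {kL} {uL} {kR} {uR} {cE} {ins} first left right two keeps ct) pkP pathP visP h h' em sol vis arc Y≢[] bal =
    out {kept = kL ++ kP ++ pj ∷ kR} {uL ++ uP ++ uR} {ins ++ cI ++ kQ ++ cR}
      (subst (λ l → Pockets a l (kL ++ kP ++ pj ∷ kR) (uL ++ uP ++ uR)) (sym eL) (pockets-++ left lastp (pockets-++ pkP em (pockets-++ (pockets-edge h') refl right))))
      (two-two two (two-extend sol h (path-rev pathP)) (lin {as = (cE ++ (cS ++ cP))} {bs = ([ pi ] ++ ([ pj ] ++ ([ a ] ++ ((kL ++ (kP ++ ([ pj ] ++ kR))) ++ (ins ++ (cI ++ (kQ ++ cR)))))))} (keeps ⊹ vis ⊹ visP) (prove ((# 0 ⊕ # 1 ⊕ # 2) ⊕ ((# 3 ⊕ # 4) ⊕ (# 5 ⊕ # 6) ⊕ # 7) ⊕ ((# 5 ⊕ # 8) ⊕ # 9) ⊕ (# 10 ⊕ # 11) ⊕ # 12) ((# 10 ⊕ # 5 ⊕ # 3 ⊕ (# 4 ⊕ # 11 ⊕ # 5 ⊕ # 6) ⊕ # 7 ⊕ # 12 ⊕ # 8 ⊕ # 9) ⊕ # 0 ⊕ # 1 ⊕ # 2) (cE ∷ cS ∷ cP ∷ [ a ] ∷ kL ∷ [ pj ] ∷ kR ∷ ins ∷ kQ ∷ cR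 ∷ [ pi ] ∷ kP ∷ cI ∷  []))))
      (lin {as = ([ z ] ++ ([ a ] ++ (r ++ i)))} {bs = (([ a ] ++ ((kL ++ (kP ++ ([ pj ] ++ kR))) ++ (ins ++ (cI ++ (kQ ++ cR))))) ++ (uL ++ (uP ++ uR)))} (((bal {cE} {uL} {uR} ct)) ⊹ keeps ⊹ vis ⊹ visP) (prove ((# 0 ⊕ # 1 ⊕ # 2 ⊕ # 3) ⊕ ((# 4 ⊕ # 5 ⊕ # 6) ⊕ (# 7 ⊕ # 8) ⊕ # 9) ⊕ ((# 1 ⊕ # 10) ⊕ (# 11 ⊕ # 12) ⊕ # 13) ⊕ ((# 11 ⊕ # 14) ⊕ # 15) ⊕ (# 16 ⊕ # 17) ⊕ # 18) (((# 1 ⊕ (# 10 ⊕ # 17 ⊕ # 11 ⊕ # 12) ⊕ # 13 ⊕ # 18 ⊕ # 14 ⊕ # 15) ⊕ # 5 ⊕ # 8 ⊕ # 6) ⊕ ((# 0 ⊕ # 1 ⊕ # 2 ⊕ # 3) ⊕ # 16 ⊕ # 11 ⊕ ε) ⊕ # 4 ⊕ # 9 ⊕ # 7) ([ z ] ∷ [ a ] ∷ r ∷ i ∷ cE ∷ uL ∷ uR ∷ cP ∷ uP ∷ cS ∷ kL ∷ [ pj ] ∷ kR ∷ ins ∷ kQ ∷ cR ∷ [ pi ] ∷ kP ∷ cI ∷  [])))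
      (subst (2 ≤_) (sym (Lₚ.length-++ kL)) (ℕₚ.≤-trans (subst (2 ≤_) (sym (Lₚ.length-++ kP)) (ℕₚ.≤-trans (s≤s (long right Y≢[])) (ℕₚ.m≤n+m _ (length kP)))) (ℕₚ.m≤n+m _ (length kL))))
    where
    long : ∀ {l k u} → Pockets pj l k u → l ≢ [] → 1 ≤ length k
    long nil n = ⊥-elim (n refl)
    long (cons _ _ _ _) _ = s≤s z≤n
    eL : r ∷ʳ z ≡ lp ++ ps₂ ++ pj ∷ Y
    eL = Lₚ.∷-injectiveʳ (trans arc (trans (sym (Lₚ.++-assoc X₁ [ pi ] _)) (cong (_++ (ps₂ ++ pj ∷ Y)) first)))
    lastp : last a lp ≡ pi
    lastp = proj₂ (∷ʳ-inj (init a lp) X₁ (trans (sym (init-last a lp)) (sym first)))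

  last-++-last : ∀ h (xs : Ls) {ys} → last h (xs ++ ys) ≡ last (last h xs) ys
  last-++-last h [] = refl
  last-++-last h (x ∷ xs) = last-++-last x xs

  module InnerRun {N : ℕ} (S : Solver N) {z a : V} {r i : Ls} {x y : V} (D : Disk z a r i) (len : length (z ∷ a ∷ r ++ i) ≤ N)
    (U : Unique (z ∷ a ∷ r ++ i)) (ne : r ≢ []) (xi : x ∈ i) (yi : y ∈ i) (n : x ≢ y) where

    x∉ : ∀ {v} → v ∈ i → v ∉ z ∷ a ∷ r
    x∉ m m' = Unique-clash {xs = z ∷ a ∷ r} ↭-refl U m' m

    chord-out : ∀ {s t X Y mid rA iA iB} → Disk z a rA iA → Disk t s mid iB → a ∷ r ∷ʳ z ≡ X ++ s ∷ mid ++ t ∷ Y → a ∷ rA ∷ʳ z ≡ X ++ s ∷ t ∷ Y →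
      mid ≢ [] → i ↭ iA ++ iB → rA ≢ [] ⊎ iA ≢ [] → Out z a r i x y
    chord-out {X = X} {Y} DA DB arc short mn ints proper = ChordCase.chord-case S {X = X} {Y = Y} len U DA DB arc short mn ints proper (∈ₚ.∈-++⁺ʳ (z ∷ a ∷ r) xi) (∈ₚ.∈-++⁺ʳ (z ∷ a ∷ r) yi) n
      (λ { (inj₁ (q , _)) → x∉ xi (here q) ; (inj₂ (q , _)) → x∉ xi (there (here q)) })

    MyCut : Set
    MyCut = Cut [ z ] z a r r i x y

    size : MyCut → ℕ
    size C = length (C.q ∷ C.ph ∷ (C.mid ∷ʳ C.pj) ++ C.iF)
      where module C = Cut C

    -- Within `F` the arc `ph`, `mid` is removed and `pj` is spared, so one path leaves `F` at `pj`
    -- and the other one through the arc. A detour around `q` in `E` leads them to the root, as `q`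
    -- is visited from inside.
    module CutRun (C : MyCut) where
      open Cut C
      m : V
      m = last ph mid
      garc : a ∷ r ∷ʳ z ↭ X ++ ph ∷ mid ++ pj ∷ Y
      garc = ↭-reflexive arc
      garcE : a ∷ rE ∷ʳ z ↭ X ++ ph ∷ q ∷ pj ∷ Y
      garcE = ↭-reflexive arcE
      vF : (q ∷ ph ∷ (mid ∷ʳ pj) ++ iF) ++ X ++ Y ++ iE ↭ z ∷ a ∷ r ++ i
      vF = (lin {as = (([ q ] ++ ([ ph ] ++ ((mid ++ [ pj ]) ++ iF))) ++ (X ++ (Y ++ iE)))} {bs = ([ z ] ++ ([ a ] ++ (r ++ i)))} ((↭-sym garc) ⊹ (↭-sym ints)) (prove (((# 0 ⊕ # 1 ⊕ (# 2 ⊕ # 3) ⊕ # 4) ⊕ # 5 ⊕ # 6 ⊕ # 7) ⊕ (# 8 ⊕ # 9 ⊕ # 10) ⊕ # 11) ((# 10 ⊕ # 8 ⊕ # 9 ⊕ # 11) ⊕ (# 5 ⊕ # 1 ⊕ # 2 ⊕ # 3 ⊕ # 6) ⊕ # 0 ⊕ # 4 ⊕ # 7) ([ q ] ∷ [ ph ] ∷ mid ∷ [ pj ] ∷ iF ∷ X ∷ Y ∷ iE ∷ [ a ] ∷ r ∷ [ z ] ∷ i ∷  [])))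
      UF : Unique (q ∷ ph ∷ (mid ∷ʳ pj) ++ iF)
      UF = Unique-sub vF U
      lenF : length (q ∷ ph ∷ (mid ∷ʳ pj) ++ iF) ≤ N
      lenF = ℕₚ.≤-trans (≤-++ˡ (q ∷ ph ∷ (mid ∷ʳ pj) ++ iF)) (subst (_≤ N) (sym (↭-length vF)) len)
      vE : (z ∷ a ∷ rE ++ iE) ++ mid ++ iF ↭ z ∷ a ∷ r ++ i
      vE = (lin {as = (([ z ] ++ ([ a ] ++ (rE ++ iE))) ++ (mid ++ iF))} {bs = ([ z ] ++ ([ a ] ++ (r ++ i)))} ((↭-sym garc) ⊹ garcE ⊹ (↭-sym ints)) (prove (((# 0 ⊕ # 1 ⊕ # 2 ⊕ # 3) ⊕ # 4 ⊕ # 5) ⊕ (# 1 ⊕ # 6 ⊕ # 0) ⊕ (# 7 ⊕ # 8 ⊕ # 9 ⊕ # 10 ⊕ # 11) ⊕ # 12) ((# 0 ⊕ # 1 ⊕ # 6 ⊕ # 12) ⊕ (# 7 ⊕ # 8 ⊕ # 4 ⊕ # 10 ⊕ # 11) ⊕ (# 1 ⊕ # 2 ⊕ # 0) ⊕ # 9 ⊕ # 5 ⊕ # 3) ([ z ] ∷ [ a ] ∷ rE ∷ iE ∷ mid ∷ iF ∷ r ∷ X ∷ [ ph ] ∷ [ q ] ∷ [ pj ] ∷ Y ∷ i ∷  [])))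
      not-pj : ∀ {v} → v ∈ q ∷ iF → v ∉ [ pj ]
      not-pj mv (here refl) = Unique-clash {xs = q ∷ iF} {ys = pj ∷ ph ∷ mid} (prove (# 0 ⊕ # 1 ⊕ (# 2 ⊕ # 3) ⊕ # 4) ((# 0 ⊕ # 4) ⊕ # 3 ⊕ # 1 ⊕ # 2) ([ q ] ∷ [ ph ] ∷ mid ∷ [ pj ] ∷ iF ∷  [])) UF mv (here refl)
      Y≢[] : Y ≢ []
      Y≢[] e = Unique-clash {xs = [ z ]} ↭-refl U (here refl) (∈ₚ.∈-++⁺ˡ {xs = a ∷ r} (subst (_∈ a ∷ r) pj≡z pj∈))
        where
        pj≡z : pj ≡ z
        pj≡z = sym (proj₂ (∷ʳ-inj (a ∷ r) (X ++ ph ∷ mid) (trans arc (trans (cong (λ l → X ++ ph ∷ mid ++ pj ∷ l) e) (sym (Lₚ.++-assoc X _ _))))))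

      open InnerTask S pj m mid x y (not-pj x∈) (not-pj y∈) public using (task)
      open Run task public using (Res; r-none; r-corner; r-chord; r-both; r-cut; None; none; Corner; corner; Both; at-end; at-mid; Kind; cutvertex; cutedge)

      result : Res q ph mid [ pj ] [ q ] (mid ∷ʳ pj) iF x y
      result = Loop.run task {ps = mid} {[ pj ]} {[ q ]} F refl refl refl (λ m → m) UF lenF (inj₁ refl) (inj₁ refl) n (there x∈) (there y∈)

      m-pj : Adj m pj
      m-pj = boundary-adj F (init ph mid) (trans (cong (ph ∷_) (snoc-++ mid)) (trans (cong (_++ pj ∷ [ q ]) (init-last ph mid)) (Lₚ.++-assoc (init ph mid) _ _)))

      from-none : None q ph mid [ q ] (mid ∷ʳ pj) iF x y → Out z a r i x y
      from-none (none {kP} {uP} {cP} {kQ} {uQ} {cS} {cR} {cI} pkP pathP pkQ (t , h , sol) vis visP ct) with single-pocket pkQ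
      ... | refl , D₂ = assemble {kQ = [ q ]} {cR = cR} (make-detour S E arcE (ℕₚ.≤-trans (≤-++ˡ (z ∷ a ∷ rE ++ iE)) (subst (_≤ N) (sym (↭-length vE)) len)) (Unique-sub vE U))
            pkP pathP visP h m-pj refl sol vis arc Y≢[] (λ {cE} {uL} {uR} ctE → (lin {as = (([ z ] ++ ([ a ] ++ (r ++ i))) ++ ([ ph ] ++ ([ pj ] ++ [])))} {bs = ((cE ++ (uL ++ uR)) ++ ((cP ++ uP) ++ cS))} (ctE ⊹ garc ⊹ (↭-sym garcE) ⊹ ints ⊹ ct ⊹ gu) (prove (((# 0 ⊕ # 1 ⊕ # 2 ⊕ # 3) ⊕ # 4 ⊕ # 5 ⊕ ε) ⊕ (# 6 ⊕ # 7 ⊕ # 8 ⊕ # 9) ⊕ (# 10 ⊕ # 4 ⊕ # 11 ⊕ # 5 ⊕ # 12) ⊕ (# 1 ⊕ # 13 ⊕ # 0) ⊕ (# 6 ⊕ # 14 ⊕ # 15) ⊕ (# 16 ⊕ # 17 ⊕ # 18 ⊕ # 19) ⊕ ε) (((# 7 ⊕ # 8 ⊕ # 9) ⊕ (# 16 ⊕ # 17) ⊕ # 18) ⊕ (# 0 ⊕ # 1 ⊕ # 13 ⊕ # 15) ⊕ (# 1 ⊕ # 2 ⊕ # 0) ⊕ (# 10 ⊕ # 4 ⊕ # 6 ⊕ # 5 ⊕ # 12) ⊕ # 3 ⊕ (# 6 ⊕ # 4 ⊕ (# 11 ⊕ # 5) ⊕ # 14) ⊕ # 19) ([ z ] ∷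 [ a ] ∷ r ∷ i ∷ [ ph ] ∷ [ pj ] ∷ [ q ] ∷ cE ∷ uL ∷ uR ∷ X ∷ mid ∷ Y ∷ rE ∷ iF ∷ iE ∷ cP ∷ uP ∷ cS ∷ uQ ∷  []))))
        where
        gu : uQ ↭ []
        gu = ↭-reflexive (no-digon D₂ (Unique-sub {ys = cP ++ uP ++ cR} (lin {as = (([ q ] ++ ([ pj ] ++ uQ)) ++ (cP ++ (uP ++ cR)))} {bs = ([ q ] ++ ([ ph ] ++ ((mid ++ [ pj ]) ++ iF)))} ((↭-sym ct) ⊹ (↭-sym vis)) (prove (((# 0 ⊕ # 1 ⊕ # 2) ⊕ # 3 ⊕ # 4 ⊕ # 5) ⊕ (# 0 ⊕ # 6 ⊕ (# 7 ⊕ # 1) ⊕ # 8) ⊕ # 9) ((# 0 ⊕ # 6 ⊕ (# 7 ⊕ # 1) ⊕ # 8) ⊕ (# 3 ⊕ # 4 ⊕ # 9 ⊕ # 2) ⊕ (# 1 ⊕ # 0) ⊕ # 5) ([ q ] ∷ [ pj ] ∷ uQ ∷ cP ∷ uP ∷ cR ∷ [ ph ] ∷ mid ∷ iF ∷ cS ∷  []))) UF))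

      -- This corner contains `q`, so it is given back to the outer side instead of being absorbed.
      -- In the refilled disk `E'` the vertex `β`, visited from inside, takes the place of `q`, and
      -- the detour is made around `β`.
      from-corner : ∀ {ps₁ ps₂ β iZ kP uP cP kQ uQ cS cR cB cI} → mid ≡ ps₁ ++ ps₂ → Pockets (last ph ps₁) ps₂ kP uP → Path (last ph ps₁) m cP → Pockets pj [] kQ uQ →
        (∃[ t ] Adj t m × Two x y t pj cS) → cS ↭ (pj ∷ kQ) ++ cR → cP ↭ (last ph ps₁ ∷ kP) ++ cI → cS ↭ (β ∷ pj ∷ []) ++ cB →
        Disk q ph (ps₁ ++ (β ∷ pj ∷ []) ++ []) iZ → q ∷ ph ∷ (mid ∷ʳ pj) ++ iF ↭ cP ++ uP ++ cS ++ uQ ++ init ph ps₁ ++ [ q ] ++ iZ → Out z a r i x y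
      from-corner {ps₁} {ps₂} {β} {iZ} {kP} {uP} {cP} {kQ} {uQ} {cS} {cR} {cB} {cI} psE pkP pathP pkQ (t , h , sol) vis visP visB Z ct with pockets-nil pkQ | reframe X mid arc (ps₁ ∷ʳ β) | ∈→↭ (path-∈ˡ pathP)
      ... | refl , refl | R , eR | cP' , gP = assemble {kQ = []} {cR = cR} (make-detour S E' eE (ℕₚ.≤-trans (≤-++ˡ (z ∷ a ∷ R ++ q ∷ iZ ++ iE)) (subst (_≤ N) (sym (↭-length vE')) len)) (Unique-sub vE' U))
            pkP pathP visP h m-pj (trans (sym (last-++-last ph ps₁)) (cong (last ph) (sym psE))) sol vis arc' Y≢[]
            (λ {cE} {uL} {uR} ctE → (lin {as = (([ z ] ++ ([ a ] ++ (r ++ i))) ++ ([ last ph ps₁ ] ++ ([ pj ] ++ [])))} {bs = ((cE ++ (uL ++ uR)) ++ ((cP ++ uP) ++ cS))} (ctE ⊹ (↭-sym vE') ⊹ (↭-sym gP) ⊹ (↭-sym visB)) (prove (((# 0 ⊕ # 1 ⊕ # 2 ⊕ # 3) ⊕ # 4 ⊕ # 5 ⊕ ε) ⊕ (# 6 ⊕ # 7 ⊕ # 8 ⊕ # 9) ⊕ ((# 0 ⊕ # 1 ⊕ # 10 ⊕ # 11 ⊕ # 12 ⊕ # 13) ⊕ # 14 ⊕ # 15 ⊕ # 16) ⊕ # 17 ⊕ # 18) (((# 7 ⊕ # 8 ⊕ # 9) ⊕ (# 17 ⊕ # 15) ⊕ # 18) ⊕ (# 0 ⊕ # 1 ⊕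 # 10 ⊕ # 11 ⊕ # 12 ⊕ # 13) ⊕ (# 0 ⊕ # 1 ⊕ # 2 ⊕ # 3) ⊕ (# 4 ⊕ # 14) ⊕ (# 6 ⊕ # 5 ⊕ ε) ⊕ # 16) ([ z ] ∷ [ a ] ∷ r ∷ i ∷ [ last ph ps₁ ] ∷ [ pj ] ∷ [ β ] ∷ cE ∷ uL ∷ uR ∷ R ∷ [ q ] ∷ iZ ∷ iE ∷ cP' ∷ uP ∷ cB ∷ cP ∷ cS ∷  []))))
        where
        E' : Disk z a R (q ∷ iZ ++ iE)
        E' = fill (ps₁ ∷ʳ β) (subst (λ l → Disk q ph l iZ) (sym (Lₚ.++-assoc ps₁ _ _)) Z) eR
        eE : a ∷ R ∷ʳ z ≡ (X ++ init ph ps₁) ++ last ph ps₁ ∷ β ∷ pj ∷ Y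
        eE = trans eR (trans (cong (X ++_) (trans (cong (ph ∷_) (Lₚ.++-assoc ps₁ _ _)) (trans (cong (_++ β ∷ pj ∷ Y) (init-last ph ps₁)) (Lₚ.++-assoc (init ph ps₁) _ _)))) (sym (Lₚ.++-assoc X _ _)))
        arc' : a ∷ r ∷ʳ z ≡ (X ++ init ph ps₁) ++ last ph ps₁ ∷ ps₂ ++ pj ∷ Y
        arc' = trans arc (trans (cong (X ++_) (trans (cong (λ l → ph ∷ l ++ pj ∷ Y) psE) (trans (cong (ph ∷_) (Lₚ.++-assoc ps₁ _ _)) (trans (cong (_++ ps₂ ++ pj ∷ Y) (init-last ph ps₁)) (Lₚ.++-assoc (init ph ps₁) _ _))))) (sym (Lₚ.++-assoc X _ _)))
        gR : a ∷ R ∷ʳ z ↭ X ++ ph ∷ (ps₁ ∷ʳ β) ++ pj ∷ Y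
        gR = ↭-reflexive eR
        gi : ph ∷ ps₁ ↭ init ph ps₁ ∷ʳ last ph ps₁
        gi = ↭-reflexive (init-last ph ps₁)
        vE' : (z ∷ a ∷ R ++ q ∷ iZ ++ iE) ++ cP' ++ uP ++ cB ↭ z ∷ a ∷ r ++ i
        vE' = (lin {as = (([ z ] ++ ([ a ] ++ (R ++ ([ q ] ++ (iZ ++ iE))))) ++ (cP' ++ (uP ++ cB)))} {bs = ([ z ] ++ ([ a ] ++ (r ++ i)))} (gR ⊹ (↭-sym garc) ⊹ (↭-sym ints) ⊹ (↭-sym ct) ⊹ (↭-sym gP) ⊹ (↭-sym visB) ⊹ gi) (prove (((# 0 ⊕ # 1 ⊕ # 2 ⊕ # 3 ⊕ # 4 ⊕ # 5) ⊕ # 6 ⊕ # 7 ⊕ # 8) ⊕ (# 9 ⊕ # 10 ⊕ (# 11 ⊕ # 12) ⊕ # 13 ⊕ # 14) ⊕ (# 1 ⊕ # 15 ⊕ # 0) ⊕ # 16 ⊕ (# 3 ⊕ # 10 ⊕ (# 17 ⊕ # 13) ⊕ # 18) ⊕ # 19 ⊕ # 20 ⊕ # 21 ⊕ # 22) ((# 0 ⊕ # 1 ⊕ # 15 ⊕ # 16) ⊕ (# 1 ⊕ # 2 ⊕ # 0) ⊕ (# 9 ⊕ # 10 ⊕ # 17 ⊕ # 13 ⊕ # 14) ⊕ (# 3 ⊕ # 18 ⊕ # 5) ⊕ (# 19 ⊕ # 7 ⊕ # 20 ⊕ ε ⊕ # 21 ⊕ # 3 ⊕ # 4) ⊕ (#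 22 ⊕ # 6) ⊕ ((# 12 ⊕ # 13 ⊕ ε) ⊕ # 8) ⊕ # 10 ⊕ # 11) ([ z ] ∷ [ a ] ∷ R ∷ [ q ] ∷ iZ ∷ iE ∷ cP' ∷ uP ∷ cB ∷ X ∷ [ ph ] ∷ ps₁ ∷ [ β ] ∷ [ pj ] ∷ Y ∷ r ∷ i ∷ mid ∷ iF ∷ cP ∷ cS ∷ init ph ps₁ ∷ [ last ph ps₁ ] ∷  [])))

      -- A decomposition of the boundary of F away from q is one of the boundary of the whole disk.
      inside : ∀ X' {s w Y'} M → w ≢ q → ph ∷ (mid ∷ʳ pj) ∷ʳ q ≡ X' ++ s ∷ M ++ w ∷ Y' →
        ∃[ Y'' ] Y' ≡ Y'' ∷ʳ q × ph ∷ mid ∷ʳ pj ≡ X' ++ s ∷ M ++ w ∷ Y'' × a ∷ r ∷ʳ z ≡ (X ++ X') ++ s ∷ M ++ w ∷ Y'' ++ Y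
      inside X' {s} {w} {Y'} M nw e with unsnoc Y'
      ... | inj₁ refl = ⊥-elim (nw (sym (proj₂ (∷ʳ-inj (ph ∷ mid ∷ʳ pj) (X' ++ s ∷ M) (trans e (sym (Lₚ.++-assoc X' (s ∷ M) _)))))))
      ... | inj₂ (Y'' , q' , refl) with ∷ʳ-inj (ph ∷ mid ∷ʳ pj) (X' ++ s ∷ M ++ w ∷ Y'') (trans e (trans (cong (λ l → X' ++ s ∷ l) (sym (Lₚ.++-assoc M _ _))) (sym (Lₚ.++-assoc X' _ _))))
      ... | e' , refl = Y'' , refl , e' , trans arc (trans (cong (X ++_) (trans (cong (ph ∷_) (sym (Lₚ.++-assoc mid _ _))) (trans (cong (_++ Y) e') (trans (Lₚ.++-assoc X' _ _) (cong (λ l → X' ++ s ∷ l) (Lₚ.++-assoc M _ _)))))) (sym (Lₚ.++-assoc X _ _)))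

      -- Disks with boundary agreeing with that of F from w on are filled in.
      put : ∀ X' {s w Y'' M R M' j} → ph ∷ mid ∷ʳ pj ≡ X' ++ s ∷ M ++ w ∷ Y'' → Disk q ph R j → ph ∷ R ∷ʳ q ≡ X' ++ s ∷ M' ++ w ∷ Y'' ∷ʳ q →
        ∀ {R'} → a ∷ R' ∷ʳ z ≡ (X ++ X') ++ s ∷ M' ++ w ∷ Y'' ++ Y → Disk z a R' (q ∷ j ++ iE)
      put X' {s} {w} {Y''} {M} {R} {M'} {j} e₀ W e₁ {R'} e₂ with reframe X' M e₀ M'
      ... | R₀ , e₃ = fill R₀ (subst (λ l → Disk q ph l j) R≡ W) (trans e₂ (trans (Lₚ.++-assoc X _ _) (cong (X ++_) e₄)))
        where
        R≡ : R ≡ R₀ ∷ʳ pj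
        R≡ = Lₚ.∷-injectiveʳ (proj₁ (∷ʳ-inj (ph ∷ R) (ph ∷ R₀ ∷ʳ pj) (trans e₁ (trans (cong (λ l → X' ++ s ∷ l) (sym (Lₚ.++-assoc M' _ _))) (trans (sym (Lₚ.++-assoc X' _ _)) (cong (_∷ʳ q) (sym e₃)))))))
        e₄ : X' ++ s ∷ M' ++ w ∷ Y'' ++ Y ≡ ph ∷ R₀ ++ pj ∷ Y
        e₄ = trans (cong (λ l → X' ++ s ∷ l) (sym (Lₚ.++-assoc M' _ _))) (trans (sym (Lₚ.++-assoc X' _ _)) (trans (cong (_++ Y) (sym e₃)) (cong (ph ∷_) (Lₚ.++-assoc R₀ _ _))))

      ≢q : ∀ {w} → w ∈ (ph ∷ mid) ++ [ pj ] → w ≢ q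
      ≢q mw refl = Unique-clash {xs = [ q ]} ↭-refl UF (here refl) (∈ₚ.∈-++⁺ˡ {xs = ph ∷ mid ∷ʳ pj} mw)

      from-chord : Chord [ pj ] q ph mid (mid ∷ʳ pj) iF → Out z a r i x y
      from-chord K with inside K.X K.mid (≢q K.t∈) K.arc
        where module K = Chord K
      ... | Y'' , eY , e' , e'' with reframe (X ++ Chord.X K) (Chord.mid K) e'' []
      ... | R , eR = chord-out (put K.X {M' = []} e' K.DA (trans K.short (cong (λ l → K.X ++ K.s ∷ K.t ∷ l) eY)) eR) K.DB e'' eR K.mid≢[]
           (lin {as = i} {bs = (([ q ] ++ (K.iA ++ iE)) ++ K.iB)} (ints ⊹ K.ints) (prove (# 0 ⊕ (# 1 ⊕ # 2 ⊕ # 3) ⊕ # 4 ⊕ # 5) (((# 1 ⊕ # 4 ⊕ # 3) ⊕ # 5) ⊕ # 0 ⊕ # 2) (i ∷ [ q ] ∷ iF ∷ iE ∷ K.iA ∷ K.iB ∷  []))) (inj₂ λ ())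
        where module K = Chord K

      on-arc : ∀ {v} → v ∈ ph ∷ mid → v ∈ a ∷ r
      on-arc {v} mv with unsnoc Y
      ... | inj₁ e = ⊥-elim (Y≢[] e)
      ... | inj₂ (Y₀ , z' , refl) with ∷ʳ-inj (a ∷ r) (X ++ ph ∷ mid ++ pj ∷ Y₀) (trans arc (trans (cong (λ l → X ++ ph ∷ l) (sym (Lₚ.++-assoc mid _ _))) (sym (Lₚ.++-assoc X _ _))))
      ... | e , refl = subst (v ∈_) (sym e) (∈ₚ.∈-++⁺ʳ X (∈ₚ.∈-++⁺ˡ {xs = ph ∷ mid} mv))

      Smaller : Set
      Smaller = Σ[ C' ∈ MyCut ] size C' < size C

      -- The 2-path can be moved to `ph`, `q`, `pj'` with an earlier arc vertex `pj'`. The region in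
      -- between is pasted onto `E`, and the inner disk shrinks.
      from-both : Both q ph mid [ pj ] iF x y → Smaller
      from-both (at-mid {Q₁ = []} _ refl _ _ _ _ _ nq _ _) = ⊥-elim (nq (here refl))
      from-both (at-mid {Q₁ = _ ∷ Q₁} _ e _ _ _ _ _ _ _ _) = ⊥-elim (∷ʳ-≢[] Q₁ (sym (Lₚ.∷-injectiveʳ e)))
      from-both (at-end {ps₁} {ps₂} {iF'} {iR} psE F' R g mx my _ _ _) with unsnoc ps₁
      ... | inj₁ refl = ⊥-elim (point F' mx my (no-digon F' (Unique-sub {ys = (mid ∷ʳ pj) ++ iR} (lin {as = (([ q ] ++ ([ ph ] ++ iF')) ++ ((mid ++ [ pj ]) ++ iR))} {bs = ([ q ] ++ ([ ph ] ++ ((mid ++ [ pj ]) ++ iF)))} ((↭-sym g)) (prove (((# 0 ⊕ # 1 ⊕ # 2) ⊕ (# 3 ⊕ # 4) ⊕ # 5) ⊕ # 6) ((# 0 ⊕ # 1 ⊕ (# 3 ⊕ # 4) ⊕ # 6) ⊕ # 2 ⊕ # 5) ([ q ] ∷ [ ph ] ∷ iF' ∷ mid ∷ [ pj ] ∷ iR ∷ iF ∷  []))) UF)))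
        where
        point : ∀ {j} → Disk q ph [] j → x ∈ q ∷ j → y ∈ q ∷ j → j ≡ [] → ⊥
        point _ (here refl) (here refl) refl = n refl
      ... | inj₂ (mid' , pj' , refl) = rest (reframe X mid' arc' [ q ])
        where
        R₀ : Disk q pj' (ps₂ ∷ʳ pj) iR
        R₀ = subst (λ v → Disk q v (ps₂ ∷ʳ pj) iR) (last-∷ʳ ph mid') R
        R₁ : Disk pj q (pj' ∷ ps₂) iR
        R₁ = rotate∘ (q ∷ pj' ∷ ps₂) [ pj ] R₀
        midE : mid ≡ mid' ++ pj' ∷ ps₂
        midE = trans psE (Lₚ.++-assoc mid' _ _)
        gm : mid ↭ mid' ++ pj' ∷ ps₂
        gm = ↭-reflexive midE
        arc' : a ∷ r ∷ʳ z ≡ X ++ ph ∷ mid' ++ pj' ∷ ps₂ ++ pj ∷ Y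
        arc' = trans arc (cong (λ l → X ++ ph ∷ l) (trans (cong (_++ pj ∷ Y) midE) (Lₚ.++-assoc mid' _ _)))
        fill' : ∀ T {j R'} → Disk q ph (T ∷ʳ pj') j → a ∷ R' ∷ʳ z ≡ X ++ ph ∷ T ++ pj' ∷ ps₂ ++ pj ∷ Y → Disk z a R' (q ∷ j ++ iE ++ iR)
        fill' T {j} W e = permute (prove (# 0 ⊕ (# 1 ⊕ # 2) ⊕ # 3) (# 0 ⊕ # 1 ⊕ # 3 ⊕ # 2) ([ q ] ∷ j ∷ iR ∷ iE ∷  [])) (fill (T ++ pj' ∷ ps₂)
          (pasteAt W (ph ∷ T) (cong (ph ∷_) (snoc-++ T)) R₀ (cong (ph ∷_) (trans (cong (_∷ʳ q) (snoc-++ T)) (snoc-++ T))))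
          (trans e (cong (λ l → X ++ ph ∷ l) (sym (Lₚ.++-assoc T _ _)))))
        rest : ∃[ R' ] a ∷ R' ∷ʳ z ≡ X ++ ph ∷ q ∷ pj' ∷ ps₂ ++ pj ∷ Y → Smaller
        rest (R' , e₁) = record { F = F' ; E = pasteAt E (X ∷ʳ ph) (trans arcE (sym (Lₚ.++-assoc X _ _))) R₁ (trans e₁ (sym (Lₚ.++-assoc X _ _)))
          ; arc = arc' ; arcE = e₁ ; ints = (lin {as = i} {bs = ([ q ] ++ (iF' ++ (iE ++ iR)))} (ints ⊹ g) (prove (# 0 ⊕ (# 1 ⊕ # 2 ⊕ # 3) ⊕ # 4 ⊕ # 5) ((# 1 ⊕ # 4 ⊕ # 3 ⊕ # 5) ⊕ # 0 ⊕ # 2) (i ∷ [ q ] ∷ iF ∷ iE ∷ iF' ∷ iR ∷  [])))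
          ; fill = fill' ; x∈ = mx ; y∈ = my ; x∉O = x∉O ; y∉O = y∉O ; q∉O = q∉O ; pj∈ = on-arc (there (subst (pj' ∈_) (sym midE) (∈-mid mid'))) } ,
          length-↭-< {xs = q ∷ ph ∷ (mid' ∷ʳ pj') ++ iF'} {ys = ps₂ ++ iR} (lin {as = ([ q ] ++ ([ ph ] ++ ((mid ++ [ pj ]) ++ iF)))} {bs = ([ pj ] ++ (([ q ] ++ ([ ph ] ++ ((mid' ++ [ pj' ]) ++ iF'))) ++ (ps₂ ++ iR)))} (g ⊹ gm) (prove ((# 0 ⊕ # 1 ⊕ (# 2 ⊕ # 3) ⊕ # 4) ⊕ (# 5 ⊕ # 6) ⊕ # 7 ⊕ # 8 ⊕ # 9) ((# 3 ⊕ (# 0 ⊕ # 1 ⊕ (# 7 ⊕ # 8) ⊕ # 5) ⊕ # 9 ⊕ # 6) ⊕ # 4 ⊕ # 2) ([ q ] ∷ [ ph ] ∷ mid ∷ [ pj ] ∷ iF ∷ iF' ∷ iR ∷ mid' ∷ [ pj' ] ∷ ps₂ ∷  [])))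

      -- A cut of `F` is a cut of the whole disk with a smaller inner side; `q` passes to the outer
      -- side.
      from-cut : Cut [ pj ] q ph mid (mid ∷ʳ pj) iF x y → Smaller
      from-cut K with inside K.X K.mid (≢q (∈ₚ.∈-++⁺ˡ K.pj∈)) K.arc
        where module K = Cut K
      ... | Y'' , eY , e' , e'' = rest (reframe (X ++ K.X) K.mid e'' [ K.q ])
        where
        module K = Cut K
        ge : ph ∷ mid ∷ʳ pj ↭ K.X ++ K.ph ∷ K.mid ++ K.pj ∷ Y''
        ge = ↭-reflexive e'
        fill' : ∀ T {j R'} → Disk K.q K.ph (T ∷ʳ K.pj) j → a ∷ R' ∷ʳ z ≡ (X ++ K.X) ++ K.ph ∷ T ++ K.pj ∷ Y'' ++ Y → Disk z a R' (K.q ∷ j ++ q ∷ K.iE ++ iE)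
        fill' T {j} W e with reframe K.X K.mid K.arc T
        ... | R₀ , e₀ = permute (prove (# 0 ⊕ (# 1 ⊕ # 2 ⊕ # 3) ⊕ # 4) (# 1 ⊕ # 2 ⊕ # 0 ⊕ # 3 ⊕ # 4) ([ q ] ∷ [ K.q ] ∷ j ∷ K.iE ∷ iE ∷  []))
             (put K.X {M' = T} e' (K.fill T W e₀) (trans e₀ (cong (λ l → K.X ++ K.ph ∷ T ++ K.pj ∷ l) eY)) e)
        K∉ : K.q ∉ [ z ]
        K∉ (here e) = x∉ (∈-resp-↭ (↭-sym ints) (there (∈ₚ.∈-++⁺ˡ (∈-resp-↭ (↭-sym K.ints) (here refl))))) (here e)
        rest : ∃[ R' ] a ∷ R' ∷ʳ z ≡ (X ++ K.X) ++ K.ph ∷ K.q ∷ K.pj ∷ Y'' ++ Y → Smaller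
        rest (R' , e₁) = record { F = K.F ; E = put K.X {M' = [ K.q ]} e' K.E (trans K.arcE (cong (λ l → K.X ++ K.ph ∷ K.q ∷ K.pj ∷ l) eY)) e₁
          ; arc = e'' ; arcE = e₁ ; ints = (lin {as = i} {bs = ([ K.q ] ++ (K.iF ++ ([ q ] ++ (K.iE ++ iE))))} (ints ⊹ K.ints) (prove (# 0 ⊕ (# 1 ⊕ # 2 ⊕ # 3) ⊕ # 4 ⊕ # 5 ⊕ # 6) ((# 4 ⊕ # 5 ⊕ # 1 ⊕ # 6 ⊕ # 3) ⊕ # 0 ⊕ # 2) (i ∷ [ q ] ∷ iF ∷ iE ∷ [ K.q ] ∷ K.iF ∷ K.iE ∷  [])))
          ; fill = fill' ; x∈ = K.x∈ ; y∈ = K.y∈ ; x∉O = x∉O ; y∉O = y∉O ; q∉O = K∉ ; pj∈ = on-arc K.pj∈ } ,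
          length-↭-< {xs = K.q ∷ K.ph ∷ (K.mid ∷ʳ K.pj) ++ K.iF} {ys = K.X ++ Y'' ++ K.iE} (lin {as = ([ q ] ++ ([ ph ] ++ ((mid ++ [ pj ]) ++ iF)))} {bs = ([ q ] ++ (([ K.q ] ++ ([ K.ph ] ++ ((K.mid ++ [ K.pj ]) ++ K.iF))) ++ (K.X ++ (Y'' ++ K.iE))))} (ge ⊹ K.ints) (prove ((# 0 ⊕ # 1 ⊕ (# 2 ⊕ # 3) ⊕ # 4) ⊕ (# 5 ⊕ # 6 ⊕ # 7 ⊕ # 8 ⊕ # 9) ⊕ # 10 ⊕ # 11 ⊕ # 12) ((# 0 ⊕ (# 10 ⊕ # 6 ⊕ (# 7 ⊕ # 8) ⊕ # 11) ⊕ # 5 ⊕ # 9 ⊕ # 12) ⊕ (# 1 ⊕ # 2 ⊕ # 3) ⊕ # 4) ([ q ] ∷ [ ph ] ∷ mid ∷ [ pj ] ∷ iF ∷ K.X ∷ [ K.ph ] ∷ K.mid ∷ [ K.pj ] ∷ Y'' ∷ [ K.q ] ∷ K.iF ∷ K.iE ∷  [])))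

      kind-corner : ∀ {ps₁ ps₂ B iZ kP uP cP kQ uQ cS cR cB cI} → Kind pj B → mid ≡ ps₁ ++ ps₂ → Pockets (last ph ps₁) ps₂ kP uP → Path (last ph ps₁) m cP → Pockets pj [] kQ uQ →
        (∃[ t ] Adj t m × Two x y t pj cS) → cS ↭ (pj ∷ kQ) ++ cR → cP ↭ (last ph ps₁ ∷ kP) ++ cI → cS ↭ B ++ cB →
        Disk q ph (ps₁ ++ B ++ []) iZ → q ∷ ph ∷ (mid ∷ʳ pj) ++ iF ↭ cP ++ uP ++ cS ++ uQ ++ init ph ps₁ ++ [ q ] ++ iZ → Out z a r i x y
      kind-corner (cutvertex nα) = ⊥-elim (nα (here refl))
      kind-corner cutedge = from-corner

      outcome : Res q ph mid [ pj ] [ q ] (mid ∷ʳ pj) iF x y → Out z a r i x y ⊎ Smaller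
      outcome (r-none K) = inj₁ (from-none K)
      outcome (r-corner (corner {Qv = []} {[]} psE pkP pathP QE pkQ sol vis visP kind visB Z ct)) = inj₁ (kind-corner kind psE pkP pathP pkQ sol vis visP visB Z ct)
      outcome (r-corner (corner {Qv = []} {_ ∷ Qu} psE pkP pathP QE pkQ sol vis visP kind visB Z ct)) = ⊥-elim (∷ʳ-≢[] Qu (sym (Lₚ.∷-injectiveʳ QE)))
      outcome (r-corner (corner {Qv = _ ∷ Qv} {Qu} psE pkP pathP QE pkQ sol vis visP kind visB Z ct)) = ⊥-elim (∷ʳ-≢[] (Qv ++ Qu) (trans (Lₚ.++-assoc Qv _ _) (sym (Lₚ.∷-injectiveʳ QE))))
      outcome (r-chord K) = inj₁ (from-chord K)
      outcome (r-both K) = inj₂ (from-both K)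
      outcome (r-cut K) = inj₂ (from-cut K)

    cut-out : ∀ M → (C : MyCut) → size C ≤ M → Out z a r i x y
    cut-out zero C ()
    cut-out (suc M) C l with CutRun.outcome C (CutRun.result C)
    ... | inj₁ o = o
    ... | inj₂ (C' , lt) = cut-out M C' (ℕₚ.≤-pred (ℕₚ.<-≤-trans lt l))

    off-z : ∀ {v} → v ∈ i → v ∉ [ z ]
    off-z m (here e) = x∉ m (here e)

    module Top = InnerTask S z (last a r) r x y (off-z xi) (off-z yi)
    open Run Top.task using (Res; r-none; r-corner; r-chord; r-both; r-cut; none; corner; at-end; at-mid)

    result : Res z a r [] [] r i x y
    result = Loop.run Top.task {ps = r} {[]} {[]} D (sym (Lₚ.++-identityʳ r)) refl refl (λ m → m) U len (inj₁ refl) (inj₁ refl) n (there xi) (there yi)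

    from : Res z a r [] [] r i x y → Out z a r i x y
    from (r-none (none {kP} {uP} {cP} {kQ} {uQ} {cS} {cR} {cI} pkP pathP pkQ (t , h , sol) vis visP ct)) with pockets-nil pkQ
    ... | refl , refl = out {kept = kP ∷ʳ z} {uP} {cI ++ cR} (pockets-perm (pockets-++ pkP refl (pockets-edge edge-z)) (prove (# 0 ⊕ ε) (# 0) (uP ∷  [])))
         (two-perm (two-extend sol h (path-rev pathP)) (lin {as = (cS ++ cP)} {bs = ([ a ] ++ ((kP ++ [ z ]) ++ (cI ++ cR)))} (vis ⊹ visP) (prove ((# 0 ⊕ # 1) ⊕ (# 2 ⊕ # 3) ⊕ (# 4 ⊕ # 5) ⊕ # 6) ((# 4 ⊕ (# 5 ⊕ # 2) ⊕ # 6 ⊕ # 3) ⊕ # 0 ⊕ # 1) (cS ∷ cP ∷ [ z ] ∷ cR ∷ [ a ] ∷ kP ∷ cI ∷  []))))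
         (lin {as = ([ z ] ++ ([ a ] ++ (r ++ i)))} {bs = (([ a ] ++ ((kP ++ [ z ]) ++ (cI ++ cR))) ++ uP)} (ct ⊹ vis ⊹ visP) (prove ((# 0 ⊕ # 1 ⊕ # 2 ⊕ # 3) ⊕ (# 4 ⊕ # 5 ⊕ # 6 ⊕ ε) ⊕ (# 0 ⊕ # 7) ⊕ (# 1 ⊕ # 8) ⊕ # 9) (((# 1 ⊕ (# 8 ⊕ # 0) ⊕ # 9 ⊕ # 7) ⊕ # 5) ⊕ (# 0 ⊕ # 1 ⊕ # 2 ⊕ # 3) ⊕ # 6 ⊕ # 4) ([ z ] ∷ [ a ] ∷ r ∷ i ∷ cP ∷ uP ∷ cS ∷ cR ∷ kP ∷ cI ∷  [])))
         (long pkP ne)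
      where
      edge-z : Adj (last a r) z
      edge-z = boundary-adj D (init a r) (trans (cong (_∷ʳ z) (init-last a r)) (Lₚ.++-assoc (init a r) _ _))
      long : ∀ {h l k u} → Pockets h l k u → l ≢ [] → 2 ≤ length (k ∷ʳ z)
      long nil n = ⊥-elim (n refl)
      long (cons {k = k} _ _ _ _) _ = s≤s (subst (1 ≤_) (sym (Lₚ.length-++ k)) (ℕₚ.m≤n+m 1 (length k)))
    from (r-corner (corner {Qv = Qv} {Qu} psE pkP pathP QE pkQ sol vis visP kind visB Z ct)) = ⊥-elim (∷ʳ-≢[] (Qv ++ Qu) (trans (Lₚ.++-assoc Qv _ _) (sym QE)))
    from (r-chord K) = chord-out K.DA K.DB K.arc K.short K.mid≢[] K.ints K.proper
      where module K = Chord K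
    from (r-both (at-end _ _ _ _ _ _ nz _ _)) = ⊥-elim (nz (here refl))
    from (r-both (at-mid {Q₁ = Q₁} _ e _ _ _ _ _ _ _ _)) = ⊥-elim (∷ʳ-≢[] Q₁ (sym e))
    from (r-cut C) = cut-out _ C ℕₚ.≤-refl

  -- Conclusion of the induction

  inner-case : ∀ {N} → Solver N → Disk z a r i → r ≢ [] → length (z ∷ a ∷ r ++ i) ≤ N → Unique (z ∷ a ∷ r ++ i) →
    x ∈ i → y ∈ i → x ≢ y → Out z a r i x y
  inner-case S D ne len U mx my n = InnerRun.from S D len U ne mx my n (InnerRun.result S D len U ne mx my n)

  -- The arc to be removed ends at whichever of `x`, `y` comes first, so that the other one is not
  -- on it.
  first-on : ∀ x y (l : Ls) → (∃[ l₁ ] ∃[ l₂ ] l ≡ l₁ ++ x ∷ l₂ × y ∉ l₁) ⊎ (∃[ l₁ ] ∃[ l₂ ] l ≡ l₁ ++ y ∷ l₂ × x ∉ l₁) ⊎ (x ∉ l × y ∉ l)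
  first-on x y [] = inj₂ (inj₂ ((λ ()) , λ ()))
  first-on x y (v ∷ l) with x ≟ v | y ≟ v
  ... | yes refl | _ = inj₁ ([] , l , refl , λ ())
  ... | no _ | yes refl = inj₂ (inj₁ ([] , l , refl , λ ()))
  ... | no nx | no ny with first-on x y l
  ... | inj₁ (l₁ , l₂ , refl , ni) = inj₁ (v ∷ l₁ , l₂ , refl , λ { (here e) → ny e ; (there m) → ni m })
  ... | inj₂ (inj₁ (l₁ , l₂ , refl , ni)) = inj₂ (inj₁ (v ∷ l₁ , l₂ , refl , λ { (here e) → nx e ; (there m) → ni m }))
  ... | inj₂ (inj₂ (n₁ , n₂)) = inj₂ (inj₂ ((λ { (here e) → nx e ; (there m) → n₁ m }) , λ { (here e) → ny e ; (there m) → n₂ m }))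

  solver : ∀ N → Solver N
  solver zero D ne () U mx my n se
  solver (suc N) {z} {a} {r} {i} {x} {y} D ne lt U mx my n se = go (x ≟ a) (y ≟ a) (x ≟ z) (y ≟ z) (first-on x y r)
    where
    S : Solver N
    S = solver N
    len : length (z ∷ a ∷ r ++ i) ≤ N
    len = ℕₚ.≤-pred lt
    on-r : ∀ {x y} l₁ l₂ → r ≡ l₁ ++ x ∷ l₂ → y ∉ l₁ → x ≢ y → y ≢ a → y ≢ z → y ∈ z ∷ a ∷ r ++ i → Out z a r i x y
    on-r {x} {y} l₁ l₂ e ny n na nz my = subst (λ l → Out z a l i x y) (sym e') (subst (λ v → Out z a ((l₁ ∷ʳ x) ++ l₂) i v y) (last-∷ʳ a l₁)
        (arc-case S (l₁ ∷ʳ x) l₂ (subst (λ l → Disk z a l i) e' D) (subst (λ l → length (z ∷ a ∷ l ++ i) ≤ N) e' len) (subst (λ l → Unique (z ∷ a ∷ l ++ i)) e' U)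
          (λ q → ne (trans e' q)) (subst (λ l → y ∈ z ∷ a ∷ l ++ i) e' my) not nz))
      where
      e' : r ≡ (l₁ ∷ʳ x) ++ l₂
      e' = trans e (sym (Lₚ.++-assoc l₁ _ _))
      not : y ∉ a ∷ l₁ ∷ʳ x
      not (here q) = na q
      not (there m) with ∈ₚ.∈-++⁻ l₁ m
      ... | inj₁ m' = ny m'
      ... | inj₂ (here q) = n (sym q)
    in-i : ∀ {v} → v ∈ z ∷ a ∷ r ++ i → v ≢ z → v ≢ a → v ∉ r → v ∈ i
    in-i (here e) nz _ _ = ⊥-elim (nz e)
    in-i (there (here e)) _ na _ = ⊥-elim (na e)
    in-i (there (there m)) _ _ nr with ∈ₚ.∈-++⁻ r m
    ... | inj₁ m' = ⊥-elim (nr m')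
    ... | inj₂ m' = m'
    go : Dec (x ≡ a) → Dec (y ≡ a) → Dec (x ≡ z) → Dec (y ≡ z) → (∃[ l₁ ] ∃[ l₂ ] r ≡ l₁ ++ x ∷ l₂ × y ∉ l₁) ⊎ (∃[ l₁ ] ∃[ l₂ ] r ≡ l₁ ++ y ∷ l₂ × x ∉ l₁) ⊎ (x ∉ r × y ∉ r) → Out z a r i x y
    go (yes refl) _ _ _ _ = arc-case S [] r D len U ne my (λ { (here e) → n (sym e) }) (λ e → se (inj₂ (refl , e)))
    go (no _) (yes refl) _ _ _ = out-swap (arc-case S [] r D len U ne mx (λ { (here e) → n e }) (λ e → se (inj₁ (e , refl))))
    go (no _) (no ya) (yes refl) _ _ = root-case S D ne len U my (λ e → n (sym e)) ya
    go (no xa) (no _) (no _) (yes refl) _ = out-swap (root-case S D ne len U mx n xa)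
    go (no xa) (no ya) (no xz) (no yz) (inj₁ (l₁ , l₂ , e , ni)) = on-r l₁ l₂ e ni n ya yz my
    go (no xa) (no ya) (no xz) (no yz) (inj₂ (inj₁ (l₁ , l₂ , e , ni))) = out-swap (on-r l₁ l₂ e ni (λ q → n (sym q)) xa xz mx)
    go (no xa) (no ya) (no xz) (no yz) (inj₂ (inj₂ (nx , ny))) = inner-case S D ne len U (in-i mx xz xa nx) (in-i my yz ya ny) n

-- The Jordan curve theorem from Euler's formula

module Planarity {n : ℕ} (T : PlaneTriangulation n) where

  V : Set
  V = Fin n

  open Lists V Fin._≟_
  open PlaneTriangulation T
  open SimpleGraph graph using (adj)

  Adj : V → V → Set
  Adj = Defs.Adj graph

  open DecMembership (≡-dec (Fin._≟_ {n}) (Fin._≟_ {n})) using () renaming (_∈?_ to _∈ᵈ?_)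

  private variable
    x y z a b p q s t : V
    d e f : Dart
    K L : List Dart
    E E' : V → V → Set

  adj-sym : Adj x y → Adj y x
  adj-sym {x} {y} h = subst Bool.T (SimpleGraph.adj-sym graph x y) h

  adj-irrefl : Adj x x → ⊥
  adj-irrefl {x} h = subst Bool.T (SimpleGraph.adj-irrefl graph x) h

  adj-≢ : Adj x y → x ≢ y
  adj-≢ h refl = adj-irrefl h

  -- `rot y x` is the apex of the triangle to the left of the dart from `x` to `y`; passing to the
  -- dart from `y` to it goes around that triangle.
  turn-adj : Adj x y → Adj y (rot y x)
  turn-adj {x} {y} h = rot-closed y x (adj-sym h)

  turn² : Adj x y → rot (rot y x) y ≡ x
  turn² {x} {y} h = proj₁ (faces-triangular x y h)

  turn³ : Adj x y → rot x (rot y x) ≡ y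
  turn³ {x} {y} h = proj₂ (faces-triangular x y h)

  -- Lists of darts

  sub-perm : ∀ {A : Set} {xs ys : List A} → Unique ys → (∀ {v} → v ∈ ys → v ∈ xs) → ∃[ zs ] xs ↭ ys ++ zs
  sub-perm {xs = xs} [] _ = xs , ↭-refl
  sub-perm {xs = xs} {y ∷ ys} (h ∷ u) sub with ∈ₚ.∈-∃++ (sub (here refl))
  ... | as , bs , refl with sub-perm {xs = as ++ bs} u sub'
    where
    sub' : ∀ {v} → v ∈ ys → v ∈ as ++ bs
    sub' m with ∈-resp-↭ (shift y as bs) (sub (there m))
    ... | here refl = ⊥-elim (All.lookup h m refl)
    ... | there m' = m'
  ... | zs , g = zs , ↭-trans (shift y as bs) (prep y g)

  sub-length : ∀ {A : Set} {xs ys : List A} → Unique ys → (∀ {v} → v ∈ ys → v ∈ xs) → length ys ≤ length xs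
  sub-length {xs = xs} {ys} u sub with sub-perm u sub
  ... | zs , g = subst (length ys ≤_) (sym (trans (↭-length g) (Lₚ.length-++ ys))) (ℕₚ.m≤m+n _ _)

  dartsFrom : List V → List Dart
  dartsFrom [] = []
  dartsFrom (x ∷ l) = map (x ,_) (filterᵇ (adj x) (allFin n)) ++ dartsFrom l

  dartsFrom-∈ : ∀ l → (x , y) ∈ dartsFrom l → x ∈ l × Adj x y
  dartsFrom-∈ {x} {y} (w ∷ l) m with ∈ₚ.∈-++⁻ (map (w ,_) (filterᵇ (adj w) (allFin n))) m
  ... | inj₂ m' with dartsFrom-∈ l m'
  ... | m'' , h = there m'' , h
  dartsFrom-∈ {x} {y} (w ∷ l) m | inj₁ m' with ∈ₚ.∈-map⁻ (w ,_) m'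
  ... | _ , m'' , refl = here refl , proj₂ (∈ₚ.∈-filter⁻ (Bool.T? ∘ adj w) {xs = allFin n} m'')

  dartsFrom-∈⁺ : ∀ {l} → x ∈ l → Adj x y → (x , y) ∈ dartsFrom l
  dartsFrom-∈⁺ {x} {y} (here refl) h = ∈ₚ.∈-++⁺ˡ (∈ₚ.∈-map⁺ (x ,_) (∈ₚ.∈-filter⁺ (Bool.T? ∘ adj x) (∈ₚ.∈-allFin y) h))
  dartsFrom-∈⁺ {l = w ∷ l} (there m) h = ∈ₚ.∈-++⁺ʳ (map (w ,_) (filterᵇ (adj w) (allFin n))) (dartsFrom-∈⁺ m h)

  dartsFrom-length : ∀ l → length (dartsFrom l) ≡ sum (map (degree graph) l)
  dartsFrom-length [] = refl
  dartsFrom-length (x ∷ l) = trans (Lₚ.length-++ (map (x ,_) (filterᵇ (adj x) (allFin n)))) (cong₂ _+_ (Lₚ.length-map (x ,_) (filterᵇ (adj x) (allFin n))) (dartsFrom-length l))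

  dartsFrom-unique : ∀ {l} → Unique l → Unique (dartsFrom l)
  dartsFrom-unique [] = []
  dartsFrom-unique {x ∷ l} (h ∷ u) = Uniqueₚ.++⁺ (Uniqueₚ.map⁺ (λ { refl → refl }) (Uniqueₚ.filter⁺ (Bool.T? ∘ adj x) (Uniqueₚ.allFin⁺ n))) (dartsFrom-unique u)
    (λ (m , m') → case m m')
    where
    case : ∀ {d} → d ∈ map (x ,_) (filterᵇ (adj x) (allFin n)) → d ∈ dartsFrom l → ⊥
    case m m' with ∈ₚ.∈-map⁻ (x ,_) m
    ... | _ , _ , refl = All.lookup h (proj₁ (dartsFrom-∈ l m')) refl

  allDarts : List Dart
  allDarts = dartsFrom (allFin n)

  allDarts-length : length allDarts + 12 ≡ 6 * n
  allDarts-length = trans (cong (_+ 12) (dartsFrom-length (allFin n))) euler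

  allDarts-∈ : Adj x y → (x , y) ∈ allDarts
  allDarts-∈ {x} = dartsFrom-∈⁺ (∈ₚ.∈-allFin x)

  allDarts-adj : (x , y) ∈ allDarts → Adj x y
  allDarts-adj m = proj₂ (dartsFrom-∈ (allFin n) m)

  allDarts-unique : Unique allDarts
  allDarts-unique = dartsFrom-unique (Uniqueₚ.allFin⁺ n)

  -- `Unique (double L)` expresses that `L`, read as a list of undirected edges, has no repetition
  -- in either orientation and no loop.
  double : List Dart → List Dart
  double [] = []
  double ((x , y) ∷ L) = (x , y) ∷ (y , x) ∷ double L

  double-∈ : ∀ L → (x , y) ∈ double L → (x , y) ∈ L ⊎ (y , x) ∈ L
  double-∈ (_ ∷ L) (here refl) = inj₁ (here refl)
  double-∈ (_ ∷ L) (there (here refl)) = inj₂ (here refl)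
  double-∈ (_ ∷ L) (there (there m)) with double-∈ L m
  ... | inj₁ m' = inj₁ (there m')
  ... | inj₂ m' = inj₂ (there m')

  double-length : ∀ L → length (double L) ≡ 2 * length L
  double-length [] = refl
  double-length (_ ∷ L) = trans (cong (2 +_) (double-length L)) (lem (length L))
    where
    lem : ∀ l → 2 + 2 * l ≡ 2 * suc l
    lem = solve-∀

  Free : List Dart → V → V → Set
  Free K x y = (x , y) ∉ K × (y , x) ∉ K

  free? : ∀ K x y → Free K x y ⊎ ((x , y) ∈ K ⊎ (y , x) ∈ K)
  free? K x y with (x , y) ∈ᵈ? K | (y , x) ∈ᵈ? K
  ... | yes m | _ = inj₂ (inj₁ m)
  ... | no _ | yes m = inj₂ (inj₂ m)
  ... | no m | no m' = inj₁ (m , m')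

  double-∷ : x ≢ y → Free L x y → Unique (double L) → Unique (double ((x , y) ∷ L))
  double-∷ {x} {y} {L} ne (n₁ , n₂) u = All.tabulate (λ { (here refl) refl → ne refl ; (there m) refl → off (double-∈ L m) }) ∷ All.tabulate (λ { m refl → off' (double-∈ L m) }) ∷ u
    where
    off : (x , y) ∈ L ⊎ (y , x) ∈ L → ⊥
    off (inj₁ m) = n₁ m
    off (inj₂ m) = n₂ m
    off' : (y , x) ∈ L ⊎ (x , y) ∈ L → ⊥
    off' (inj₁ m) = n₂ m
    off' (inj₂ m) = n₁ m

  -- Connectivity of the dual graph

  -- Reachability of darts, where one may turn around the triangle to the left of a dart and cross the edges outside K.
  data Reach (K : List Dart) (d : Dart) : Dart → Set where
    stop  : Reach K d d
    turn  : Reach K d (x , y) → Reach K d (y , rot y x)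
    cross : Reach K d (x , y) → Free K x y → Reach K d (y , x)

  IsDart : Dart → Set
  IsDart (x , y) = Adj x y

  reach-adj : IsDart d → Reach K d e → IsDart e
  reach-adj h stop = h
  reach-adj h (turn R) = turn-adj (reach-adj h R)
  reach-adj h (cross R _) = adj-sym (reach-adj h R)

  reach-trans : Reach K d e → Reach K e f → Reach K d f
  reach-trans R stop = R
  reach-trans R (turn S) = turn (reach-trans R S)
  reach-trans R (cross S g) = cross (reach-trans R S) g

  unturn : Adj x y → Reach K (y , rot y x) (x , y)
  unturn {x} {y} {K} h = subst (λ v → Reach K (y , rot y x) (x , v)) (turn³ h) (turn (subst (λ v → Reach K (y , rot y x) (rot y x , v)) (turn² h) (turn stop)))

  reach-sym : IsDart d → Reach K d e → Reach K e d
  reach-sym h stop = stop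
  reach-sym h (turn R) = reach-trans (unturn (reach-adj h R)) (reach-sym h R)
  reach-sym h (cross R (n₁ , n₂)) = reach-trans (cross stop (n₂ , n₁)) (reach-sym h R)

  reach-map : (∀ {x y} → Adj x y → Free K x y → Reach L (x , y) (y , x)) → IsDart d → Reach K d e → Reach L d e
  reach-map f h stop = stop
  reach-map f h (turn R) = turn (reach-map f h R)
  reach-map f h (cross R g) = reach-trans (reach-map f h R) (f (reach-adj h R) g)

  AllReach : List Dart → Set
  AllReach K = ∀ {d e} → IsDart d → IsDart e → Reach K d e

  iterate-suc : ∀ (f : V → V) k {x} → iterate f (suc k) x ≡ iterate f k (f x)
  iterate-suc f zero = refl
  iterate-suc f (suc k) = cong f (iterate-suc f k)

  spin : ∀ k → Reach [] (s , x) (iterate (rot x) k s , x)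
  spin zero = stop
  spin (suc k) = cross (turn (spin k)) ((λ ()) , λ ())

  spin-to : Adj s x → Adj t x → Reach [] (s , x) (t , x)
  spin-to {s} {x} {t} h h' with rot-cyclic x s t (adj-sym h) (adj-sym h')
  ... | k , refl = spin k

  reach-walk : WalkIn graph (λ _ → ⊤) x y → Adj s x → Adj t y → Reach [] (s , x) (t , y)
  reach-walk (WalkIn.here _) h h' = spin-to h h'
  reach-walk (WalkIn.step _ g W) h h' = reach-trans (cross (spin-to h (adj-sym g)) ((λ ()) , λ ())) (reach-walk W g h')

  all-reach : AllReach []
  all-reach {_ , x} {_ , y} h h' = reach-walk (connected x y tt tt) h h'

  -- A pendant edge does not separate its two sides, since one can turn around its end vertex.
  pendant : (∀ {s} → s ≢ x → Free K y s) → Adj x y → Reach K (x , y) (y , x)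
  pendant {x} {K} {y} fr h with rot-cyclic y (rot y x) x (turn-adj h) (adj-sym h)
  ... | k , e = go k (turn stop) e
    where
    go : ∀ k {s} → Reach K (x , y) (y , s) → iterate (rot y) k s ≡ x → Reach K (x , y) (y , x)
    go zero R refl = R
    go (suc k) {s} R e with s Fin.≟ x
    ... | yes refl = R
    ... | no ne = go k (turn (cross R (fr ne))) (trans (sym (iterate-suc (rot y) k)) e)

  -- When the edge `h x` is added, no other edge of the path is at `h`. So its two sides are still
  -- joined by turning around `h`, and nothing that was connected is separated.
  path-reach : ∀ h l → Unique (h ∷ l) → All IsDart (pairs h l) → AllReach (pairs h l)
  path-reach h [] _ _ = all-reach
  path-reach h (x ∷ l) (u ∷ us) (g ∷ gs) H H' = reach-map sides H (path-reach x l us gs H H')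
    where
    K' = pairs h (x ∷ l)
    h∉ : h ∉ x ∷ l
    h∉ m = All.lookup u m refl
    fr : s ≢ x → Free K' h s
    fr ne = (λ { (here refl) → ne refl ; (there m) → h∉ (proj₁ (pairs-∈ x l m)) }) , λ { (here refl) → h∉ (here refl) ; (there m) → h∉ (there (proj₂ (pairs-∈ x l m))) }
    around : Reach K' (x , h) (h , x)
    around = pendant fr (adj-sym g)
    sides : ∀ {p q} → Adj p q → Free (pairs x l) p q → Reach K' (p , q) (q , p)
    sides {p} {q} adj (n₁ , n₂) with free? K' p q
    ... | inj₁ f = cross stop f
    ... | inj₂ (inj₁ (here refl)) = reach-sym (adj-sym g) around
    ... | inj₂ (inj₁ (there m)) = ⊥-elim (n₁ m)
    ... | inj₂ (inj₂ (here refl)) = around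
    ... | inj₂ (inj₂ (there m)) = ⊥-elim (n₂ m)

  -- Spanning trees

  data Walk (E : V → V → Set) : V → V → Set where
    end  : Walk E x x
    next : E x y → Walk E y z → Walk E x z

  walk-++ : Walk E x y → Walk E y z → Walk E x z
  walk-++ end W = W
  walk-++ (next h U) W = next h (walk-++ U W)

  walk-map : (∀ {x y} → E x y → Walk E' x y) → Walk E x y → Walk E' x y
  walk-map f end = end
  walk-map f (next h W) = walk-++ (f h) (walk-map f W)

  walk-rev : (∀ {x y} → E x y → E y x) → Walk E x y → Walk E y x
  walk-rev f end = end
  walk-rev f (next h W) = walk-++ (walk-rev f W) (next (f h) end)

  exit : ∀ {S} → Walk E x y → x ∈ S → y ∉ S → ∃[ p ] ∃[ q ] E p q × p ∈ S × q ∉ S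
  exit end m n = ⊥-elim (n m)
  exit {S = S} (next {x} {y} h W) m n with y ∈? S
  ... | yes m' = exit W m' n
  ... | no n' = x , y , h , m , n'

  missing : ∀ (S l : Ls) → (∀ {v} → v ∈ l → v ∈ S) ⊎ ∃[ v ] v ∉ S
  missing S [] = inj₁ λ ()
  missing S (v ∷ l) with v ∈? S | missing S l
  ... | no m | _ = inj₂ (v , m)
  ... | yes _ | inj₂ r = inj₂ r
  ... | yes m | inj₁ f = inj₁ λ { (here refl) → m ; (there m') → f m' }

  -- The tree grows by one edge and one vertex at a time. Only the number of its edges is needed, so
  -- being acyclic is not recorded.
  spanning-tree : (∀ x y → Walk E x y) → V → ∃[ L ] Unique (double L) × (∀ {x y} → (x , y) ∈ L → E x y) × n ≤ suc (length L)
  spanning-tree {E} conn o = grow n {[ o ]} {[]} ℕₚ.≤-refl ([] ∷ []) (λ ()) [] (λ ()) refl (here refl)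
    where
    grow : ∀ N {S L} → suc n ≤ length S + N → Unique S → (∀ {x y} → (x , y) ∈ L → x ∈ S × y ∈ S) → Unique (double L) → (∀ {x y} → (x , y) ∈ L → E x y) →
      length S ≡ suc (length L) → o ∈ S → ∃[ L ] Unique (double L) × (∀ {x y} → (x , y) ∈ L → E x y) × n ≤ suc (length L)
    grow N {S} {L} fuel uS ends uL inE len m with missing S (allFin n)
    ... | inj₁ sub = L , uL , inE , subst (n ≤_) len (subst (_≤ length S) (Lₚ.length-tabulate {n = n} (λ x → x)) (sub-length (Uniqueₚ.allFin⁺ n) sub))
    grow zero {S} fuel uS ends uL inE len m | inj₂ _ = ⊥-elim (ℕₚ.<⇒≱ (subst (n <_) (ℕₚ.+-identityʳ _) fuel) (subst (length S ≤_) (Lₚ.length-tabulate {n = n} (λ x → x)) (sub-length uS (λ _ → ∈ₚ.∈-allFin _))))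
    grow (suc N) {S} {L} fuel uS ends uL inE len m | inj₂ (v , nv) with exit (conn o v) m nv
    ... | p , q , h , mp , nq = grow N {q ∷ S} {(p , q) ∷ L} (subst (suc n ≤_) (ℕₚ.+-suc (length S) N) fuel) (All.tabulate (λ { m' refl → nq m' }) ∷ uS)
          (λ { (here refl) → there mp , here refl ; (there m') → there (proj₁ (ends m')) , there (proj₂ (ends m')) })
          (double-∷ (λ { refl → nq mp }) ((λ m' → nq (proj₂ (ends m'))) , λ m' → nq (proj₁ (ends m'))) uL)
          (λ { (here refl) → h ; (there m') → inE m' }) (cong suc len) (there m)

  missing-dart : ∀ (S l : List Dart) → (∀ {d} → d ∈ l → d ∈ S) ⊎ ∃[ d ] d ∈ l × d ∉ S
  missing-dart S [] = inj₁ λ ()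
  missing-dart S (d ∷ l) with d ∈ᵈ? S | missing-dart S l
  ... | no m | _ = inj₂ (d , here refl , m)
  ... | yes _ | inj₂ (e , m , n) = inj₂ (e , there m , n)
  ... | yes m | inj₁ f = inj₁ λ { (here refl) → m ; (there m') → f m' }

  exit-dart : ∀ {S} → (∀ {x y} → (x , y) ∈ S → (y , rot y x) ∈ S) → Reach K d e → d ∈ S → e ∉ S → ∃[ x ] ∃[ y ] Free K x y × (x , y) ∈ S × (y , x) ∉ S
  exit-dart cl stop m n = ⊥-elim (n m)
  exit-dart cl (turn R) m n = exit-dart cl R m (λ m' → n (cl m'))
  exit-dart {S = S} cl (cross {x} {y} R g) m n with (x , y) ∈ᵈ? S
  ... | yes m' = x , y , g , m' , n
  ... | no n' = exit-dart cl R m n'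

  Rest : List Dart → V → V → Set
  Rest R x y = Adj x y × Free R x y

  -- If K does not separate the dual graph, the edges crossed by a spanning tree of the dual graph can be
  -- removed without disconnecting the graph; K is among the remaining edges.
  module DualTree (K : List Dart) (all : AllReach K) where

    Result : Set
    Result = ∃[ R ] Unique (double R) × (∀ {x y} → (x , y) ∈ R → Adj x y × Free K x y) × (∀ x y → Walk (Rest R) x y) × length allDarts ≤ 3 * suc (length R)

    -- `S` holds the darts of the triangles reached by the dual tree and `R` the edges it crosses.
    -- Three darts per triangle, and one triangle more than edges, give `len`.
    record State : Set where
      field
        {S R}  : List Dart
        uniqS  : Unique S
        adjS   : ∀ {x y} → (x , y) ∈ S → Adj x y
        closed : ∀ {x y} → (x , y) ∈ S → (y , rot y x) ∈ S
        len    : length S ≡ 3 * suc (length R)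
        uniqR  : Unique (double R)
        inR    : ∀ {x y} → (x , y) ∈ R → (x , y) ∈ S × (y , x) ∈ S × Free K x y
        conn   : ∀ x y → Walk (Rest R) x y

    walks : WalkIn graph (λ _ → ⊤) x y → Walk (Rest []) x y
    walks (WalkIn.here _) = end
    walks (WalkIn.step _ h W) = next (h , (λ ()) , λ ()) (walks W)

    tri : V → V → List Dart
    tri x y = (x , y) ∷ (y , rot y x) ∷ (rot y x , x) ∷ []

    tri-unique : Adj x y → Unique (tri x y)
    tri-unique {y = y} h = ((λ e → adj-irrefl (subst (λ v → Adj v y) (cong proj₁ e) h)) ∷ (λ e → adj-irrefl (subst (Adj _) (cong proj₂ e) h)) ∷ []) ∷ ((λ e → adj-irrefl (subst (λ v → Adj v (rot y _)) (cong proj₁ e) (turn-adj h))) ∷ []) ∷ [] ∷ []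

    tri-adj : Adj x y → (p , q) ∈ tri x y → Adj p q
    tri-adj h (here refl) = h
    tri-adj h (there (here refl)) = turn-adj h
    tri-adj h (there (there (here refl))) = subst (Adj _) (turn² h) (turn-adj (turn-adj h))

    tri-closed : Adj x y → (p , q) ∈ tri x y → (q , rot q p) ∈ tri x y
    tri-closed h (here refl) = there (here refl)
    tri-closed {x} {y} h (there (here refl)) = there (there (here (cong (rot y x ,_) (turn² h))))
    tri-closed {x} h (there (there (here refl))) = here (cong (x ,_) (turn³ h))

    start : Adj x y → State
    start {x} {y} h = record { S = tri x y ; R = [] ; uniqS = tri-unique h ; adjS = tri-adj h ; closed = tri-closed h ; len = refl ; uniqR = [] ; inR = λ () ; conn = λ p q → walks (connected p q tt tt) }

    extend : (G : State) → (x , y) ∈ State.S G → (y , x) ∉ State.S G → Free K x y → State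
    extend {x} {y} G m nm fr = record
      { S = tri y x ++ S ; R = (x , y) ∷ R
      ; uniqS = Uniqueₚ.++⁺ (tri-unique h) uniqS (λ (m₁ , m₂) → fresh m₁ m₂)
      ; adjS = λ m' → case-adj (∈ₚ.∈-++⁻ (tri y x) m')
      ; closed = λ m' → case-closed (∈ₚ.∈-++⁻ (tri y x) m')
      ; len = trans (cong (3 +_) len) (lem (length R))
      ; uniqR = double-∷ (adj-≢ (adj-sym h)) ((λ m' → nm (proj₁ (proj₂ (inR m')))) , λ m' → nm (proj₁ (inR m'))) uniqR
      ; inR = λ { (here refl) → ∈ₚ.∈-++⁺ʳ (tri y x) m , here refl , fr
                ; (there m') → let (m₁ , m₂ , f) = inR m' in ∈ₚ.∈-++⁺ʳ (tri y x) m₁ , ∈ₚ.∈-++⁺ʳ (tri y x) m₂ , f }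
      ; conn = λ p q → walk-map detour (conn p q) }
      where
      open State G
      h : Adj y x
      h = adj-sym (adjS m)
      τ = rot x y
      lem : ∀ l → 3 + 3 * suc l ≡ 3 * suc (suc l)
      lem = solve-∀
      xt∉ : (x , τ) ∉ S
      xt∉ m' = nm (subst (λ v → (v , x) ∈ S) (turn² h) (subst (λ v → (rot τ x , v) ∈ S) (trans (cong (λ v → rot v τ) (turn² h)) (turn³ h)) (closed (closed m'))))
      ty∉ : (τ , y) ∉ S
      ty∉ m' = nm (subst (λ v → (y , v) ∈ S) (turn³ h) (closed m'))
      fresh : ∀ {d} → d ∈ tri y x → d ∉ S
      fresh (here refl) = nm
      fresh (there (here refl)) = xt∉
      fresh (there (there (here refl))) = ty∉
      case-adj : ∀ {p q} → (p , q) ∈ tri y x ⊎ (p , q) ∈ S → Adj p q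
      case-adj (inj₁ m') = tri-adj h m'
      case-adj (inj₂ m') = adjS m'
      case-closed : ∀ {p q} → (p , q) ∈ tri y x ⊎ (p , q) ∈ S → (q , rot q p) ∈ tri y x ++ S
      case-closed (inj₁ m') = ∈ₚ.∈-++⁺ˡ (tri-closed h m')
      case-closed (inj₂ m') = ∈ₚ.∈-++⁺ʳ (tri y x) (closed m')
      xt : Adj x τ
      xt = turn-adj h
      ty : Adj τ y
      ty = tri-adj h (there (there (here refl)))
      via : Walk (Rest ((x , y) ∷ R)) x y
      via = next (xt , (λ { (here e) → adj-irrefl (subst (λ v → Adj v y) (cong proj₂ e) ty) ; (there m') → xt∉ (proj₁ (inR m')) }) , λ { (here e) → adj-irrefl (subst (Adj x) (cong proj₁ e) xt) ; (there m') → xt∉ (proj₁ (proj₂ (inR m'))) })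
           (next (ty , (λ { (here e) → adj-irrefl (subst (Adj x) (cong proj₁ e) xt) ; (there m') → ty∉ (proj₁ (inR m')) }) , λ { (here e) → adj-irrefl (subst (λ v → Adj v x) (cong proj₁ e) h) ; (there m') → ty∉ (proj₁ (proj₂ (inR m'))) }) end)
      rest-sym : ∀ {R p q} → Rest R p q → Rest R q p
      rest-sym (g , n₁ , n₂) = adj-sym g , n₂ , n₁
      detour : ∀ {p q} → Rest R p q → Walk (Rest ((x , y) ∷ R)) p q
      detour {p} {q} (g , n₁ , n₂) with free? ((x , y) ∷ R) p q
      ... | inj₁ f = next (g , f) end
      ... | inj₂ (inj₁ (here refl)) = via
      ... | inj₂ (inj₁ (there m')) = ⊥-elim (n₁ m')
      ... | inj₂ (inj₂ (here refl)) = walk-rev rest-sym via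
      ... | inj₂ (inj₂ (there m')) = ⊥-elim (n₂ m')

    grow : ∀ N (G : State) → Adj p q → (p , q) ∈ State.S G → suc (length allDarts) ≤ length (State.S G) + N → Result
    grow N G h m fuel with missing-dart (State.S G) allDarts
    ... | inj₁ sub = R , uniqR , (λ m' → adjS (proj₁ (inR m')) , proj₂ (proj₂ (inR m'))) , conn , subst (length allDarts ≤_) len (sub-length allDarts-unique sub)
      where open State G
    grow zero G h m fuel | inj₂ _ = ⊥-elim (ℕₚ.<⇒≱ (subst (length allDarts <_) (ℕₚ.+-identityʳ _) fuel) (sub-length uniqS (λ m' → allDarts-∈ (adjS m'))))
      where open State G
    grow (suc N) G h m fuel | inj₂ (d , dm , nd) with exit-dart (State.closed G) (all h (allDarts-adj dm)) m nd
    ... | x , y , fr , m₁ , n₁ = grow N (extend G m₁ n₁ fr) h (there (there (there m))) (ℕₚ.≤-trans fuel (ℕₚ.≤-trans (ℕₚ.≤-reflexive (ℕₚ.+-suc (length (State.S G)) N)) (s≤s (ℕₚ.m≤n+m _ 2))))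

    dual-tree : Adj x y → Result
    dual-tree h = grow (suc (length allDarts)) (start h) h (here refl) (ℕₚ.m≤n+m _ 3)

  -- The edges that a dual spanning tree crosses and a spanning tree of what remains when also one edge
  -- of the cycle is removed would together be too many.
  jordan : ∀ {z a b r} → Unique (z ∷ a ∷ b ∷ r) → All IsDart (boundary z a (b ∷ r)) → ¬ Reach (boundary z a (b ∷ r)) (z , a) (a , z)
  jordan {z} {a} {b} {r} U (h ∷ hs) R₀ with DualTree.dual-tree (boundary z a (b ∷ r)) all h
    where
    C = boundary z a (b ∷ r)
    P = pairs a (b ∷ r ∷ʳ z)
    UP : Unique (a ∷ b ∷ r ∷ʳ z)
    UP = Unique-↭ (prove (# 0 ⊕ # 1 ⊕ # 2 ⊕ # 3) (# 1 ⊕ # 2 ⊕ # 3 ⊕ # 0) ([ z ] ∷ [ a ] ∷ [ b ] ∷ r ∷  [])) U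
    sides : ∀ {p q} → Adj p q → Free P p q → Reach C (p , q) (q , p)
    sides {p} {q} adj (n₁ , n₂) with free? C p q
    ... | inj₁ f = cross stop f
    ... | inj₂ (inj₁ (here refl)) = R₀
    ... | inj₂ (inj₁ (there m)) = ⊥-elim (n₁ m)
    ... | inj₂ (inj₂ (here refl)) = reach-sym h R₀
    ... | inj₂ (inj₂ (there m)) = ⊥-elim (n₂ m)
    -- The cycle without `z a` is a path, which does not separate, and `R₀` makes up for the edge
    -- `z a`.
    all : AllReach C
    all H H' = reach-map sides H (path-reach a (b ∷ r ∷ʳ z) UP hs H H')
  ... | R , uR , inR , conn , lenR = count (spanning-tree conn' z)
    where
    C = boundary z a (b ∷ r)
    Kept : V → V → Set
    Kept x y = Adj x y × Free ((z , a) ∷ R) x y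
    around : ∀ h l → (∀ {p q} → (p , q) ∈ pairs h l → Kept p q) → Walk Kept h (last h l)
    around h [] f = end
    around h (x ∷ l) f = next (f (here refl)) (around x l (λ m → f (there m)))
    z∉ : z ∉ a ∷ b ∷ r
    z∉ m = Unique-clash {xs = [ z ]} ↭-refl U (here refl) m
    a∉ : a ∉ b ∷ r
    a∉ m = Unique-clash {xs = [ a ]} {ys = z ∷ b ∷ r} (prove (# 0 ⊕ # 1 ⊕ # 2 ⊕ # 3) (# 1 ⊕ # 0 ⊕ # 2 ⊕ # 3) ([ z ] ∷ [ a ] ∷ [ b ] ∷ r ∷  [])) U (here refl) (there m)
    az∉ : (a , z) ∉ pairs a (b ∷ r ∷ʳ z)
    az∉ (here refl) = z∉ (there (here refl))
    az∉ (there m) = a∉ (pairs-∈ˡ b r m)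
    on-path : ∀ {p q} → (p , q) ∈ pairs a (b ∷ r ∷ʳ z) → Kept p q
    on-path m = All.lookup hs m , (λ { (here refl) → z∉ (pairs-∈ˡ a (b ∷ r) m) ; (there m') → proj₁ (proj₂ (inR m')) (there m) }) , λ { (here refl) → az∉ m ; (there m') → proj₂ (proj₂ (inR m')) (there m) }
    way : Walk Kept a z
    way = subst (Walk Kept a) (last-∷ʳ a (b ∷ r)) (around a (b ∷ r ∷ʳ z) on-path)
    detour : ∀ {p q} → Rest R p q → Walk Kept p q
    detour {p} {q} (g , n₁ , n₂) with free? ((z , a) ∷ R) p q
    ... | inj₁ f = next (g , f) end
    ... | inj₂ (inj₁ (here refl)) = walk-rev (λ (g , n₁ , n₂) → adj-sym g , n₂ , n₁) way
    ... | inj₂ (inj₁ (there m')) = ⊥-elim (n₁ m')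
    ... | inj₂ (inj₂ (here refl)) = way
    ... | inj₂ (inj₂ (there m')) = ⊥-elim (n₂ m')
    conn' : ∀ x y → Walk Kept x y
    conn' x y = walk-map detour (conn x y)
    R' = (z , a) ∷ R
    uR' : Unique (double R')
    uR' = double-∷ (adj-≢ h) ((λ m → proj₁ (proj₂ (inR m)) (here refl)) , λ m → proj₂ (proj₂ (inR m)) (here refl)) uR
    adjR' : ∀ {x y} → (x , y) ∈ R' → Adj x y
    adjR' (here refl) = h
    adjR' (there m) = proj₁ (inR m)
    double-adj : ∀ {L} → (∀ {x y} → (x , y) ∈ L → Adj x y) → ∀ {x y} → (x , y) ∈ double L → Adj x y
    double-adj {L} f m with double-∈ L m
    ... | inj₁ m' = f m'
    ... | inj₂ m' = adj-sym (f m')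
    count : ∃[ L ] Unique (double L) × (∀ {x y} → (x , y) ∈ L → Kept x y) × n ≤ suc (length L) → ⊥
    count (L , uL , inL , lenL) = ℕₚ.<⇒≱ (lt (length L) (length R) (length allDarts) n allDarts-length lenR lenL) (subst (_≤ length allDarts) lenW (sub-length uW subW))
      where
      W = double L ++ double R'
      disj : ∀ {d} → d ∈ double L → d ∈ double R' → ⊥
      disj m m' with double-∈ L m | double-∈ R' m'
      ... | inj₁ l | inj₁ k = proj₁ (proj₂ (inL l)) k
      ... | inj₁ l | inj₂ k = proj₂ (proj₂ (inL l)) k
      ... | inj₂ l | inj₁ k = proj₂ (proj₂ (inL l)) k
      ... | inj₂ l | inj₂ k = proj₁ (proj₂ (inL l)) k
      uW : Unique W
      uW = Uniqueₚ.++⁺ uL uR' (λ (m , m') → disj m m')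
      subW : ∀ {d} → d ∈ W → d ∈ allDarts
      subW {_ , _} m with ∈ₚ.∈-++⁻ (double L) m
      ... | inj₁ m' = allDarts-∈ (double-adj (λ l → proj₁ (inL l)) m')
      ... | inj₂ m' = allDarts-∈ (double-adj adjR' m')
      lenW : length W ≡ 2 * length L + 2 * suc (length R)
      lenW = trans (Lₚ.length-++ (double L)) (cong₂ _+_ (double-length L) (double-length R'))
      -- With E edges and F triangles, A is 2E and 3F. The disjoint edge sets have at least (n - 1)
      -- + (F - 1) + 1 members, one more than the n + F - 2 of Euler's formula. The factor 3 avoids
      -- dividing A.
      lt : ∀ l r A n → A + 12 ≡ 6 * n → A ≤ 3 * suc r → n ≤ suc l → A < 2 * l + 2 * suc r
      lt l r A n e le₁ le₂ = ℕₚ.*-cancelˡ-< 3 _ _ (ℕₚ.+-cancelʳ-≤ 12 _ _ (begin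
          suc (3 * A) + 12 ≡⟨ lem₁ A ⟩
          suc (2 * A + (A + 12)) ≡⟨ cong (λ v → suc (2 * A + v)) e ⟩
          suc (2 * A + 6 * n) ≤⟨ s≤s (ℕₚ.+-mono-≤ (ℕₚ.*-monoʳ-≤ 2 le₁) (ℕₚ.*-monoʳ-≤ 6 le₂)) ⟩
          suc (2 * (3 * suc r) + 6 * suc l) ≤⟨ ℕₚ.m≤m+n _ 5 ⟩
          suc (2 * (3 * suc r) + 6 * suc l) + 5 ≡⟨ lem₂ l r ⟩
          3 * (2 * l + 2 * suc r) + 12 ∎))
        where
        open ℕₚ.≤-Reasoning
        lem₁ : ∀ A → suc (3 * A) + 12 ≡ suc (2 * A + (A + 12))
        lem₁ = solve-∀
        lem₂ : ∀ l r → suc (2 * (3 * suc r) + 6 * suc l) + 5 ≡ 3 * (2 * l + 2 * suc r) + 12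
        lem₂ = solve-∀

-- Deleting the edge uv

module EdgeDeletion {n : ℕ} (T : PlaneTriangulation n) (tc : ThreeConnected (PlaneTriangulation.graph T))
  (u v : Fin n) (uv : Defs.Adj (PlaneTriangulation.graph T) u v)
  (sep : ∀ a b c → SeparatingTriangle (PlaneTriangulation.graph T) a b c → (u ≡ a ⊎ u ≡ b ⊎ u ≡ c) × (v ≡ a ⊎ v ≡ b ⊎ v ≡ c))
  where

  open Planarity T
  open Lists V Fin._≟_
  open PlaneTriangulation T

  Adj' : V → V → Set
  Adj' x y = Adj x y × Free [ (u , v) ] x y

  -- The two triangles at `uv` are not faces here, so that no disk extends across the deleted edge.
  Face' : V → V → V → Set
  Face' z a t = t ≡ rot a z × Adj' z a × Adj' a t × Adj' t z

  private variable
    x y z a b c p q s t w : V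
    d e : Dart
    C L : List Dart
    xs ys r i j k l unv : Ls

  adj'-sym : Adj' x y → Adj' y x
  adj'-sym (h , n₁ , n₂) = adj-sym h , n₂ , n₁

  adj'-irrefl : Adj' x x → ⊥
  adj'-irrefl (h , _) = adj-irrefl h

  face'-adj : Face' x y z → Adj' x y
  face'-adj (_ , h , _) = h

  face'-rot : Face' x y z → Face' y z x
  face'-rot (refl , h₁ , h₂ , h₃) = sym (turn² (proj₁ h₁)) , h₂ , h₃ , h₁

  surface : Surface
  surface = record { V = V ; _≟_ = Fin._≟_ ; Adj = Adj' ; Face = Face' ; adj-sym = adj'-sym ; adj-irrefl = adj'-irrefl ; face-adj = face'-adj ; face-rot = face'-rot }

  open Disks surface

  rot-closure : ∀ (P : V → Set) {m s x} → (∀ {y} → Adj m y → P y → P (rot m y)) → P s → Adj m s → Adj m x → P x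
  rot-closure P {m} {s} {x} cl p h h' with rot-cyclic m s x h h'
  ... | k , e = subst P e (proj₁ (go k))
    where
    go : ∀ k → P (iterate (rot m) k s) × Adj m (iterate (rot m) k s)
    go zero = p , h
    go (suc k) = let (p' , h'') = go k in cl h'' p' , rot-closed m _ h''

  u≢v : u ≢ v
  u≢v = adj-≢ uv

  not-uv : ¬ Adj' u v
  not-uv (_ , n₁ , _) = n₁ (here refl)

  not-vu : ¬ Adj' v u
  not-vu (_ , _ , n₂) = n₂ (here refl)

  -- Digons and triangles have no interior

  -- The rotation around an interior vertex never meets the boundary, so all darts into `w` belong
  -- to the disk. Since these are edges other than `uv`, neither `u` nor `v` can be interior.
  interior-closed : (D : Disk z a r i) → Unique (z ∷ a ∷ r ++ i) → w ∈ i → Adj w x → Adj' w x × x ∈ z ∷ a ∷ r ++ i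
  interior-closed {z} {a} {r} {i} {w} {x} D U m h with inner-dart D m
  ... | s , ms = adj'-sym (face'-adj (proj₁ (proj₂ (darts-face D mx)))) , dart-source D mx
    where
    onward : ∀ {y} → (y , w) ∈ dartsOf D → (rot w y , w) ∈ dartsOf D
    onward my with darts-face D my
    ... | _ , (refl , _) , mt with darts-reverse D mt
    ... | inj₁ m' = m'
    ... | inj₂ m' = ⊥-elim (Unique-clash {xs = z ∷ a ∷ r} ↭-refl U (boundary-∈ m') m)
    into : ∀ {y} → (y , w) ∈ dartsOf D → Adj w y
    into my with darts-face D my
    ... | _ , (_ , hy , _) , _ = adj-sym (proj₁ hy)
    mx : (x , w) ∈ dartsOf D
    mx = rot-closure (λ y → (y , w) ∈ dartsOf D) (λ _ → onward) ms (into ms) h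

  walk-start : ∀ {ok : V → Set} → WalkIn graph ok x y → ok x
  walk-start (WalkIn.here o) = o
  walk-start (WalkIn.step o _ _) = o

  stay-inside : ∀ {ok : V → Set} (D : Disk z a r i) → Unique (z ∷ a ∷ r ++ i) → (∀ {x} → ok x → x ∉ z ∷ a ∷ r) → WalkIn graph ok x y → x ∈ i → y ∈ i
  stay-inside D U off (WalkIn.here _) m = m
  stay-inside {z} {a} {r} {ok = ok} D U off (WalkIn.step _ h W) m with ∈ₚ.∈-++⁻ (z ∷ a ∷ r) (proj₂ (interior-closed D U m h))
  ... | inj₂ m' = stay-inside D U off W m'
  ... | inj₁ m' = ⊥-elim (off (walk-start W) m')

  -- A walk off the boundary that starts inside stays inside. If such walks reach everything, each
  -- vertex off the boundary is interior, and an interior vertex cannot be an end of the deleted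
  -- edge.
  ends-on-boundary : ∀ {ok : V → Set} (D : Disk z a r i) → Unique (z ∷ a ∷ r ++ i) → (∀ {x} → ok x → x ∉ z ∷ a ∷ r) → (∀ {x} → x ∉ z ∷ a ∷ r → ok x) →
    ConnectedOn graph ok → w ∈ i → u ∈ z ∷ a ∷ r × v ∈ z ∷ a ∷ r
  ends-on-boundary {z} {a} {r} {i} {w} {ok} D U off on conn m = side uv not-uv , side (adj-sym uv) not-vu
    where
    w∉ : w ∉ z ∷ a ∷ r
    w∉ m' = Unique-clash {xs = z ∷ a ∷ r} ↭-refl U m' m
    side : ∀ {x y} → Adj x y → ¬ Adj' x y → x ∈ z ∷ a ∷ r
    side {x} h n with x ∈? (z ∷ a ∷ r)
    ... | yes m' = m'
    ... | no m' = ⊥-elim (n (proj₁ (interior-closed D U (stay-inside D U off (conn w x (on w∉) (on m')) m) h)))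

  boundary-clash : ∀ {S : Ls} → (∀ {x y} → x ∈ S → y ∈ S → x ≢ y → Adj' x y) → u ∈ S → v ∈ S → ⊥
  boundary-clash f mu mv = not-uv (f mu mv u≢v)

  cast-∈ : ∀ {A : Set} {d : A} {xs ys} → xs ≡ ys → d ∈ xs → d ∈ ys
  cast-∈ refl m = m

  empty : ∀ {l : Ls} → (∀ {w} → w ∈ l → ⊥) → l ≡ []
  empty {[]} _ = refl
  empty {_ ∷ _} f = ⊥-elim (f (here refl))

  -- By 3-connectivity, deleting `z` and `a` leaves a connected graph. So an interior vertex would
  -- force `u` and `v` to be the two ends of the root edge, which is not the edge `uv`.
  no-digon : Disk z a [] i → Unique (z ∷ a ∷ i) → i ≡ []
  no-digon {z} {a} D U = empty inside
    where
    pair : ∀ {x y} → x ∈ z ∷ a ∷ [] → y ∈ z ∷ a ∷ [] → x ≢ y → Adj' x y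
    pair (here refl) (here refl) n = ⊥-elim (n refl)
    pair (here refl) (there (here refl)) _ = root-adj D
    pair (there (here refl)) (here refl) _ = adj'-sym (root-adj D)
    pair (there (here refl)) (there (here refl)) n = ⊥-elim (n refl)
    inside : w ∈ _ → ⊥
    inside m with ends-on-boundary D U (λ { (n₁ , n₂) (here e) → n₁ e ; (n₁ , n₂) (there (here e)) → n₂ e })
      (λ n → (λ e → n (here e)) , λ e → n (there (here e))) (proj₂ (proj₂ tc) z a) m
    ... | mu , mv = boundary-clash pair mu mv

  -- An interior vertex makes the triangle separating, for otherwise `u` and `v` would be on it. But
  -- then the hypothesis puts them there as well, although all sides of the triangle differ from
  -- `uv`.
  no-triangle : Disk z a (b ∷ []) i → Unique (z ∷ a ∷ b ∷ i) → i ≡ []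
  no-triangle {z} {a} {b} {i} D U = empty inside
    where
    za : Adj' z a
    za = root-adj D
    ab : Adj' a b
    ab = root-adj (rotate D refl)
    bz : Adj' b z
    bz = root-adj (rotate (rotate D refl) refl)
    mem : ∀ {x} → x ≡ z ⊎ x ≡ a ⊎ x ≡ b → x ∈ z ∷ a ∷ b ∷ []
    mem (inj₁ e) = here e
    mem (inj₂ (inj₁ e)) = there (here e)
    mem (inj₂ (inj₂ e)) = there (there (here e))
    pair : ∀ {x y} → x ∈ z ∷ a ∷ b ∷ [] → y ∈ z ∷ a ∷ b ∷ [] → x ≢ y → Adj' x y
    pair (here refl) (here refl) n = ⊥-elim (n refl)
    pair (here refl) (there (here refl)) _ = za
    pair (here refl) (there (there (here refl))) _ = adj'-sym bz
    pair (there (here refl)) (here refl) _ = adj'-sym za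
    pair (there (here refl)) (there (here refl)) n = ⊥-elim (n refl)
    pair (there (here refl)) (there (there (here refl))) _ = ab
    pair (there (there (here refl))) (here refl) _ = bz
    pair (there (there (here refl))) (there (here refl)) _ = adj'-sym ab
    pair (there (there (here refl))) (there (there (here refl))) n = ⊥-elim (n refl)
    not-connected : w ∈ i → ¬ ConnectedOn graph (λ x → x ≢ z × x ≢ a × x ≢ b)
    not-connected m conn with ends-on-boundary D U (λ { (n₁ , n₂ , n₃) (here e) → n₁ e ; (n₁ , n₂ , n₃) (there (here e)) → n₂ e ; (n₁ , n₂ , n₃) (there (there (here e))) → n₃ e })
      (λ n → (λ e → n (here e)) , (λ e → n (there (here e))) , λ e → n (there (there (here e)))) conn m
    ... | mu , mv = boundary-clash pair mu mv
    inside : w ∈ i → ⊥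
    inside m with sep z a b ((proj₁ za , proj₁ ab , proj₁ bz) , not-connected m)
    ... | eu , ev = boundary-clash pair (mem eu) (mem ev)

  -- Regions to the left of a cycle

  Region : V → V → Ls → Dart → Set
  Region z a r = Reach (boundary z a r) (z , a)

  Edges : List Dart → Set
  Edges L = ∀ {x y} → (x , y) ∈ L → Adj' x y

  left-right : Unique (z ∷ a ∷ r) → r ≢ [] → Edges (boundary z a r) → ¬ Region z a r (a , z)
  left-right {r = []} _ n _ _ = n refl
  left-right {r = _ ∷ _} U _ E R = jordan U (All.tabulate (λ m → proj₁ (E m))) R

  reach-lift : (∀ {x y} → Reach C d (x , y) → Free C x y → Free L x y) → Reach C d e → Reach L d e
  reach-lift f stop = stop
  reach-lift f (turn R) = turn (reach-lift f R)
  reach-lift f (cross R g) = cross (reach-lift f R) (f R g)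

  -- All darts at vertices of a path off C are equivalent.
  hub : (∀ {y} → Free C x y) → Adj s x → Adj t x → Reach C (s , x) (t , x)
  hub {C} {x} {s} {t} fr h h' = rot-closure (λ y → Reach C (s , x) (y , x)) (λ _ R → cross (turn R) fr) stop (adj-sym h) (adj-sym h')

  chain : Ls → List Dart
  chain [] = []
  chain (h ∷ l) = pairs h l

  chain-pairs : ∀ l → d ∈ chain l → d ∈ pairs t l
  chain-pairs (_ ∷ _) m = there m

  hubs : ∀ {P} → (∀ {w y} → w ∈ P → Free C w y) → (∀ {x y} → (x , y) ∈ chain P → Adj x y) → x ∈ P → y ∈ P → Adj s x → Adj t y → Reach C (s , x) (t , y)
  hubs {C} {P = []} fr E ()
  hubs {P = h ∷ []} fr E (here refl) (here refl) hx hy = hub (fr (here refl)) hx hy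
  hubs {C} {P = h ∷ w ∷ l} fr E mx my hx hy = reach-trans (to-head fr E mx hx hw) (reach-sym hy (to-head fr E my hy hw))
    where
    hw : Adj w h
    hw = adj-sym (E (here refl))
    to-head : ∀ {h l x s s₀} → (∀ {w y} → w ∈ h ∷ l → Free C w y) → (∀ {x y} → (x , y) ∈ pairs h l → Adj x y) → x ∈ h ∷ l → Adj s x → Adj s₀ h → Reach C (s , x) (s₀ , h)
    to-head fr E (here refl) hx h₀ = hub (fr (here refl)) hx h₀
    to-head {l = _ ∷ _} fr E (there m) hx h₀ = reach-trans (cross (to-head (λ m → fr (there m)) (λ m → E (there m)) m hx (E (here refl))) (fr (here refl))) (hub (fr (here refl)) (adj-sym (E (here refl))) h₀)

  turn-face : Face' x y w → Reach C d (x , y) → Reach C d (y , w)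
  turn-face (refl , _) R = turn R

  boundary-target : (x , y) ∈ boundary z a r → y ∈ z ∷ a ∷ r
  boundary-target (here refl) = there (here refl)
  boundary-target {z = z} {a} {r} (there m) = ∈-resp-↭ (prove (# 0 ⊕ # 1 ⊕ # 2) (# 2 ⊕ # 0 ⊕ # 1) ([ a ] ∷ r ∷ [ z ] ∷  [])) (there (proj₂ (pairs-∈ a (r ∷ʳ z) m)))

  off-boundary : w ∉ z ∷ a ∷ r → Free (boundary z a r) w y
  off-boundary n = (λ b → n (boundary-∈ b)) , λ b → n (boundary-target b)

  free-sym : Free C x y → Free C y x
  free-sym (n₁ , n₂) = n₂ , n₁

  module Inner {z a t r} (U : Unique (z ∷ a ∷ r)) (t∉ : t ∉ z ∷ a ∷ r) (Ed : Edges (boundary z a r)) (f : Face' z a t) where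

    private
      R' = boundary t a (r ∷ʳ z)

    split-off : pairs a ((r ∷ʳ z) ∷ʳ t) ≡ pairs a (r ∷ʳ z) ++ [ (z , t) ]
    split-off = trans (cong (pairs a) (snoc-++ r)) (pairs-++ a r)

    edges′ : Edges R'
    edges′ (here refl) = adj'-sym (face-adj₂ f)
    edges′ (there m) with ∈ₚ.∈-++⁻ (pairs a (r ∷ʳ z)) (cast-∈ split-off m)
    ... | inj₁ m' = Ed (there m')
    ... | inj₂ (here refl) = adj'-sym (face-adj₃ f)

    unique′ : Unique (t ∷ a ∷ r ∷ʳ z)
    unique′ = Unique-↭ (prove (# 0 ⊕ # 1 ⊕ # 2 ⊕ # 3) (# 0 ⊕ # 2 ⊕ # 3 ⊕ # 1) ([ t ] ∷ [ z ] ∷ [ a ] ∷ r ∷  [])) (All.tabulate (λ { m refl → t∉ m }) ∷ U)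

    -- Turning in the root triangle leads to the dart from `a` to `t`, which is the reverse of the
    -- new root dart.
    outside : d ∈ triangle z a t → Region t a (r ∷ʳ z) d → ⊥
    outside (there (here refl)) R = left-right unique′ (∷ʳ-≢[] r) edges′ R
    outside (here refl) R = left-right unique′ (∷ʳ-≢[] r) edges′ (turn-face f R)
    outside (there (there (here refl))) R = left-right unique′ (∷ʳ-≢[] r) edges′ (turn-face f (turn-face (face'-rot (face'-rot f)) R))

    -- A step within the new region crosses no edge of the old cycle: the old edges other than `z a`
    -- are on the new cycle too, and `outside` excludes the edge `z a`.
    region-⊆ : Region t a (r ∷ʳ z) d → Region z a r d
    region-⊆ R = reach-trans (cross (turn-face f stop) (free-sym (off-boundary t∉))) (reach-lift (λ S g → free S g , free' S g) R)
      where
      on : pairs a (r ∷ʳ z) ⊆ R'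
      on m = there (cast-∈ (sym split-off) (∈ₚ.∈-++⁺ˡ m))
      free : Region t a (r ∷ʳ z) (x , y) → Free R' x y → (x , y) ∉ boundary z a r
      free S g (here refl) = outside (here refl) S
      free S g (there m) = proj₁ g (on m)
      free' : Region t a (r ∷ʳ z) (x , y) → Free R' x y → (y , x) ∉ boundary z a r
      free' S g (here refl) = outside (here refl) (cross S g)
      free' S g (there m) = proj₂ g (on m)

  module Split {z a t xs ys} (U : Unique (z ∷ a ∷ xs ++ t ∷ ys)) (Ed : Edges (boundary z a (xs ++ t ∷ ys))) (f : Face' z a t) where

    boundary-split : boundary z a (xs ++ t ∷ ys) ≡ (z , a) ∷ pairs a (xs ∷ʳ t) ++ pairs t (ys ∷ʳ z)
    boundary-split = cong ((z , a) ∷_) (trans (cong (pairs a) (snoc-++ xs)) (pairs-++ a xs))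

    edges₁ : Edges (boundary t a xs)
    edges₁ (here refl) = adj'-sym (face-adj₂ f)
    edges₁ (there m) = Ed (cast-∈ (sym boundary-split) (there (∈ₚ.∈-++⁺ˡ m)))

    edges₂ : Edges (boundary z t ys)
    edges₂ (here refl) = adj'-sym (face-adj₃ f)
    edges₂ (there m) = Ed (cast-∈ (sym boundary-split) (there (∈ₚ.∈-++⁺ʳ (pairs a (xs ∷ʳ t)) m)))

    unique₁ : Unique (t ∷ a ∷ xs)
    unique₁ = Unique-sub {ys = z ∷ ys} (prove ((# 0 ⊕ # 1 ⊕ # 2) ⊕ # 3 ⊕ # 4) (# 3 ⊕ # 1 ⊕ # 2 ⊕ # 0 ⊕ # 4) ([ t ] ∷ [ a ] ∷ xs ∷ [ z ] ∷ ys ∷  [])) U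

    unique₂ : Unique (z ∷ t ∷ ys)
    unique₂ = Unique-sub {ys = a ∷ xs} (prove ((# 0 ⊕ # 1 ⊕ # 2) ⊕ # 3 ⊕ # 4) (# 0 ⊕ # 3 ⊕ # 4 ⊕ # 1 ⊕ # 2) ([ z ] ∷ [ t ] ∷ ys ∷ [ a ] ∷ xs ∷  [])) U

    off₁ : w ∈ ys ∷ʳ z → w ∉ t ∷ a ∷ xs
    off₁ m m' = Unique-clash {xs = t ∷ a ∷ xs} (prove (# 0 ⊕ # 1 ⊕ # 2 ⊕ # 3 ⊕ # 4) ((# 3 ⊕ # 1 ⊕ # 2) ⊕ # 4 ⊕ # 0) ([ z ] ∷ [ a ] ∷ xs ∷ [ t ] ∷ ys ∷  [])) U m' m

    off₂ : w ∈ a ∷ xs → w ∉ z ∷ t ∷ ys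
    off₂ m m' = Unique-clash {xs = z ∷ t ∷ ys} (prove (# 0 ⊕ # 1 ⊕ # 2 ⊕ # 3 ⊕ # 4) ((# 0 ⊕ # 3 ⊕ # 4) ⊕ # 1 ⊕ # 2) ([ z ] ∷ [ a ] ∷ xs ∷ [ t ] ∷ ys ∷  [])) U m' m

    -- Following the other arc, which is off this cycle, the region would contain the dart from `t`
    -- to `z` and then, around the root triangle, the one from `a` to `t`, the reverse of its root.
    avoid₁ : xs ≢ [] → Region t a xs (x , y) → x ∈ ys ∷ʳ z ⊎ y ∈ ys ∷ʳ z → ⊥
    avoid₁ ne R (inj₁ m) = avoid₁ ne (cross R (off-boundary (off₁ m))) (inj₂ m)
    avoid₁ ne R (inj₂ m) = left-right unique₁ ne edges₁ (turn-face f (turn-face (face'-rot (face'-rot f)) (reach-trans R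
        (hubs (λ m' → off-boundary (off₁ m')) (λ m' → proj₁ (edges₂ (there (chain-pairs (ys ∷ʳ z) m')))) m (∈-mid ys) (reach-adj (proj₁ (adj'-sym (face-adj₂ f))) R) (proj₁ (face-adj₃ f))))))

    avoid₂ : ys ≢ [] → Region z t ys (x , y) → x ∈ a ∷ xs ⊎ y ∈ a ∷ xs → ⊥
    avoid₂ ne R (inj₁ m) = avoid₂ ne (cross R (off-boundary (off₂ m))) (inj₂ m)
    avoid₂ ne R (inj₂ m) = left-right unique₂ ne edges₂ (turn-face (face'-rot f) (turn-face f (reach-trans R
        (hubs (λ m' → off-boundary (off₂ m')) (λ m' → proj₁ (edges₁ (there (pairs-snoc a xs m')))) m (here refl) (reach-adj (proj₁ (adj'-sym (face-adj₃ f))) R) (proj₁ (face'-adj f))))))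
      where
      pairs-snoc : ∀ h l → d ∈ pairs h l → d ∈ pairs h (l ∷ʳ t)
      pairs-snoc h (_ ∷ l) (here e) = here e
      pairs-snoc h (x ∷ l) (there m) = there (pairs-snoc x l m)

    private
      R₀ = boundary z a (xs ++ t ∷ ys)

    sides : (x , y) ∈ R₀ → (x , y) ≡ (z , a) ⊎ (x , y) ∈ pairs a (xs ∷ʳ t) ⊎ (x , y) ∈ pairs t (ys ∷ʳ z)
    sides m with cast-∈ boundary-split m
    ... | here e = inj₁ e
    ... | there m' = inj₂ (∈ₚ.∈-++⁻ (pairs a (xs ∷ʳ t)) m')

    t∉ : t ∉ a ∷ xs
    t∉ m = off₂ m (there (here refl))

    t∉′ : t ∉ ys ∷ʳ z
    t∉′ m = off₁ m (here refl)

    a∉ : a ∉ xs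
    a∉ m = Unique-clash {xs = [ a ]} (prove (# 0 ⊕ # 1 ⊕ # 2 ⊕ # 3 ⊕ # 4) (# 1 ⊕ # 0 ⊕ # 2 ⊕ # 3 ⊕ # 4) ([ z ] ∷ [ a ] ∷ xs ∷ [ t ] ∷ ys ∷  [])) U (here refl) (there (∈ₚ.∈-++⁺ˡ m))

    z∉ : z ∉ ys
    z∉ m = Unique-clash {xs = [ z ]} (prove (# 0 ⊕ # 1 ⊕ # 2 ⊕ # 3 ⊕ # 4) (# 0 ⊕ # 4 ⊕ # 1 ⊕ # 2 ⊕ # 3) ([ z ] ∷ [ a ] ∷ xs ∷ [ t ] ∷ ys ∷  [])) U (here refl) (∈ₚ.∈-++⁺ˡ m)

    cross₁ : xs ≢ [] → Free R₀ a t
    cross₁ ne = (λ m → to (sides m)) , λ m → from (sides m)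
      where
      first : ∀ l → l ≢ [] → a ∉ l → t ∉ l → (a , t) ∉ pairs a (l ∷ʳ t)
      first [] n _ _ _ = n refl
      first (_ ∷ l) _ _ n (here refl) = n (here refl)
      first (x ∷ l) _ n _ (there m) = n (pairs-∈ˡ x l m)
      to : (a , t) ≡ (z , a) ⊎ (a , t) ∈ pairs a (xs ∷ʳ t) ⊎ (a , t) ∈ pairs t (ys ∷ʳ z) → ⊥
      to (inj₁ refl) = t∉ (here refl)
      to (inj₂ (inj₁ m)) = first xs ne a∉ (λ m' → t∉ (there m')) m
      to (inj₂ (inj₂ m)) = t∉′ (proj₂ (pairs-∈ t (ys ∷ʳ z) m))
      from : (t , a) ≡ (z , a) ⊎ (t , a) ∈ pairs a (xs ∷ʳ t) ⊎ (t , a) ∈ pairs t (ys ∷ʳ z) → ⊥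
      from (inj₁ refl) = t∉′ (∈-mid ys)
      from (inj₂ (inj₁ m)) = t∉ (pairs-∈ˡ a xs m)
      from (inj₂ (inj₂ m)) = off₁ (proj₂ (pairs-∈ t (ys ∷ʳ z) m)) (there (here refl))

    cross₂ : ys ≢ [] → Free R₀ t z
    cross₂ ne = (λ m → to (sides m)) , λ m → from (sides m)
      where
      first : ∀ l → l ≢ [] → z ∉ l → t ∉ l → (t , z) ∉ pairs t (l ∷ʳ z)
      first [] n _ _ _ = n refl
      first (_ ∷ l) _ n _ (here refl) = n (here refl)
      first (x ∷ l) _ _ n (there m) = n (pairs-∈ˡ x l m)
      to : (t , z) ≡ (z , a) ⊎ (t , z) ∈ pairs a (xs ∷ʳ t) ⊎ (t , z) ∈ pairs t (ys ∷ʳ z) → ⊥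
      to (inj₁ refl) = t∉ (here refl)
      to (inj₂ (inj₁ m)) = t∉ (pairs-∈ˡ a xs m)
      to (inj₂ (inj₂ m)) = first ys ne z∉ (λ m' → t∉′ (∈ₚ.∈-++⁺ˡ m')) m
      from : (z , t) ≡ (z , a) ⊎ (z , t) ∈ pairs a (xs ∷ʳ t) ⊎ (z , t) ∈ pairs t (ys ∷ʳ z) → ⊥
      from (inj₁ refl) = t∉ (here refl)
      from (inj₂ (inj₁ m)) = off₂ (pairs-∈ˡ a xs m) (here refl)
      from (inj₂ (inj₂ m)) = t∉′ (proj₂ (pairs-∈ t (ys ∷ʳ z) m))

    region₁-⊆ : xs ≢ [] → Region t a xs d → Region z a (xs ++ t ∷ ys) d
    region₁-⊆ ne R = reach-trans (cross (turn-face f stop) (cross₁ ne)) (reach-lift (λ S (n₁ , n₂) →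
        (λ m → old S n₁ (sides m)) , λ m → old' S n₂ (sides m)) R)
      where
      old : Region t a xs (x , y) → (x , y) ∉ boundary t a xs → (x , y) ≡ (z , a) ⊎ (x , y) ∈ pairs a (xs ∷ʳ t) ⊎ (x , y) ∈ pairs t (ys ∷ʳ z) → ⊥
      old S n (inj₁ refl) = avoid₁ ne S (inj₁ (∈-mid ys))
      old S n (inj₂ (inj₁ m)) = n (there m)
      old S n (inj₂ (inj₂ m)) = avoid₁ ne S (inj₂ (proj₂ (pairs-∈ t (ys ∷ʳ z) m)))
      old' : Region t a xs (x , y) → (y , x) ∉ boundary t a xs → (y , x) ≡ (z , a) ⊎ (y , x) ∈ pairs a (xs ∷ʳ t) ⊎ (y , x) ∈ pairs t (ys ∷ʳ z) → ⊥
      old' S n (inj₁ refl) = avoid₁ ne S (inj₂ (∈-mid ys))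
      old' S n (inj₂ (inj₁ m)) = n (there m)
      old' S n (inj₂ (inj₂ m)) = avoid₁ ne S (inj₁ (proj₂ (pairs-∈ t (ys ∷ʳ z) m)))

    region₂-⊆ : ys ≢ [] → Region z t ys d → Region z a (xs ++ t ∷ ys) d
    region₂-⊆ ne R = reach-trans (cross (turn-face (face'-rot f) (turn-face f stop)) (cross₂ ne)) (reach-lift (λ S (n₁ , n₂) →
        (λ m → old S n₁ (sides m)) , λ m → old' S n₂ (sides m)) R)
      where
      old : Region z t ys (x , y) → (x , y) ∉ boundary z t ys → (x , y) ≡ (z , a) ⊎ (x , y) ∈ pairs a (xs ∷ʳ t) ⊎ (x , y) ∈ pairs t (ys ∷ʳ z) → ⊥
      old S n (inj₁ refl) = avoid₂ ne S (inj₂ (here refl))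
      old S n (inj₂ (inj₁ m)) = avoid₂ ne S (inj₁ (pairs-∈ˡ a xs m))
      old S n (inj₂ (inj₂ m)) = n (there m)
      old' : Region z t ys (x , y) → (y , x) ∉ boundary z t ys → (y , x) ≡ (z , a) ⊎ (y , x) ∈ pairs a (xs ∷ʳ t) ⊎ (y , x) ∈ pairs t (ys ∷ʳ z) → ⊥
      old' S n (inj₁ refl) = avoid₂ ne S (inj₁ (here refl))
      old' S n (inj₂ (inj₁ m)) = avoid₂ ne S (inj₂ (pairs-∈ˡ a xs m))
      old' S n (inj₂ (inj₂ m)) = n (there m)

    -- From a common dart one could walk back to the root of the second region without crossing the
    -- first cycle; then the first region would reach `z`.
    disjoint : xs ≢ [] → ys ≢ [] → Region t a xs d → Region z t ys d → ⊥
    disjoint ne₁ ne₂ R S = avoid₁ ne₁ (reach-trans R (reach-sym (proj₁ (adj'-sym (face-adj₃ f))) (reach-lift (λ S' _ → (λ m → off S' m) , λ m → off' S' m) S))) (inj₁ (∈-mid ys))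
      where
      off : Region z t ys (x , y) → (x , y) ∉ boundary t a xs
      off S (here refl) = avoid₂ ne₂ S (inj₂ (here refl))
      off S (there m) = avoid₂ ne₂ S (inj₁ (pairs-∈ˡ a xs m))
      off' : Region z t ys (x , y) → (y , x) ∉ boundary t a xs
      off' S (here refl) = avoid₂ ne₂ S (inj₁ (here refl))
      off' S (there m) = avoid₂ ne₂ S (inj₂ (pairs-∈ˡ a xs m))

    outside₁ : xs ≢ [] → d ∈ triangle z a t → Region t a xs d → ⊥
    outside₁ ne (here refl) R = avoid₁ ne R (inj₁ (∈-mid ys))
    outside₁ ne (there (here refl)) R = left-right unique₁ ne edges₁ R
    outside₁ ne (there (there (here refl))) R = avoid₁ ne R (inj₂ (∈-mid ys))

    outside₂ : ys ≢ [] → d ∈ triangle z a t → Region z t ys d → ⊥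
    outside₂ ne (here refl) R = avoid₂ ne R (inj₂ (here refl))
    outside₂ ne (there (here refl)) R = avoid₂ ne R (inj₁ (here refl))
    outside₂ ne (there (there (here refl))) R = left-right unique₂ ne edges₂ R

  -- The triangulated disk to the left of a cycle

  -- Only the darts are known to be distinct at this stage. That the vertices are distinct is
  -- obtained afterwards by counting.
  record Filling (z a : V) (r : Ls) : Set where
    constructor filling
    field
      {interior} : Ls
      disk   : Disk z a r interior
      unique : Unique (dartsOf disk)
      inside : ∀ {d} → d ∈ dartsOf disk → r ≢ [] × Region z a r d

  triangle-unique : Adj x y → Adj y w → Adj w x → Unique (triangle x y w)
  triangle-unique h₁ h₂ h₃ = ((λ { refl → adj-irrefl h₁ }) ∷ (λ { refl → adj-irrefl h₁ }) ∷ []) ∷ ((λ { refl → adj-irrefl h₂ }) ∷ []) ∷ [] ∷ []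

  -- `Av` is a finite supply that contains the darts of the region. Each step consumes the root
  -- dart, which is not in the regions of the smaller cycles, and this bounds the recursion.
  fill : ∀ N {Av} → length Av ≤ N → Unique (z ∷ a ∷ r) → Edges (boundary z a r) → (∀ {d} → r ≢ [] → Region z a r d → d ∈ Av) →
    (∀ {x y} → r ≢ [] → Region z a r (x , y) → Free [ (u , v) ] x y) → Filling z a r
  fill {r = []} N len U Ed av free = filling (edge (Ed (here refl))) [] λ ()
  fill {r = _ ∷ _} zero {[]} len U Ed av free with av (λ ()) stop
  ... | ()
  fill {z} {a} {r = b ∷ r} (suc N) {Av} len U Ed av free = go (rot a z ∈? (z ∷ a ∷ b ∷ r)) less
    where
    h : Adj z a
    h = proj₁ (Ed (here refl))
    last-turn : Region z a (b ∷ r) (rot a z , z)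
    last-turn = subst (λ v → Region z a (b ∷ r) (rot a z , v)) (turn² h) (turn (turn stop))
    f : Face' z a (rot a z)
    f = refl , Ed (here refl) , (turn-adj h , free (λ ()) (turn stop)) , (reach-adj h last-turn , free (λ ()) last-turn)
    Tu : Unique (triangle z a (rot a z))
    Tu = triangle-unique h (proj₁ (face-adj₂ f)) (proj₁ (face-adj₃ f))
    in-region : ∀ {d} → d ∈ triangle z a (rot a z) → Region z a (b ∷ r) d
    in-region (here refl) = stop
    in-region (there (here refl)) = turn stop
    in-region (there (there (here refl))) = last-turn
    Less : Set
    Less = ∃[ Av' ] length Av' ≤ N × (∀ {d} → d ∈ Av → d ≢ (z , a) → d ∈ Av')
    less : Less
    less with ∈ₚ.∈-∃++ (av (λ ()) stop)
    ... | as , bs , refl = as ++ bs , ℕₚ.≤-pred (subst (_≤ suc N) (↭-length (shift (z , a) as bs)) len) , λ m n → drop (∈-resp-↭ (shift (z , a) as bs) m) n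
      where
      drop : ∀ {d} → d ∈ (z , a) ∷ as ++ bs → d ≢ (z , a) → d ∈ as ++ bs
      drop (here e) n = ⊥-elim (n e)
      drop (there m) _ = m
    at : ∀ {xs ys} → b ∷ r ≡ xs ++ rot a z ∷ ys → Less → Filling z a (b ∷ r)
    at {xs} {ys} e (Av' , len' , sub) = together (fill N len' unique₁ edges₁ (λ ne R → sub (av (λ ()) (up (region₁-⊆ ne R))) λ { refl → outside₁ ne (here refl) R }) (λ ne R → free (λ ()) (up (region₁-⊆ ne R))))
                          (fill N len' unique₂ edges₂ (λ ne R → sub (av (λ ()) (up (region₂-⊆ ne R))) λ { refl → outside₂ ne (here refl) R }) (λ ne R → free (λ ()) (up (region₂-⊆ ne R))))
      where
      open Split {z} {a} {rot a z} {xs} {ys} (subst (λ l → Unique (z ∷ a ∷ l)) e U) (subst (λ l → Edges (boundary z a l)) e Ed) f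
      up : ∀ {d} → Region z a (xs ++ rot a z ∷ ys) d → Region z a (b ∷ r) d
      up {d} = subst (λ l → Region z a l d) (sym e)
      together : Filling (rot a z) a xs → Filling z (rot a z) ys → Filling z a (b ∷ r)
      together (filling D uD inD) (filling E uE inE) = filling (split f D E e ↭-refl)
        (Uniqueₚ.++⁺ Tu (Uniqueₚ.++⁺ uD uE (λ (m , m') → disjoint (proj₁ (inD m)) (proj₁ (inE m')) (proj₂ (inD m)) (proj₂ (inE m'))))
          (λ (m , m') → off m (∈ₚ.∈-++⁻ (dartsOf D) m')))
        λ m → (λ ()) , [ in-region , (λ m' → [ (λ m'' → up (region₁-⊆ (proj₁ (inD m'')) (proj₂ (inD m'')))) , (λ m'' → up (region₂-⊆ (proj₁ (inE m'')) (proj₂ (inE m'')))) ]′ (∈ₚ.∈-++⁻ (dartsOf D) m')) ]′ (∈ₚ.∈-++⁻ (triangle z a (rot a z)) m)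
        where
        off : ∀ {d} → d ∈ triangle z a (rot a z) → d ∈ dartsOf D ⊎ d ∈ dartsOf E → ⊥
        off m (inj₁ m') = outside₁ (proj₁ (inD m')) m (proj₂ (inD m'))
        off m (inj₂ m') = outside₂ (proj₁ (inE m')) m (proj₂ (inE m'))
    new : rot a z ∉ z ∷ a ∷ b ∷ r → Less → Filling z a (b ∷ r)
    new t∉ (Av' , len' , sub) = together (fill N len' unique′ edges′ (λ _ R → sub (av (λ ()) (region-⊆ R)) λ { refl → outside (here refl) R }) (λ _ R → free (λ ()) (region-⊆ R)))
      where
      open Inner {z} {a} {rot a z} {b ∷ r} U t∉ Ed f
      together : Filling (rot a z) a ((b ∷ r) ∷ʳ z) → Filling z a (b ∷ r)
      together (filling D uD inD) = filling (inner f D ↭-refl) (Uniqueₚ.++⁺ Tu uD (λ (m , m') → outside m (proj₂ (inD m'))))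
        λ m → (λ ()) , [ in-region , (λ m' → region-⊆ (proj₂ (inD m'))) ]′ (∈ₚ.∈-++⁻ (triangle z a (rot a z)) m)
    go : Dec (rot a z ∈ z ∷ a ∷ b ∷ r) → Less → Filling z a (b ∷ r)
    go (yes (here e)) _ = ⊥-elim (adj-irrefl (subst (λ v → Adj v z) e (proj₁ (face-adj₃ f))))
    go (yes (there (here e))) _ = ⊥-elim (adj-irrefl (subst (Adj a) e (proj₁ (face-adj₂ f))))
    go (yes (there (there m))) l with ∈-split m
    ... | xs , ys , e = at e l
    go (no t∉) l = new t∉ l

  solver : ∀ N → Solver N
  solver = Solutions.solver surface record { no-digon = no-digon ; no-triangle = no-triangle }

  full : Unique ys → n ≤ length ys → ∀ x → x ∈ ys
  full {ys} U le x with sub-perm {xs = allFin n} U (λ _ → ∈ₚ.∈-allFin _)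
  ... | [] , g = subst (x ∈_) (Lₚ.++-identityʳ ys) (∈-resp-↭ g (∈ₚ.∈-allFin x))
  ... | z ∷ zs , g = ⊥-elim (ℕₚ.<⇒≱ (length-↭-< {xs = ys} {ys = zs} (lin {as = allFin n} {bs = ([ z ] ++ (ys ++ zs))} (g) (prove (# 0 ⊕ # 1 ⊕ # 2 ⊕ # 3) ((# 2 ⊕ # 1 ⊕ # 3) ⊕ # 0) (allFin n ∷ ys ∷ [ z ] ∷ zs ∷  [])))) (subst (_≤ length ys) (sym (Lₚ.length-tabulate {n = n} (λ x → x))) le))

  fresh : ∀ l → length l < n → ∃[ x ] x ∉ l
  fresh l lt with missing l (allFin n)
  ... | inj₂ r = r
  ... | inj₁ sub = ⊥-elim (ℕₚ.<⇒≱ lt (subst (_≤ length l) (Lₚ.length-tabulate {n = n} (λ x → x)) (sub-length (Uniqueₚ.allFin⁺ n) sub)))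

  isolated : ∀ {ok : V → Set} {S : Ls} {m x} → (∀ {y} → Adj m y → y ∈ S) → (∀ {y} → ok y → y ∉ S) → x ≢ m → ¬ WalkIn graph ok m x
  isolated nb off n (WalkIn.here _) = n refl
  isolated nb off n (WalkIn.step _ h W) = off (walk-start W) (nb h)

  HamPath : V → V → Set
  HamPath = Defs.HamiltonianPath graph

  module Small (n≤4 : n ≤ 4) where

    -- Deleting the two other vertices leaves `p` and `q` connected, which is possible only by an
    -- edge.
    complete : Unique (p ∷ q ∷ s ∷ t ∷ []) → Adj p q
    complete {p} {q} {s} {t} U@((p≢q ∷ p≢s ∷ p≢t ∷ []) ∷ (q≢s ∷ q≢t ∷ []) ∷ _) = go (proj₂ (proj₂ tc) s t p q (p≢s , p≢t) (q≢s , q≢t))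
      where
      go : WalkIn graph (λ x → x ≢ s × x ≢ t) p q → Adj p q
      go (WalkIn.here _) = ⊥-elim (p≢q refl)
      go (WalkIn.step {y = y} _ h W) with full U n≤4 y
      ... | here refl = ⊥-elim (adj-irrefl h)
      ... | there (here refl) = h
      ... | there (there (here e)) = ⊥-elim (proj₁ (walk-start W) e)
      ... | there (there (there (here e))) = ⊥-elim (proj₂ (walk-start W) e)

    hamiltonian : x ≢ y → HamPath x y
    hamiltonian {x} {y} x≢y with fresh (x ∷ y ∷ []) (ℕₚ.<-≤-trans (s≤s (s≤s (s≤s z≤n))) (proj₁ tc))
    ... | p , p∉ with fresh (x ∷ y ∷ p ∷ []) (proj₁ tc)
    ... | q , q∉ = x ∷ p ∷ q ∷ [ y ] , Defs.cons (complete U) (Defs.cons (complete (Unique-↭ (prove (# 0 ⊕ # 1 ⊕ # 2 ⊕ # 3) (# 1 ⊕ # 2 ⊕ # 0 ⊕ # 3) ([ x ] ∷ [ p ] ∷ [ q ] ∷ [ y ] ∷  [])) U)) (Defs.cons (complete (Unique-↭ (prove (# 0 ⊕ # 1 ⊕ # 2 ⊕ # 3) (# 2 ⊕ # 3 ⊕ # 1 ⊕ # 0) ([ x ] ∷ [ p ] ∷ [ q ] ∷ [ y ] ∷  [])) U)) Defs.single)) , U , full U n≤4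
      where
      U : Unique (x ∷ p ∷ q ∷ [ y ])
      U = ((λ e → p∉ (here (sym e))) ∷ (λ e → q∉ (here (sym e))) ∷ x≢y ∷ []) ∷ ((λ e → q∉ (there (there (here (sym e))))) ∷ (λ e → p∉ (there (here e))) ∷ []) ∷ ((λ e → q∉ (there (here e))) ∷ []) ∷ [] ∷ []

  -- The disk that remains when the edge uv is deleted

  w₀ w₁ : V
  w₀ = rot v u
  w₁ = rot u v

  vu : Adj v u
  vu = adj-sym uv

  vw₀ : Adj v w₀
  vw₀ = turn-adj uv

  w₀u : Adj w₀ u
  w₀u = subst (Adj w₀) (turn² uv) (turn-adj vw₀)

  uw₁ : Adj u w₁
  uw₁ = turn-adj vu

  w₁v : Adj w₁ v
  w₁v = subst (Adj w₁) (turn² vu) (turn-adj uw₁)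

  -- Otherwise the rotation at `u` consists of `v` and `w₀` only, and deleting these two vertices
  -- isolates `u`.
  w₀≢w₁ : w₀ ≢ w₁
  w₀≢w₁ e with fresh (u ∷ v ∷ w₀ ∷ []) (proj₁ tc)
  ... | x , x∉ = isolated {S = v ∷ w₀ ∷ []} (λ h → rot-closure (_∈ v ∷ w₀ ∷ []) (λ { _ (here refl) → there (here (sym e)) ; _ (there (here refl)) → here (turn³ uv) }) (here refl) uv h)
        (λ { (n₁ , n₂) (here e) → n₁ e ; (n₁ , n₂) (there (here e)) → n₂ e }) (λ e → x∉ (here e))
        (proj₂ (proj₂ tc) v w₀ u x (adj-≢ uv , adj-≢ (adj-sym w₀u)) ((λ e → x∉ (there (here e))) , λ e → x∉ (there (there (here e)))))

  U₄ : Unique (u ∷ w₀ ∷ v ∷ w₁ ∷ [])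
  U₄ = (adj-≢ (adj-sym w₀u) ∷ u≢v ∷ adj-≢ uw₁ ∷ []) ∷ (adj-≢ (adj-sym vw₀) ∷ w₀≢w₁ ∷ []) ∷ (adj-≢ (adj-sym w₁v) ∷ []) ∷ [] ∷ []

  off-uv : x ∉ u ∷ v ∷ [] → Free [ (u , v) ] x y
  off-uv n = (λ { (here refl) → n (here refl) }) , λ { (here refl) → n (there (here refl)) }

  w₀∉ : w₀ ∉ u ∷ v ∷ []
  w₀∉ (here e) = adj-≢ w₀u e
  w₀∉ (there (here e)) = adj-≢ vw₀ (sym e)

  w₁∉ : w₁ ∉ u ∷ v ∷ []
  w₁∉ (here e) = adj-≢ uw₁ (sym e)
  w₁∉ (there (here e)) = adj-≢ w₁v e

  edges₄ : Edges (boundary u w₀ (v ∷ w₁ ∷ []))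
  edges₄ (here refl) = adj-sym w₀u , free-sym (off-uv w₀∉)
  edges₄ (there (here refl)) = adj-sym vw₀ , off-uv w₀∉
  edges₄ (there (there (here refl))) = adj-sym w₁v , free-sym (off-uv w₁∉)
  edges₄ (there (there (there (here refl)))) = adj-sym uw₁ , off-uv w₁∉

  uv-free : Free (boundary u w₀ (v ∷ w₁ ∷ [])) v u
  uv-free = (λ m → not-vu (edges₄ m)) , λ m → not-uv (edges₄ m)

  -- From each of these darts one turns to the dart from `w₀` to `u`, the reverse of the root.
  outer : d ∈ triangle u v w₀ → ¬ Region u w₀ (v ∷ w₁ ∷ []) d
  outer m R = left-right U₄ (λ ()) edges₄ (go m R)
    where
    last-turn : ∀ {e} → Reach (boundary u w₀ (v ∷ w₁ ∷ [])) e (v , w₀) → Reach (boundary u w₀ (v ∷ w₁ ∷ [])) e (w₀ , u)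
    last-turn {e} R = subst (λ x → Reach (boundary u w₀ (v ∷ w₁ ∷ [])) e (w₀ , x)) (turn² uv) (turn R)
    go : d ∈ triangle u v w₀ → Region u w₀ (v ∷ w₁ ∷ []) d → Region u w₀ (v ∷ w₁ ∷ []) (w₀ , u)
    go (here refl) R = last-turn (turn R)
    go (there (here refl)) R = last-turn R
    go (there (there (here refl))) R = R

  top : Filling u w₀ (v ∷ w₁ ∷ [])
  top = fill (length allDarts) ℕₚ.≤-refl U₄ edges₄ (λ _ R → allDarts-∈ (reach-adj (adj-sym w₀u) R))
    λ _ R → (λ { (here refl) → outer (here refl) R }) , λ { (here refl) → outer (here refl) (cross R uv-free) }

  open Filling top using () renaming (interior to i₀; disk to D₀; unique to unique₀; inside to inside₀)

  verts : Ls
  verts = u ∷ w₀ ∷ v ∷ w₁ ∷ i₀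

  -- The triangles of the disk and one triangle at uv are distinct; by parity, this is enough in Euler's formula.
  verts-length : length verts ≤ n
  verts-length = bound (length i₀) (length allDarts) n allDarts-length (subst (_≤ length allDarts) len (sub-length (Uniqueₚ.++⁺ (triangle-unique uv vw₀ w₀u) unique₀ (λ (m , m') → outer m (proj₂ (inside₀ m')))) sub))
    where
    len : length (triangle u v w₀ ++ dartsOf D₀) ≡ 3 + 3 * (2 + (length i₀ + length i₀))
    len = cong (3 +_) (darts-length D₀)
    sub : d ∈ triangle u v w₀ ++ dartsOf D₀ → d ∈ allDarts
    sub (here refl) = allDarts-∈ uv
    sub (there (here refl)) = allDarts-∈ vw₀
    sub (there (there (here refl))) = allDarts-∈ w₀u
    sub (there (there (there m))) = allDarts-∈ (reach-adj (adj-sym w₀u) (proj₂ (inside₀ m)))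
    bound : ∀ i A n → A + 12 ≡ 6 * n → 3 + 3 * (2 + (i + i)) ≤ A → 4 + i ≤ n
    bound i A n e le = ℕₚ.≤-pred (ℕₚ.*-cancelˡ-< 6 (4 + i) (suc n) (begin-strict
      6 * (4 + i) <⟨ ℕₚ.m<m+n _ {3} (s≤s z≤n) ⟩
      6 * (4 + i) + 3 ≡⟨ lem i ⟩
      (3 + 3 * (2 + (i + i))) + 12 + 6 ≤⟨ ℕₚ.+-monoˡ-≤ 6 (ℕₚ.+-monoˡ-≤ 12 le) ⟩
      A + 12 + 6 ≡⟨ cong (_+ 6) e ⟩
      6 * n + 6 ≡⟨ lem' n ⟩
      6 * suc n ∎))
      where
      open ℕₚ.≤-Reasoning
      lem : ∀ i → 6 * (4 + i) + 3 ≡ (3 + 3 * (2 + (i + i))) + 12 + 6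
      lem = solve-∀
      lem' : ∀ n → 6 * n + 6 ≡ 6 * suc n
      lem' = solve-∀

  -- The darts of all triangles, the two at uv included.
  allD : List Dart
  allD = (triangle u v w₀ ++ triangle v u w₁) ++ dartsOf D₀

  inner-∈ : d ∈ boundary u w₀ (v ∷ w₁ ∷ []) → d ∈ allD
  inner-∈ m = ∈ₚ.∈-++⁺ʳ (triangle u v w₀ ++ triangle v u w₁) (boundary-darts D₀ (λ ()) m)

  turn-∈ : (x , y) ∈ allD → (y , rot y x) ∈ allD
  turn-∈ (here refl) = there (here refl)
  turn-∈ (there (here refl)) = there (there (here (cong (w₀ ,_) (turn² uv))))
  turn-∈ (there (there (here refl))) = here (cong (u ,_) (turn³ uv))
  turn-∈ (there (there (there (here refl)))) = there (there (there (there (here refl))))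
  turn-∈ (there (there (there (there (here refl))))) = there (there (there (there (there (here (cong (w₁ ,_) (turn² vu)))))))
  turn-∈ (there (there (there (there (there (here refl)))))) = there (there (there (here (cong (v ,_) (turn³ vu)))))
  turn-∈ (there (there (there (there (there (there m)))))) with darts-face D₀ m
  ... | _ , (refl , _) , m' = there (there (there (there (there (there m')))))

  reverse-∈ : (x , y) ∈ allD → (y , x) ∈ allD
  reverse-∈ (here refl) = there (there (there (here refl)))
  reverse-∈ (there (here refl)) = inner-∈ (there (here refl))
  reverse-∈ (there (there (here refl))) = inner-∈ (here refl)
  reverse-∈ (there (there (there (here refl)))) = here refl
  reverse-∈ (there (there (there (there (here refl))))) = inner-∈ (there (there (there (here refl))))
  reverse-∈ (there (there (there (there (there (here refl)))))) = inner-∈ (there (there (here refl)))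
  reverse-∈ (there (there (there (there (there (there m)))))) with darts-reverse D₀ m
  ... | inj₁ m' = there (there (there (there (there (there m')))))
  ... | inj₂ (here refl) = there (there (here refl))
  ... | inj₂ (there (here refl)) = there (here refl)
  ... | inj₂ (there (there (here refl))) = there (there (there (there (there (here refl)))))
  ... | inj₂ (there (there (there (here refl)))) = there (there (there (there (here refl))))

  source-∈ : (x , y) ∈ allD → x ∈ verts
  source-∈ (here refl) = here refl
  source-∈ (there (here refl)) = there (there (here refl))
  source-∈ (there (there (here refl))) = there (here refl)
  source-∈ (there (there (there (here refl)))) = there (there (here refl))
  source-∈ (there (there (there (there (here refl))))) = here refl
  source-∈ (there (there (there (there (there (here refl)))))) = there (there (there (here refl)))
  source-∈ (there (there (there (there (there (there m)))))) = dart-source D₀ m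

  allD-adj : (x , y) ∈ allD → Adj x y
  allD-adj (here refl) = uv
  allD-adj (there (here refl)) = vw₀
  allD-adj (there (there (here refl))) = w₀u
  allD-adj (there (there (there (here refl)))) = vu
  allD-adj (there (there (there (there (here refl))))) = uw₁
  allD-adj (there (there (there (there (there (here refl)))))) = w₁v
  allD-adj (there (there (there (there (there (there m)))))) with darts-face D₀ m
  ... | _ , (_ , h , _) , _ = proj₁ h

  -- `allD` is closed under turning and reversing, hence under rotation at each vertex, and walks
  -- carry this to every vertex.
  cover : ∀ x → x ∈ verts
  cover x with along (connected u x tt tt) (v , there (there (there (here refl))))
    where
    along : WalkIn graph (λ _ → ⊤) y x → ∃[ s ] (s , y) ∈ allD → ∃[ s ] (s , x) ∈ allD
    along (WalkIn.here _) m = m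
    along (WalkIn.step {x = y} {w} _ h W) (s , m) = along W (y , reverse-∈ (rot-closure (λ t → (t , y) ∈ allD) (λ _ m' → reverse-∈ (turn-∈ m')) m (adj-sym (allD-adj m)) h))
  ... | s , m = source-∈ (reverse-∈ m)

  -- A list of at most `n` entries that contains all `n` vertices cannot repeat any of them.
  unique-verts : Unique verts
  unique-verts with sub-perm {xs = verts} (Uniqueₚ.allFin⁺ n) (λ _ → cover _)
  ... | [] , g = Unique-↭ (↭-sym (lin {as = verts} {bs = allFin n} (g) (prove (# 0 ⊕ # 1 ⊕ ε) (# 1 ⊕ # 0) (verts ∷ allFin n ∷  [])))) (Uniqueₚ.allFin⁺ n)
  ... | z ∷ zs , g = ⊥-elim (ℕₚ.<⇒≱ (subst (_< length verts) (Lₚ.length-tabulate {n = n} (λ x → x)) (length-↭-< {xs = allFin n} {ys = zs} (lin {as = verts} {bs = ([ z ] ++ ((allFin n) ++ zs))} (g) (prove (# 0 ⊕ # 1 ⊕ # 2 ⊕ # 3) ((# 2 ⊕ # 1 ⊕ # 3) ⊕ # 0) (verts ∷ allFin n ∷ [ z ] ∷ zs ∷  []))))) verts-length)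

  -- The neighbours of `m` form a triangle that cuts `m` off from a fifth vertex. It is separating
  -- but does not contain `m`, which is `u` or `v`.
  degree-three : ∀ {m o p q} → 5 ≤ n → m ≡ u ⊎ m ≡ v → Adj m o → Adj m p → Adj m q → rot m o ≡ p → rot m p ≡ q → rot m q ≡ o → Adj o p → Adj p q → Adj q o → ⊥
  degree-three {m} {o} {p} {q} 5≤n mE mo mp mq e₁ e₂ e₃ op pq qo with fresh (m ∷ o ∷ p ∷ q ∷ []) 5≤n
  ... | x , x∉ = contra mE (sep o p q ((op , pq , qo) , λ conn → isolated {S = o ∷ p ∷ q ∷ []}
          (λ h → rot-closure (_∈ o ∷ p ∷ q ∷ []) (λ { _ (here refl) → there (here e₁) ; _ (there (here refl)) → there (there (here e₂)) ; _ (there (there (here refl))) → here e₃ }) (here refl) mo h)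
          (λ { (n₁ , n₂ , n₃) (here e) → n₁ e ; (n₁ , n₂ , n₃) (there (here e)) → n₂ e ; (n₁ , n₂ , n₃) (there (there (here e))) → n₃ e })
          (λ e → x∉ (here e))
          (conn m x (adj-≢ mo , adj-≢ mp , adj-≢ mq) ((λ e → x∉ (there (here e))) , (λ e → x∉ (there (there (here e)))) , λ e → x∉ (there (there (there (here e))))))))
    where
    none-of : m ≡ o ⊎ m ≡ p ⊎ m ≡ q → ⊥
    none-of (inj₁ e) = adj-≢ mo e
    none-of (inj₂ (inj₁ e)) = adj-≢ mp e
    none-of (inj₂ (inj₂ e)) = adj-≢ mq e
    contra : m ≡ u ⊎ m ≡ v → (u ≡ o ⊎ u ≡ p ⊎ u ≡ q) × (v ≡ o ⊎ v ≡ p ⊎ v ≡ q) → ⊥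
    contra (inj₁ refl) (m₁ , _) = none-of m₁
    contra (inj₂ refl) (_ , m₂) = none-of m₂

  triangle-face : Disk z a (b ∷ []) [] → Face' z a b
  triangle-face (inner _ _ h) with ↭-length h
  ... | ()
  triangle-face (split {xs = []} f _ _ refl _) = f
  triangle-face (split {xs = _ ∷ xs} _ _ _ e _) = ⊥-elim (∷ʳ-≢[] xs (sym (Lₚ.∷-injectiveʳ e)))

  -- Joining the two paths of a solution on a 4-cycle without diagonals

  -- A pocket that skips a vertex of this arc is cut off by `b z`, `a c` or `a z`. The first two
  -- would be the excluded triangles, and with the third only `z` would be kept, contrary to the
  -- length bound.
  pockets-trivial : Pockets a (b ∷ c ∷ z ∷ []) k unv → 2 ≤ length k → Unique (a ∷ k ++ unv) → ¬ Disk z b [ c ] [] → ¬ Disk c a [ b ] [] → unv ≡ []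
  pockets-trivial (cons {m = []} _ nil () _)
  pockets-trivial {a} {b} {c} {z} {k} {unv} (cons {m = []} {i₁} D (cons {m = []} {i₂} E P refl g₂) refl g₁) long U no₁ no₂ with single-pocket P
  ... | refl , F = ↭-empty-inv (↭-trans g (lin {as = (i₁ ++ (i₂ ++ u₂))} {bs = []} ((((↭-reflexive (no-digon D U₁)))) ⊹ (((↭-reflexive (no-digon E U₂)))) ⊹ (((↭-reflexive (no-digon F U₃))))) (prove ((# 0 ⊕ # 1 ⊕ # 2) ⊕ ε ⊕ ε ⊕ ε) (ε ⊕ # 0 ⊕ # 1 ⊕ # 2) (i₁ ∷ i₂ ∷ u₂ ∷  []))))
    where
    u₂ = _
    g : unv ↭ i₁ ++ i₂ ++ u₂
    g = ↭-trans g₁ (++⁺ˡ i₁ g₂)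
    U₁ : Unique (b ∷ a ∷ i₁)
    U₁ = Unique-sub {ys = c ∷ z ∷ i₂ ++ u₂} (lin {as = (([ b ] ++ ([ a ] ++ i₁)) ++ ([ c ] ++ ([ z ] ++ (i₂ ++ u₂))))} {bs = ([ a ] ++ ([ b ] ++ ([ c ] ++ ([ z ] ++ unv))))} ((↭-sym g)) (prove (((# 0 ⊕ # 1 ⊕ # 2) ⊕ # 3 ⊕ # 4 ⊕ # 5 ⊕ # 6) ⊕ # 7) ((# 1 ⊕ # 0 ⊕ # 3 ⊕ # 4 ⊕ # 7) ⊕ # 2 ⊕ # 5 ⊕ # 6) ([ b ] ∷ [ a ] ∷ i₁ ∷ [ c ] ∷ [ z ] ∷ i₂ ∷ u₂ ∷ unv ∷  []))) U
    U₂ : Unique (c ∷ b ∷ i₂)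
    U₂ = Unique-sub {ys = a ∷ z ∷ i₁ ++ u₂} (lin {as = (([ c ] ++ ([ b ] ++ i₂)) ++ ([ a ] ++ ([ z ] ++ (i₁ ++ u₂))))} {bs = ([ a ] ++ ([ b ] ++ ([ c ] ++ ([ z ] ++ unv))))} ((↭-sym g)) (prove (((# 0 ⊕ # 1 ⊕ # 2) ⊕ # 3 ⊕ # 4 ⊕ # 5 ⊕ # 6) ⊕ # 7) ((# 3 ⊕ # 1 ⊕ # 0 ⊕ # 4 ⊕ # 7) ⊕ # 5 ⊕ # 2 ⊕ # 6) ([ c ] ∷ [ b ] ∷ i₂ ∷ [ a ] ∷ [ z ] ∷ i₁ ∷ u₂ ∷ unv ∷  []))) U
    U₃ : Unique (z ∷ c ∷ u₂)
    U₃ = Unique-sub {ys = a ∷ b ∷ i₁ ++ i₂} (lin {as = (([ z ] ++ ([ c ] ++ u₂)) ++ ([ a ] ++ ([ b ] ++ (i₁ ++ i₂))))} {bs = ([ a ] ++ ([ b ] ++ ([ c ] ++ ([ z ] ++ unv))))} ((↭-sym g)) (prove (((# 0 ⊕ # 1 ⊕ # 2) ⊕ # 3 ⊕ # 4 ⊕ # 5 ⊕ # 6) ⊕ # 7) ((# 3 ⊕ # 4 ⊕ # 1 ⊕ # 0 ⊕ # 7) ⊕ # 5 ⊕ # 6 ⊕ # 2) ([ z ] ∷ [ c ] ∷ u₂ ∷ [ a ] ∷ [ b ] ∷ i₁ ∷ i₂ ∷ unv ∷  []))) U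
  pockets-trivial {a} {b} {c} {z} {k} {unv} (cons {m = []} {i₁} D (cons {m = _ ∷ []} {i₂} {k = k'} {u₂} E P refl g₂) refl g₁) long U no₁ no₂ =
    ⊥-elim (no₁ (subst (Disk z b [ c ]) (no-triangle E (Unique-sub {ys = a ∷ k' ++ i₁ ++ u₂} (lin {as = (([ z ] ++ ([ b ] ++ ([ c ] ++ i₂))) ++ ([ a ] ++ (k' ++ (i₁ ++ u₂))))} {bs = ([ a ] ++ (([ b ] ++ ([ z ] ++ k')) ++ unv))} ((↭-sym g₁) ⊹ (↭-sym g₂)) (prove (((# 0 ⊕ # 1 ⊕ # 2 ⊕ # 3) ⊕ # 4 ⊕ # 5 ⊕ # 6 ⊕ # 7) ⊕ # 8 ⊕ # 9) ((# 4 ⊕ (# 1 ⊕ # 0 ⊕ # 5) ⊕ # 8) ⊕ (# 6 ⊕ # 9) ⊕ # 2 ⊕ # 3 ⊕ # 7) ([ z ] ∷ [ b ] ∷ [ c ] ∷ i₂ ∷ [ a ] ∷ k' ∷ i₁ ∷ u₂ ∷ unv ∷ u' ∷  []))) U)) E))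
    where
    u' = _
  pockets-trivial (cons {m = []} D (cons {m = _ ∷ _ ∷ m} E P e₂ g₂) refl g₁) long U no₁ no₂ = ⊥-elim (∷ʳ-≢[] m (sym (Lₚ.∷-injectiveʳ (Lₚ.∷-injectiveʳ e₂))))
  pockets-trivial {a} {b} {c} {z} {k} {unv} (cons {m = _ ∷ []} {i₁} {k = k'} {u₁} D P refl g₁) long U no₁ no₂ =
    ⊥-elim (no₂ (subst (Disk c a [ b ]) (no-triangle D (Unique-sub {ys = k' ++ u₁} (lin {as = (([ c ] ++ ([ a ] ++ ([ b ] ++ i₁))) ++ (k' ++ u₁))} {bs = ([ a ] ++ (([ c ] ++ k') ++ unv))} ((↭-sym g₁)) (prove (((# 0 ⊕ # 1 ⊕ # 2 ⊕ # 3) ⊕ # 4 ⊕ # 5) ⊕ # 6) ((# 1 ⊕ (# 0 ⊕ # 4) ⊕ # 6) ⊕ # 2 ⊕ # 3 ⊕ # 5) ([ c ] ∷ [ a ] ∷ [ b ] ∷ i₁ ∷ k' ∷ u₁ ∷ unv ∷  []))) U)) D))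
  pockets-trivial (cons {m = _ ∷ _ ∷ []} D nil refl g₁) (s≤s ()) U no₁ no₂
  pockets-trivial (cons {m = _ ∷ _ ∷ []} D (cons {m = []} _ _ () _) refl g₁) long U no₁ no₂
  pockets-trivial (cons {m = _ ∷ _ ∷ []} D (cons {m = _ ∷ _} _ _ () _) refl g₁) long U no₁ no₂
  pockets-trivial (cons {m = _ ∷ _ ∷ _ ∷ m} D P e g₁) long U no₁ no₂ = ⊥-elim (∷ʳ-≢[] m (sym (Lₚ.∷-injectiveʳ (Lₚ.∷-injectiveʳ (Lₚ.∷-injectiveʳ e)))))

  trail-path : ∀ {l} → Trail x l y → Defs.PathList graph x y (x ∷ l)
  trail-path stop = Defs.single
  trail-path (Trail.step h S) = Defs.cons (proj₁ h) (trail-path S)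

  hamiltonian-from : Disk z a (b ∷ c ∷ []) i → Unique (z ∷ a ∷ b ∷ c ∷ i) → (∀ x → x ∈ z ∷ a ∷ b ∷ c ∷ i) → ¬ Disk z b [ c ] [] → ¬ Disk c a [ b ] [] →
    x ≢ y → ¬ SameEnds x y z a → HamPath x y
  hamiltonian-from {z} {a} {b} {c} {i} {x} {y} D U all no₁ no₂ n se with solver _ D (λ ()) ℕₚ.≤-refl U (all x) (all y) n se
  ... | out {kept} {unv} {ins} pk two ct long with pockets-trivial pk long (Unique-sub {ys = ins} (lin {as = (([ a ] ++ (kept ++ unv)) ++ ins)} {bs = ([ z ] ++ ([ a ] ++ ([ b ] ++ ([ c ] ++ i))))} ((↭-sym ct)) (prove (((# 0 ⊕ # 1 ⊕ # 2) ⊕ # 3) ⊕ # 4 ⊕ # 0 ⊕ # 5 ⊕ # 6 ⊕ # 7) ((# 4 ⊕ # 0 ⊕ # 5 ⊕ # 6 ⊕ # 7) ⊕ (# 0 ⊕ # 1 ⊕ # 3) ⊕ # 2) ([ a ] ∷ kept ∷ unv ∷ ins ∷ [ z ] ∷ [ b ] ∷ [ c ] ∷ i ∷  []))) U) no₁ no₂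
  ... | refl with two-join two (root-adj D)
  ... | l , S , g = x ∷ l , trail-path S , Unique-↭ vl U , λ w → ∈-resp-↭ vl (all w)
    where
    vl : z ∷ a ∷ b ∷ c ∷ i ↭ x ∷ l
    vl = (lin {as = ([ z ] ++ ([ a ] ++ ([ b ] ++ ([ c ] ++ i))))} {bs = ([ x ] ++ l)} (ct ⊹ (↭-sym g)) (prove ((# 0 ⊕ # 1 ⊕ # 2 ⊕ # 3 ⊕ # 4) ⊕ ((# 1 ⊕ # 5 ⊕ # 6) ⊕ ε) ⊕ # 7 ⊕ # 8) ((# 7 ⊕ # 8) ⊕ (# 0 ⊕ # 1 ⊕ # 2 ⊕ # 3 ⊕ # 4) ⊕ # 1 ⊕ # 5 ⊕ # 6) ([ z ] ∷ [ a ] ∷ [ b ] ∷ [ c ] ∷ i ∷ kept ∷ ins ∷ [ x ] ∷ l ∷  [])))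

  module Large (5≤n : 5 ≤ n) where

    corner-v : ¬ Disk w₁ w₀ [ v ] []
    corner-v D with triangle-face D
    ... | f = degree-three {v} {u} {w₀} {w₁} 5≤n (inj₂ refl) vu vw₀ (adj-sym w₁v) refl (sym (proj₁ (face'-rot f))) (turn³ vu) (adj-sym w₀u) (adj-sym (proj₁ (face'-adj f))) (adj-sym uw₁)

    corner-u : ¬ Disk w₀ w₁ [ u ] []
    corner-u D with triangle-face D
    ... | f = degree-three {u} {v} {w₁} {w₀} 5≤n (inj₁ refl) uv uw₁ (adj-sym w₀u) refl (sym (proj₁ (face'-rot f))) (turn³ uv) (adj-sym w₁v) (adj-sym (proj₁ (face'-adj f))) (adj-sym vw₀)

    -- One of the two possible chords is the deleted edge; the other, from `w₀` to `w₁`, would leave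
    -- `v` with degree three.
    root-u : x ≢ y → ¬ SameEnds x y u w₀ → HamPath x y
    root-u = hamiltonian-from D₀ unique-verts cover (λ D → not-uv (root-adj D)) corner-v

    root-w₀ : x ≢ y → ¬ SameEnds x y w₀ v → HamPath x y
    root-w₀ = hamiltonian-from (rotate D₀ refl) (Unique-↭ turned unique-verts) (λ x → ∈-resp-↭ turned (cover x)) corner-u (λ D → not-uv (root-adj D))
      where
      turned : u ∷ w₀ ∷ v ∷ w₁ ∷ i₀ ↭ w₀ ∷ v ∷ w₁ ∷ u ∷ i₀
      turned = (prove (# 0 ⊕ # 1 ⊕ # 2 ⊕ # 3 ⊕ # 4) (# 1 ⊕ # 2 ⊕ # 3 ⊕ # 0 ⊕ # 4) ([ u ] ∷ [ w₀ ] ∷ [ v ] ∷ [ w₁ ] ∷ i₀ ∷  []))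

    -- The root `u w₀` fails at most when `u` is an end vertex. In that case `w₀ v` is a valid root,
    -- because `u` is not on it.
    hamiltonian : x ≢ y → HamPath x y
    hamiltonian {x} {y} n with x Fin.≟ u | y Fin.≟ u
    ... | yes refl | _ = root-w₀ n λ { (inj₁ (e , _)) → adj-≢ w₀u (sym e) ; (inj₂ (e , _)) → u≢v e }
    ... | no _ | yes refl = root-w₀ n λ { (inj₁ (_ , e)) → u≢v e ; (inj₂ (_ , e)) → adj-≢ w₀u (sym e) }
    ... | no x≢u | no y≢u = root-u n λ { (inj₁ (e , _)) → x≢u e ; (inj₂ (_ , e)) → y≢u e }

  hamiltonian-connected : Defs.HamiltonianConnected graph
  hamiltonian-connected x y x≢y with n ℕₚ.≤? 4
  ... | yes n≤4 = Small.hamiltonian n≤4 x≢y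
  ... | no n≰4 = Large.hamiltonian (ℕₚ.≰⇒> n≰4) x≢y

open import Defs

theorem2 : (n : ℕ) (T : PlaneTriangulation n) →
    ThreeConnected (PlaneTriangulation.graph T) →
    (u v : Fin n) → Adj (PlaneTriangulation.graph T) u v →
    (∀ a b c → SeparatingTriangle (PlaneTriangulation.graph T) a b c →
    (u ≡ a ⊎ u ≡ b ⊎ u ≡ c) × (v ≡ a ⊎ v ≡ b ⊎ v ≡ c)) →
    HamiltonianConnected (PlaneTriangulation.graph T)
theorem2 n T tc u v uv sep = EdgeDeletion.hamiltonian-connected T tc u v uv sep
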